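{- Let $M=p_i^{n_i}p_j^{2}p_k^{2}$ with $p_i,p_j,p_k$ distinct primes and $n_i\ge1$. Let $A,B\subset\mathbb{Z}_M$ with $A\oplus B=\mathbb{Z}_M$, $|A|=p_ip_jp_k$ and $\Phi_M\mid A$, and suppose $A$ contains a $p_i$ extended corner on a $D(M)$-grid $\Lambda$: there exist $a,a_i\in A\cap\Lambda$ with $(a-a_i,M)=M/p_i$ such that $A\cap(a*F_j*F_k)$ is $M$-fibered in the $p_j$ direction but not in the $p_k$ direction, and $A\cap(a_i*F_j*F_k)$ is $M$-fibered in the $p_k$ direction but not in the $p_j$ direction. Then the tiling $A\oplus B=\mathbb{Z}_M$ is T2-equivalent to $\Lambda\oplus B=\mathbb{Z}_M$ via fiber shifts, and both $A$ and $B$ satisfy (T2).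
   Context: $A\oplus B=\mathbb{Z}_M$: unique representation $a+b$. Masks $A(X)=\sum_{a\in A}X^a$ mod $X^M-1$; $\Phi_s$ cyclotomic. (T2) for $A$: with $S_A$ the set of prime powers $s\mid M$ with $\Phi_s\mid A$, whenever $s_1,\dots,s_r\in S_A$ are powers of distinct primes, $\Phi_{s_1\cdots s_r}\mid A$. $(x,M)$ is the gcd. $D(M)=p_i^{n_i-1}p_jp_k$; a $D(M)$-grid is $x+D(M)\mathbb{Z}_M$. $F_\nu=\{0,M/p_\nu,\dots,(p_\nu-1)M/p_\nu\}$, $x*F_\nu=x+F_\nu$, $x*F_j*F_k=x+F_j+F_k$; a set $S$ is $M$-fibered in the $p_\nu$ direction if $S=S'+F_\nu$ for some $S'\subset S$. T2-equivalent: $A$ satisfies (T2) iff $\Lambda$ does, both tiling with $B$. "Via fiber shifts": the new set is obtained by finitely many steps each replacing an $M$-fiber $x*F_\nu$ ($\nu\in\{j,k\}$) in the current set by $x'*F_\nu$ with $(x-x',M)=M/p_\nu^2$, each intermediate set tiling with $B$. -}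

module Defs where

open import Data.Nat using (ℕ; zero; suc; _+_; _*_; _∸_; _^_; _≤_; _<_; _≤?_; NonZero)
open import Data.Nat.DivMod using (_/_; _%_; m%n<n)
open import Data.Nat.Divisibility using (_∣_; _∣?_)
open import Data.Nat.GCD using (gcd)
open import Data.Nat.Primality using (Prime)
open import Data.Integer as ℤ using (ℤ; +_; -[1+_])
open import Data.Fin using (Fin; toℕ; fromℕ<)
open import Data.Fin.Subset using (Subset; _∈_; _⊆_)
open import Data.Bool using (Bool; true; false; if_then_else_)
open import Data.List using (List; []; _∷_; map; foldr; filter; drop; upTo; replicate; _++_; length; reverse)
open import Data.Nat.ListAction using (product)
open import Data.List.Relation.Unary.All using (All)
open import Data.List.Relation.Unary.Unique.Propositional using (Unique)
open import Data.Vec using (toList)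
open import Data.Product using (Σ; ∃; ∃-syntax; _×_; _,_; proj₁; proj₂)
open import Data.Sum using (_⊎_)
open import Relation.Nullary using (¬_; yes; no)
open import Relation.Binary.PropositionalEquality using (_≡_; _≢_)
open import Function.Bundles using (_⇔_)
open import Relation.Binary.Construct.Closure.ReflexiveTransitive using (Star)

-- Integer polynomials, as coefficient lists (lowest degree first)

Poly : Set
Poly = List ℤ

infixl 6 _+ₚ_
infixl 7 _*ₚ_

_+ₚ_ : Poly → Poly → Poly
[]       +ₚ q        = q
(a ∷ p)  +ₚ []       = a ∷ p
(a ∷ p)  +ₚ (b ∷ q)  = (a ℤ.+ b) ∷ (p +ₚ q)

negₚ : Poly → Poly
negₚ = map (λ a → ℤ.- a)

_*ₚ_ : Poly → Poly → Poly
[]      *ₚ q = []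
(a ∷ p) *ₚ q = map (a ℤ.*_) q +ₚ (+ 0 ∷ (p *ₚ q))

-- equality of polynomials (ignoring trailing zero coefficients)
_≈ₚ_ : Poly → Poly → Set
p ≈ₚ q = All (_≡ + 0) (p +ₚ negₚ q)

_∣ₚ_ : Poly → Poly → Set
P ∣ₚ Q = ∃[ R ] (Q ≈ₚ (P *ₚ R))

-- X^d - 1   (for d ≥ 1)
X^-1 : ℕ → Poly
X^-1 d = -[1+ 0 ] ∷ (replicate (d ∸ 1) (+ 0) ++ (+ 1 ∷ []))

-- long division by a monic polynomial, both given highest degree first;
-- returns the quotient (highest degree first).  Fuel = length of dividend.
private
  subPre : List ℤ → List ℤ → List ℤ
  subPre (n ∷ ns) (d ∷ ds) = (n ℤ.- d) ∷ subPre ns ds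
  subPre ns       []       = ns
  subPre []       (_ ∷ _)  = []

  divHF : ℕ → List ℤ → List ℤ → List ℤ
  divHF zero    _        _        = []
  divHF (suc f) []       _        = []
  divHF (suc f) (c ∷ ns) []       = []
  divHF (suc f) (c ∷ ns) (_ ∷ ds) with length ds ≤? length ns
  ... | yes _ = c ∷ divHF f (subPre ns (map (c ℤ.*_) ds)) (+ 1 ∷ ds)
  ... | no  _ = []

-- exact quotient N / D for D monic (lowest degree first)
divMonic : Poly → Poly → Poly
divMonic N D = reverse (divHF (length N) (reverse N) (reverse D))

properDivisors : ℕ → List ℕ
properDivisors s = filter (λ d → d ∣? s) (drop 1 (upTo s))

private
  cyc : ℕ → ℕ → Poly
  cyc zero    s = []
  cyc (suc f) s = divMonic (X^-1 s) (foldr _*ₚ_ (+ 1 ∷ []) (map (cyc f) (properDivisors s)))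

Φ : ℕ → Poly
Φ s = cyc s s

-- M / p  (with the convention M / 0 = 0; only used with p ≥ 2)
_/'_ : ℕ → ℕ → ℕ
m /' zero  = zero
m /' suc n = m / suc n

module ZM (M : ℕ) .{{_ : NonZero M}} where

  [_] : ℕ → Fin M
  [ n ] = fromℕ< (m%n<n n M)

  _+ₘ_ : Fin M → Fin M → Fin M
  x +ₘ y = [ toℕ x + toℕ y ]

  _-ₘ_ : Fin M → Fin M → Fin M
  x -ₘ y = [ toℕ x + (M ∸ toℕ y) ]

  gcdM : Fin M → ℕ
  gcdM x = gcd (toℕ x) M

  Tiles : Subset M → Subset M → Set
  Tiles A B =
    (∀ x → ∃[ a ] ∃[ b ] (a ∈ A × b ∈ B × a +ₘ b ≡ x)) ×
    (∀ a a' b b' → a ∈ A → a' ∈ A → b ∈ B → b' ∈ B →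
       a +ₘ b ≡ a' +ₘ b' → a ≡ a' × b ≡ b')

  -- mask A(X) = ∑_{a ∈ A} X^a  (degree < M representative)
  mask : Subset M → Poly
  mask A = map (λ b → if b then + 1 else + 0) (toList A)

  CycDiv : ℕ → Subset M → Set
  CycDiv s A = Φ s ∣ₚ mask A

  T2 : Subset M → Set
  T2 A = ∀ (ps : List (ℕ × ℕ)) → ps ≢ [] →
         All (λ pα → Prime (proj₁ pα) × 1 ≤ proj₂ pα ×
                     (proj₁ pα ^ proj₂ pα) ∣ M × CycDiv (proj₁ pα ^ proj₂ pα) A) ps →
         Unique (map proj₁ ps) →
         CycDiv (product (map (λ pα → proj₁ pα ^ proj₂ pα) ps)) A

  InFiber : ℕ → Fin M → Fin M → Set
  InFiber p x y = ∃[ t ] (t < p × y ≡ x +ₘ [ t * (M /' p) ])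

  InPlane : ℕ → ℕ → Fin M → Fin M → Set
  InPlane p q x y = ∃[ t ] ∃[ u ] (t < p × u < q × y ≡ (x +ₘ [ t * (M /' p) ]) +ₘ [ u * (M /' q) ])

  Fibered : ℕ → (Fin M → Set) → Set
  Fibered p S = ∃[ S' ] ((∀ y → y ∈ S' → S y) ×
                         (∀ y → S y ⇔ (∃[ s ] (s ∈ S' × InFiber p s y))))

  IsGrid : ℕ → Subset M → Set
  IsGrid D Λ = ∃[ x ] (∀ y → y ∈ Λ ⇔ D ∣ toℕ (y -ₘ x))

  FiberShift : ℕ → Subset M → Subset M → Set
  FiberShift p A A' = ∃[ x ] ∃[ x' ]
    ((∀ y → InFiber p x y → y ∈ A) ×
     gcdM (x -ₘ x') ≡ M /' (p * p) ×
     (∀ y → y ∈ A' ⇔ ((y ∈ A × ¬ InFiber p x y) ⊎ InFiber p x' y)))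

  ShiftStep : ℕ → ℕ → Subset M → Subset M → Subset M → Set
  ShiftStep pj pk B A A' = (FiberShift pj A A' ⊎ FiberShift pk A A') × Tiles A' B

  T2EquivViaShifts : ℕ → ℕ → Subset M → Subset M → Subset M → Set
  T2EquivViaShifts pj pk A Λ B =
    Tiles A B × Tiles Λ B × (T2 A ⇔ T2 Λ) × Star (ShiftStep pj pk B) A Λ

{-# OPTIONS --safe #-}
module Submission where

-- By Tijdeman's theorem (B(X^p) ≡ B(X)^p modulo p) A ⊕ uB tiles for every unit u, so a nonzero
-- difference of A and a difference of B are never associated at all three primes at once (Sands).
-- Covering a point missing from one of the two half-fibred planes of the corner by dilates of B
-- therefore leaves few choices for the covering pair, and produces neighbours of every element of B.
-- As |B| = D(M), counting B in residue classes then makes B a system of representatives modulo D(M),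
-- and restricts its differences that vanish modulo D(M) / p_j or D(M) / p_k.  Consequently A lies in
-- the coset of p_i^(n_i-1) through Λ, and each part of A lying in one class modulo p_i^n_i is a union
-- of parallel fibres.  Fibres outside Λ are shifted towards Λ one at a time; the number of
-- coordinates in which elements of A differ from Λ modulo D(M) decreases at each step.
-- For (T2): Λ + D(M) = Λ gives Φ_s ∣ Λ(X) for s ∣ M, s ∤ D(M); fibre shifts preserve divisibility by
-- the Φ_s that matter; and evaluation at 1 shows that no other Φ_{p^α} can divide A(X) or B(X).

-- The exponent 2 at p_j and p_k keeps the covering argument finite: modulo p^2 a residue is zero, a
-- nonzero multiple of p, or a unit, and each kind is a single class up to multiplication by units.
-- At p_i the exponent is arbitrary, and nonzero residues are compared only when both are multiples
-- of p_i^(n_i-1) or when they differ by one. This is why `B` has to be understood before `A` can be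
-- confined to a coset of p_i^(n_i-1). The two fibres of the corner forbid every nonzero multiple of
-- D(M) as a difference of `B`, except the diagonals: those with zero component at p_i and nonzero
-- components at both p_j and p_k. Excluding them is the hard point. It rests on pigeonhole
-- comparisons of the primes, is asymmetric in which of p_j and p_k is smaller, and ends with one
-- prime dividing another. Cyclotomic polynomials are treated without roots of unity: coprimality is
-- a Bézout identity in ℤ[X] whose right-hand side is a nonzero integer, and that integer can be
-- cancelled because constant terms are units.

open import Defs

-- The recursion behind the cyclotomic polynomials

module PrivateDefinitions where
  open import Data.Nat as ℕ using (ℕ; zero; suc; _≤_; _<_; _≤?_; z≤n; s≤s)
  import Data.Nat.Properties as ℕ
  open import Data.Nat.Divisibility using (_∣_; _∣?_)
  open import Data.Integer as ℤ using (ℤ; +_)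
  open import Data.List using (List; []; _∷_; map; foldr; foldl; length; reverse; drop; upTo)
  open import Data.List.Membership.Propositional using (_∈_)
  open import Data.List.Membership.Propositional.Properties using (∈-filter⁻; ∈-filter⁺)
  open import Data.List.Relation.Unary.Any using (here; there)
  open import Data.Product using (_,_; _×_; proj₁; proj₂)
  open import Data.Empty using (⊥-elim)
  open import Relation.Nullary
  open import Relation.Binary.PropositionalEquality

  -- The functions behind divMonic and Φ are private in Defs; unification against an unfolded
  -- equation recovers them.  Abstracting over foldl keeps reverse from blocking the unifier.
  mutual
    divH : ℕ → List ℤ → List ℤ → List ℤ
    divH = _

    divMonic-divH′ : ∀ f ns ds (N D : List ℤ) → length N ≡ f → reverse N ≡ ns → reverse D ≡ ds →
      divMonic N D ≡ reverse (divH f ns ds)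
    divMonic-divH′ f ns ds N D e₁ e₂ e₃ rewrite e₁ | e₂ | e₃
      with foldl {A = List ℤ} {B = ℤ} (λ y x → x ∷ y) []
    ... | w = refl {x = w (divH f ns ds)}

  divMonic-divH : ∀ N D → divMonic N D ≡ reverse (divH (length N) (reverse N) (reverse D))
  divMonic-divH N D = divMonic-divH′ _ _ _ N D refl refl refl

  -- `subMul c ns ds` is the elimination step of long division: `c` times the tail of the divisor is
  -- taken off the leading entries of `ns`.
  mutual
    subMul : ℤ → List ℤ → List ℤ → List ℤ
    subMul = _

    divH-yes : ∀ f c ns d ds → length ds ≤ length ns →
      divH (suc f) (c ∷ ns) (d ∷ ds) ≡ c ∷ divH f (subMul c ns ds) (+ 1 ∷ ds)
    divH-yes f c ns d ds le with length ds ≤? length ns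
    ... | yes _ = refl {x = c ∷ divH f (subMul c ns ds) (+ 1 ∷ ds)}
    ... | no ¬le = ⊥-elim (¬le le)

  divH-no : ∀ f c ns d ds → ¬ length ds ≤ length ns → divH (suc f) (c ∷ ns) (d ∷ ds) ≡ []
  divH-no f c ns d ds ¬le with length ds ≤? length ns
  ... | yes le = ⊥-elim (¬le le)
  ... | no _ = refl

  divH-[] : ∀ f ds → divH f [] ds ≡ []
  divH-[] zero ds = refl
  divH-[] (suc f) ds = refl

  subMul-[] : ∀ c ns → subMul c ns [] ≡ ns
  subMul-[] c [] = refl
  subMul-[] c (n ∷ ns) = refl

  mutual
    cycF : ℕ → ℕ → Poly
    cycF = _

    Φ-cycF : ∀ n → Φ (suc n) ≡ divMonic (X^-1 (suc n)) (foldr _*ₚ_ (+ 1 ∷ []) (map (cycF n) (properDivisors (suc n))))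
    Φ-cycF n = refl

  ∈-properDivisors⁻ : ∀ {d s} → d ∈ properDivisors s → 1 ≤ d × d < s × d ∣ s
  ∈-properDivisors⁻ {d} {s} d∈ with ∈-filter⁻ (λ d → d ∣? s) {xs = drop 1 (upTo s)} d∈
  ... | d∈′ , d∣s = proj₁ (lemma s d∈′) , proj₂ (lemma s d∈′) , d∣s
    where
    open import Data.List.Membership.Propositional.Properties using (∈-applyUpTo⁻)
    lemma : ∀ s → d ∈ drop 1 (upTo s) → 1 ≤ d × d < s
    lemma (suc s) m with ∈-applyUpTo⁻ suc {n = s} m
    ... | i , i<s , refl = s≤s z≤n , s≤s i<s

  ∈-properDivisors⁺ : ∀ {d s} → 1 ≤ d → d < s → d ∣ s → d ∈ properDivisors s
  ∈-properDivisors⁺ {suc d} {suc s} _ (s≤s d<s) d∣s =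
    ∈-filter⁺ (λ d → d ∣? suc s) (∈-applyUpTo⁺ suc d<s) d∣s
    where open import Data.List.Membership.Propositional.Properties using (∈-applyUpTo⁺)

  map-cong-∈ : ∀ {f g : ℕ → Poly} (xs : List ℕ) → (∀ {x} → x ∈ xs → f x ≡ g x) → map f xs ≡ map g xs
  map-cong-∈ [] h = refl
  map-cong-∈ (x ∷ xs) h = cong₂ _∷_ (h (here refl)) (map-cong-∈ xs (λ m → h (there m)))

  -- Recursive calls go to proper divisors only, which are smaller than `s`, so all amounts of fuel
  -- from `s` upwards give the same value.
  cycF-fuel : ∀ f g s → 1 ≤ s → s ≤ f → s ≤ g → cycF f s ≡ cycF g s
  cycF-fuel zero _ _ (s≤s _) ()
  cycF-fuel (suc _) zero _ (s≤s _) _ ()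
  cycF-fuel (suc f) (suc g) s 1≤s s≤f s≤g =
    cong (λ ps → divMonic (X^-1 s) (foldr _*ₚ_ (+ 1 ∷ []) ps))
      (map-cong-∈ (properDivisors s) λ d∈ → let (1≤d , d<s , _) = ∈-properDivisors⁻ {s = s} d∈ in
        cycF-fuel f g _ 1≤d (ℕ.≤-pred (ℕ.≤-trans d<s s≤f)) (ℕ.≤-pred (ℕ.≤-trans d<s s≤g)))

  Φ-rec : ∀ s → 1 ≤ s → Φ s ≡ divMonic (X^-1 s) (foldr _*ₚ_ (+ 1 ∷ []) (map Φ (properDivisors s)))
  Φ-rec (suc n) _ = trans (Φ-cycF n) (cong (λ ps → divMonic (X^-1 (suc n)) (foldr _*ₚ_ (+ 1 ∷ []) ps))
    (map-cong-∈ (properDivisors (suc n)) λ {d} d∈ → let (1≤d , d<s , _) = ∈-properDivisors⁻ {s = suc n} d∈ in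
      cycF-fuel n d d 1≤d (ℕ.≤-pred d<s) ℕ.≤-refl))

-- The commutative ring of coefficient lists

module PolynomialRing where
  open import Data.Nat as ℕ using (ℕ; zero; suc)
  open import Data.Integer as ℤ using (ℤ; +_)
  import Data.Integer.Properties as ℤ
  open import Data.Integer.Tactic.RingSolver using (solve-∀)
  open import Data.List using ([]; _∷_; map)
  open import Data.List.Relation.Unary.All as All using (All; []; _∷_)
  open import Data.Maybe using (Maybe; just; nothing)
  open import Data.Product using (_,_)
  open import Relation.Nullary using (yes; no)
  open import Algebra.Bundles using (CommutativeRing)
  open import Level using (0ℓ)
  open import Relation.Binary.PropositionalEquality

  coeff : Poly → ℕ → ℤ
  coeff []      n       = + 0
  coeff (a ∷ p) zero    = a
  coeff (a ∷ p) (suc n) = coeff p n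

  infix 4 _≋_
  -- Trailing zeros are ignored, as in `≈ₚ`. A record instead of a bare quantification lets the two
  -- polynomials be inferred from a proof.
  record _≋_ (p q : Poly) : Set where
    constructor mk≋
    field at : ∀ n → coeff p n ≡ coeff q n
  open _≋_ public

  coeff-+ : ∀ p q n → coeff (p +ₚ q) n ≡ coeff p n ℤ.+ coeff q n
  coeff-+ []      q       n       = sym (ℤ.+-identityˡ _)
  coeff-+ (a ∷ p) []      n       = sym (ℤ.+-identityʳ _)
  coeff-+ (a ∷ p) (b ∷ q) zero    = refl
  coeff-+ (a ∷ p) (b ∷ q) (suc n) = coeff-+ p q n

  coeff-scale : ∀ a p n → coeff (map (a ℤ.*_) p) n ≡ a ℤ.* coeff p n
  coeff-scale a []      n       = sym (ℤ.*-zeroʳ a)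
  coeff-scale a (b ∷ p) zero    = refl
  coeff-scale a (b ∷ p) (suc n) = coeff-scale a p n

  coeff-neg : ∀ p n → coeff (negₚ p) n ≡ ℤ.- coeff p n
  coeff-neg []      n       = refl
  coeff-neg (b ∷ p) zero    = refl
  coeff-neg (b ∷ p) (suc n) = coeff-neg p n

  private
    all⇒coeff : ∀ p → All (_≡ + 0) p → ∀ n → coeff p n ≡ + 0
    all⇒coeff []      _        n       = refl
    all⇒coeff (a ∷ p) (e ∷ es) zero    = e
    all⇒coeff (a ∷ p) (e ∷ es) (suc n) = all⇒coeff p es n

    coeff⇒all : ∀ p → (∀ n → coeff p n ≡ + 0) → All (_≡ + 0) p
    coeff⇒all []      h = []
    coeff⇒all (a ∷ p) h = h 0 ∷ coeff⇒all p (λ n → h (suc n))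

    coeff-diff : ∀ p q n → coeff (p +ₚ negₚ q) n ≡ coeff p n ℤ.- coeff q n
    coeff-diff p q n = trans (coeff-+ p (negₚ q) n) (cong (λ t → coeff p n ℤ.+ t) (coeff-neg q n))

  ≈ₚ⇒≋ : ∀ {p q} → p ≈ₚ q → p ≋ q
  ≈ₚ⇒≋ {p} {q} e .at n = ℤ.i-j≡0⇒i≡j (coeff p n) (coeff q n) (trans (sym (coeff-diff p q n)) (all⇒coeff (p +ₚ negₚ q) e n))

  ≋⇒≈ₚ : ∀ {p q} → p ≋ q → p ≈ₚ q
  ≋⇒≈ₚ {p} {q} e = coeff⇒all (p +ₚ negₚ q) λ n → trans (coeff-diff p q n) (ℤ.i≡j⇒i-j≡0 (e .at n))

  ≋-refl : ∀ {p} → p ≋ p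
  ≋-refl .at n = refl

  ≋-sym : ∀ {p q} → p ≋ q → q ≋ p
  ≋-sym e .at n = sym (e .at n)

  ≋-trans : ∀ {p q r} → p ≋ q → q ≋ r → p ≋ r
  ≋-trans e f .at n = trans (e .at n) (f .at n)

  ≋-tail : ∀ {a b p q} → (a ∷ p) ≋ (b ∷ q) → p ≋ q
  ≋-tail e .at n = e .at (suc n)

  ∷-cong : ∀ {a b p q} → a ≡ b → p ≋ q → (a ∷ p) ≋ (b ∷ q)
  ∷-cong e f .at zero    = e
  ∷-cong e f .at (suc n) = f .at n

  +ₚ-cong : ∀ {p q r s} → p ≋ q → r ≋ s → p +ₚ r ≋ q +ₚ s
  +ₚ-cong {p} {q} {r} {s} e f .at n =
    trans (coeff-+ p r n) (trans (cong₂ ℤ._+_ (e .at n) (f .at n)) (sym (coeff-+ q s n)))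

  +ₚ-comm : ∀ p q → p +ₚ q ≋ q +ₚ p
  +ₚ-comm p q .at n = trans (coeff-+ p q n) (trans (ℤ.+-comm (coeff p n) _) (sym (coeff-+ q p n)))

  +ₚ-assoc : ∀ p q r → (p +ₚ q) +ₚ r ≋ p +ₚ (q +ₚ r)
  +ₚ-assoc p q r .at n = begin
    coeff ((p +ₚ q) +ₚ r) n                  ≡⟨ coeff-+ (p +ₚ q) r n ⟩
    coeff (p +ₚ q) n ℤ.+ coeff r n           ≡⟨ cong (ℤ._+ _) (coeff-+ p q n) ⟩
    coeff p n ℤ.+ coeff q n ℤ.+ coeff r n    ≡⟨ ℤ.+-assoc (coeff p n) _ _ ⟩
    coeff p n ℤ.+ (coeff q n ℤ.+ coeff r n)  ≡⟨ cong (λ z → coeff p n ℤ.+ z) (coeff-+ q r n) ⟨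
    coeff p n ℤ.+ coeff (q +ₚ r) n           ≡⟨ coeff-+ p (q +ₚ r) n ⟨
    coeff (p +ₚ (q +ₚ r)) n                  ∎
    where open ≡-Reasoning

  +ₚ-identityʳ : ∀ p → p +ₚ [] ≋ p
  +ₚ-identityʳ p .at n = trans (coeff-+ p [] n) (ℤ.+-identityʳ _)

  negₚ-cong : ∀ {p q} → p ≋ q → negₚ p ≋ negₚ q
  negₚ-cong {p} {q} e .at n = trans (coeff-neg p n) (trans (cong ℤ.-_ (e .at n)) (sym (coeff-neg q n)))

  negₚ-inverseʳ : ∀ p → p +ₚ negₚ p ≋ []
  negₚ-inverseʳ p .at n = trans (coeff-diff p p n) (ℤ.+-inverseʳ (coeff p n))

  scale-cong : ∀ {a b p q} → a ≡ b → p ≋ q → map (a ℤ.*_) p ≋ map (b ℤ.*_) q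
  scale-cong {a} {b} {p} {q} refl e .at n = trans (coeff-scale a p n) (trans (cong (a ℤ.*_) (e .at n)) (sym (coeff-scale a q n)))

  private
    0∷-zero : + 0 ∷ [] ≋ []
    0∷-zero .at zero    = refl
    0∷-zero .at (suc n) = refl

    scale-0 : ∀ p → map (+ 0 ℤ.*_) p ≋ []
    scale-0 p .at n = coeff-scale (+ 0) p n

  *ₚ-zeroʳ : ∀ p → p *ₚ [] ≋ []
  *ₚ-zeroʳ []      = ≋-refl
  *ₚ-zeroʳ (a ∷ p) = ≋-trans (∷-cong refl (*ₚ-zeroʳ p)) 0∷-zero

  coeff-*-zero : ∀ a p q → coeff ((a ∷ p) *ₚ q) 0 ≡ a ℤ.* coeff q 0
  coeff-*-zero a p q = trans (coeff-+ (map (a ℤ.*_) q) _ 0) (trans (ℤ.+-identityʳ _) (coeff-scale a q 0))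

  coeff-*-suc : ∀ a p q n → coeff ((a ∷ p) *ₚ q) (suc n) ≡ a ℤ.* coeff q (suc n) ℤ.+ coeff (p *ₚ q) n
  coeff-*-suc a p q n = trans (coeff-+ (map (a ℤ.*_) q) _ (suc n)) (cong (ℤ._+ coeff (p *ₚ q) n) (coeff-scale a q (suc n)))

  *ₚ-congʳ : ∀ p {q r} → q ≋ r → p *ₚ q ≋ p *ₚ r
  *ₚ-congʳ []      e = ≋-refl
  *ₚ-congʳ (a ∷ p) e = +ₚ-cong (scale-cong (refl {x = a}) e) (∷-cong refl (*ₚ-congʳ p e))

  -- Multiplication recurses on its left factor; this is the mirror recursion on the right factor,
  -- and commutativity is the comparison of the two.
  *ₚ-∷ : ∀ q a p → q *ₚ (a ∷ p) ≋ map (a ℤ.*_) q +ₚ (+ 0 ∷ (q *ₚ p))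
  *ₚ-∷ []      a p = ≋-sym 0∷-zero
  *ₚ-∷ (b ∷ q) a p .at zero = cong (ℤ._+ + 0) (ℤ.*-comm b a)
  *ₚ-∷ (b ∷ q) a p .at (suc n) = begin
    coeff (map (b ℤ.*_) p +ₚ (q *ₚ (a ∷ p))) n                         ≡⟨ coeff-+ (map (b ℤ.*_) p) _ n ⟩
    coeff (map (b ℤ.*_) p) n ℤ.+ coeff (q *ₚ (a ∷ p)) n                ≡⟨ cong (λ z → coeff (map (b ℤ.*_) p) n ℤ.+ z) (trans (*ₚ-∷ q a p .at n) (coeff-+ (map (a ℤ.*_) q) _ n)) ⟩
    x ℤ.+ (y ℤ.+ z)                                                     ≡⟨ lem x y z ⟩
    y ℤ.+ (x ℤ.+ z)                                                     ≡⟨ cong (λ w → y ℤ.+ w) (coeff-+ (map (b ℤ.*_) p) _ n) ⟨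
    y ℤ.+ coeff ((b ∷ q) *ₚ p) n                                        ≡⟨ coeff-+ (map (a ℤ.*_) q) _ n ⟨
    coeff (map (a ℤ.*_) q +ₚ ((b ∷ q) *ₚ p)) n                          ∎
    where
    open ≡-Reasoning
    x = coeff (map (b ℤ.*_) p) n
    y = coeff (map (a ℤ.*_) q) n
    z = coeff (+ 0 ∷ (q *ₚ p)) n
    lem : ∀ x y z → x ℤ.+ (y ℤ.+ z) ≡ y ℤ.+ (x ℤ.+ z)
    lem = solve-∀

  *ₚ-comm : ∀ p q → p *ₚ q ≋ q *ₚ p
  *ₚ-comm []      q = ≋-sym (*ₚ-zeroʳ q)
  *ₚ-comm (a ∷ p) q = ≋-trans (+ₚ-cong ≋-refl (∷-cong refl (*ₚ-comm p q))) (≋-sym (*ₚ-∷ q a p))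

  *ₚ-cong : ∀ {p q r s} → p ≋ q → r ≋ s → p *ₚ r ≋ q *ₚ s
  *ₚ-cong {p} {q} {r} {s} e f = ≋-trans (*ₚ-congʳ p f) (≋-trans (*ₚ-comm p s) (≋-trans (*ₚ-congʳ s e) (*ₚ-comm s q)))

  *ₚ-distribˡ : ∀ p q r → p *ₚ (q +ₚ r) ≋ p *ₚ q +ₚ p *ₚ r
  *ₚ-distribˡ []      q r = ≋-refl
  *ₚ-distribˡ (a ∷ p) q r = ≋-trans (+ₚ-cong (dist a q r) (∷-cong refl (*ₚ-distribˡ p q r))) (interchange (map (a ℤ.*_) q) (map (a ℤ.*_) r) (p *ₚ q) (p *ₚ r))
    where
    dist : ∀ a q r → map (a ℤ.*_) (q +ₚ r) ≋ map (a ℤ.*_) q +ₚ map (a ℤ.*_) r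
    dist a q r .at n = trans (coeff-scale a (q +ₚ r) n) (trans (cong (a ℤ.*_) (coeff-+ q r n))
      (trans (ℤ.*-distribˡ-+ a (coeff q n) (coeff r n)) (sym (trans (coeff-+ (map (a ℤ.*_) q) _ n) (cong₂ ℤ._+_ (coeff-scale a q n) (coeff-scale a r n))))))
    lem : ∀ x y z w → (x ℤ.+ y) ℤ.+ (z ℤ.+ w) ≡ (x ℤ.+ z) ℤ.+ (y ℤ.+ w)
    lem = solve-∀
    interchange : ∀ x y z w → (x +ₚ y) +ₚ (+ 0 ∷ (z +ₚ w)) ≋ (x +ₚ (+ 0 ∷ z)) +ₚ (y +ₚ (+ 0 ∷ w))
    interchange x y z w .at n
      rewrite coeff-+ (x +ₚ y) (+ 0 ∷ (z +ₚ w)) n | coeff-+ x y n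
            | coeff-+ (x +ₚ (+ 0 ∷ z)) (y +ₚ (+ 0 ∷ w)) n | coeff-+ x (+ 0 ∷ z) n | coeff-+ y (+ 0 ∷ w) n =
      trans (cong (λ t → (coeff x n ℤ.+ coeff y n) ℤ.+ t) (0+0 n)) (lem (coeff x n) _ _ _)
      where
      0+0 : ∀ n → coeff (+ 0 ∷ (z +ₚ w)) n ≡ coeff (+ 0 ∷ z) n ℤ.+ coeff (+ 0 ∷ w) n
      0+0 zero    = refl
      0+0 (suc n) = coeff-+ z w n

  *ₚ-distribʳ : ∀ r p q → (p +ₚ q) *ₚ r ≋ p *ₚ r +ₚ q *ₚ r
  *ₚ-distribʳ r p q = ≋-trans (*ₚ-comm (p +ₚ q) r) (≋-trans (*ₚ-distribˡ r p q) (+ₚ-cong (*ₚ-comm r p) (*ₚ-comm r q)))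

  0∷-* : ∀ p q → (+ 0 ∷ p) *ₚ q ≋ + 0 ∷ (p *ₚ q)
  0∷-* p q = +ₚ-cong (scale-0 q) ≋-refl

  scale-* : ∀ a p q → map (a ℤ.*_) p *ₚ q ≋ map (a ℤ.*_) (p *ₚ q)
  scale-* a []      q = ≋-refl
  scale-* a (b ∷ p) q .at n
    rewrite coeff-+ (map ((a ℤ.* b) ℤ.*_) q) (+ 0 ∷ (map (a ℤ.*_) p *ₚ q)) n
          | coeff-scale (a ℤ.* b) q n | coeff-scale a (map (b ℤ.*_) q +ₚ (+ 0 ∷ (p *ₚ q))) n
          | coeff-+ (map (b ℤ.*_) q) (+ 0 ∷ (p *ₚ q)) n | coeff-scale b q n =
    trans (cong (λ t → a ℤ.* b ℤ.* coeff q n ℤ.+ t) (tl n)) (lem a b (coeff q n) (coeff (+ 0 ∷ (p *ₚ q)) n))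
    where
    lem : ∀ a b x y → a ℤ.* b ℤ.* x ℤ.+ a ℤ.* y ≡ a ℤ.* (b ℤ.* x ℤ.+ y)
    lem = solve-∀
    tl : ∀ n → coeff (+ 0 ∷ (map (a ℤ.*_) p *ₚ q)) n ≡ a ℤ.* coeff (+ 0 ∷ (p *ₚ q)) n
    tl zero    = sym (ℤ.*-zeroʳ a)
    tl (suc n) = trans (scale-* a p q .at n) (coeff-scale a (p *ₚ q) n)

  *ₚ-assoc : ∀ p q r → (p *ₚ q) *ₚ r ≋ p *ₚ (q *ₚ r)
  *ₚ-assoc []      q r = ≋-refl
  *ₚ-assoc (a ∷ p) q r = ≋-trans (*ₚ-distribʳ r (map (a ℤ.*_) q) (+ 0 ∷ (p *ₚ q)))
    (+ₚ-cong (scale-* a q r) (≋-trans (0∷-* (p *ₚ q) r) (∷-cong refl (*ₚ-assoc p q r))))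

  1ₚ : Poly
  1ₚ = + 1 ∷ []

  *ₚ-identityˡ : ∀ p → 1ₚ *ₚ p ≋ p
  *ₚ-identityˡ p .at n = trans (coeff-+ (map (+ 1 ℤ.*_) p) _ n) (trans (cong₂ ℤ._+_ (trans (coeff-scale (+ 1) p n) (ℤ.*-identityˡ _)) (0∷-zero .at n)) (ℤ.+-identityʳ _))

  polyRing : CommutativeRing 0ℓ 0ℓ
  polyRing = record
    { Carrier = Poly ; _≈_ = _≋_ ; _+_ = _+ₚ_ ; _*_ = _*ₚ_ ; -_ = negₚ ; 0# = [] ; 1# = 1ₚ
    ; isCommutativeRing = record
      { isRing = record
        { +-isAbelianGroup = record
          { isGroup = record
            { isMonoid = record
              { isSemigroup = record
                { isMagma = record { isEquivalence = record { refl = ≋-refl ; sym = ≋-sym ; trans = ≋-trans } ; ∙-cong = +ₚ-cong }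
                ; assoc = +ₚ-assoc }
              ; identity = (λ _ → ≋-refl) , +ₚ-identityʳ }
            ; inverse = (λ p → ≋-trans (+ₚ-comm (negₚ p) p) (negₚ-inverseʳ p)) , negₚ-inverseʳ
            ; ⁻¹-cong = negₚ-cong }
          ; comm = +ₚ-comm }
        ; *-cong = *ₚ-cong
        ; *-assoc = *ₚ-assoc
        ; *-identity = *ₚ-identityˡ , (λ p → ≋-trans (*ₚ-comm p 1ₚ) (*ₚ-identityˡ p))
        ; distrib = *ₚ-distribˡ , *ₚ-distribʳ }
      ; *-comm = *ₚ-comm } }

  open import Tactic.RingSolver.Core.AlmostCommutativeRing using (AlmostCommutativeRing; fromCommutativeRing)

  polySolverRing : AlmostCommutativeRing 0ℓ 0ℓ
  polySolverRing = fromCommutativeRing polyRing 0≟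
    where
    0≟ : ∀ p → Maybe ([] ≋ p)
    0≟ p with All.all? (ℤ._≟ + 0) p
    ... | yes z = just (mk≋ λ n → sym (all⇒coeff p z n))
    ... | no _  = nothing

-- Monomials and the correctness of long division

module Monomials where
  open PrivateDefinitions
  open PolynomialRing
  open import Data.Nat as ℕ using (ℕ; zero; suc; _≤_; _∸_; z≤n; s≤s; _≤?_)
  import Data.Nat.Properties as ℕ
  open import Data.Integer as ℤ using (ℤ; +_)
  import Data.Integer.Properties as ℤ
  open import Data.List using (List; []; _∷_; _++_; length; reverse)
  import Data.List.Properties as List
  open import Data.Product using (_,_; ∃-syntax; _×_)
  open import Data.Empty using (⊥-elim)
  open import Relation.Nullary using (yes; no; ¬_)
  open import Relation.Binary.PropositionalEquality
  open import Algebra.Bundles using (CommutativeRing)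
  open import Tactic.RingSolver.NonReflective polySolverRing using (Expr; _⊕_; _⊗_; ⊝_; Κ) renaming (solve to solveₚ)
  open CommutativeRing polyRing using () renaming (setoid to polySetoid)
  import Relation.Binary.Reasoning.Setoid as SetoidReasoning

  module ≋-Reasoning = SetoidReasoning polySetoid

  infix 4 _⊜_
  _⊜_ : ∀ {n} → Expr Poly n → Expr Poly n → Expr Poly n × Expr Poly n
  _⊜_ = _,_

  mono : ℕ → Poly
  mono zero    = 1ₚ
  mono (suc n) = + 0 ∷ mono n

  -- Opaque, so that products with constants remain symbolic in ring identities instead of computing
  -- into coefficient lists.
  opaque
    const : ℤ → Poly
    const c = c ∷ []

    const-+ : ∀ a b → const (a ℤ.+ b) ≋ const a +ₚ const b
    const-+ a b = ≋-refl

    const-neg : ∀ a → const (ℤ.- a) ≋ negₚ (const a)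
    const-neg a = ≋-refl

    const-1 : const (+ 1) ≋ 1ₚ
    const-1 = ≋-refl

    const-0 : const (+ 0) ≋ []
    const-0 .at zero    = refl
    const-0 .at (suc n) = refl

    const-* : ∀ a b → const (a ℤ.* b) ≋ const a *ₚ const b
    const-* a b .at zero    = sym (ℤ.+-identityʳ _)
    const-* a b .at (suc n) = refl

    coeff-const-* : ∀ c p n → coeff (const c *ₚ p) n ≡ c ℤ.* coeff p n
    coeff-const-* c p zero    = coeff-*-zero c [] p
    coeff-const-* c p (suc n) = trans (coeff-*-suc c [] p n) (ℤ.+-identityʳ _)

  mono-+ : ∀ m n → mono (m ℕ.+ n) ≋ mono m *ₚ mono n
  mono-+ zero    n = ≋-sym (*ₚ-identityˡ (mono n))
  mono-+ (suc m) n = ≋-trans (∷-cong refl (mono-+ m n)) (≋-sym (0∷-* (mono m) (mono n)))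

  snoc : ∀ p c → p ++ (c ∷ []) ≋ p +ₚ const c *ₚ mono (length p)
  snoc []      c .at zero    = sym (trans (coeff-const-* c 1ₚ 0) (ℤ.*-identityʳ c))
  snoc []      c .at (suc n) = sym (trans (coeff-const-* c 1ₚ (suc n)) (ℤ.*-zeroʳ c))
  snoc (a ∷ p) c .at zero    = sym (trans (coeff-+ (a ∷ p) (const c *ₚ mono (suc (length p))) 0) (trans (cong (λ t → a ℤ.+ t)
    (trans (coeff-const-* c (mono (suc (length p))) 0) (ℤ.*-zeroʳ c))) (ℤ.+-identityʳ a)))
  snoc (a ∷ p) c .at (suc n) = trans (snoc p c .at n) (trans (coeff-+ p (const c *ₚ mono (length p)) n)
    (trans (cong (λ t → coeff p n ℤ.+ t) (trans (coeff-const-* c (mono (length p)) n) (sym (coeff-const-* c (mono (suc (length p))) (suc n)))))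
      (sym (coeff-+ (a ∷ p) (const c *ₚ mono (suc (length p))) (suc n)))))

  reverse-∷ : ∀ c ns → reverse (c ∷ ns) ≋ reverse ns +ₚ const c *ₚ mono (length ns)
  reverse-∷ c ns rewrite List.unfold-reverse c ns | sym (List.length-reverse ns) = snoc (reverse ns) c

  reverse-1∷ : ∀ ds → reverse (+ 1 ∷ ds) ≋ reverse ds +ₚ 1ₚ *ₚ mono (length ds)
  reverse-1∷ ds = ≋-trans (reverse-∷ (+ 1) ds) (+ₚ-cong (≋-refl {reverse ds}) (*ₚ-cong const-1 (≋-refl {mono (length ds)})))

  length-subMul : ∀ c ns ds → length ds ≤ length ns → length (subMul c ns ds) ≡ length ns
  length-subMul c ns [] _ = cong length (subMul-[] c ns)
  length-subMul c (n ∷ ns) (d ∷ ds) (s≤s le) = cong suc (length-subMul c ns ds le)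

  -- Lists here start with the highest degree. Aligning `ds` with the front of `ns` therefore
  -- multiplies it by X to the difference of the lengths.
  reverse-subMul : ∀ c ns ds → length ds ≤ length ns →
    reverse (subMul c ns ds) +ₚ (const c *ₚ reverse ds) *ₚ mono (length ns ∸ length ds) ≋ reverse ns
  reverse-subMul c ns [] _ rewrite subMul-[] c ns =
    ≋-trans (+ₚ-cong (≋-refl {reverse ns}) (*ₚ-cong (*ₚ-zeroʳ (const c)) ≋-refl)) (+ₚ-identityʳ _)
  reverse-subMul c (n ∷ ns) (d ∷ ds) (s≤s le) = begin
    reverse ((n ℤ.- c ℤ.* d) ∷ S) +ₚ (const c *ₚ reverse (d ∷ ds)) *ₚ E
      ≈⟨ +ₚ-cong (≋-trans (reverse-∷ (n ℤ.- c ℤ.* d) S) (+ₚ-cong (≋-refl {reverse S}) (*ₚ-cong const-eq mono-len)))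
          (*ₚ-cong (*ₚ-cong (≋-refl {const c}) (reverse-∷ d ds)) (≋-refl {E})) ⟩
    (reverse S +ₚ (const n +ₚ negₚ (const c *ₚ const d)) *ₚ (mono (length ds) *ₚ E)) +ₚ (const c *ₚ (reverse ds +ₚ const d *ₚ mono (length ds))) *ₚ E
      ≈⟨ solveₚ 7 (λ s n c d m e r → ((s ⊕ (n ⊕ ⊝ (c ⊗ d)) ⊗ (m ⊗ e)) ⊕ (c ⊗ (r ⊕ d ⊗ m)) ⊗ e) ⊜ ((s ⊕ (c ⊗ r) ⊗ e) ⊕ n ⊗ (m ⊗ e))) ≋-refl
          (reverse S) (const n) (const c) (const d) (mono (length ds)) E (reverse ds) ⟩
    (reverse S +ₚ (const c *ₚ reverse ds) *ₚ E) +ₚ const n *ₚ (mono (length ds) *ₚ E)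
      ≈⟨ +ₚ-cong (reverse-subMul c ns ds le) (*ₚ-cong (≋-refl {const n}) (≋-sym mono-len′)) ⟩
    reverse ns +ₚ const n *ₚ mono (length ns) ≈⟨ reverse-∷ n ns ⟨
    reverse (n ∷ ns) ∎
    where
    open ≋-Reasoning
    S = subMul c ns ds
    E = mono (length ns ∸ length ds)
    mono-len′ : mono (length ns) ≋ mono (length ds) *ₚ E
    mono-len′ = ≋-trans (subst (λ k → mono (length ns) ≋ mono k) (sym (ℕ.m+[n∸m]≡n le)) ≋-refl) (mono-+ (length ds) _)
    mono-len : mono (length S) ≋ mono (length ds) *ₚ E
    mono-len = subst (λ k → mono k ≋ mono (length ds) *ₚ E) (sym (length-subMul c ns ds le)) mono-len′
    const-eq : const (n ℤ.- c ℤ.* d) ≋ const n +ₚ negₚ (const c *ₚ const d)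
    const-eq = ≋-trans (const-+ n (ℤ.- (c ℤ.* d))) (+ₚ-cong (≋-refl {const n}) (≋-trans (const-neg (c ℤ.* d)) (negₚ-cong (const-* c d))))

  length-divH : ∀ f ns ds → length ns ≤ f → length (divH f ns (+ 1 ∷ ds)) ≡ length ns ∸ length ds
  length-divH f [] ds _ = trans (cong length (divH-[] f (+ 1 ∷ ds))) (sym (ℕ.0∸n≡0 (length ds)))
  length-divH (suc f) (c ∷ ns) ds (s≤s le) with length ds ≤? length ns
  ... | yes l = trans (cong suc (trans (length-divH f (subMul c ns ds) ds (subst (_≤ f) (sym (length-subMul c ns ds l)) le))
                  (cong (_∸ length ds) (length-subMul c ns ds l)))) (sym (ℕ.+-∸-assoc 1 l))
  ... | no ¬l = sym (ℕ.m≤n⇒m∸n≡0 (ℕ.≰⇒> ¬l))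

  -- Induction over the elimination steps. The divisor `+ 1 ∷ ds` has degree `length ds`, so the
  -- bound on `length R` says that the remainder has smaller degree than the divisor.
  divH-remainder : ∀ f ns ds → length ns ≤ f → ∃[ R ] (length R ≤ length ds ×
    reverse ns ≋ reverse (+ 1 ∷ ds) *ₚ reverse (divH f ns (+ 1 ∷ ds)) +ₚ R)
  divH-remainder f [] ds _ rewrite divH-[] f (+ 1 ∷ ds) = [] , z≤n , ≋-sym (≋-trans (+ₚ-identityʳ _) (*ₚ-zeroʳ (reverse (+ 1 ∷ ds))))
  divH-remainder (suc f) (c ∷ ns) ds (s≤s le) with length ds ≤? length ns
  ... | no ¬l = reverse (c ∷ ns) , subst (_≤ length ds) (sym (List.length-reverse (c ∷ ns))) (ℕ.≰⇒> ¬l) ,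
                ≋-sym (+ₚ-cong (*ₚ-zeroʳ (reverse (+ 1 ∷ ds))) ≋-refl)
  ... | yes l with divH-remainder f (subMul c ns ds) ds (subst (_≤ f) (sym (length-subMul c ns ds l)) le)
  ... | R , R≤ , eq = R , R≤ , (begin
    reverse (c ∷ ns) ≈⟨ reverse-∷ c ns ⟩
    reverse ns +ₚ const c *ₚ mono (length ns)
      ≈⟨ +ₚ-cong (≋-sym (reverse-subMul c ns ds l)) (*ₚ-cong (≋-refl {const c}) mono-len) ⟩
    (reverse S +ₚ (const c *ₚ reverse ds) *ₚ E) +ₚ const c *ₚ (mono (length ds) *ₚ E)
      ≈⟨ +ₚ-cong (+ₚ-cong (≋-trans eq (+ₚ-cong (*ₚ-cong (reverse-1∷ ds) (≋-refl {reverse Q})) (≋-refl {R}))) (≋-refl {(const c *ₚ reverse ds) *ₚ E})) ≋-refl ⟩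
    (((reverse ds +ₚ 1ₚ *ₚ mono (length ds)) *ₚ reverse Q +ₚ R) +ₚ (const c *ₚ reverse ds) *ₚ E) +ₚ const c *ₚ (mono (length ds) *ₚ E)
      ≈⟨ solveₚ 6 (λ r m q R c e → ((((r ⊕ Κ 1ₚ ⊗ m) ⊗ q ⊕ R) ⊕ (c ⊗ r) ⊗ e) ⊕ c ⊗ (m ⊗ e)) ⊜ ((r ⊕ Κ 1ₚ ⊗ m) ⊗ (q ⊕ c ⊗ e) ⊕ R)) ≋-refl
          (reverse ds) (mono (length ds)) (reverse Q) R (const c) E ⟩
    (reverse ds +ₚ 1ₚ *ₚ mono (length ds)) *ₚ (reverse Q +ₚ const c *ₚ E) +ₚ R
      ≈⟨ +ₚ-cong (*ₚ-cong (≋-sym (reverse-1∷ ds)) (≋-trans (+ₚ-cong (≋-refl {reverse Q}) (*ₚ-cong (≋-refl {const c}) E≋)) (≋-sym (reverse-∷ c Q)))) (≋-refl {R}) ⟩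
    reverse (+ 1 ∷ ds) *ₚ reverse (c ∷ Q) +ₚ R ∎)
    where
    open ≋-Reasoning
    S = subMul c ns ds
    Q = divH f S (+ 1 ∷ ds)
    E = mono (length ns ∸ length ds)
    mono-len : mono (length ns) ≋ mono (length ds) *ₚ E
    mono-len = ≋-trans (subst (λ k → mono (length ns) ≋ mono k) (sym (ℕ.m+[n∸m]≡n l)) ≋-refl) (mono-+ (length ds) _)
    lenQ : length Q ≡ length ns ∸ length ds
    lenQ = trans (length-divH f S ds (subst (_≤ f) (sym (length-subMul c ns ds l)) le)) (cong (_∸ length ds) (length-subMul c ns ds l))
    E≋ : E ≋ mono (length Q)
    E≋ = subst (λ k → E ≋ mono k) (sym lenQ) ≋-refl

  VanishFrom : ℕ → Poly → Set
  VanishFrom a p = ∀ n → a ≤ n → coeff p n ≡ + 0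

  vanish-length : ∀ p → VanishFrom (length p) p
  vanish-length []      n       _        = refl
  vanish-length (a ∷ p) (suc n) (s≤s le) = vanish-length p n le

  vanish⇒≋[] : ∀ p → VanishFrom 0 p → p ≋ []
  vanish⇒≋[] p v .at n = v n z≤n

  -- The bounds are degrees plus one, so those of the factors add up to one more than that of the
  -- product; hence the `suc`.
  vanish-* : ∀ a b p q → VanishFrom a p → VanishFrom b q → ∀ n → a ℕ.+ b ≤ suc n → coeff (p *ₚ q) n ≡ + 0
  vanish-* a b [] q vp vq n le = refl
  vanish-* zero b (c ∷ p) q vp vq n le = *ₚ-cong {c ∷ p} {[]} {q} {q} (vanish⇒≋[] (c ∷ p) vp) ≋-refl .at n
  vanish-* (suc a) b (c ∷ p) q vp vq zero (s≤s le) = trans (coeff-*-zero c p q) (trans (cong (c ℤ.*_) (vq 0 (ℕ.≤-trans (ℕ.m≤n+m b a) le))) (ℤ.*-zeroʳ c))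
  vanish-* (suc a) b (c ∷ p) q vp vq (suc n) (s≤s le) = trans (coeff-*-suc c p q n)
    (cong₂ ℤ._+_ (trans (cong (c ℤ.*_) (vq (suc n) (ℕ.≤-trans (ℕ.m≤n+m b a) le))) (ℤ.*-zeroʳ c))
      (vanish-* a b p q (λ m l → vp (suc m) (s≤s l)) vq n le))

  coeff-mono-* : ∀ m p n → coeff (mono m *ₚ p) (m ℕ.+ n) ≡ coeff p n
  coeff-mono-* zero    p n = *ₚ-identityˡ p .at n
  coeff-mono-* (suc m) p n = trans (0∷-* (mono m) p .at (suc (m ℕ.+ n))) (coeff-mono-* m p n)

  -- Since the divisor is monic, the top coefficient of `S` reappears in the product in a degree
  -- where `R` has no coefficient left. So the coefficients of `S` vanish one after another from the
  -- top down.
  monic-multiple : ∀ ds R S → length R ≤ length ds → R ≋ reverse (+ 1 ∷ ds) *ₚ S → S ≋ []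
  monic-multiple ds R S R≤ eq = vanish⇒≋[] S (down (length S) (vanish-length S))
    where
    d = length ds
    eq′ : R ≋ reverse ds *ₚ S +ₚ mono d *ₚ S
    eq′ = ≋-trans eq (≋-trans (*ₚ-cong (reverse-1∷ ds) (≋-refl {S}))
            (solveₚ 3 (λ r m s → ((r ⊕ Κ 1ₚ ⊗ m) ⊗ s) ⊜ (r ⊗ s ⊕ m ⊗ s)) ≋-refl (reverse ds) (mono d) S))
    top : ∀ k → VanishFrom (suc k) S → coeff S k ≡ + 0
    top k v = begin
      coeff S k                                                    ≡⟨ coeff-mono-* d S k ⟨
      coeff (mono d *ₚ S) (d ℕ.+ k)                                ≡⟨ ℤ.+-identityˡ _ ⟨
      + 0 ℤ.+ coeff (mono d *ₚ S) (d ℕ.+ k)                        ≡⟨ cong (ℤ._+ coeff (mono d *ₚ S) (d ℕ.+ k)) (vanish-* d (suc k) (reverse ds) S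
                                                                        (subst (λ l → VanishFrom l (reverse ds)) (List.length-reverse ds) (vanish-length (reverse ds))) v (d ℕ.+ k)
                                                                        (ℕ.≤-reflexive (ℕ.+-suc d k))) ⟨
      coeff (reverse ds *ₚ S) (d ℕ.+ k) ℤ.+ coeff (mono d *ₚ S) (d ℕ.+ k) ≡⟨ coeff-+ (reverse ds *ₚ S) _ (d ℕ.+ k) ⟨
      coeff (reverse ds *ₚ S +ₚ mono d *ₚ S) (d ℕ.+ k)             ≡⟨ eq′ .at (d ℕ.+ k) ⟨
      coeff R (d ℕ.+ k)                                            ≡⟨ vanish-length R _ (ℕ.≤-trans R≤ (ℕ.m≤m+n d k)) ⟩
      + 0                                                          ∎
      where open ≡-Reasoning
    down : ∀ k → VanishFrom k S → VanishFrom 0 S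
    down zero    v = v
    down (suc k) v = down k λ n k≤n → case n k≤n
      where
      case : ∀ n → k ≤ n → coeff S n ≡ + 0
      case n k≤n with k ℕ.≟ n
      ... | yes refl = top k v
      ... | no k≢n = v n (ℕ.≤∧≢⇒< k≤n k≢n)

  record Monic (p : Poly) : Set where
    constructor _,_
    field
      lower   : List ℤ
      leading : reverse p ≡ + 1 ∷ lower

  divMonic-exact : ∀ N D Q → Monic D → N ≋ D *ₚ Q → divMonic N D ≋ Q
  divMonic-exact N D Q (ds , rD) eq with divH-remainder (length N) (reverse N) ds (ℕ.≤-reflexive (List.length-reverse N))
  ... | R , R≤ , div rewrite divMonic-divH N D | rD = ≋-sym (begin
    Q              ≈⟨ solveₚ 2 (λ q t → q ⊜ ((q ⊕ ⊝ t) ⊕ t)) ≋-refl Q T ⟩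
    (Q +ₚ negₚ T) +ₚ T ≈⟨ +ₚ-cong (monic-multiple ds R (Q +ₚ negₚ T) R≤ R≋) (≋-refl {T}) ⟩
    T ∎)
    where
    open ≋-Reasoning
    T = reverse (divH (length N) (reverse N) (+ 1 ∷ ds))
    D≡ : D ≡ reverse (+ 1 ∷ ds)
    D≡ = trans (sym (List.reverse-involutive D)) (cong reverse rD)
    N≋ : reverse (reverse N) ≋ reverse (+ 1 ∷ ds) *ₚ Q
    N≋ = subst₂ (λ n d → n ≋ d *ₚ Q) (sym (List.reverse-involutive N)) D≡ eq
    R≋ : R ≋ reverse (+ 1 ∷ ds) *ₚ (Q +ₚ negₚ T)
    R≋ = begin
      R ≈⟨ solveₚ 3 (λ r d t → r ⊜ ((d ⊗ t ⊕ r) ⊕ ⊝ (d ⊗ t))) ≋-refl R (reverse (+ 1 ∷ ds)) T ⟩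
      (reverse (+ 1 ∷ ds) *ₚ T +ₚ R) +ₚ negₚ (reverse (+ 1 ∷ ds) *ₚ T)
        ≈⟨ +ₚ-cong (≋-trans (≋-sym div) N≋) (≋-refl {negₚ (reverse (+ 1 ∷ ds) *ₚ T)}) ⟩
      reverse (+ 1 ∷ ds) *ₚ Q +ₚ negₚ (reverse (+ 1 ∷ ds) *ₚ T)
        ≈⟨ solveₚ 3 (λ q d t → (d ⊗ q ⊕ ⊝ (d ⊗ t)) ⊜ (d ⊗ (q ⊕ ⊝ t))) ≋-refl Q (reverse (+ 1 ∷ ds)) T ⟩
      reverse (+ 1 ∷ ds) *ₚ (Q +ₚ negₚ T) ∎

  -- The first digit of the quotient is the leading coefficient 1 of the dividend. If the dividend
  -- were shorter than the divisor, the quotient and with it `N` would be zero.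
  divMonic-monic : ∀ N D Q → Monic N → Monic D → ¬ (N ≋ []) → N ≋ D *ₚ Q → Monic (divMonic N D)
  divMonic-monic N D Q (ns , rN) mD@(ds , rD) N≢0 eq = go (length ds ≤? length ns)
    where
    len : length N ≡ suc (length ns)
    len = trans (sym (List.length-reverse N)) (cong length rN)
    e : divMonic N D ≡ reverse (divH (suc (length ns)) (+ 1 ∷ ns) (+ 1 ∷ ds))
    e = divMonic-divH′ _ _ _ N D len rN rD
    go : _ → Monic (divMonic N D)
    go (yes le) = divH (length ns) (subMul (+ 1) ns ds) (+ 1 ∷ ds) , trans (cong reverse (trans e (cong reverse (divH-yes (length ns) (+ 1) ns (+ 1) ds le)))) (List.reverse-involutive _)
    go (no ¬le) = ⊥-elim (N≢0 (≋-trans eq (≋-trans (*ₚ-cong (≋-refl {D}) (≋-trans (≋-sym (divMonic-exact N D Q mD eq)) quot)) (*ₚ-zeroʳ D))))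
      where
      quot : divMonic N D ≋ []
      quot = subst (_≋ []) (sym (trans e (cong reverse (divH-no (length ns) (+ 1) ns (+ 1) ds ¬le)))) ≋-refl

-- Divisibility and coprimality in ℤ[X]

module PolynomialDivisibility where
  open PrivateDefinitions
  open PolynomialRing
  open Monomials
  open import Data.Nat as ℕ using (ℕ; zero; suc; _≤_)
  import Data.Nat.Properties as ℕ
  import Data.Nat.Divisibility as ℕ
  open import Data.Nat.GCD using (module Bézout; gcd; gcd-GCD)
  open import Data.Integer as ℤ using (ℤ; +_; -[1+_])
  import Data.Integer.Properties as ℤ
  open import Data.Integer.Divisibility.Signed as ℤ∣ using (divides; _∣_)
  open import Data.List using (List; []; _∷_; map; _++_; replicate; foldr)
  open import Data.List.Membership.Propositional using (_∈_)
  open import Data.List.Relation.Unary.Any using (here; there)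
  open import Data.List.Relation.Unary.All as All using (All; []; _∷_)
  open import Data.List.Relation.Unary.AllPairs using (AllPairs; []; _∷_)
  open import Data.List.Relation.Unary.Unique.Propositional using (Unique)
  open import Data.Product using (_,_; ∃-syntax)
  open import Relation.Binary.PropositionalEquality
  open import Tactic.RingSolver.NonReflective polySolverRing using (_⊕_; _⊗_; ⊝_; Κ) renaming (solve to solveₚ)

  infix 4 _∣P_
  record _∣P_ (f g : Poly) : Set where
    constructor _,_
    field
      quot : Poly
      quot-eq : g ≋ f *ₚ quot

  ∣P-refl : ∀ {f} → f ∣P f
  ∣P-refl {f} = 1ₚ , solveₚ 1 (λ f → f ⊜ f ⊗ Κ 1ₚ) ≋-refl f

  ∣P-trans : ∀ {f g h} → f ∣P g → g ∣P h → f ∣P h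
  ∣P-trans {f} {g} {h} (a , ea) (b , eb) = a *ₚ b , ≋-trans eb (≋-trans (*ₚ-cong ea (≋-refl {b})) (*ₚ-assoc f a b))

  ∣P-resp : ∀ {f g h} → g ≋ h → f ∣P g → f ∣P h
  ∣P-resp e (a , ea) = a , ≋-trans (≋-sym e) ea

  ∣P-respˡ : ∀ {f g h} → f ≋ g → f ∣P h → g ∣P h
  ∣P-respˡ e (a , ea) = a , ≋-trans ea (*ₚ-cong e (≋-refl {a}))

  ∣P-+ : ∀ {f g h} → f ∣P g → f ∣P h → f ∣P g +ₚ h
  ∣P-+ {f} (a , ea) (b , eb) = a +ₚ b , ≋-trans (+ₚ-cong ea eb) (≋-sym (*ₚ-distribˡ f a b))

  ∣P-*ʳ : ∀ {f g} h → f ∣P g → f ∣P g *ₚ h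
  ∣P-*ʳ {f} h (a , ea) = a *ₚ h , ≋-trans (*ₚ-cong ea (≋-refl {h})) (*ₚ-assoc f a h)

  ∣P-*ˡ : ∀ {f g} h → f ∣P g → f ∣P h *ₚ g
  ∣P-*ˡ {f} {g} h d = ∣P-resp (*ₚ-comm g h) (∣P-*ʳ h d)

  -- Cancellation is by polynomials whose constant term is ±1: unlike for monic
  -- polynomials, the argument is a plain induction on the coefficient list.
  record UnitConst (f : Poly) : Set where
    constructor _,_
    field
      inv : ℤ
      inv-eq : coeff f 0 ℤ.* inv ≡ + 1

  0∣⇒≡0 : ∀ {x} → + 0 ∣ x → x ≡ + 0
  0∣⇒≡0 (divides q e) = trans e (ℤ.*-zeroʳ q)

  -- As the constant term of `f` is invertible, the coefficients of `S` are recovered from those of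
  -- the product, lowest first. The case `c` = 0 is cancellation of `f`; general `c` plays the part
  -- of Gauss's lemma.
  unitConst-content : ∀ c f S → UnitConst f → (∀ n → c ∣ coeff (f *ₚ S) n) → ∀ n → c ∣ coeff S n
  unitConst-content c f [] u h n = ℤ∣.∣ᵤ⇒∣ (_ ℕ.∣0)
  unitConst-content c f (s ∷ S) u@(k , f₀k) h = λ { zero → c∣s ; (suc n) → unitConst-content c f S u tail n }
    where
    expand : ∀ n → coeff (f *ₚ (s ∷ S)) n ≡ s ℤ.* coeff f n ℤ.+ coeff (+ 0 ∷ (f *ₚ S)) n
    expand n = trans (*ₚ-∷ f s S .at n) (trans (coeff-+ (map (s ℤ.*_) f) _ n) (cong (ℤ._+ coeff (+ 0 ∷ (f *ₚ S)) n) (coeff-scale s f n)))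
    c∣s : c ∣ s
    c∣s = subst (c ∣_) (begin
      coeff (f *ₚ (s ∷ S)) 0 ℤ.* k        ≡⟨ cong (ℤ._* k) (trans (expand 0) (ℤ.+-identityʳ (s ℤ.* coeff f 0))) ⟩
      s ℤ.* coeff f 0 ℤ.* k               ≡⟨ ℤ.*-assoc s _ k ⟩
      s ℤ.* (coeff f 0 ℤ.* k)             ≡⟨ cong (s ℤ.*_) f₀k ⟩
      s ℤ.* + 1                           ≡⟨ ℤ.*-identityʳ s ⟩
      s                                   ∎) (ℤ∣.∣m⇒∣m*n k (h 0))
      where open ≡-Reasoning
    tail : ∀ n → c ∣ coeff (f *ₚ S) n
    tail n = ℤ∣.∣m+n∣m⇒∣n (subst (c ∣_) (expand (suc n)) (h (suc n))) (ℤ∣.∣m⇒∣m*n (coeff f (suc n)) c∣s)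

  ≋[]-from-diff : ∀ {f g} → f +ₚ negₚ g ≋ [] → f ≋ g
  ≋[]-from-diff {f} {g} e = ≋-trans (solveₚ 2 (λ f g → f ⊜ (f ⊕ ⊝ g) ⊕ g) ≋-refl f g) (+ₚ-cong e (≋-refl {g}))

  unitConst-cancel : ∀ {f S T} → UnitConst f → f *ₚ S ≋ f *ₚ T → S ≋ T
  unitConst-cancel {f} {S} {T} u e = ≋[]-from-diff (mk≋ λ n → 0∣⇒≡0 (unitConst-content (+ 0) f (S +ₚ negₚ T) u zeros n))
    where
    zeros : ∀ n → + 0 ∣ coeff (f *ₚ (S +ₚ negₚ T)) n
    zeros n = subst (+ 0 ∣_) (sym (≋-trans (solveₚ 3 (λ f s t → f ⊗ (s ⊕ ⊝ t) ⊜ f ⊗ s ⊕ ⊝ (f ⊗ t)) ≋-refl f S T)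
      (≋-trans (+ₚ-cong e (≋-refl {negₚ (f *ₚ T)})) (negₚ-inverseʳ (f *ₚ T))) .at n)) ℤ∣.∣-refl

  const-cancel : ∀ {c f g} → c ≢ + 0 → const c *ₚ f ≋ const c *ₚ g → f ≋ g
  const-cancel {c} {f} {g} c≢0 e .at n = ℤ.*-cancelˡ-≡ c _ _ ⦃ ℤ.≢-nonZero c≢0 ⦄
    (trans (sym (coeff-const-* c f n)) (trans (e .at n) (coeff-const-* c g n)))

  const-factor : ∀ c S → (∀ n → c ∣ coeff S n) → ∃[ S′ ] S ≋ const c *ₚ S′
  const-factor c []      h = [] , ≋-sym (*ₚ-zeroʳ (const c))
  const-factor c (s ∷ S) h with h 0 | const-factor c S (λ n → h (suc n))
  ... | divides q e | S′ , e′ = q ∷ S′ , mk≋ λ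
    { zero → trans e (trans (ℤ.*-comm q c) (sym (coeff-const-* c (q ∷ S′) 0)))
    ; (suc n) → trans (e′ .at n) (trans (coeff-const-* c S′ n) (sym (coeff-const-* c (q ∷ S′) (suc n)))) }

  ∣P-const-cancel : ∀ {c f k} → UnitConst f → c ≢ + 0 → f ∣P const c *ₚ k → f ∣P k
  ∣P-const-cancel {c} {f} {k} u c≢0 (S , e)
    with const-factor c S (unitConst-content c f S u λ n → subst (c ∣_) (e .at n) (subst (c ∣_) (sym (coeff-const-* c k n)) (ℤ∣.∣m⇒∣m*n _ ℤ∣.∣-refl)))
  ... | S′ , e′ = S′ , const-cancel {c} {k} {f *ₚ S′} c≢0 (≋-trans e (≋-trans (*ₚ-cong (≋-refl {f}) e′)
        (solveₚ 3 (λ f c s → f ⊗ (c ⊗ s) ⊜ c ⊗ (f ⊗ s)) ≋-refl f (const c) S′)))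

  -- Coprimality over ℚ, with denominators cleared.
  record CoprimeP (f g : Poly) : Set where
    constructor bézout
    field
      {u v} : Poly
      {c} : ℤ
      c≢0 : c ≢ + 0
      eq  : u *ₚ f +ₚ v *ₚ g ≋ const c

  coprimeP-sym : ∀ {f g} → CoprimeP f g → CoprimeP g f
  coprimeP-sym {f} {g} (bézout {u} {v} c≢0 e) = bézout {u = v} {u} c≢0 (≋-trans (+ₚ-comm (v *ₚ g) (u *ₚ f)) e)

  coprimeP-∣ : ∀ {f g h} → h ∣P g → CoprimeP f g → CoprimeP f h
  coprimeP-∣ {f} {g} {h} (a , ea) (bézout {u} {v} c≢0 e) = bézout {u = u} {v *ₚ a} c≢0 (≋-trans
    (+ₚ-cong (≋-refl {u *ₚ f}) (≋-trans (solveₚ 3 (λ v a h → (v ⊗ a) ⊗ h ⊜ v ⊗ (h ⊗ a)) ≋-refl v a h) (*ₚ-cong (≋-refl {v}) (≋-sym ea)))) e)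

  -- Multiplying the Bézout identity by `k` shows that `f` divides c k, and the integer c is then
  -- removed by the content argument.
  coprimeP-cancel : ∀ {f g k} → UnitConst f → CoprimeP f g → f ∣P g *ₚ k → f ∣P k
  coprimeP-cancel {f} {g} {k} uf (bézout {u} {v} {c} c≢0 e) (h , eh) = ∣P-const-cancel {c} {f} {k} uf c≢0 (u *ₚ k +ₚ v *ₚ h , (begin
    const c *ₚ k                           ≈⟨ *ₚ-cong (≋-sym e) (≋-refl {k}) ⟩
    (u *ₚ f +ₚ v *ₚ g) *ₚ k                ≈⟨ solveₚ 5 (λ u f v g k → (u ⊗ f ⊕ v ⊗ g) ⊗ k ⊜ f ⊗ (u ⊗ k) ⊕ v ⊗ (g ⊗ k)) ≋-refl u f v g k ⟩
    f *ₚ (u *ₚ k) +ₚ v *ₚ (g *ₚ k)         ≈⟨ +ₚ-cong (≋-refl {f *ₚ (u *ₚ k)}) (*ₚ-cong (≋-refl {v}) eh) ⟩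
    f *ₚ (u *ₚ k) +ₚ v *ₚ (f *ₚ h)         ≈⟨ solveₚ 5 (λ u f v h k → f ⊗ (u ⊗ k) ⊕ v ⊗ (f ⊗ h) ⊜ f ⊗ (u ⊗ k ⊕ v ⊗ h)) ≋-refl u f v h k ⟩
    f *ₚ (u *ₚ k +ₚ v *ₚ h)                ∎))
    where open ≋-Reasoning

  coprimeP-∣-* : ∀ {f g h} → UnitConst f → CoprimeP f g → f ∣P h → g ∣P h → g *ₚ f ∣P h
  coprimeP-∣-* {f} {g} {h} uf co f∣h (k , e) = step (coprimeP-cancel {f} {g} {k} uf co (∣P-resp e f∣h))
    where
    step : f ∣P k → g *ₚ f ∣P h
    step (l , e′) = l , ≋-trans e (≋-trans (*ₚ-cong (≋-refl {g}) e′) (≋-sym (*ₚ-assoc g f l)))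

  prodP : List Poly → Poly
  prodP = foldr _*ₚ_ 1ₚ

  coprimeP-prod-cancel : ∀ {f k} {F : ℕ → Poly} es → UnitConst f → All (λ e → CoprimeP f (F e)) es → f ∣P prodP (map F es) *ₚ k → f ∣P k
  coprimeP-prod-cancel {k = k} [] uf [] d = ∣P-resp (*ₚ-identityˡ k) d
  coprimeP-prod-cancel {k = k} {F} (e ∷ es) uf (c ∷ cs) d =
    coprimeP-prod-cancel es uf cs (coprimeP-cancel {g = F e} uf c (∣P-resp (*ₚ-assoc (F e) (prodP (map F es)) k) d))

  -- The factors are split off one at a time: if h = P k already and a further factor is coprime to
  -- every factor of P, it has to divide k.
  prodP-∣ : ∀ {h} {F : ℕ → Poly} ds → (∀ {d} → d ∈ ds → UnitConst (F d)) → (∀ {d} → d ∈ ds → F d ∣P h) →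
    AllPairs (λ d e → CoprimeP (F d) (F e)) ds → prodP (map F ds) ∣P h
  prodP-∣ {h} [] u div [] = h , ≋-sym (*ₚ-identityˡ h)
  prodP-∣ {h} {F} (d ∷ ds) u div (c ∷ cs) with prodP-∣ ds (λ m → u (there m)) (λ m → div (there m)) cs
  ... | k , e with coprimeP-prod-cancel {k = k} ds (u (here refl)) c (∣P-resp e (div (here refl)))
  ... | l , e′ = l , ≋-trans e (≋-trans (*ₚ-cong (≋-refl {prodP (map F ds)}) e′)
        (solveₚ 3 (λ p f l → p ⊗ (f ⊗ l) ⊜ (f ⊗ p) ⊗ l) ≋-refl (prodP (map F ds)) (F d) l))

  ∈-prodP : ∀ {F : ℕ → Poly} {d ds} → d ∈ ds → F d ∣P prodP (map F ds)
  ∈-prodP {F} (here {xs = ds} refl) = prodP (map F ds) , ≋-refl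
  ∈-prodP {F} (there {x} m) = ∣P-*ˡ (F x) (∈-prodP m)

  unique⇒allPairs : ∀ {R : ℕ → ℕ → Set} xs → Unique xs → (∀ {x y} → x ∈ xs → y ∈ xs → x ≢ y → R x y) → AllPairs R xs
  unique⇒allPairs [] [] h = []
  unique⇒allPairs (x ∷ xs) (x∉ ∷ u) h =
    All.tabulate (λ m → h (here refl) (there m) (All.lookup x∉ m)) ∷ unique⇒allPairs xs u (λ m m′ → h (there m) (there m′))

  -- X^d - 1, correct also for d = 0, where `X^-1` is not.
  EE : ℕ → Poly
  EE d = mono d +ₚ negₚ 1ₚ

  X^-1≋EE : ∀ d → X^-1 (suc d) ≋ EE (suc d)
  X^-1≋EE d = ∷-cong refl (≋-trans (lemma d) (≋-sym (+ₚ-identityʳ (mono d))))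
    where
    lemma : ∀ d → replicate d (+ 0) ++ (+ 1 ∷ []) ≋ mono d
    lemma zero    = ≋-refl
    lemma (suc d) = ∷-cong refl (lemma d)

  unitConst-EE : ∀ d → 1 ≤ d → UnitConst (EE d)
  unitConst-EE (suc d) _ = -[1+ 0 ] , refl

  -- The quotient of X^(tg) - 1 by X^g - 1, with t terms.
  geo : ℕ → ℕ → Poly
  geo g zero    = []
  geo g (suc t) = 1ₚ +ₚ mono g *ₚ geo g t

  EE-geo : ∀ g t → EE (t ℕ.* g) ≋ EE g *ₚ geo g t
  EE-geo g zero = ≋-trans (negₚ-inverseʳ 1ₚ) (≋-sym (*ₚ-zeroʳ (EE g)))
  EE-geo g (suc t) = begin
    mono (g ℕ.+ t ℕ.* g) +ₚ negₚ 1ₚ             ≈⟨ +ₚ-cong (mono-+ g (t ℕ.* g)) (≋-refl {negₚ 1ₚ}) ⟩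
    mono g *ₚ mono (t ℕ.* g) +ₚ negₚ 1ₚ         ≈⟨ solveₚ 2 (λ x y → x ⊗ y ⊕ ⊝ Κ 1ₚ ⊜ x ⊗ (y ⊕ ⊝ Κ 1ₚ) ⊕ (x ⊕ ⊝ Κ 1ₚ)) ≋-refl (mono g) (mono (t ℕ.* g)) ⟩
    mono g *ₚ EE (t ℕ.* g) +ₚ EE g              ≈⟨ +ₚ-cong (*ₚ-cong (≋-refl {mono g}) (EE-geo g t)) (≋-refl {EE g}) ⟩
    mono g *ₚ (EE g *ₚ geo g t) +ₚ EE g         ≈⟨ solveₚ 3 (λ x e y → x ⊗ (e ⊗ y) ⊕ e ⊜ e ⊗ (Κ 1ₚ ⊕ x ⊗ y)) ≋-refl (mono g) (EE g) (geo g t) ⟩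
    EE g *ₚ geo g (suc t)                       ∎
    where open ≋-Reasoning

  EE-∣ : ∀ {s m} → s ℕ.∣ m → EE s ∣P EE m
  EE-∣ {s} (ℕ.divides t refl) = geo s t , EE-geo s t

  -- Each of the t terms is 1 modulo X^g - 1. The integer t becomes the right-hand side of the
  -- Bézout identity for cyclotomic polynomials.
  geo-mod : ∀ g t → ∃[ W ] geo g t ≋ const (+ t) +ₚ EE g *ₚ W
  geo-mod g zero = [] , ≋-sym (+ₚ-cong const-0 (*ₚ-zeroʳ (EE g)))
  geo-mod g (suc t) with geo-mod g t
  ... | W , e = W +ₚ geo g t , (begin
    1ₚ +ₚ mono g *ₚ geo g t                          ≈⟨ solveₚ 2 (λ x y → Κ 1ₚ ⊕ x ⊗ y ⊜ (Κ 1ₚ ⊕ y) ⊕ (x ⊕ ⊝ Κ 1ₚ) ⊗ y) ≋-refl (mono g) (geo g t) ⟩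
    (1ₚ +ₚ geo g t) +ₚ EE g *ₚ geo g t               ≈⟨ +ₚ-cong (+ₚ-cong (≋-refl {1ₚ}) e) (≋-refl {EE g *ₚ geo g t}) ⟩
    (1ₚ +ₚ (const (+ t) +ₚ EE g *ₚ W)) +ₚ EE g *ₚ geo g t ≈⟨ solveₚ 5 (λ o c e w y → (o ⊕ (c ⊕ e ⊗ w)) ⊕ e ⊗ y ⊜ (o ⊕ c) ⊕ e ⊗ (w ⊕ y)) ≋-refl 1ₚ (const (+ t)) (EE g) W (geo g t) ⟩
    (1ₚ +ₚ const (+ t)) +ₚ EE g *ₚ (W +ₚ geo g t)    ≈⟨ +ₚ-cong (≋-sym (≋-trans (const-+ (+ 1) (+ t)) (+ₚ-cong const-1 (≋-refl {const (+ t)})))) (≋-refl {EE g *ₚ (W +ₚ geo g t)}) ⟩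
    const (+ suc t) +ₚ EE g *ₚ (W +ₚ geo g t)        ∎)
    where open ≋-Reasoning

  EE-+ : ∀ g b → EE g ≋ EE (g ℕ.+ b) +ₚ negₚ (mono g *ₚ EE b)
  EE-+ g b = ≋-trans (solveₚ 2 (λ x y → x ⊕ ⊝ Κ 1ₚ ⊜ (x ⊗ y ⊕ ⊝ Κ 1ₚ) ⊕ ⊝ (x ⊗ (y ⊕ ⊝ Κ 1ₚ))) ≋-refl (mono g) (mono b))
    (+ₚ-cong (+ₚ-cong (≋-sym (mono-+ g b)) (≋-refl {negₚ 1ₚ})) (≋-refl {negₚ (mono g *ₚ EE b)}))

  -- X^g - 1 = (X^(g+c) - 1) - X^g (X^c - 1) with c = yn: a difference of exponents turns into a
  -- combination of polynomials.
  EE-combination : ∀ {g m n x y} → g ℕ.+ y ℕ.* n ≡ x ℕ.* m → ∃[ U ] ∃[ V ] EE g ≋ U *ₚ EE m +ₚ V *ₚ EE n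
  EE-combination {g} {m} {n} {x} {y} e = geo m x , negₚ (mono g *ₚ geo n y) , (begin
    EE g ≈⟨ EE-+ g (y ℕ.* n) ⟩
    EE (g ℕ.+ y ℕ.* n) +ₚ negₚ (mono g *ₚ EE (y ℕ.* n))
      ≈⟨ +ₚ-cong (subst (λ k → EE k ≋ EE m *ₚ geo m x) (sym e) (EE-geo m x)) (negₚ-cong (*ₚ-cong (≋-refl {mono g}) (EE-geo n y))) ⟩
    EE m *ₚ geo m x +ₚ negₚ (mono g *ₚ (EE n *ₚ geo n y))
      ≈⟨ solveₚ 5 (λ a b x c d → a ⊗ b ⊕ ⊝ (x ⊗ (c ⊗ d)) ⊜ b ⊗ a ⊕ (⊝ (x ⊗ d)) ⊗ c) ≋-refl (EE m) (geo m x) (mono g) (EE n) (geo n y) ⟩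
    geo m x *ₚ EE m +ₚ negₚ (mono g *ₚ geo n y) *ₚ EE n ∎)
    where open ≋-Reasoning

  EE-bézout : ∀ m n → ∃[ U ] ∃[ V ] EE (gcd m n) ≋ U *ₚ EE m +ₚ V *ₚ EE n
  EE-bézout m n with Bézout.identity (gcd-GCD m n)
  ... | Bézout.+- x y e = EE-combination {gcd m n} {m} {n} {x} {y} e
  ... | Bézout.-+ x y e with EE-combination {gcd m n} {n} {m} {y} {x} e
  ...   | U , V , e′ = V , U , ≋-trans e′ (+ₚ-comm (U *ₚ EE n) (V *ₚ EE m))

-- Cyclotomic polynomials and evaluation at 1

module CyclotomicPolynomials where
  open PrivateDefinitions
  open PolynomialRing
  open Monomials
  open PolynomialDivisibility
  open import Data.Nat as ℕ using (ℕ; zero; suc; _≤_; _<_; _∸_; s≤s; _^_)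
  import Data.Nat.Properties as ℕ
  import Data.Nat.Divisibility as ℕ
  open import Data.Nat.Coprimality using (Coprime; coprime-divisor)
  open import Data.Nat.Primality using (Prime; prime⇒irreducible; prime⇒nonZero)
  open import Data.Nat.GCD using (gcd; gcd[m,n]∣m; gcd[m,n]∣n)
  open import Data.Nat.Induction using (<-rec)
  open import Data.Integer as ℤ using (ℤ; +_; -[1+_])
  import Data.Integer.Properties as ℤ
  open import Data.Integer.Divisibility.Signed as ℤ∣ using (divides; _∣_)
  open import Data.Integer.Tactic.RingSolver using (solve-∀)
  open import Data.List using (List; []; _∷_; map; _++_; length; reverse; replicate; drop; upTo)
  import Data.List.Properties as List
  open import Data.List.Membership.Propositional using (_∈_)
  open import Data.List.Relation.Unary.Any using (here; there)
  import Data.List.Relation.Unary.All as All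
  open import Data.List.Relation.Unary.AllPairs using (AllPairs; []; _∷_)
  open import Data.List.Relation.Unary.Unique.Propositional using (Unique)
  import Data.List.Relation.Unary.Unique.Propositional.Properties as Unique
  open import Data.Product using (_,_; ∃-syntax; _×_)
  open import Data.Sum using (inj₁; inj₂)
  open import Data.Empty using (⊥-elim)
  open import Relation.Nullary using (yes; no; ¬_)
  open import Relation.Binary.PropositionalEquality
  open import Relation.Binary.Definitions using (tri<; tri≈; tri>)
  open import Tactic.RingSolver.NonReflective polySolverRing using (_⊕_; _⊗_; ⊝_) renaming (solve to solveₚ)

  -- Leading coefficient 1 read off at the end of the list, where multiplication can be followed by
  -- induction; `Monic` reads it off the reversed list, as division does.
  Ends : Poly → Set
  Ends p = ∃[ i ] p ≡ i ++ (+ 1 ∷ [])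

  ends⇒monic : ∀ {p} → Ends p → Monic p
  ends⇒monic (i , refl) = reverse i , List.reverse-++ i (+ 1 ∷ [])

  monic⇒ends : ∀ {p} → Monic p → Ends p
  monic⇒ends {p} (ds , e) = reverse ds , trans (sym (List.reverse-involutive p)) (trans (cong reverse e) (List.unfold-reverse (+ 1) ds))

  X^-1-monic : ∀ d → Monic (X^-1 d)
  X^-1-monic d = ends⇒monic ((-[1+ 0 ] ∷ replicate (d ∸ 1) (+ 0)) , refl)

  ends-+ : ∀ x i → length x ≤ length i → ∃[ j ] (length j ≡ length i × x +ₚ (i ++ (+ 1 ∷ [])) ≡ j ++ (+ 1 ∷ []))
  ends-+ [] i _ = i , refl , refl
  ends-+ (a ∷ x) (b ∷ i) (s≤s le) with ends-+ x i le
  ... | j , l , e = (a ℤ.+ b) ∷ j , cong suc l , cong ((a ℤ.+ b) ∷_) e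

  ends-* : ∀ i i′ → ∃[ j ] (length i′ ≤ length j × (i ++ (+ 1 ∷ [])) *ₚ (i′ ++ (+ 1 ∷ [])) ≡ j ++ (+ 1 ∷ []))
  ends-* [] i′ = map (+ 1 ℤ.*_) i′ , ℕ.≤-reflexive (sym (List.length-map (+ 1 ℤ.*_) i′)) , lemma i′
    where
    lemma : ∀ i → map (+ 1 ℤ.*_) (i ++ (+ 1 ∷ [])) +ₚ (+ 0 ∷ []) ≡ map (+ 1 ℤ.*_) i ++ (+ 1 ∷ [])
    +ₚ-[] : ∀ p → p +ₚ [] ≡ p
    +ₚ-[] []      = refl
    +ₚ-[] (a ∷ p) = refl
    lemma []      = refl
    lemma (a ∷ i) = cong₂ _∷_ (ℤ.+-identityʳ _) (trans (+ₚ-[] _) (List.map-++ (+ 1 ℤ.*_) i (+ 1 ∷ [])))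
  ends-* (a ∷ i) i′ with ends-* i i′
  ... | j , l , e with ends-+ (map (a ℤ.*_) (i′ ++ (+ 1 ∷ []))) (+ 0 ∷ j)
    (ℕ.≤-trans (ℕ.≤-reflexive (trans (List.length-map (a ℤ.*_) (i′ ++ (+ 1 ∷ []))) (trans (List.length-++ i′) (ℕ.+-comm _ 1)))) (s≤s l))
  ... | k , l′ , e′ = k , ℕ.≤-trans (ℕ.m≤n⇒m≤1+n l) (ℕ.≤-reflexive (sym l′)) ,
    trans (cong (λ t → map (a ℤ.*_) (i′ ++ (+ 1 ∷ [])) +ₚ (+ 0 ∷ t)) e) e′

  monic-* : ∀ {p q} → Monic p → Monic q → Monic (p *ₚ q)
  monic-* {p} {q} mp mq with monic⇒ends {p} mp | monic⇒ends {q} mq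
  ... | i , refl | i′ , refl = let (j , _ , e) = ends-* i i′ in ends⇒monic (j , e)

  prodP-monic : ∀ {F : ℕ → Poly} ds → (∀ {d} → d ∈ ds → Monic (F d)) → Monic (prodP (map F ds))
  prodP-monic [] h = [] , refl
  prodP-monic (d ∷ ds) h = monic-* (h (here refl)) (prodP-monic ds (λ m → h (there m)))

  coeff-*-0 : ∀ p q → coeff (p *ₚ q) 0 ≡ coeff p 0 ℤ.* coeff q 0
  coeff-*-0 []      q = refl
  coeff-*-0 (a ∷ p) q = coeff-*-zero a p q

  Ψ : ℕ → Poly
  Ψ s = prodP (map Φ (properDivisors s))

  properDivisors-unique : ∀ s → Unique (properDivisors s)
  properDivisors-unique s = Unique.filter⁺ (λ d → d ℕ.∣? s) {drop 1 (upTo s)} (Unique.drop⁺ 1 (Unique.upTo⁺ s))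

  -- The three properties need one strong induction: the division defining Φ_s is exact only because
  -- the Φ_d of proper divisors are pairwise coprime, and dividing by their product requires it to
  -- be monic.
  record Cyclotomic (s : ℕ) : Set where
    field
      factor  : EE s ≋ Φ s *ₚ Ψ s
      monic   : Monic (Φ s)
      coprime : ∀ m → ¬ s ℕ.∣ m → CoprimeP (Φ s) (EE m)

    divisor : Φ s ∣P EE s
    divisor = Ψ s , factor

    -- The constant terms of Φ_s and Ψ_s multiply to that of X^s - 1, which is -1.
    unit : 1 ≤ s → UnitConst (Φ s)
    unit (s≤s {n = n} _) = ℤ.- coeff (Ψ s) 0 , (begin
      coeff (Φ s) 0 ℤ.* ℤ.- coeff (Ψ s) 0     ≡⟨ ℤ.neg-distribʳ-* (coeff (Φ s) 0) (coeff (Ψ s) 0) ⟨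
      ℤ.- (coeff (Φ s) 0 ℤ.* coeff (Ψ s) 0)   ≡⟨ cong ℤ.-_ (coeff-*-0 (Φ s) (Ψ s)) ⟨
      ℤ.- coeff (Φ s *ₚ Ψ s) 0                ≡⟨ cong ℤ.-_ (factor .at 0) ⟨
      + 1                                     ∎)
      where open ≡-Reasoning
  open Cyclotomic

  private
    module Step (s : ℕ) (1≤s : 1 ≤ s) (ih : ∀ {d} → d < s → 1 ≤ d → Cyclotomic d) where

      -- For e < d the polynomial Φ_e divides X^e - 1, and Φ_d is coprime to X^e - 1 because d does
      -- not divide e.
      pairwise : ∀ ds → Unique ds → (∀ {d} → d ∈ ds → 1 ≤ d × d < s) → AllPairs (λ d e → CoprimeP (Φ d) (Φ e)) ds
      pairwise ds u h = unique⇒allPairs ds u λ {d} {e} m m′ d≢e → let (1≤d , d<s) = h m; (1≤e , e<s) = h m′ in co 1≤d d<s 1≤e e<s d≢e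
        where
        co′ : ∀ {d e} → d < s → 1 ≤ d → 1 ≤ e → e < d → CoprimeP (Φ d) (Φ e)
        co′ {d} {e} d<s 1≤d 1≤e e<d = coprimeP-∣ (divisor (ih (ℕ.<-trans e<d d<s) 1≤e))
          (coprime (ih d<s 1≤d) e (ℕ.>⇒∤ ⦃ ℕ.>-nonZero 1≤e ⦄ e<d))
        co : ∀ {d e} → 1 ≤ d → d < s → 1 ≤ e → e < s → d ≢ e → CoprimeP (Φ d) (Φ e)
        co {d} {e} 1≤d d<s 1≤e e<s d≢e with ℕ.<-cmp d e
        ... | tri< d<e _ _ = coprimeP-sym (co′ e<s 1≤e 1≤d d<e)
        ... | tri≈ _ d≡e _ = ⊥-elim (d≢e d≡e)
        ... | tri> _ _ e<d = co′ d<s 1≤d 1≤e e<d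

      prod-∣ : ∀ {h} ds → Unique ds → (∀ {d} → d ∈ ds → 1 ≤ d × d < s) → (∀ {d} → d ∈ ds → Φ d ∣P h) → prodP (map Φ ds) ∣P h
      prod-∣ ds u lt dv = prodP-∣ ds (λ m → let (1≤d , d<s) = lt m in unit (ih d<s 1≤d) 1≤d) dv (pairwise ds u lt)

      Ψ-∣ : ∀ {h} → (∀ {d} → 1 ≤ d → d < s → d ℕ.∣ s → Φ d ∣P h) → Ψ s ∣P h
      Ψ-∣ f = prod-∣ (properDivisors s) (properDivisors-unique s)
        (λ m → let (1≤d , d<s , _) = ∈-properDivisors⁻ {s = s} m in 1≤d , d<s)
        (λ m → let (1≤d , d<s , d∣s) = ∈-properDivisors⁻ {s = s} m in f 1≤d d<s d∣s)

      Ψ∣X : Ψ s ∣P X^-1 s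
      Ψ∣X = subst (λ n → Ψ s ∣P X^-1 n) (ℕ.suc-pred s ⦃ ℕ.>-nonZero 1≤s ⦄)
        (∣P-resp (≋-sym (X^-1≋EE (ℕ.pred s))) (subst (λ n → Ψ s ∣P EE n) (sym (ℕ.suc-pred s ⦃ ℕ.>-nonZero 1≤s ⦄))
          (Ψ-∣ λ 1≤d d<s d∣s → ∣P-trans (divisor (ih d<s 1≤d)) (EE-∣ d∣s))))

      X≋EE : X^-1 s ≋ EE s
      X≋EE = subst (λ n → X^-1 n ≋ EE n) (ℕ.suc-pred s ⦃ ℕ.>-nonZero 1≤s ⦄) (X^-1≋EE (ℕ.pred s))

      Ψ-monic : Monic (Ψ s)
      Ψ-monic = prodP-monic (properDivisors s) λ m → let (1≤d , d<s , _) = ∈-properDivisors⁻ {s = s} m in monic (ih d<s 1≤d)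

      module _ (Q : Poly) (X≋ : X^-1 s ≋ Ψ s *ₚ Q) where
        Φ≋Q : Φ s ≋ Q
        Φ≋Q = subst (_≋ Q) (sym (Φ-rec s 1≤s)) (divMonic-exact (X^-1 s) (Ψ s) Q Ψ-monic X≋)

        factor′ : EE s ≋ Φ s *ₚ Ψ s
        factor′ = ≋-trans (≋-sym X≋EE) (≋-trans X≋ (≋-trans (*ₚ-comm (Ψ s) Q) (*ₚ-cong (≋-sym Φ≋Q) (≋-refl {Ψ s}))))

        X≢0 : ¬ X^-1 s ≋ []
        X≢0 e with e .at 0
        ... | ()

        monic′ : Monic (Φ s)
        monic′ = subst Monic (sym (Φ-rec s 1≤s)) (divMonic-monic (X^-1 s) (Ψ s) Q (X^-1-monic s) Ψ-monic X≢0 X≋)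

        -- X^g - 1 is the product of the Φ_d over d ∣ g, and each such d is a proper divisor of s.
        EEg∣Ψ : ∀ {g} → 1 ≤ g → g < s → g ℕ.∣ s → EE g ∣P Ψ s
        EEg∣Ψ {g} 1≤g g<s g∣s = ∣P-respˡ (≋-sym (factor (ih g<s 1≤g)))
          (prod-∣ (g ∷ properDivisors g) (All.tabulate (λ m → let (_ , d<g , _) = ∈-properDivisors⁻ {s = g} m in λ { refl → ℕ.<-irrefl refl d<g }) ∷ properDivisors-unique g)
            (λ m → let (1≤d , d<s , _) = lt m in 1≤d , d<s)
            (λ m → let (1≤d , d<s , d∣s) = lt m in ∈-prodP (∈-properDivisors⁺ {s = s} 1≤d d<s d∣s)))
          where
          lt : ∀ {d} → d ∈ g ∷ properDivisors g → 1 ≤ d × d < s × d ℕ.∣ s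
          lt (here refl) = 1≤g , g<s , g∣s
          lt (there m) = let (1≤d , d<g , d∣g) = ∈-properDivisors⁻ {s = g} m in 1≤d , ℕ.<-trans d<g g<s , ℕ.∣-trans d∣g g∣s

        -- Φ_s divides (X^s - 1)/(X^g - 1), which is congruent to s/g modulo X^g - 1.
        coprime′ : ∀ m → ¬ s ℕ.∣ m → CoprimeP (Φ s) (EE m)
        coprime′ m s∤m = go (gcd[m,n]∣m s m) (EE-bézout s m)
          where
          g = gcd s m
          go : g ℕ.∣ s → ∃[ U ] ∃[ V ] EE g ≋ U *ₚ EE s +ₚ V *ₚ EE m → CoprimeP (Φ s) (EE m)
          go g∣s@(ℕ.divides t s≡tg) (U , V , bez) = go₂ (EEg∣Ψ 1≤g g<s g∣s) (geo-mod g t)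
            where
            1≤g : 1 ≤ g
            1≤g = ℕ.n≢0⇒n>0 λ g≡0 → ℕ.<-irrefl (trans (sym (trans s≡tg (trans (cong (t ℕ.*_) g≡0) (ℕ.*-zeroʳ t)))) refl) 1≤s
            g<s : g < s
            g<s = ℕ.≤∧≢⇒< (ℕ.∣⇒≤ ⦃ ℕ.>-nonZero 1≤s ⦄ g∣s) λ g≡s → s∤m (subst (ℕ._∣ m) g≡s (gcd[m,n]∣n s m))
            t≢0 : + t ≢ + 0
            t≢0 refl = ℕ.<-irrefl (sym s≡tg) 1≤s
            go₂ : EE g ∣P Ψ s → ∃[ W ] geo g t ≋ const (+ t) +ₚ EE g *ₚ W → CoprimeP (Φ s) (EE m)
            go₂ (W , eW) (W′ , eW′) = bézout {u = W +ₚ negₚ (W′ *ₚ (U *ₚ Ψ s))} {v = negₚ (W′ *ₚ V)} t≢0 (begin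
              (W +ₚ negₚ (W′ *ₚ (U *ₚ Ψ s))) *ₚ Φ s +ₚ negₚ (W′ *ₚ V) *ₚ EE m
                ≈⟨ solveₚ 7 (λ w w′ u v ψ φ e → (w ⊕ ⊝ (w′ ⊗ (u ⊗ ψ))) ⊗ φ ⊕ (⊝ (w′ ⊗ v)) ⊗ e ⊜ φ ⊗ w ⊕ ⊝ (w′ ⊗ (u ⊗ (φ ⊗ ψ) ⊕ v ⊗ e))) ≋-refl W W′ U V (Ψ s) (Φ s) (EE m) ⟩
              Φ s *ₚ W +ₚ negₚ (W′ *ₚ (U *ₚ (Φ s *ₚ Ψ s) +ₚ V *ₚ EE m))
                ≈⟨ +ₚ-cong (≋-trans ΦW eW′) (negₚ-cong (*ₚ-cong (≋-refl {W′}) (≋-sym (≋-trans bez (+ₚ-cong (*ₚ-cong (≋-refl {U}) factor′) (≋-refl {V *ₚ EE m})))))) ⟩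
              (const (+ t) +ₚ EE g *ₚ W′) +ₚ negₚ (W′ *ₚ EE g)
                ≈⟨ solveₚ 3 (λ c e w → (c ⊕ e ⊗ w) ⊕ ⊝ (w ⊗ e) ⊜ c) ≋-refl (const (+ t)) (EE g) W′ ⟩
              const (+ t) ∎)
              where
              open ≋-Reasoning
              ΦW : Φ s *ₚ W ≋ geo g t
              ΦW = unitConst-cancel {EE g} {Φ s *ₚ W} {geo g t} (unitConst-EE g 1≤g) (begin
                EE g *ₚ (Φ s *ₚ W)     ≈⟨ solveₚ 3 (λ e f w → e ⊗ (f ⊗ w) ⊜ f ⊗ (e ⊗ w)) ≋-refl (EE g) (Φ s) W ⟩
                Φ s *ₚ (EE g *ₚ W)     ≈⟨ *ₚ-cong (≋-refl {Φ s}) eW ⟨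
                Φ s *ₚ Ψ s             ≈⟨ factor′ ⟨
                EE s                   ≈⟨ subst (λ k → EE k ≋ EE g *ₚ geo g t) (sym s≡tg) (EE-geo g t) ⟩
                EE g *ₚ geo g t        ∎)

        cyclotomic′ : Cyclotomic s
        cyclotomic′ = record { factor = factor′ ; monic = monic′ ; coprime = coprime′ }

      cyclotomic″ : Ψ s ∣P X^-1 s → Cyclotomic s
      cyclotomic″ (Q , e) = cyclotomic′ Q e

  cyclotomic : ∀ s → 1 ≤ s → Cyclotomic s
  cyclotomic = <-rec _ λ s ih 1≤s → let open Step s 1≤s ih in cyclotomic″ Ψ∣X

  Φ-unit : ∀ s → 1 ≤ s → UnitConst (Φ s)
  Φ-unit s 1≤s = unit (cyclotomic s 1≤s) 1≤s

  Ψ-∣ : ∀ {s h} → 1 ≤ s → (∀ {d} → 1 ≤ d → d < s → d ℕ.∣ s → Φ d ∣P h) → Ψ s ∣P h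
  Ψ-∣ {s} 1≤s = Step.Ψ-∣ s 1≤s (λ {d} _ → cyclotomic d)

  Φ∣EE : ∀ {s m} → 1 ≤ s → s ℕ.∣ m → Φ s ∣P EE m
  Φ∣EE {s} 1≤s s∣m = ∣P-trans (divisor (cyclotomic s 1≤s)) (EE-∣ s∣m)

  Φ-cancel-EE : ∀ {s m f} → 1 ≤ s → ¬ s ℕ.∣ m → Φ s ∣P EE m *ₚ f → Φ s ∣P f
  Φ-cancel-EE {s} {m} {f} 1≤s s∤m d = coprimeP-cancel {Φ s} {EE m} {f} (Φ-unit s 1≤s) (coprime (cyclotomic s 1≤s) m s∤m) d

  eval1 : Poly → ℤ
  eval1 []      = + 0
  eval1 (a ∷ p) = a ℤ.+ eval1 p

  eval1-+ : ∀ p q → eval1 (p +ₚ q) ≡ eval1 p ℤ.+ eval1 q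
  eval1-+ []      q       = sym (ℤ.+-identityˡ _)
  eval1-+ (a ∷ p) []      = sym (ℤ.+-identityʳ _)
  eval1-+ (a ∷ p) (b ∷ q) = trans (cong (λ t → a ℤ.+ b ℤ.+ t) (eval1-+ p q)) (lem a b (eval1 p) (eval1 q))
    where
    lem : ∀ a b p q → a ℤ.+ b ℤ.+ (p ℤ.+ q) ≡ a ℤ.+ p ℤ.+ (b ℤ.+ q)
    lem = solve-∀

  eval1-scale : ∀ a p → eval1 (map (a ℤ.*_) p) ≡ a ℤ.* eval1 p
  eval1-scale a []      = sym (ℤ.*-zeroʳ a)
  eval1-scale a (b ∷ p) = trans (cong (λ t → a ℤ.* b ℤ.+ t) (eval1-scale a p)) (sym (ℤ.*-distribˡ-+ a b (eval1 p)))

  eval1-* : ∀ p q → eval1 (p *ₚ q) ≡ eval1 p ℤ.* eval1 q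
  eval1-* []      q = refl
  eval1-* (a ∷ p) q = trans (eval1-+ (map (a ℤ.*_) q) _) (trans (cong₂ ℤ._+_ (eval1-scale a q) (trans (ℤ.+-identityˡ _) (eval1-* p q)))
    (sym (ℤ.*-distribʳ-+ (eval1 q) a (eval1 p))))

  eval1-cong : ∀ {p q} → p ≋ q → eval1 p ≡ eval1 q
  eval1-cong {[]}    {[]}    e = refl
  eval1-cong {[]}    {b ∷ q} e = trans (sym (ℤ.+-identityˡ _)) (cong₂ ℤ._+_ (e .at 0) (eval1-cong {[]} {q} (mk≋ λ n → e .at (suc n))))
  eval1-cong {a ∷ p} {[]}    e = trans (cong₂ ℤ._+_ (e .at 0) (eval1-cong {p} {[]} (mk≋ λ n → e .at (suc n)))) (ℤ.+-identityˡ _)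
  eval1-cong {a ∷ p} {b ∷ q} e = cong₂ ℤ._+_ (e .at 0) (eval1-cong {p} {q} (≋-tail e))

  eval1-∣ : ∀ {f g} → f ∣P g → eval1 f ∣ eval1 g
  eval1-∣ {f} {g} (h , e) = divides (eval1 h) (trans (eval1-cong e) (trans (eval1-* f h) (ℤ.*-comm (eval1 f) (eval1 h))))

  eval1-mono : ∀ n → eval1 (mono n) ≡ + 1
  eval1-mono zero    = refl
  eval1-mono (suc n) = trans (ℤ.+-identityˡ _) (eval1-mono n)

  eval1-geo : ∀ g t → eval1 (geo g t) ≡ + t
  eval1-geo g zero    = refl
  eval1-geo g (suc t) = trans (eval1-+ 1ₚ (mono g *ₚ geo g t)) (cong (λ z → + 1 ℤ.+ z)
    (trans (eval1-* (mono g) (geo g t)) (trans (cong₂ ℤ._*_ (eval1-mono g) (eval1-geo g t)) (ℤ.*-identityˡ (+ t)))))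

  prime∤⇒coprime : ∀ {p n} → Prime p → ¬ p ℕ.∣ n → Coprime n p
  prime∤⇒coprime {p} {n} pp p∤n {d} (d∣n , d∣p) with prime⇒irreducible pp d∣p
  ... | inj₁ d≡1  = d≡1
  ... | inj₂ refl = ⊥-elim (p∤n d∣n)

  ∤⇒∣primePower⇒≡1 : ∀ {p k} → Prime p → ∀ a → ¬ p ℕ.∣ k → k ℕ.∣ p ^ a → k ≡ 1
  ∤⇒∣primePower⇒≡1 pp zero    p∤k k∣ = ℕ.∣1⇒≡1 k∣
  ∤⇒∣primePower⇒≡1 pp (suc a) p∤k k∣ = ∤⇒∣primePower⇒≡1 pp a p∤k (coprime-divisor (prime∤⇒coprime pp p∤k) k∣)

  properDivisor-primePower : ∀ {p d} a → Prime p → d ℕ.∣ p ^ suc a → d < p ^ suc a → d ℕ.∣ p ^ a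
  properDivisor-primePower {p} {d} a pp (ℕ.divides k e) d< with p ℕ.∣? k
  ... | no p∤k with ∤⇒∣primePower⇒≡1 pp (suc a) p∤k (ℕ.divides d (trans e (ℕ.*-comm k d)))
  ...   | refl = ⊥-elim (ℕ.<-irrefl (trans (sym (ℕ.+-identityʳ d)) (sym e)) d<)
  properDivisor-primePower {p} {d} a pp (ℕ.divides k e) d< | yes (ℕ.divides l refl) = ℕ.divides l
    (ℕ.*-cancelˡ-≡ _ _ p ⦃ prime⇒nonZero pp ⦄ (trans e (trans (cong (ℕ._* d) (ℕ.*-comm l p)) (ℕ.*-assoc p l d))))

  -- X^(p^a) - 1 = (X^(p^(a-1)) - 1) Y with Y(1) = p, and Ψ divides the first factor, so Y divides Φ.
  prime∣Φ1 : ∀ {p} a → Prime p → + p ∣ eval1 (Φ (p ^ suc a))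
  prime∣Φ1 {p} a pp = subst (_∣ eval1 (Φ (p ^ suc a))) (eval1-geo h p) (eval1-∣ (go (Ψ-∣ {p ^ suc a} {EE h} 1≤s (λ 1≤d d<s d∣s → Φ∣EE 1≤d (properDivisor-primePower a pp d∣s d<s)))))
    where
    s = p ^ suc a
    h = p ^ a
    1≤s : 1 ≤ s
    1≤s = ℕ.m^n>0 p ⦃ prime⇒nonZero pp ⦄ (suc a)
    go : Ψ s ∣P EE h → geo h p ∣P Φ s
    go (R , e) = R , unitConst-cancel {EE h} {Φ s} {geo h p *ₚ R} (unitConst-EE h (ℕ.m^n>0 p ⦃ prime⇒nonZero pp ⦄ a)) (begin
      EE h *ₚ Φ s             ≈⟨ *ₚ-cong e (≋-refl {Φ s}) ⟩
      (Ψ s *ₚ R) *ₚ Φ s       ≈⟨ solveₚ 3 (λ ψ r φ → (ψ ⊗ r) ⊗ φ ⊜ (φ ⊗ ψ) ⊗ r) ≋-refl (Ψ s) R (Φ s) ⟩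
      (Φ s *ₚ Ψ s) *ₚ R       ≈⟨ *ₚ-cong (factor (cyclotomic s 1≤s)) (≋-refl {R}) ⟨
      EE s *ₚ R               ≈⟨ *ₚ-cong (EE-geo h p) (≋-refl {R}) ⟩
      (EE h *ₚ geo h p) *ₚ R  ≈⟨ *ₚ-assoc (EE h) (geo h p) R ⟩
      EE h *ₚ (geo h p *ₚ R)  ∎)
      where open ≋-Reasoning

-- Congruences of polynomials, Frobenius, and reading off coefficients

module Congruences where
  open PolynomialRing
  open Monomials
  open PolynomialDivisibility
  open CyclotomicPolynomials
  open import Data.Nat as ℕ using (ℕ; zero; suc; _<_; _∸_; z≤n; s≤s; _!)
  import Data.Nat.Properties as ℕ
  import Data.Nat.Divisibility as ℕ
  import Data.Nat.DivMod as ℕ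
  open import Data.Nat.Combinatorics using (_C_; nCn≡1; nCk≡n!/k![n-k]!; k![n∸k]!∣n!)
  open import Data.Nat.Primality using (Prime; prime⇒nonZero; prime⇒nonTrivial; euclidsLemma)
  open import Data.Integer as ℤ using (ℤ; +_)
  import Data.Integer.Properties as ℤ
  open import Data.Fin as Fin using (Fin; zero; suc; toℕ; fromℕ; inject₁)
  import Data.Fin.Properties as Fin
  open import Data.List using ([]; _∷_; map)
  open import Data.Sum using (inj₁; inj₂)
  open import Data.Empty using (⊥-elim)
  open import Function using (_∘_)
  open import Relation.Nullary using (¬_)
  open import Relation.Binary.PropositionalEquality
  open import Algebra.Bundles using (CommutativeRing; CommutativeMonoid)
  open import Tactic.RingSolver.NonReflective polySolverRing using (_⊕_; _⊗_; ⊝_; Κ) renaming (solve to solveₚ)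
  open CommutativeRing polyRing using () renaming (semiring to polySemiring; commutativeSemiring to polyCommutativeSemiring)
  open import Algebra.Properties.Semiring.Sum polySemiring public using () renaming
    (sum to sumP; sum-cong-≋ to sumP-cong; ∑-comm to sumP-comm; ∑-distrib-+ to sumP-+; *-distribˡ-sum to sumP-*ˡ; *-distribʳ-sum to sumP-*ʳ; sum-init-last to sumP-init-last)
  open import Algebra.Properties.Semiring.Sum ℕ.+-*-semiring public using () renaming
    (sum to sumℕ; sum-cong-≗ to sumℕ-cong; ∑-comm to sumℕ-comm; ∑-distrib-+ to sumℕ-+; *-distribˡ-sum to sumℕ-*ˡ; *-distribʳ-sum to sumℕ-*ʳ)
  open import Algebra.Properties.Semiring.Exp polySemiring using () renaming (_^_ to _^P_; ^-congˡ to ^P-cong)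
  open import Algebra.Properties.CommutativeSemiring.Exp polyCommutativeSemiring using () renaming (^-distrib-* to ^P-*)
  open import Algebra.Properties.Semiring.Mult polySemiring using () renaming (_×_ to _×P_)
  import Algebra.Properties.CommutativeSemiring.Binomial polyCommutativeSemiring as Binomial

  -- Congruence modulo the ideal generated by the polynomial `m` and the integer `l`. With `l` = p
  -- this is the setting for Frobenius, with `l` = 0 congruence modulo `m` alone.
  record Congruent (m : Poly) (l : ℤ) (f g : Poly) : Set where
    constructor cong-by
    field
      S T : Poly
      eq  : f ≋ g +ₚ (m *ₚ S +ₚ const l *ₚ T)

  module Congruence (m : Poly) (l : ℤ) where
    infix 4 _~_
    _~_ = Congruent m l

    ≋⇒~ : ∀ {f g} → f ≋ g → f ~ g
    ≋⇒~ {f} {g} e = cong-by [] [] (≋-trans e (≋-sym (≋-trans (+ₚ-cong (≋-refl {g}) (≋-trans (+ₚ-cong (*ₚ-zeroʳ m) (*ₚ-zeroʳ (const l))) ≋-refl)) (+ₚ-identityʳ g))))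

    ~-refl : ∀ {f} → f ~ f
    ~-refl = ≋⇒~ ≋-refl

    ~-sym : ∀ {f g} → f ~ g → g ~ f
    ~-sym {f} {g} (cong-by S T e) = cong-by (negₚ S) (negₚ T) (≋-trans
      (solveₚ 5 (λ g m s c t → g ⊜ (g ⊕ (m ⊗ s ⊕ c ⊗ t)) ⊕ (m ⊗ (⊝ s) ⊕ c ⊗ (⊝ t))) ≋-refl g m S (const l) T)
      (+ₚ-cong (≋-sym e) ≋-refl))

    ~-trans : ∀ {f g h} → f ~ g → g ~ h → f ~ h
    ~-trans {f} {g} {h} (cong-by S T e) (cong-by S′ T′ e′) = cong-by (S′ +ₚ S) (T′ +ₚ T) (≋-trans e (≋-trans (+ₚ-cong e′ ≋-refl)
      (solveₚ 7 (λ h m s c t s′ t′ → (h ⊕ (m ⊗ s′ ⊕ c ⊗ t′)) ⊕ (m ⊗ s ⊕ c ⊗ t) ⊜ h ⊕ (m ⊗ (s′ ⊕ s) ⊕ c ⊗ (t′ ⊕ t))) ≋-refl h m S (const l) T S′ T′)))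

    ~-+ : ∀ {f g h k} → f ~ g → h ~ k → f +ₚ h ~ g +ₚ k
    ~-+ {f} {g} {h} {k} (cong-by S T e) (cong-by S′ T′ e′) = cong-by (S +ₚ S′) (T +ₚ T′) (≋-trans (+ₚ-cong e e′)
      (solveₚ 8 (λ g k m s c t s′ t′ → (g ⊕ (m ⊗ s ⊕ c ⊗ t)) ⊕ (k ⊕ (m ⊗ s′ ⊕ c ⊗ t′)) ⊜ (g ⊕ k) ⊕ (m ⊗ (s ⊕ s′) ⊕ c ⊗ (t ⊕ t′))) ≋-refl g k m S (const l) T S′ T′))

    ~-*ʳ : ∀ {f g} h → f ~ g → f *ₚ h ~ g *ₚ h
    ~-*ʳ {f} {g} h (cong-by S T e) = cong-by (S *ₚ h) (T *ₚ h) (≋-trans (*ₚ-cong e (≋-refl {h}))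
      (solveₚ 6 (λ g h m s c t → (g ⊕ (m ⊗ s ⊕ c ⊗ t)) ⊗ h ⊜ (g ⊗ h) ⊕ (m ⊗ (s ⊗ h) ⊕ c ⊗ (t ⊗ h))) ≋-refl g h m S (const l) T))

    ~-*ˡ : ∀ {f g} h → f ~ g → h *ₚ f ~ h *ₚ g
    ~-*ˡ {f} {g} h e = ~-trans (≋⇒~ (*ₚ-comm h f)) (~-trans (~-*ʳ h e) (≋⇒~ (*ₚ-comm g h)))

    ~-sum : ∀ {n} {f g : Fin n → Poly} → (∀ i → f i ~ g i) → sumP f ~ sumP g
    ~-sum {zero}  h = ~-refl
    ~-sum {suc n} h = ~-+ (h zero) (~-sum (λ i → h (suc i)))

  κ : ℕ → Poly
  κ n = const (+ n)

  κ-+ : ∀ m n → κ (m ℕ.+ n) ≋ κ m +ₚ κ n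
  κ-+ m n = const-+ (+ m) (+ n)

  κ-* : ∀ m n → κ (m ℕ.* n) ≋ κ m *ₚ κ n
  κ-* m n = ≋-trans (subst (λ z → κ (m ℕ.* n) ≋ const z) (ℤ.pos-* m n) ≋-refl) (const-* (+ m) (+ n))

  κ-sum : ∀ {n} (f : Fin n → ℕ) → κ (sumℕ f) ≋ sumP (λ i → κ (f i))
  κ-sum {zero}  f = const-0
  κ-sum {suc n} f = ≋-trans (κ-+ (f zero) _) (+ₚ-cong (≋-refl {κ (f zero)}) (κ-sum (λ i → f (suc i))))

  ×P≋κ : ∀ n p → n ×P p ≋ κ n *ₚ p
  ×P≋κ zero    p = ≋-sym (*ₚ-cong const-0 (≋-refl {p}))
  ×P≋κ (suc n) p = ≋-trans (+ₚ-cong (≋-refl {p}) (×P≋κ n p)) (≋-trans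
    (solveₚ 2 (λ p k → p ⊕ k ⊗ p ⊜ (Κ 1ₚ ⊕ k) ⊗ p) ≋-refl p (κ n))
    (*ₚ-cong (≋-sym (≋-trans (κ-+ 1 n) (+ₚ-cong const-1 ≋-refl))) (≋-refl {p})))

  prime∤! : ∀ {p} → Prime p → ∀ k → k < p → ¬ p ℕ.∣ k !
  prime∤! {p} pp zero    k<p d = ℕ.<-irrefl (sym (ℕ.∣1⇒≡1 d)) (ℕ.nonTrivial⇒n>1 p ⦃ prime⇒nonTrivial pp ⦄)
  prime∤! {p} pp (suc k) k<p d with euclidsLemma (suc k) (k !) pp d
  ... | inj₁ d′ = ℕ.<⇒≱ k<p (ℕ.∣⇒≤ d′)
  ... | inj₂ d′ = prime∤! pp k (ℕ.<-trans (ℕ.n<1+n k) k<p) d′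

  -- The prime divides p! = C(p,k) k! (p-k)!, but neither of the two factorials.
  prime∣C : ∀ {p} → Prime p → ∀ k → 0 < k → k < p → p ℕ.∣ p C k
  prime∣C {p} pp k 0<k k<p with euclidsLemma (p C k) (k ! ℕ.* (p ∸ k) !) pp (subst (p ℕ.∣_) (sym e) p∣p!)
    where
    instance _ = ℕ._!*_!≢0 k (p ∸ k)
    e : (p C k) ℕ.* (k ! ℕ.* (p ∸ k) !) ≡ p !
    e = trans (cong (ℕ._* (k ! ℕ.* (p ∸ k) !)) (nCk≡n!/k![n-k]! (ℕ.<⇒≤ k<p))) (ℕ.m/n*n≡m (k![n∸k]!∣n! (ℕ.<⇒≤ k<p)))
    p∣p! : p ℕ.∣ p !
    p∣p! = subst (λ n → n ℕ.∣ n !) (ℕ.suc-pred p ⦃ prime⇒nonZero pp ⦄) (ℕ.m∣m*n (ℕ.pred p !))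
  ... | inj₁ d = d
  ... | inj₂ d with euclidsLemma (k !) ((p ∸ k) !) pp d
  ...   | inj₁ d′ = ⊥-elim (prime∤! pp k k<p d′)
  ...   | inj₂ d′ = ⊥-elim (prime∤! pp (p ∸ k) (ℕ.∸-monoʳ-< 0<k (ℕ.<⇒≤ k<p)) d′)

  module Frobenius {p : ℕ} (pp : Prime p) (m : Poly) where
    open Congruence m (+ p)

    multiple~0 : ∀ {n} → p ℕ.∣ n → ∀ f → n ×P f ~ []
    multiple~0 {n} (ℕ.divides k refl) f = cong-by [] (κ k *ₚ f) (≋-trans (×P≋κ (k ℕ.* p) f)
      (≋-trans (*ₚ-cong (κ-* k p) (≋-refl {f})) (≋-trans (solveₚ 3 (λ k p f → (k ⊗ p) ⊗ f ⊜ p ⊗ (k ⊗ f)) ≋-refl (κ k) (κ p) f)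
        (≋-sym (+ₚ-cong (*ₚ-zeroʳ m) (≋-refl {κ p *ₚ (κ k *ₚ f)}))))))

    sum~0 : ∀ {n} (f : Fin n → Poly) → (∀ i → f i ~ []) → sumP f ~ []
    sum~0 {zero}  f h = ~-refl
    sum~0 {suc n} f h = ~-+ (h zero) (sum~0 (λ i → f (suc i)) (λ i → h (suc i)))

    ^-+ : ∀ f g → (f +ₚ g) ^P p ~ f ^P p +ₚ g ^P p
    ^-+ f g = subst (λ n → n ≡ p → (f +ₚ g) ^P n ~ f ^P n +ₚ g ^P n) (ℕ.suc-pred p ⦃ prime⇒nonZero pp ⦄) (go (ℕ.pred p)) refl
      where
      go : ∀ n → suc n ≡ p → (f +ₚ g) ^P suc n ~ f ^P suc n +ₚ g ^P suc n
      go n refl = ~-trans (≋⇒~ (Binomial.theorem p f g)) (~-trans (~-+ (≋⇒~ first)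
        (~-trans (≋⇒~ (sumP-init-last (λ k → term (suc k)))) (~-+ (sum~0 _ middle) (≋⇒~ last))))
        (≋⇒~ (+ₚ-comm (g ^P p) (f ^P p))))
        where
        term = Binomial.binomialTerm f g p
        first : term zero ≋ g ^P p
        first = ≋-trans (+ₚ-identityʳ _) (*ₚ-identityˡ (g ^P p))
        middle : ∀ i → term (suc (inject₁ i)) ~ []
        middle i = multiple~0 (prime∣C pp (suc (toℕ (inject₁ i))) (s≤s z≤n)
          (s≤s (subst (_< n) (sym (Fin.toℕ-inject₁ i)) (Fin.toℕ<n i)))) (Binomial.binomial f g p (suc (inject₁ i)))
        last : term (suc (fromℕ n)) ≋ f ^P p
        last rewrite Fin.toℕ-fromℕ n | nCn≡1 p | ℕ.n∸n≡0 n = ≋-trans (+ₚ-identityʳ _) (≋-trans (*ₚ-comm (f ^P p) 1ₚ) (*ₚ-identityˡ (f ^P p)))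

    0^ : [] ^P p ~ []
    0^ = subst (λ n → [] ^P n ~ []) (ℕ.suc-pred p ⦃ prime⇒nonZero pp ⦄) ~-refl

    sum-^ : ∀ {n} (f : Fin n → Poly) → (sumP f) ^P p ~ sumP (λ i → f i ^P p)
    sum-^ {zero}  f = 0^
    sum-^ {suc n} f = ~-trans (^-+ (f zero) _) (~-+ ~-refl (sum-^ (λ i → f (suc i))))

  mono-^ : ∀ k n → mono k ^P n ≋ mono (n ℕ.* k)
  mono-^ k zero    = ≋-refl
  mono-^ k (suc n) = ≋-trans (*ₚ-cong (≋-refl {mono k}) (mono-^ k n)) (≋-sym (mono-+ k (n ℕ.* k)))

  -- A linear functional on polynomials. When `g` has period M it kills all multiples of X^M - 1, so
  -- it can test coefficients modulo X^M - 1.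
  pair : Poly → (ℕ → ℤ) → ℤ
  pair []      g = + 0
  pair (a ∷ p) g = a ℤ.* g 0 ℤ.+ pair p (g ∘ suc)

  pair-congʳ : ∀ p {g h} → (∀ n → g n ≡ h n) → pair p g ≡ pair p h
  pair-congʳ []      e = refl
  pair-congʳ (a ∷ p) e = cong₂ ℤ._+_ (cong (a ℤ.*_) (e 0)) (pair-congʳ p (λ n → e (suc n)))

  pair-+ : ∀ p q g → pair (p +ₚ q) g ≡ pair p g ℤ.+ pair q g
  pair-+ []      q       g = sym (ℤ.+-identityˡ _)
  pair-+ (a ∷ p) []      g = sym (ℤ.+-identityʳ _)
  pair-+ (a ∷ p) (b ∷ q) g = trans (cong (λ t → (a ℤ.+ b) ℤ.* g 0 ℤ.+ t) (pair-+ p q (g ∘ suc))) (lem a b (g 0) _ _)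
    where
    open import Data.Integer.Tactic.RingSolver using (solve-∀)
    lem : ∀ a b g x y → (a ℤ.+ b) ℤ.* g ℤ.+ (x ℤ.+ y) ≡ (a ℤ.* g ℤ.+ x) ℤ.+ (b ℤ.* g ℤ.+ y)
    lem = solve-∀

  pair-scale : ∀ c p g → pair (map (c ℤ.*_) p) g ≡ c ℤ.* pair p g
  pair-scale c []      g = sym (ℤ.*-zeroʳ c)
  pair-scale c (a ∷ p) g = trans (cong (λ t → c ℤ.* a ℤ.* g 0 ℤ.+ t) (pair-scale c p (g ∘ suc)))
    (trans (cong (ℤ._+ c ℤ.* pair p (g ∘ suc)) (ℤ.*-assoc c a (g 0))) (sym (ℤ.*-distribˡ-+ c (a ℤ.* g 0) _)))

  pair-cong : ∀ {p q} → p ≋ q → ∀ g → pair p g ≡ pair q g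
  pair-cong {[]}    {[]}    e g = refl
  pair-cong {[]}    {b ∷ q} e g = trans (sym (ℤ.+-identityˡ _)) (cong₂ ℤ._+_ (cong (ℤ._* g 0) (e .at 0)) (pair-cong {[]} {q} (mk≋ λ n → e .at (suc n)) (g ∘ suc)))
  pair-cong {a ∷ p} {[]}    e g = trans (cong₂ ℤ._+_ (cong (ℤ._* g 0) (e .at 0)) (pair-cong {p} {[]} (mk≋ λ n → e .at (suc n)) (g ∘ suc))) (ℤ.+-identityˡ _)
  pair-cong {a ∷ p} {b ∷ q} e g = cong₂ ℤ._+_ (cong (ℤ._* g 0) (e .at 0)) (pair-cong {p} {q} (≋-tail e) (g ∘ suc))

  pair-const : ∀ c p g → pair (const c *ₚ p) g ≡ c ℤ.* pair p g
  pair-const c p g = trans (pair-cong {const c *ₚ p} {map (c ℤ.*_) p} (mk≋ λ n → trans (coeff-const-* c p n) (sym (coeff-scale c p n))) g) (pair-scale c p g)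

  pair-mono : ∀ k p g → pair (mono k *ₚ p) g ≡ pair p (g ∘ (k ℕ.+_))
  pair-mono zero    p g = pair-cong (*ₚ-identityˡ p) g
  pair-mono (suc k) p g = trans (pair-cong (0∷-* (mono k) p) g) (trans (ℤ.+-identityˡ _) (pair-mono k p (g ∘ suc)))

  pair-mono1 : ∀ k g → pair (mono k) g ≡ g k
  pair-mono1 zero    g = trans (ℤ.+-identityʳ _) (ℤ.*-identityˡ (g 0))
  pair-mono1 (suc k) g = trans (ℤ.+-identityˡ _) (pair-mono1 k (g ∘ suc))

  pair-neg : ∀ p g → pair (negₚ p) g ≡ ℤ.- pair p g
  pair-neg []      g = refl
  pair-neg (a ∷ p) g = trans (cong₂ ℤ._+_ (sym (ℤ.neg-distribˡ-* a (g 0))) (pair-neg p (g ∘ suc))) (sym (ℤ.neg-distrib-+ (a ℤ.* g 0) _))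

  pair-EE : ∀ M S g → (∀ n → g (M ℕ.+ n) ≡ g n) → pair (EE M *ₚ S) g ≡ + 0
  pair-EE M S g per = begin
    pair (EE M *ₚ S) g                          ≡⟨ pair-cong (solveₚ 2 (λ x s → (x ⊕ ⊝ Κ 1ₚ) ⊗ s ⊜ x ⊗ s ⊕ ⊝ s) ≋-refl (mono M) S) g ⟩
    pair (mono M *ₚ S +ₚ negₚ S) g              ≡⟨ pair-+ (mono M *ₚ S) _ g ⟩
    pair (mono M *ₚ S) g ℤ.+ pair (negₚ S) g    ≡⟨ cong₂ ℤ._+_ (trans (pair-mono M S g) (pair-congʳ S per)) (pair-neg S g) ⟩
    pair S g ℤ.- pair S g                       ≡⟨ ℤ.+-inverseʳ (pair S g) ⟩
    + 0                                         ∎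
    where open ≡-Reasoning

  module _ {c ℓ} (CM : CommutativeMonoid c ℓ) where
    open CommutativeMonoid CM renaming (Carrier to X; _∙_ to _+′_; ε to 0′; _≈_ to _≈′_; refl to refl′; sym to sym′; trans to trans′)
    open import Algebra.Properties.CommutativeMonoid.Sum CM using (sum; sum-cong-≋; sum-replicate-zero)

    sum-zero : ∀ {n} (f : Fin n → X) → (∀ i → f i ≈′ 0′) → sum f ≈′ 0′
    sum-zero {n} f h = trans′ (sum-cong-≋ h) (sum-replicate-zero n)

    sum-pick : ∀ {n} (i : Fin n) (f : Fin n → X) → (∀ j → j ≢ i → f j ≈′ 0′) → sum f ≈′ f i
    sum-pick zero    f h = trans′ (∙-congˡ (sum-zero (f ∘ suc) (λ j → h (suc j) λ ()))) (identityʳ _)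
    sum-pick (suc i) f h = trans′ (∙-cong (h zero λ ()) (sum-pick i (f ∘ suc) (λ j j≢i → h (suc j) (λ e → j≢i (Fin.suc-injective e))))) (identityˡ _)

-- Tijdeman's theorem on dilates of a tiling

module Tijdeman where
  open PolynomialRing
  open Monomials
  open PolynomialDivisibility
  open CyclotomicPolynomials
  open Congruences
  open import Data.Nat as ℕ using (ℕ; zero; suc; _≤_; z≤n; _^_; NonZero)
  import Data.Nat.Properties as ℕ
  import Data.Nat.Divisibility as ℕ
  open import Data.Nat.DivMod as ℕ using (_%_; _/_; m%n<n; m≡m%n+[m/n]*n; [m+n]%n≡m%n; m<n⇒m%n≡m)
  open import Data.Nat.Primality using (Prime; prime⇒nonZero; prime⇒nonTrivial; euclidsLemma)
  open import Data.Nat.Primality.Factorisation using (factorise; PrimeFactorisation)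
  open import Data.Nat.ListAction using (product)
  open import Data.Integer as ℤ using (ℤ; +_)
  import Data.Integer.Properties as ℤ
  open import Data.Integer.Divisibility.Signed as ℤ∣ using (divides; _∣_)
  open import Data.Fin as Fin using (Fin; zero; suc; toℕ; fromℕ<)
  import Data.Fin.Properties as Fin
  open import Data.Bool using (if_then_else_)
  open import Data.List using ([]; _∷_)
  open import Data.List.Relation.Unary.All as All using (All; []; _∷_)
  open import Data.Sum using (_⊎_; inj₁; inj₂)
  open import Function using (_∘_)
  open import Relation.Nullary using (¬_; does)
  open import Relation.Nullary.Decidable using (dec-true; dec-false)
  open import Relation.Binary.PropositionalEquality hiding (J)
  open import Algebra.Bundles using (CommutativeRing)
  open import Tactic.RingSolver.NonReflective polySolverRing using (_⊕_; _⊗_; ⊝_; Κ) renaming (solve to solveₚ)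
  open CommutativeRing polyRing using () renaming (semiring to polySemiring; commutativeSemiring to polyCommutativeSemiring; +-commutativeMonoid to poly-+-commutativeMonoid)
  open import Algebra.Properties.Semiring.Exp polySemiring using () renaming (_^_ to _^P_; ^-congˡ to ^P-cong)
  open import Algebra.Properties.CommutativeSemiring.Exp polyCommutativeSemiring using () renaming (^-distrib-* to ^P-*)
  open import Algebra.Properties.CommutativeMonoid.Sum ℤ.+-0-commutativeMonoid using () renaming (sum to sumℤ; sum-cong-≗ to sumℤ-cong)

  pair-sum : ∀ {n} (f : Fin n → Poly) g → pair (sumP f) g ≡ sumℤ (λ i → pair (f i) g)
  pair-sum {zero}  f g = refl
  pair-sum {suc n} f g = trans (pair-+ (f zero) _ g) (cong (λ t → pair (f zero) g ℤ.+ t) (pair-sum (f ∘ suc) g))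

  sumℕ-zero : ∀ {n} (f : Fin n → ℕ) → (∀ i → f i ≡ 0) → sumℕ f ≡ 0
  sumℕ-zero = sum-zero ℕ.+-0-commutativeMonoid

  sumℕ-pick : ∀ {n} (i : Fin n) (f : Fin n → ℕ) → (∀ j → j ≢ i → f j ≡ 0) → sumℕ f ≡ f i
  sumℕ-pick = sum-pick ℕ.+-0-commutativeMonoid

  sumℕ-≥ : ∀ {n} (f : Fin n → ℕ) → (∀ i → 1 ≤ f i) → n ≤ sumℕ f
  sumℕ-≥ {zero}  f h = z≤n
  sumℕ-≥ {suc n} f h = ℕ.+-mono-≤ (h zero) (sumℕ-≥ (f ∘ suc) (h ∘ suc))

  all-ones : ∀ {n} (f : Fin n → ℕ) → (∀ i → 1 ≤ f i) → sumℕ f ≡ n → ∀ i → f i ≡ 1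
  all-ones {suc n} f h e i = go i
    where
    f0≤1 : f zero ≤ 1
    f0≤1 = ℕ.+-cancelʳ-≤ n (f zero) 1 (ℕ.≤-trans (ℕ.+-monoʳ-≤ (f zero) (sumℕ-≥ (f ∘ suc) (h ∘ suc))) (ℕ.≤-reflexive e))
    f0≡1 : f zero ≡ 1
    f0≡1 = ℕ.≤-antisym f0≤1 (h zero)
    go : ∀ i → f i ≡ 1
    go zero    = f0≡1
    go (suc i) = all-ones (f ∘ suc) (h ∘ suc) (ℕ.suc-injective (trans (cong (ℕ._+ sumℕ (f ∘ suc)) (sym f0≡1)) e)) i

  geo-sum : ∀ n → sumP {n} (λ x → mono (toℕ x)) ≋ geo 1 n
  geo-sum zero    = ≋-refl
  geo-sum (suc n) = +ₚ-cong (≋-refl {1ₚ}) (≋-trans (sumP-cong {n} (λ i → mono-+ 1 (toℕ i)))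
    (≋-trans (≋-sym (sumP-*ˡ {n} (mono 1) (λ i → mono (toℕ i)))) (*ₚ-cong (≋-refl {mono 1}) (geo-sum n))))

  module Convolution (M : ℕ) .{{_ : NonZero M}} (α β : Fin M → ℕ) where

    hit : ℕ → Fin M → ℕ
    hit k x = if does (k % M ℕ.≟ toℕ x) then 1 else 0

    hit-yes : ∀ k x → k % M ≡ toℕ x → hit k x ≡ 1
    hit-yes k x e = cong (if_then 1 else 0) (dec-true (k % M ℕ.≟ toℕ x) e)

    hit-no : ∀ k x → k % M ≢ toℕ x → hit k x ≡ 0
    hit-no k x e = cong (if_then 1 else 0) (dec-false (k % M ℕ.≟ toℕ x) e)

    residue : ℕ → Fin M
    residue k = fromℕ< (m%n<n k M)

    toℕ-residue : ∀ k → toℕ (residue k) ≡ k % M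
    toℕ-residue k = Fin.toℕ-fromℕ< (m%n<n k M)

    hit-residue : ∀ k → hit k (residue k) ≡ 1
    hit-residue k = hit-yes k (residue k) (sym (toℕ-residue k))

    hit-other : ∀ k x → x ≢ residue k → hit k x ≡ 0
    hit-other k x x≢ = hit-no k x λ e → x≢ (Fin.toℕ-injective (trans (sym e) (sym (toℕ-residue k))))

    -- The number of ways to write `x` as a + u b modulo M, counted with the weights α and β;
    -- equivalently the coefficient of X^x in A(X) B(X^u) modulo X^M - 1.
    count : ℕ → Fin M → ℕ
    count u x = sumℕ λ a → sumℕ λ b → α a ℕ.* β b ℕ.* hit (toℕ a ℕ.+ u ℕ.* toℕ b) x

    sum-count : ∀ u → sumℕ (count u) ≡ sumℕ α ℕ.* sumℕ β
    sum-count u = begin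
      sumℕ (λ x → sumℕ λ a → sumℕ λ b → t a b x)   ≡⟨ sumℕ-comm (λ x a → sumℕ λ b → t a b x) ⟩
      sumℕ (λ a → sumℕ λ x → sumℕ λ b → t a b x)   ≡⟨ sumℕ-cong (λ a → sumℕ-comm (λ x b → t a b x)) ⟩
      sumℕ (λ a → sumℕ λ b → sumℕ λ x → t a b x)   ≡⟨ sumℕ-cong (λ a → sumℕ-cong λ b → inner a b) ⟩
      sumℕ (λ a → sumℕ λ b → α a ℕ.* β b)          ≡⟨ sumℕ-cong (λ a → sumℕ-*ˡ (α a) β) ⟨
      sumℕ (λ a → α a ℕ.* sumℕ β)                  ≡⟨ sumℕ-*ʳ (sumℕ β) α ⟨
      sumℕ α ℕ.* sumℕ β                            ∎
      where
      open ≡-Reasoning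
      t : Fin M → Fin M → Fin M → ℕ
      t a b x = α a ℕ.* β b ℕ.* hit (toℕ a ℕ.+ u ℕ.* toℕ b) x
      inner : ∀ a b → sumℕ (t a b) ≡ α a ℕ.* β b
      inner a b = trans (sym (sumℕ-*ˡ (α a ℕ.* β b) (hit k))) (trans (cong (α a ℕ.* β b ℕ.*_)
        (trans (sumℕ-pick (residue k) (hit k) (λ x → hit-other k x)) (hit-residue k))) (ℕ.*-identityʳ _))
        where k = toℕ a ℕ.+ u ℕ.* toℕ b

    Ap : Poly
    Ap = sumP λ a → κ (α a) *ₚ mono (toℕ a)

    Bp : ℕ → Poly
    Bp u = sumP λ b → κ (β b) *ₚ mono (u ℕ.* toℕ b)

    J : Poly
    J = sumP λ (x : Fin M) → mono (toℕ x)

    module Mod (l : ℤ) where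
      open Congruence (EE M) l

      mono~ : ∀ k → mono k ~ mono (k % M)
      mono~ k = cong-by (mono (k % M) *ₚ geo M (k / M)) [] (≋-trans
        (subst (λ n → mono n ≋ mono (k % M) +ₚ EE M *ₚ (mono (k % M) *ₚ geo M (k / M))) (sym (m≡m%n+[m/n]*n k M)) (begin
          mono (k % M ℕ.+ k / M ℕ.* M)                                   ≈⟨ mono-+ (k % M) (k / M ℕ.* M) ⟩
          mono (k % M) *ₚ mono (k / M ℕ.* M)                             ≈⟨ solveₚ 2 (λ x y → x ⊗ y ⊜ x ⊕ x ⊗ (y ⊕ ⊝ Κ 1ₚ)) ≋-refl (mono (k % M)) (mono (k / M ℕ.* M)) ⟩
          mono (k % M) +ₚ mono (k % M) *ₚ EE (k / M ℕ.* M)               ≈⟨ +ₚ-cong (≋-refl {mono (k % M)}) (*ₚ-cong (≋-refl {mono (k % M)}) (EE-geo M (k / M))) ⟩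
          mono (k % M) +ₚ mono (k % M) *ₚ (EE M *ₚ geo M (k / M))        ≈⟨ solveₚ 3 (λ x e g → x ⊕ x ⊗ (e ⊗ g) ⊜ x ⊕ e ⊗ (x ⊗ g)) ≋-refl (mono (k % M)) (EE M) (geo M (k / M)) ⟩
          mono (k % M) +ₚ EE M *ₚ (mono (k % M) *ₚ geo M (k / M))        ∎))
        (+ₚ-cong (≋-refl {mono (k % M)}) (≋-sym (≋-trans (+ₚ-cong (≋-refl {EE M *ₚ (mono (k % M) *ₚ geo M (k / M))}) (*ₚ-zeroʳ (const l))) (+ₚ-identityʳ _)))))
        where open ≋-Reasoning

      mono~hits : ∀ k → mono k ~ sumP (λ x → κ (hit k x) *ₚ mono (toℕ x))
      mono~hits k = ~-trans (mono~ k) (≋⇒~ (≋-sym (≋-trans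
        (sum-pick poly-+-commutativeMonoid (residue k) (λ x → κ (hit k x) *ₚ mono (toℕ x)) other) at-residue)))
        where
        other : ∀ x → x ≢ residue k → κ (hit k x) *ₚ mono (toℕ x) ≋ []
        other x x≢ rewrite hit-other k x x≢ = *ₚ-cong const-0 (≋-refl {mono (toℕ x)})
        at-residue : κ (hit k (residue k)) *ₚ mono (toℕ (residue k)) ≋ mono (k % M)
        at-residue rewrite hit-residue k | toℕ-residue k = ≋-trans (*ₚ-cong const-1 (≋-refl {mono (k % M)})) (*ₚ-identityˡ (mono (k % M)))

      Ap*Bp : ∀ u → Ap *ₚ Bp u ~ sumP (λ x → κ (count u x) *ₚ mono (toℕ x))
      Ap*Bp u = ~-trans (≋⇒~ expand) (~-trans (~-sum λ a → ~-sum λ b → ~-*ˡ (κ (α a ℕ.* β b)) (mono~hits (k a b))) (≋⇒~ collect))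
        where
        k : Fin M → Fin M → ℕ
        k a b = toℕ a ℕ.+ u ℕ.* toℕ b
        expand : Ap *ₚ Bp u ≋ sumP λ a → sumP λ b → κ (α a ℕ.* β b) *ₚ mono (k a b)
        expand = ≋-trans (sumP-*ʳ (Bp u) (λ a → κ (α a) *ₚ mono (toℕ a))) (sumP-cong λ a →
          ≋-trans (sumP-*ˡ (κ (α a) *ₚ mono (toℕ a)) (λ b → κ (β b) *ₚ mono (u ℕ.* toℕ b))) (sumP-cong λ b →
            ≋-trans (solveₚ 4 (λ x y z w → (x ⊗ y) ⊗ (z ⊗ w) ⊜ (x ⊗ z) ⊗ (y ⊗ w)) ≋-refl (κ (α a)) (mono (toℕ a)) (κ (β b)) (mono (u ℕ.* toℕ b)))
              (*ₚ-cong (≋-sym (κ-* (α a) (β b))) (≋-sym (mono-+ (toℕ a) (u ℕ.* toℕ b))))))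
        t : Fin M → Fin M → Fin M → ℕ
        t a b x = α a ℕ.* β b ℕ.* hit (k a b) x
        collect : (sumP λ a → sumP λ b → κ (α a ℕ.* β b) *ₚ sumP (λ x → κ (hit (k a b) x) *ₚ mono (toℕ x))) ≋ sumP (λ x → κ (count u x) *ₚ mono (toℕ x))
        collect = begin
          (sumP λ a → sumP λ b → κ (α a ℕ.* β b) *ₚ sumP (λ x → κ (hit (k a b) x) *ₚ mono (toℕ x)))
            ≈⟨ sumP-cong (λ a → sumP-cong λ b → ≋-trans (sumP-*ˡ (κ (α a ℕ.* β b)) (λ x → κ (hit (k a b) x) *ₚ mono (toℕ x)))
                 (sumP-cong λ x → ≋-trans (≋-sym (*ₚ-assoc (κ (α a ℕ.* β b)) (κ (hit (k a b) x)) (mono (toℕ x)))) (*ₚ-cong (≋-sym (κ-* (α a ℕ.* β b) (hit (k a b) x))) (≋-refl {mono (toℕ x)})))) ⟩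
          (sumP λ a → sumP λ b → sumP λ x → κ (t a b x) *ₚ mono (toℕ x))
            ≈⟨ sumP-cong (λ a → sumP-comm (λ b x → κ (t a b x) *ₚ mono (toℕ x))) ⟩
          (sumP λ a → sumP λ x → sumP λ b → κ (t a b x) *ₚ mono (toℕ x))
            ≈⟨ sumP-comm (λ a x → sumP λ b → κ (t a b x) *ₚ mono (toℕ x)) ⟩
          (sumP λ x → sumP λ a → sumP λ b → κ (t a b x) *ₚ mono (toℕ x))
            ≈⟨ sumP-cong (λ x → ≋-trans (sumP-cong λ a → ≋-trans (≋-sym (sumP-*ʳ (mono (toℕ x)) (λ b → κ (t a b x)))) (*ₚ-cong (≋-sym (κ-sum (λ b → t a b x))) (≋-refl {mono (toℕ x)})))
                 (≋-trans (≋-sym (sumP-*ʳ (mono (toℕ x)) (λ a → κ (sumℕ λ b → t a b x)))) (*ₚ-cong (≋-sym (κ-sum (λ a → sumℕ λ b → t a b x))) (≋-refl {mono (toℕ x)})))) ⟩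
          sumP (λ x → κ (count u x) *ₚ mono (toℕ x)) ∎
          where open ≋-Reasoning

      -- Because J (X - 1) = X^M - 1, multiplication by X fixes J modulo X^M - 1.
      J*mono : ∀ k → J *ₚ mono k ~ J
      J*mono k = cong-by (geo 1 k) [] (begin
        J *ₚ mono k                          ≈⟨ solveₚ 2 (λ j x → j ⊗ x ⊜ j ⊕ j ⊗ (x ⊕ ⊝ Κ 1ₚ)) ≋-refl J (mono k) ⟩
        J +ₚ J *ₚ EE k                       ≈⟨ +ₚ-cong (≋-refl {J}) (*ₚ-cong (geo-sum M) (subst (λ n → EE n ≋ EE 1 *ₚ geo 1 k) (ℕ.*-identityʳ k) (EE-geo 1 k))) ⟩
        J +ₚ geo 1 M *ₚ (EE 1 *ₚ geo 1 k)    ≈⟨ +ₚ-cong (≋-refl {J}) (solveₚ 3 (λ g e h → g ⊗ (e ⊗ h) ⊜ (e ⊗ g) ⊗ h) ≋-refl (geo 1 M) (EE 1) (geo 1 k)) ⟩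
        J +ₚ (EE 1 *ₚ geo 1 M) *ₚ geo 1 k    ≈⟨ +ₚ-cong (≋-refl {J}) (*ₚ-cong (subst (λ n → EE n ≋ EE 1 *ₚ geo 1 M) (ℕ.*-identityʳ M) (EE-geo 1 M)) (≋-refl {geo 1 k})) ⟨
        J +ₚ EE M *ₚ geo 1 k                 ≈⟨ +ₚ-cong (≋-refl {J}) (≋-trans (+ₚ-cong (≋-refl {EE M *ₚ geo 1 k}) (*ₚ-zeroʳ (const l))) (+ₚ-identityʳ _)) ⟨
        J +ₚ (EE M *ₚ geo 1 k +ₚ const l *ₚ []) ∎)
        where open ≋-Reasoning

      J*Bp : ∀ u → J *ₚ Bp u ~ κ (sumℕ β) *ₚ J
      J*Bp u = ~-trans (≋⇒~ (sumP-*ˡ J (λ b → κ (β b) *ₚ mono (u ℕ.* toℕ b)))) (~-trans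
        (~-sum λ b → ~-trans (≋⇒~ (solveₚ 3 (λ j k x → j ⊗ (k ⊗ x) ⊜ k ⊗ (j ⊗ x)) ≋-refl J (κ (β b)) (mono (u ℕ.* toℕ b)))) (~-*ˡ (κ (β b)) (J*mono (u ℕ.* toℕ b))))
        (≋⇒~ (≋-trans (≋-sym (sumP-*ʳ J (λ b → κ (β b)))) (*ₚ-cong (≋-sym (κ-sum β)) (≋-refl {J})))))

      J*Bp^ : ∀ u n → J *ₚ (Bp u) ^P n ~ κ (sumℕ β ^ n) *ₚ J
      J*Bp^ u zero = ≋⇒~ (≋-trans (*ₚ-comm J 1ₚ) (*ₚ-cong (≋-sym const-1) (≋-refl {J})))
      J*Bp^ u (suc n) = ~-trans (≋⇒~ (≋-sym (*ₚ-assoc J (Bp u) (Bp u ^P n)))) (~-trans (~-*ʳ (Bp u ^P n) (J*Bp u))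
        (~-trans (≋⇒~ (*ₚ-assoc (κ (sumℕ β)) J (Bp u ^P n))) (~-trans (~-*ˡ (κ (sumℕ β)) (J*Bp^ u n))
          (≋⇒~ (≋-trans (≋-sym (*ₚ-assoc (κ (sumℕ β)) (κ (sumℕ β ^ n)) J)) (*ₚ-cong (≋-sym (κ-* (sumℕ β) (sumℕ β ^ n))) (≋-refl {J})))))))

      ~⇒coefficients : ∀ {f g : Fin M → ℕ} → sumP (λ x → κ (f x) *ₚ mono (toℕ x)) ~ sumP (λ x → κ (g x) *ₚ mono (toℕ x)) →
        ∀ y → l ∣ (+ f y ℤ.- + g y)
      ~⇒coefficients {f} {g} (cong-by S T e) y = divides (pair T h) (begin
        + f y ℤ.- + g y                                                       ≡⟨ cong₂ ℤ._-_ (sym (pair-poly f)) (sym (pair-poly g)) ⟩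
        pair (poly f) h ℤ.- pair (poly g) h                                   ≡⟨ cong (ℤ._- pair (poly g) h) (trans (pair-cong e h) (trans (pair-+ (poly g) _ h) (cong (λ t → pair (poly g) h ℤ.+ t)
                                                                                   (trans (pair-+ (EE M *ₚ S) (const l *ₚ T) h) (cong₂ ℤ._+_ (pair-EE M S h periodic) (pair-const l T h)))))) ⟩
        (pair (poly g) h ℤ.+ (+ 0 ℤ.+ l ℤ.* pair T h)) ℤ.- pair (poly g) h    ≡⟨ lem (pair (poly g) h) l (pair T h) ⟩
        pair T h ℤ.* l                                                        ∎)
        where
        open ≡-Reasoning
        open import Data.Integer.Tactic.RingSolver using (solve-∀)
        lem : ∀ g l t → (g ℤ.+ (+ 0 ℤ.+ l ℤ.* t)) ℤ.- g ≡ t ℤ.* l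
        lem = solve-∀
        -- The M-periodic indicator of the class of `y`: pairing with it annihilates X^M - 1 and
        -- extracts the coefficient at `y`.
        h : ℕ → ℤ
        h n = + hit n y
        periodic : ∀ n → h (M ℕ.+ n) ≡ h n
        periodic n = cong (λ k → + (if does (k ℕ.≟ toℕ y) then 1 else 0)) (trans (cong (_% M) (ℕ.+-comm M n)) ([m+n]%n≡m%n n M))
        poly : (Fin M → ℕ) → Poly
        poly f = sumP (λ x → κ (f x) *ₚ mono (toℕ x))
        pair-poly : ∀ f → pair (poly f) h ≡ + f y
        pair-poly f = begin
          pair (poly f) h                                   ≡⟨ pair-sum (λ x → κ (f x) *ₚ mono (toℕ x)) h ⟩
          sumℤ (λ x → pair (κ (f x) *ₚ mono (toℕ x)) h)     ≡⟨ sumℤ-cong {M} (λ x → trans (pair-const (+ f x) (mono (toℕ x)) h) (cong (+ f x ℤ.*_) (pair-mono1 (toℕ x) h))) ⟩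
          sumℤ (λ x → + f x ℤ.* h (toℕ x))                  ≡⟨ sum-pick ℤ.+-0-commutativeMonoid y (λ x → + f x ℤ.* h (toℕ x))
                                                                 (λ x x≢y → trans (cong (λ t → + f x ℤ.* + t) (hit-no (toℕ x) y λ eq → x≢y (Fin.toℕ-injective (trans (sym (m<n⇒m%n≡m (Fin.toℕ<n x))) eq)))) (ℤ.*-zeroʳ (+ f x))) ⟩
          + f y ℤ.* h (toℕ y)                               ≡⟨ cong (λ t → + f y ℤ.* + t) (hit-yes (toℕ y) y (m<n⇒m%n≡m (Fin.toℕ<n y))) ⟩
          + f y ℤ.* + 1                                     ≡⟨ ℤ.*-identityʳ (+ f y) ⟩
          + f y                                             ∎

    module PrimeStep {p} (pp : Prime p) (p∤M : ¬ p ℕ.∣ M) (β01 : ∀ b → β b ≡ 0 ⊎ β b ≡ 1) (u : ℕ) (one : ∀ x → count u x ≡ 1) where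
      open Congruence (EE M) (+ p)
      open Mod (+ p)
      open Frobenius pp (EE M)

      sizes : sumℕ α ℕ.* sumℕ β ≡ M
      sizes = trans (sym (sum-count u)) (trans (sumℕ-cong one) (ones M))
        where
        ones : ∀ n → sumℕ {n} (λ _ → 1) ≡ n
        ones zero    = refl
        ones (suc n) = cong suc (ones n)

      p∤β : ¬ p ℕ.∣ sumℕ β
      p∤β d = p∤M (subst (p ℕ.∣_) sizes (ℕ.∣n⇒∣m*n (sumℕ α) d))

      p∤β^ : ∀ n → ¬ p ℕ.∣ sumℕ β ^ n
      p∤β^ zero    d = ℕ.<-irrefl (sym (ℕ.∣1⇒≡1 d)) (ℕ.nonTrivial⇒n>1 p ⦃ prime⇒nonTrivial pp ⦄)
      p∤β^ (suc n) d with euclidsLemma (sumℕ β) (sumℕ β ^ n) pp d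
      ... | inj₁ d′ = p∤β d′
      ... | inj₂ d′ = p∤β^ n d′

      -- For B(X^u)^p to become B(X^(pu)), the coefficients must equal their own p-th powers, which
      -- 0 and 1 do.
      κ01^ : ∀ w → w ≡ 0 ⊎ w ≡ 1 → ∀ n → κ w ^P suc n ≋ κ w
      κ01^ w (inj₁ refl) n = ≋-trans (*ₚ-cong const-0 (≋-refl {κ 0 ^P n})) (≋-sym const-0)
      κ01^ w (inj₂ refl) zero = ≋-trans (*ₚ-comm (κ 1) 1ₚ) (*ₚ-identityˡ (κ 1))
      κ01^ w (inj₂ refl) (suc n) = ≋-trans (*ₚ-cong const-1 (κ01^ 1 (inj₂ refl) n)) (*ₚ-identityˡ (κ 1))

      Bp-^ : ∀ n → suc n ≡ p → Bp u ^P p ~ Bp (p ℕ.* u)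
      Bp-^ n refl = ~-trans (sum-^ (λ b → κ (β b) *ₚ mono (u ℕ.* toℕ b))) (~-sum λ b → ≋⇒~ (≋-trans (^P-* (κ (β b)) (mono (u ℕ.* toℕ b)) p)
        (*ₚ-cong (κ01^ (β b) (β01 b) n) (subst (λ k → mono (u ℕ.* toℕ b) ^P p ≋ mono k) (sym (ℕ.*-assoc p u (toℕ b))) (mono-^ (u ℕ.* toℕ b) p)))))

      Ap*Bp~ : ∀ n → suc n ≡ p → Ap *ₚ Bp (p ℕ.* u) ~ κ (sumℕ β ^ n) *ₚ J
      Ap*Bp~ n e@refl = ~-trans (~-*ˡ Ap (~-sym (Bp-^ n e))) (~-trans (≋⇒~ (≋-sym (*ₚ-assoc Ap (Bp u) (Bp u ^P n))))
        (~-trans (~-*ʳ (Bp u ^P n) (~-trans (Ap*Bp u) (≋⇒~ (sumP-cong λ x → subst (λ k → κ k *ₚ mono (toℕ x) ≋ mono (toℕ x)) (sym (one x)) (≋-trans (*ₚ-cong const-1 (≋-refl {mono (toℕ x)})) (*ₚ-identityˡ (mono (toℕ x))))))))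
          (J*Bp^ u n)))

      count≥1 : ∀ y → 1 ≤ count (p ℕ.* u) y
      count≥1 y = ℕ.n≢0⇒n>0 λ z → go (ℕ.pred p) (ℕ.suc-pred p ⦃ prime⇒nonZero pp ⦄) z
        where
        go : ∀ n → suc n ≡ p → count (p ℕ.* u) y ≢ 0
        -- A point that is not covered would give p ∣ |B|^(p-1), although |B| divides M and p does
        -- not.
        go n e z = p∤β^ n (ℤ∣.∣⇒∣ᵤ (subst (+ p ∣_) (cong (λ k → + k) refl) (ℤ∣p (subst (λ k → + p ∣ (+ k ℤ.- + (sumℕ β ^ n))) z
          (~⇒coefficients {count (p ℕ.* u)} {λ _ → sumℕ β ^ n} (~-trans (~-sym (Ap*Bp (p ℕ.* u))) (~-trans (Ap*Bp~ n e) (≋⇒~ (sumP-*ˡ {M} (κ (sumℕ β ^ n)) (λ x → mono (toℕ x)))))) y)))))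
          where
          ℤ∣p : ∀ {x} → + p ∣ (+ 0 ℤ.- x) → + p ∣ x
          ℤ∣p {x} d = subst (+ p ∣_) (trans (cong ℤ.-_ (ℤ.+-identityˡ (ℤ.- x))) (ℤ.neg-involutive x)) (ℤ∣.∣m⇒∣-m d)

      step : ∀ x → count (p ℕ.* u) x ≡ 1
      step = all-ones (count (p ℕ.* u)) count≥1 (trans (sum-count (p ℕ.* u)) sizes)

    -- One prime factor p of u at a time: A(X) B(X^p) ≡ A(X) B(X)^p ≡ |B|^(p-1) (1 + X + … + X^(M-1)) modulo p
    -- and X^M - 1, so every x is covered, and as |A| |B| = M it is covered once.
    tijdeman : (∀ b → β b ≡ 0 ⊎ β b ≡ 1) → (∀ x → count 1 x ≡ 1) →
      ∀ u → .{{NonZero u}} → (∀ {p} → Prime p → p ℕ.∣ u → ¬ p ℕ.∣ M) → ∀ x → count u x ≡ 1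
    tijdeman β01 one u cop = subst (λ k → ∀ x → count k x ≡ 1) (sym isFactorisation)
      (go factors factorsPrime λ pp d → cop pp (subst (_ ℕ.∣_) (sym isFactorisation) d))
      where
      open PrimeFactorisation (factorise u)
      go : ∀ ps → All Prime ps → (∀ {p} → Prime p → p ℕ.∣ product ps → ¬ p ℕ.∣ M) → ∀ x → count (product ps) x ≡ 1
      go [] [] _ = one
      go (p ∷ ps) (pp ∷ pps) cop = PrimeStep.step pp (cop pp (ℕ.m∣m*n (product ps))) β01 (product ps)
        (go ps pps (λ pq d → cop pq (ℕ.∣n⇒∣m*n p d)))

-- Coordinates at the three primes

module Corners where
  open CyclotomicPolynomials
  open Congruences
  open Tijdeman
  open import Data.Nat as ℕ using (ℕ; zero; suc; _≤_; _<_; _∸_; z≤n; s≤s; _^_; NonZero)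
  import Data.Nat.Properties as ℕ
  import Data.Nat.Divisibility as ℕ
  open import Data.Nat.Primality using (Prime; prime⇒nonZero; prime⇒nonTrivial; euclidsLemma; prime⇒irreducible)
  open import Data.Nat.Coprimality using (Coprime; coprime-Bézout)
  open import Data.Nat.GCD using (module Bézout)
  open import Data.Integer as ℤ using (ℤ; +_; -[1+_]; _+_; _*_; _-_; -_) renaming (∣_∣ to abs)
  import Data.Integer.Properties as ℤ
  import Data.Integer.DivMod as ℤ
  open import Data.Integer.Divisibility.Signed as ℤ∣ using (divides; _∣_; _∣?_)
  open import Data.Integer.Solver using (module +-*-Solver)
  open +-*-Solver using (solve; _:+_; _:*_; _:-_; :-_; con; _:=_)
  open import Data.Fin as Fin using (Fin; zero; suc; toℕ; fromℕ<)
  import Data.Fin.Properties as Fin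
  open import Data.Product using (_,_; ∃; ∃-syntax; _×_; proj₁; proj₂)
  open import Data.Sum using (_⊎_; inj₁; inj₂)
  open import Data.Empty using (⊥; ⊥-elim)
  open import Relation.Nullary using (yes; no; ¬_; Dec; does)
  open import Relation.Binary.PropositionalEquality hiding (J; resp)
  open import Function using (case_of_)
  open import Data.Bool using (if_then_else_)
  open import Relation.Nullary.Decidable using (dec-true; dec-false; decidable-stable; _×-dec_; ¬?)
  open import Relation.Binary.Definitions using (tri<; tri≈; tri>)

  by : ∀ {m x y} → m ∣ x → x ≡ y → m ∣ y
  by {m} d e = subst (m ∣_) e d

  infixl 6 _∣+_ _∣-_
  infixl 7 _∣*_

  _∣+_ : ∀ {m x y} → m ∣ x → m ∣ y → m ∣ x + y
  _∣+_ = ℤ∣.∣m∣n⇒∣m+n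

  _∣-_ : ∀ {m x y} → m ∣ x → m ∣ y → m ∣ x - y
  _∣-_ = ℤ∣.∣m∣n⇒∣m-n

  _∣*_ : ∀ {m x} c → m ∣ x → m ∣ c * x
  c ∣* d = ℤ∣.∣n⇒∣m*n c d

  ∣-neg : ∀ {m x} → m ∣ x → m ∣ - x
  ∣-neg = ℤ∣.∣m⇒∣-m

  ∣-zero : ∀ {m} → m ∣ + 0
  ∣-zero {m} = divides (+ 0) refl

  ∣-self : ∀ {m} x → m ∣ x - x
  ∣-self x = by ∣-zero (sym (ℤ.+-inverseʳ x))

  ∣-sym : ∀ {m} x y → m ∣ x - y → m ∣ y - x
  ∣-sym x y d = by (∣-neg d) (solve 2 (λ x y → :- (x :- y) := y :- x) refl x y)

  ∣-trans : ∀ {m} x y z → m ∣ x - y → m ∣ y - z → m ∣ x - z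
  ∣-trans x y z d e = by (d ∣+ e) (solve 3 (λ x y z → (x :- y) :+ (y :- z) := x :- z) refl x y z)

  ∣-transport : ∀ {m} x y → m ∣ x - y → m ∣ y → m ∣ x
  ∣-transport x y d e = by (d ∣+ e) (solve 2 (λ x y → (x :- y) :+ y := x) refl x y)

  ℕ∣⇒∣ : ∀ {a b} → a ℕ.∣ b → + a ∣ + b
  ℕ∣⇒∣ (ℕ.divides q refl) = divides (+ q) (ℤ.pos-* q _)

  ∣⇒ℕ∣ : ∀ {a b} → + a ∣ + b → a ℕ.∣ b
  ∣⇒ℕ∣ d = ℤ∣.∣⇒∣ᵤ d

  data Dir : Set where
    i j k : Dir

  -- The three prime directions of ℤ_M, M = Π i Π j Π k, where Π ν = π ν · Π′ ν is a power of π ν.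
  record Frame : Set where
    field
      π Π′ ex : Dir → ℕ
      prime  : ∀ ν → Prime (π ν)
      pow    : ∀ ν → Π′ ν ≡ π ν ^ ex ν
      i≢j    : π i ≢ π j
      i≢k    : π i ≢ π k
      j≢k    : π j ≢ π k
      flatj  : Π′ j ≡ π j
      flatk  : Π′ k ≡ π k

  swapDir : Dir → Dir
  swapDir i = i
  swapDir j = k
  swapDir k = j

  -- The corner is symmetric under exchanging j and k together with its two half-fibred planes.
  -- Arguments are given in one orientation and transported along this exchange.
  swap : Frame → Frame
  swap F = record
    { π = λ ν → π (swapDir ν) ; Π′ = λ ν → Π′ (swapDir ν) ; ex = λ ν → ex (swapDir ν)
    ; prime = λ ν → prime (swapDir ν) ; pow = λ ν → pow (swapDir ν)
    ; i≢j = i≢k ; i≢k = i≢j ; j≢k = λ eq → j≢k (sym eq) ; flatj = flatk ; flatk = flatj }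
    where open Frame F

  -- The directions of exponent 2 in M. There W is divisibility by `π ν`, and everything outside W
  -- is a unit.
  data Flat : Dir → Set where
    j : Flat j
    k : Flat k

  congruent-pair : ∀ n {m} → n < m → (f : Fin m → ℤ) → .{{_ : NonZero n}} → ∃[ a ] ∃[ b ] (a ≢ b × + n ∣ f a - f b)
  congruent-pair n n<m f with Fin.pigeonhole n<m (λ a → fromℕ< (ℤ.n%ℕd<d (f a) n))
  ... | a , b , a<b , e = a , b , (λ { refl → ℕ.<-irrefl refl a<b }) , divides (f a ℤ./ℕ n - f b ℤ./ℕ n) (begin
    f a - f b ≡⟨ cong₂ _-_ (ℤ.a≡a%ℕn+[a/ℕn]*n (f a) n) (ℤ.a≡a%ℕn+[a/ℕn]*n (f b) n) ⟩
    (+ (f a ℤ.%ℕ n) + f a ℤ./ℕ n * + n) - (+ (f b ℤ.%ℕ n) + f b ℤ./ℕ n * + n)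
      ≡⟨ cong (λ t → (+ t + f a ℤ./ℕ n * + n) - (+ (f b ℤ.%ℕ n) + f b ℤ./ℕ n * + n)) (Fin.fromℕ<-injective _ _ (ℤ.n%ℕd<d (f a) n) (ℤ.n%ℕd<d (f b) n) e) ⟩
    (+ (f b ℤ.%ℕ n) + f a ℤ./ℕ n * + n) - (+ (f b ℤ.%ℕ n) + f b ℤ./ℕ n * + n)
      ≡⟨ solve 4 (λ s a b n → (s :+ a :* n) :- (s :+ b :* n) := (a :- b) :* n) refl (+ (f b ℤ.%ℕ n)) (f a ℤ./ℕ n) (f b ℤ./ℕ n) (+ n) ⟩
    (f a ℤ./ℕ n - f b ℤ./ℕ n) * + n ∎)
    where open ≡-Reasoning

  abs-sign : ∀ x → ∃[ s ] + abs x ≡ s * x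
  abs-sign (+ n)    = + 1 , sym (ℤ.*-identityˡ (+ n))
  abs-sign -[1+ n ] = -[1+ 0 ] , sym (ℤ.-1*i≡-i -[1+ n ])

  module FrameProperties (F : Frame) where
    open Frame F public

    Π : Dir → ℕ
    Π ν = π ν ℕ.* Π′ ν

    -- The ν-component of d in ℤ_{Π ν} is zero (Z), or lies in the subgroup of order π ν (W).
    Z W : Dir → ℤ → Set
    Z ν d = + Π ν ∣ d
    W ν d = + Π′ ν ∣ d

    Z? : ∀ ν d → Dec (Z ν d)
    Z? ν d = + Π ν ∣? d

    W? : ∀ ν d → Dec (W ν d)
    W? ν d = + Π′ ν ∣? d

    Eq : ℤ → Set
    Eq d = ∀ ν → Z ν d

    πnz : ∀ ν → NonZero (π ν)
    πnz ν = prime⇒nonZero (prime ν)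

    flat : ∀ {ν} → Flat ν → Π′ ν ≡ π ν
    flat j = flatj
    flat k = flatk

    Z⇒W : ∀ {ν d} → Z ν d → W ν d
    Z⇒W {ν} dv = ℤ∣.∣-trans (divides (+ π ν) (ℤ.pos-* (π ν) (Π′ ν))) dv

    Π-pow : ∀ ν → Π ν ≡ π ν ^ suc (ex ν)
    Π-pow ν = cong (π ν ℕ.*_) (pow ν)

    π-euclid : ∀ ν x y → + π ν ∣ x * y → + π ν ∣ x ⊎ + π ν ∣ y
    π-euclid ν x y d with euclidsLemma (abs x) (abs y) (prime ν) (subst (π ν ℕ.∣_) (ℤ.abs-* x y) (ℤ∣.∣⇒∣ᵤ d))
    ... | inj₁ d′ = inj₁ (ℤ∣.∣ᵤ⇒∣ d′)
    ... | inj₂ d′ = inj₂ (ℤ∣.∣ᵤ⇒∣ d′)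

    π∣Π : ∀ ν → + π ν ∣ + Π ν
    π∣Π ν = divides (+ Π′ ν) (trans (cong +_ (ℕ.*-comm (π ν) (Π′ ν))) (ℤ.pos-* (Π′ ν) (π ν)))

    Z⇒π : ∀ {ν d} → Z ν d → + π ν ∣ d
    Z⇒π {ν} dv = ℤ∣.∣-trans (π∣Π ν) dv

    π∤1 : ∀ ν → ¬ + π ν ∣ + 1
    π∤1 ν d = ℕ.<-irrefl (sym (ℕ.∣1⇒≡1 (∣⇒ℕ∣ d))) (ℕ.nonTrivial⇒n>1 (π ν) ⦃ prime⇒nonTrivial (prime ν) ⦄)

    inverse : ∀ ν x → ¬ + π ν ∣ x → ∃[ w ] Z ν (x * w - + 1)
    inverse ν x π∤x with coprime-Bézout cop
      where
      cop : Coprime (abs x) (Π ν)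
      cop {d} (d∣x , d∣Π) = ∤⇒∣primePower⇒≡1 (prime ν) (suc (ex ν)) (λ π∣d → π∤x (ℤ∣.∣ᵤ⇒∣ (ℕ.∣-trans π∣d d∣x))) (subst (d ℕ.∣_) (Π-pow ν) d∣Π)
    ... | Bézout.+- a b eq = + a * proj₁ (abs-sign x) , divides (+ b) (begin
      x * (+ a * s) - + 1               ≡⟨ solve 3 (λ x a s → x :* (a :* s) :- con (+ 1) := a :* (s :* x) :- con (+ 1)) refl x (+ a) s ⟩
      + a * (s * x) - + 1               ≡⟨ cong (λ t → + a * t - + 1) (sym (proj₂ (abs-sign x))) ⟩
      + a * + abs x - + 1               ≡⟨ cong (_- + 1) (trans (sym (ℤ.pos-* a (abs x))) (trans (cong +_ (sym eq)) (cong (λ t → + 1 + t) (ℤ.pos-* b (Π ν))))) ⟩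
      (+ 1 + + b * + Π ν) - + 1         ≡⟨ solve 1 (λ t → (con (+ 1) :+ t) :- con (+ 1) := t) refl (+ b * + Π ν) ⟩
      + b * + Π ν                       ∎)
      where
      open ≡-Reasoning
      s = proj₁ (abs-sign x)
    ... | Bézout.-+ a b eq = - (+ a * proj₁ (abs-sign x)) , divides (- + b) (begin
      x * - (+ a * s) - + 1             ≡⟨ solve 3 (λ x a s → x :* (:- (a :* s)) :- con (+ 1) := :- (con (+ 1) :+ a :* (s :* x))) refl x (+ a) s ⟩
      - (+ 1 + + a * (s * x))           ≡⟨ cong (λ t → - (+ 1 + + a * t)) (sym (proj₂ (abs-sign x))) ⟩
      - (+ 1 + + a * + abs x)           ≡⟨ cong -_ (trans (cong (λ t → + 1 + t) (sym (ℤ.pos-* a (abs x)))) (trans (cong +_ eq) (ℤ.pos-* b (Π ν)))) ⟩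
      - (+ b * + Π ν)                   ≡⟨ ℤ.neg-distribˡ-* (+ b) (+ Π ν) ⟩
      - + b * + Π ν                     ∎)
      where
      open ≡-Reasoning
      s = proj₁ (abs-sign x)

    UnitAt : Dir → ℤ → Set
    UnitAt ν u = ¬ + π ν ∣ u

    inverse-unit : ∀ ν x w → Z ν (x * w - + 1) → UnitAt ν w
    inverse-unit ν x w d π∣w = π∤1 ν (by ((x ∣* π∣w) ∣- Z⇒π {ν} d) (solve 1 (λ t → t :- (t :- con (+ 1)) := con (+ 1)) refl (x * w)))

    unit-* : ∀ {ν u v} → UnitAt ν u → UnitAt ν v → UnitAt ν (u * v)
    unit-* {ν} {u} {v} pu pv d with π-euclid ν u v d
    ... | inj₁ d′ = pu d′
    ... | inj₂ d′ = pv d′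

    unit-cancel-Z : ∀ {ν u d} → UnitAt ν u → Z ν (u * d) → Z ν d
    unit-cancel-Z {ν} {u} {d} pu z with inverse ν u pu
    ... | w , iw = by ((w ∣* z) ∣- (d ∣* iw)) (solve 3 (λ w u d → w :* (u :* d) :- d :* (u :* w :- con (+ 1)) := d) refl w u d)

    unit-cancel-W : ∀ {ν u d} → UnitAt ν u → W ν (u * d) → W ν d
    unit-cancel-W {ν} {u} {d} pu z with inverse ν u pu
    ... | w , iw = by ((w ∣* z) ∣- (d ∣* Z⇒W {ν} iw)) (solve 3 (λ w u d → w :* (u :* d) :- d :* (u :* w :- con (+ 1)) := d) refl w u d)

    -- Equality of valuations at π ν, truncated at that of Π ν.
    record Sim (ν : Dir) (x y : ℤ) : Set where
      constructor sim
      field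
        ratio : ℤ
        unit  : UnitAt ν ratio
        eq    : Z ν (x - ratio * y)

    sim-≡ : ∀ ν x y → Z ν (x - y) → Sim ν x y
    sim-≡ ν x y d = sim (+ 1) (π∤1 ν) (by d (cong (λ t → x - t) (sym (ℤ.*-identityˡ y))))

    sim-trans : ∀ {ν x y z} → Sim ν x y → Sim ν y z → Sim ν x z
    sim-trans {ν} {x} {y} {z} (sim u pu d) (sim v pv d′) = sim (u * v) (unit-* {ν} {u} {v} pu pv)
      (by (d ∣+ (u ∣* d′)) (solve 5 (λ x y z u v → (x :- u :* y) :+ u :* (y :- v :* z) := x :- (u :* v) :* z) refl x y z u v))

    sim-Z : ∀ {ν x y} → Z ν x → Z ν y → Sim ν x y
    sim-Z {ν} {x} {y} dx dy = sim-≡ ν x y (dx ∣- dy)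

    sim-ratio : ∀ ν g x y → UnitAt ν x → UnitAt ν y → Sim ν (g * x) (g * y)
    sim-ratio ν g x y px py with inverse ν y py
    ... | w , iw = sim (x * w) (unit-* {ν} {x} {w} px (inverse-unit ν y w iw))
      (by ((- (g * x)) ∣* iw) (solve 4 (λ g x y w → (:- (g :* x)) :* (y :* w :- con (+ 1)) := g :* x :- (x :* w) :* (g :* y)) refl g x y w))

    top-quotient : ∀ {ν x} → ¬ Z ν x → (d : W ν x) → UnitAt ν (_∣_.quotient d)
    top-quotient {ν} {x} nz (divides q eq) (divides q′ eq′) = nz (divides q′ (begin
      x                              ≡⟨ eq ⟩
      q * + Π′ ν                     ≡⟨ cong (_* + Π′ ν) eq′ ⟩
      q′ * + π ν * + Π′ ν            ≡⟨ ℤ.*-assoc q′ _ _ ⟩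
      q′ * (+ π ν * + Π′ ν)          ≡⟨ cong (q′ *_) (sym (ℤ.pos-* (π ν) (Π′ ν))) ⟩
      q′ * + Π ν                     ∎))
      where open ≡-Reasoning

    -- Both numbers are `Π′ ν` times something prime to `π ν`.
    sim-T : ∀ {ν x y} → W ν x → ¬ Z ν x → W ν y → ¬ Z ν y → Sim ν x y
    sim-T {ν} wx nx wy ny with wx | top-quotient {ν} nx wx | wy | top-quotient {ν} ny wy
    ... | divides a refl | pa | divides b refl | pb =
      subst₂ (Sim ν) (ℤ.*-comm (+ Π′ ν) a) (ℤ.*-comm (+ Π′ ν) b) (sim-ratio ν (+ Π′ ν) a b pa pb)

    -- At exponent 2 both numbers are units, so all of them form one class.
    sim-N : ∀ {ν x y} → Flat ν → ¬ W ν x → ¬ W ν y → Sim ν x y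
    sim-N {ν} {x} {y} fl nx ny = subst₂ (Sim ν) (ℤ.*-identityˡ x) (ℤ.*-identityˡ y)
      (sim-ratio ν (+ 1) x y (subst (λ n → ¬ + n ∣ x) (flat fl) nx) (subst (λ n → ¬ + n ∣ y) (flat fl) ny))

    split-power : ∀ ν n x → ¬ + (π ν ^ suc n) ∣ x → ∃[ c ] ∃[ x′ ] (c ≤ n × x ≡ + (π ν ^ c) * x′ × UnitAt ν x′)
    split-power ν n x h with + π ν ∣? x
    ... | no πx = 0 , x , z≤n , sym (ℤ.*-identityˡ x) , πx
    split-power ν zero x h | yes πx = ⊥-elim (h (subst (λ t → + t ∣ x) (sym (ℕ.*-identityʳ (π ν))) πx))
    split-power ν (suc n) x h | yes (divides y refl) with split-power ν n y (λ d → h (divides (_∣_.quotient d)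
        (trans (cong (_* + π ν) (_∣_.equality d)) (trans (ℤ.*-assoc (_∣_.quotient d) _ _)
          (cong (_∣_.quotient d *_) (trans (sym (ℤ.pos-* (π ν ^ suc n) (π ν))) (cong +_ (ℕ.*-comm (π ν ^ suc n) (π ν)))))))))
    ... | c , x′ , c≤n , refl , px = suc c , x′ , s≤s c≤n ,
      trans (solve 3 (λ c x p → c :* x :* p := (p :* c) :* x) refl (+ (π ν ^ c)) x′ (+ π ν)) (cong (_* x′) (sym (ℤ.pos-* (π ν) (π ν ^ c)))) , px

    -- Let π^c be the exact power in x; as x is nonzero, c is at most `ex ν`. Changing x by a
    -- multiple of π^(ex ν) preserves the valuation if c < `ex ν`; if c = `ex ν`, then y is a
    -- nonzero multiple of π^(ex ν) and has the same valuation again.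
    sim-shift : ∀ {ν x y} → ¬ Z ν x → ¬ Z ν y → W ν (x - y) → Sim ν x y
    sim-shift {ν} {x} {y} nx ny (divides t eq) with split-power ν (ex ν) x (subst (λ n → ¬ + n ∣ x) (Π-pow ν) nx)
    ... | c , x′ , c≤e , refl , px = subst (Sim ν (g * x′)) (sym y≡) (sim-ratio ν g x′ y′ px py)
      where
      open ≡-Reasoning
      g = + (π ν ^ c)
      h = + (π ν ^ (ex ν ∸ c))
      gh : + Π′ ν ≡ g * h
      gh = trans (cong +_ (trans (pow ν) (trans (cong (π ν ^_) (sym (ℕ.m+[n∸m]≡n c≤e))) (ℕ.^-distribˡ-+-* (π ν) c _)))) (ℤ.pos-* (π ν ^ c) _)
      y′ = x′ - h * t
      y≡ : y ≡ g * y′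
      y≡ = begin
        y                           ≡⟨ solve 2 (λ y x → y := x :- (x :- y)) refl y (g * x′) ⟩
        g * x′ - (g * x′ - y)       ≡⟨ cong (λ s → g * x′ - s) (trans eq (cong (t *_) gh)) ⟩
        g * x′ - t * (g * h)        ≡⟨ solve 4 (λ g x t h → g :* x :- t :* (g :* h) := g :* (x :- h :* t)) refl g x′ t h ⟩
        g * y′                      ∎
      py : UnitAt ν y′
      py d = go (ex ν ∸ c) refl
        where
        go : ∀ n → ex ν ∸ c ≡ n → ⊥
        go zero ec = ny (subst (Z ν) (sym y≡) (subst (λ n → + Π ν ∣ + n * y′) (trans (pow ν) (cong (π ν ^_) (ℕ.≤-antisym (ℕ.m∸n≡0⇒m≤n ec) c≤e))) top))
          where
          top : + Π ν ∣ + Π′ ν * y′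
          top = let s = _∣_.quotient d in divides s (trans (cong (+ Π′ ν *_) (_∣_.equality d)) (trans (solve 3 (λ a s p → a :* (s :* p) := s :* (p :* a)) refl (+ Π′ ν) s (+ π ν))
                  (cong (s *_) (sym (ℤ.pos-* (π ν) (Π′ ν))))))
        go (suc n) ec = px (by (d ∣+ ((+ (π ν ^ n) * t) ∣* ℤ∣.∣-refl)) (trans (cong (λ q → (x′ - q * t) + + (π ν ^ n) * t * + π ν) (trans (cong (λ z → + (π ν ^ z)) ec) (ℤ.pos-* (π ν) (π ν ^ n))))
                (solve 4 (λ x p q t → (x :- (p :* q) :* t) :+ (q :* t) :* p := x) refl x′ (+ π ν) (+ (π ν ^ n)) t)))

    π∤π^ : ∀ {μ ν} → π μ ≢ π ν → ∀ n → ¬ π μ ℕ.∣ π ν ^ n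
    π∤π^ {μ} {ν} ne zero    d = ℕ.<-irrefl (sym (ℕ.∣1⇒≡1 d)) (ℕ.nonTrivial⇒n>1 (π μ) ⦃ prime⇒nonTrivial (prime μ) ⦄)
    π∤π^ {μ} {ν} ne (suc n) d with euclidsLemma (π ν) (π ν ^ n) (prime μ) d
    ... | inj₂ d′ = π∤π^ {μ} {ν} ne n d′
    ... | inj₁ d′ with prime⇒irreducible (prime ν) d′
    ...   | inj₁ π≡1 = ℕ.<-irrefl (sym π≡1) (ℕ.nonTrivial⇒n>1 (π μ) ⦃ prime⇒nonTrivial (prime μ) ⦄)
    ...   | inj₂ eq  = ne eq

    π∤Π : ∀ {μ ν} → π μ ≢ π ν → UnitAt μ (+ Π ν)
    π∤Π {μ} {ν} ne d = π∤π^ {μ} {ν} ne (suc (ex ν)) (subst (π μ ℕ.∣_) (Π-pow ν) (∣⇒ℕ∣ d))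

    private
      others : Dir → ℤ
      others i = + Π j * + Π k
      others j = + Π i * + Π k
      others k = + Π i * + Π j

      others-unit : ∀ ν → UnitAt ν (others ν)
      others-unit i = unit-* {i} {+ Π j} {+ Π k} (π∤Π {i} {j} i≢j) (π∤Π {i} {k} i≢k)
      others-unit j = unit-* {j} {+ Π i} {+ Π k} (π∤Π {j} {i} (≢-sym i≢j)) (π∤Π {j} {k} j≢k)
      others-unit k = unit-* {k} {+ Π i} {+ Π j} (π∤Π {k} {i} (≢-sym i≢k)) (π∤Π {k} {j} (≢-sym j≢k))

      -- The idempotent of the Chinese remainder theorem: 1 at ν and 0 in the other two directions.
      idem : Dir → ℤ
      idem ν = others ν * proj₁ (inverse ν (others ν) (others-unit ν))

      idem-1 : ∀ ν → Z ν (idem ν - + 1)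
      idem-1 ν = proj₂ (inverse ν (others ν) (others-unit ν))

      right : ∀ (a b w : ℤ) {m} → m ∣ b → m ∣ a * b * w
      right a b w d = by ((a * w) ∣* d) (solve 3 (λ a b w → (a :* w) :* b := a :* b :* w) refl a b w)

      left : ∀ (a b w : ℤ) {m} → m ∣ a → m ∣ a * b * w
      left a b w d = by ((b * w) ∣* d) (solve 3 (λ a b w → (b :* w) :* a := a :* b :* w) refl a b w)

      inv′ : ∀ ν → ℤ
      inv′ ν = proj₁ (inverse ν (others ν) (others-unit ν))

    crt : (x : Dir → ℤ) → ∃[ t ] ∀ ν → Z ν (t - x ν)
    crt x = t , λ
      { i → by (((x i ∣* idem-1 i) ∣+ (x j ∣* left (+ Π i) (+ Π k) (inv′ j) ℤ∣.∣-refl)) ∣+ (x k ∣* left (+ Π i) (+ Π j) (inv′ k) ℤ∣.∣-refl))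
             (solve 6 (λ x y z a b c → (x :* (a :- con (+ 1)) :+ y :* b) :+ z :* c := ((x :* a :+ y :* b) :+ z :* c) :- x) refl (x i) (x j) (x k) (idem i) (idem j) (idem k))
      ; j → by (((x j ∣* idem-1 j) ∣+ (x i ∣* left (+ Π j) (+ Π k) (inv′ i) ℤ∣.∣-refl)) ∣+ (x k ∣* right (+ Π i) (+ Π j) (inv′ k) ℤ∣.∣-refl))
             (solve 6 (λ x y z a b c → (y :* (b :- con (+ 1)) :+ x :* a) :+ z :* c := ((x :* a :+ y :* b) :+ z :* c) :- y) refl (x i) (x j) (x k) (idem i) (idem j) (idem k))
      ; k → by (((x k ∣* idem-1 k) ∣+ (x i ∣* right (+ Π j) (+ Π k) (inv′ i) ℤ∣.∣-refl)) ∣+ (x j ∣* right (+ Π i) (+ Π k) (inv′ j) ℤ∣.∣-refl))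
             (solve 6 (λ x y z a b c → (z :* (c :- con (+ 1)) :+ x :* a) :+ y :* b := ((x :* a :+ y :* b) :+ z :* c) :- z) refl (x i) (x j) (x k) (idem i) (idem j) (idem k)) }
      where
      t = (x i * idem i + x j * idem j) + x k * idem k

    -- Pigeonhole: the subgroup of order π ν of ℤ_{Π ν}.
    coincide : ∀ ν {n} → π ν < n → (f : Fin n → ℤ) → (∀ a b → W ν (f a - f b)) → ∃[ a ] ∃[ b ] (a ≢ b × Z ν (f a - f b))
    coincide ν {suc n} lt f w with congruent-pair (π ν) lt (λ a → _∣_.quotient (w a zero)) ⦃ πnz ν ⦄
    ... | a , b , a≢b , divides t eq = a , b , a≢b , divides t (begin
      f a - f b                                  ≡⟨ solve 3 (λ a b c → a :- b := (a :- c) :- (b :- c)) refl (f a) (f b) (f zero) ⟩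
      (f a - f zero) - (f b - f zero)            ≡⟨ cong₂ _-_ (_∣_.equality (w a zero)) (_∣_.equality (w b zero)) ⟩
      qa * + Π′ ν - qb * + Π′ ν                  ≡⟨ solve 3 (λ a b c → a :* c :- b :* c := (a :- b) :* c) refl qa qb (+ Π′ ν) ⟩
      (qa - qb) * + Π′ ν                         ≡⟨ cong (_* + Π′ ν) eq ⟩
      t * + π ν * + Π′ ν                         ≡⟨ ℤ.*-assoc t _ _ ⟩
      t * (+ π ν * + Π′ ν)                       ≡⟨ cong (t *_) (sym (ℤ.pos-* (π ν) (Π′ ν))) ⟩
      t * + Π ν                                  ∎)
      where
      open ≡-Reasoning
      qa = _∣_.quotient (w a zero)
      qb = _∣_.quotient (w b zero)

    coincideW : ∀ {ν n} → Flat ν → π ν < n → (f : Fin n → ℤ) → ∃[ a ] ∃[ b ] (a ≢ b × W ν (f a - f b))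
    coincideW {ν} fl lt f with congruent-pair (π ν) lt f ⦃ πnz ν ⦄
    ... | a , b , a≢b , d = a , b , a≢b , subst (λ n → + n ∣ f a - f b) (sym (flat fl)) d

  _≟D_ : (μ ν : Dir) → Dec (μ ≡ ν)
  i ≟D i = yes refl
  i ≟D j = no λ ()
  i ≟D k = no λ ()
  j ≟D i = no λ ()
  j ≟D j = yes refl
  j ≟D k = no λ ()
  k ≟D i = no λ ()
  k ≟D j = no λ ()
  k ≟D k = yes refl

  -- Integer predicates invariant under M stand for subsets of ℤ_M, so that differences need no
  -- reduction. Covering and uniqueness are demanded for all dilates of ℬ by units; that one tiling
  -- provides them all is Tijdeman's theorem.
  record Tiling (F : Frame) (𝒜 ℬ : ℤ → Set) : Set where
    open FrameProperties F
    field
      respA : ∀ x y → Eq (x - y) → 𝒜 y → 𝒜 x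
      respB : ∀ x y → Eq (x - y) → ℬ y → ℬ x
      decA  : ∀ x → Dec (𝒜 x)
      decB  : ∀ x → Dec (ℬ x)
      exist : ∀ u → (∀ ν → UnitAt ν u) → ∀ x → ∃[ a ] ∃[ b ] (𝒜 a × ℬ b × Eq (x - (a + u * b)))
      uniq  : ∀ u → (∀ ν → UnitAt ν u) → ∀ a a′ b b′ → 𝒜 a → 𝒜 a′ → ℬ b → ℬ b′ →
              Eq ((a + u * b) - (a′ + u * b′)) → Eq (a - a′)

  swapTiling : ∀ {F 𝒜 ℬ} → Tiling F 𝒜 ℬ → Tiling (swap F) 𝒜 ℬ
  swapTiling {F} T = record
    { respA = λ x y e → respA x y (back e) ; respB = λ x y e → respB x y (back e) ; decA = decA ; decB = decB
    ; exist = λ u pu x → let (a , b , pa , pb , e) = exist u (λ { i → pu i ; j → pu k ; k → pu j }) x in a , b , pa , pb , forth e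
    ; uniq = λ u pu a a′ b b′ pa pa′ pb pb′ e → forth (uniq u (λ { i → pu i ; j → pu k ; k → pu j }) a a′ b b′ pa pa′ pb pb′ (back e)) }
    where
    open Tiling T
    module P = FrameProperties F
    module S = FrameProperties (swap F)
    back : ∀ {d} → S.Eq d → P.Eq d
    back e i = e i
    back e j = e k
    back e k = e j
    forth : ∀ {d} → P.Eq d → S.Eq d
    forth e i = e i
    forth e j = e k
    forth e k = e j

  module TilingProperties {F : Frame} {𝒜 ℬ : ℤ → Set} (T : Tiling F 𝒜 ℬ) where
    open FrameProperties F
    open Tiling T public

    combine-units : (u : Dir → ℤ) → (∀ ν → UnitAt ν (u ν)) → ∃[ t ] ((∀ ν → UnitAt ν t) × (∀ ν → Z ν (t - u ν)))
    combine-units u pu with crt u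
    ... | t , c = t , (λ ν d → pu ν (by (d ∣- Z⇒π {ν} (c ν)) (solve 2 (λ t u → t :- (t :- u) := u) refl t (u ν)))) , c

    -- Sands: up to units, A - A and B - B share only 0.
    sands : ∀ {a a′ b b′} → 𝒜 a → 𝒜 a′ → ℬ b → ℬ b′ → (∀ ν → Sim ν (a - a′) (b - b′)) → Eq (a - a′)
    sands {a} {a′} {b} {b′} pa pa′ pb pb′ s = go (combine-units (λ ν → Sim.ratio (s ν)) (λ ν → Sim.unit (s ν)))
      where
      lem : ∀ a a′ b b′ u v → ((a - a′) - v * (b - b′)) - (b - b′) * (u - v) ≡ (a + u * b′) - (a′ + u * b)
      lem = solve 6 (λ a a′ b b′ u v → ((a :- a′) :- v :* (b :- b′)) :- (b :- b′) :* (u :- v) := (a :+ u :* b′) :- (a′ :+ u :* b)) refl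
      go : ∃[ t ] ((∀ ν → UnitAt ν t) × (∀ ν → Z ν (t - Sim.ratio (s ν)))) → Eq (a - a′)
      go (u , pu , c) = uniq u pu a a′ b′ b pa pa′ pb′ pb λ ν →
        by (Sim.eq (s ν) ∣- ((b - b′) ∣* c ν)) (lem a a′ b b′ u (Sim.ratio (s ν)))

    -- The point x + t b is covered as a′ + t b′ in the tiling dilated by t. By the Chinese
    -- remainder theorem t can be prescribed in each direction separately, and with it the ratio of
    -- x - a′ to b′ - b.
    cover : ∀ x {b} → ℬ b → (u : Dir → ℤ) → (∀ ν → UnitAt ν (u ν)) →
      ∃[ a′ ] ∃[ b′ ] (𝒜 a′ × ℬ b′ × (∀ ν → Z ν ((x - a′) - u ν * (b′ - b))))
    cover x {b} pb u pu = go₁ (combine-units u pu)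
      where
      go₂ : ∀ t → (∀ ν → Z ν (t - u ν)) → ∃[ a′ ] ∃[ b′ ] (𝒜 a′ × ℬ b′ × Eq ((x + t * b) - (a′ + t * b′))) →
        ∃[ a′ ] ∃[ b′ ] (𝒜 a′ × ℬ b′ × (∀ ν → Z ν ((x - a′) - u ν * (b′ - b))))
      go₂ t c (a′ , b′ , pa , pb′ , e) = a′ , b′ , pa , pb′ , λ ν → by (e ν ∣+ ((b′ - b) ∣* c ν))
        (solve 6 (λ x t b a b′ u → ((x :+ t :* b) :- (a :+ t :* b′)) :+ (b′ :- b) :* (t :- u) := (x :- a) :- u :* (b′ :- b)) refl x t b a′ b′ (u ν))
      go₁ : ∃[ t ] ((∀ ν → UnitAt ν t) × (∀ ν → Z ν (t - u ν))) → ∃[ a′ ] ∃[ b′ ] (𝒜 a′ × ℬ b′ × (∀ ν → Z ν ((x - a′) - u ν * (b′ - b))))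
      go₁ (t , pt , c) = go₂ t c (exist t pt (x + t * b))

    -- If a′ agreed at ν with neither x nor a, then a - a′ and x - a′ would be nonzero at ν with a
    -- difference in W, hence associated there; elsewhere they are equal. So a - a′ would be
    -- associated with b′ - b in every direction, against `sands`.
    bispan : ∀ ν x {a a′ b b′} → 𝒜 a → 𝒜 a′ → ℬ b → ℬ b′ → (∀ μ → Sim μ (x - a′) (b′ - b)) →
      (∀ μ → μ ≢ ν → Z μ (x - a)) → W ν (x - a) → Z ν (a′ - x) ⊎ Z ν (a′ - a)
    bispan ν x {a} {a′} {b} {b′} pa pa′ pb pb′ s off w with Z? ν (a′ - x) | Z? ν (a′ - a)
    ... | yes z | _     = inj₁ z
    ... | no _  | yes z = inj₂ z
    ... | no n₁ | no n₂ = ⊥-elim (n₂ (∣-sym a a′ (sands pa pa′ pb′ pb (λ μ → sim-trans (shift μ) (s μ)) ν)))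
      where
      shift : ∀ μ → Sim μ (a - a′) (x - a′)
      shift μ with μ ≟D ν
      ... | yes refl = sim-shift (λ z → n₂ (∣-sym a a′ z)) (λ z → n₁ (∣-sym x a′ z))
        (by (∣-neg w) (solve 3 (λ x a a′ → :- (x :- a) := (a :- a′) :- (x :- a′)) refl x a a′))
      ... | no μ≢ν = sim-≡ μ (a - a′) (x - a′) (by (∣-neg (off μ μ≢ν)) (solve 3 (λ x a a′ → :- (x :- a) := (a :- a′) :- (x :- a′)) refl x a a′))

  record Crowd (F : Frame) (ℬ R : ℤ → Set) (n : ℕ) (c : ℤ) : Set where
    open FrameProperties F
    field
      member   : Fin n → ℤ
      isMember : ∀ a → ℬ (member a)
      near     : ∀ a → R (member a - c)
      distinct : ∀ {a b} → a ≢ b → ¬ Eq (member a - member b)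

  record Corner (F : Frame) (𝒜 ℬ : ℤ → Set) : Set where
    open FrameProperties F
    field
      tiling : Tiling F 𝒜 ℬ
      o o′   : ℤ
      o∈     : 𝒜 o
      o′∈    : 𝒜 o′
      oo-W   : W i (o′ - o)
      oo-¬Z  : ¬ Z i (o′ - o)
      oo-j   : Z j (o′ - o)
      oo-k   : Z k (o′ - o)
      fibre-j : ∀ {x y} → 𝒜 x → Z i (x - o) → W j (x - o) → W k (x - o) → Z i (y - x) → W j (y - x) → Z k (y - x) → 𝒜 y
      fibre-k : ∀ {x y} → 𝒜 x → Z i (x - o′) → W j (x - o′) → W k (x - o′) → Z i (y - x) → Z j (y - x) → W k (y - x) → 𝒜 y
      -- Witnesses of the failing fibrings: `xv` lies on the k-line through `o`, and `xw` on the
      -- j-line through `o′`.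
      xv xw  : ℤ
      xv∉    : ¬ 𝒜 xv
      xw∉    : ¬ 𝒜 xw
      xv-i   : Z i (xv - o)
      xv-j   : Z j (xv - o)
      xv-k   : W k (xv - o)
      xw-i   : Z i (xw - o′)
      xw-j   : W j (xw - o′)
      xw-k   : Z k (xw - o′)
      -- As |B| = D(M), a class modulo `Π′ i` and `Π′ k` has p_j elements of `B` on average: the
      -- class of `c` has at least that many, or else some other class has more.
      crowd-j : ∀ c → Crowd F ℬ (λ d → W i d × W k d) (π j) c ⊎ ∃[ c′ ] Crowd F ℬ (λ d → W i d × W k d) (suc (π j)) c′
      crowd-k : ∀ c → Crowd F ℬ (λ d → W i d × W j d) (π k) c ⊎ ∃[ c′ ] Crowd F ℬ (λ d → W i d × W j d) (suc (π k)) c′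

  swapCorner : ∀ {F 𝒜 ℬ} → Corner F 𝒜 ℬ → Corner (swap F) 𝒜 ℬ
  swapCorner {F} {𝒜} {ℬ} C = record
    { tiling = swapTiling tiling ; o = o′ ; o′ = o ; o∈ = o′∈ ; o′∈ = o∈
    ; oo-W = ∣-sym o′ o oo-W ; oo-¬Z = λ z → oo-¬Z (∣-sym o o′ z) ; oo-j = ∣-sym o′ o oo-k ; oo-k = ∣-sym o′ o oo-j
    ; fibre-j = λ p zi wj wk zi′ wj′ zk′ → fibre-k p zi wk wj zi′ zk′ wj′
    ; fibre-k = λ p zi wj wk zi′ wj′ zk′ → fibre-j p zi wk wj zi′ zk′ wj′
    ; xv = xw ; xw = xv ; xv∉ = xw∉ ; xw∉ = xv∉ ; xv-i = xw-i ; xv-j = xw-k ; xv-k = xw-j ; xw-i = xv-i ; xw-j = xv-k ; xw-k = xv-j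
    ; crowd-j = λ c → swapCrowds (crowd-k c) ; crowd-k = λ c → swapCrowds (crowd-j c) }
    where
    open Corner C
    swapCrowd : ∀ {R n c} → Crowd F ℬ R n c → Crowd (swap F) ℬ R n c
    swapCrowd K = record { member = member ; isMember = isMember ; near = near
      ; distinct = λ ne e → distinct ne λ { i → e i ; j → e k ; k → e j } }
      where open Crowd K
    swapCrowds : ∀ {R m n c} → Crowd F ℬ R m c ⊎ ∃ (Crowd F ℬ R n) → Crowd (swap F) ℬ R m c ⊎ ∃ (Crowd (swap F) ℬ R n)
    swapCrowds (inj₁ K) = inj₁ (swapCrowd K)
    swapCrowds (inj₂ (c , K)) = inj₂ (c , swapCrowd K)

  -- Neighbours in B from covering a missing point

  module CornerProperties {F : Frame} {𝒜 ℬ : ℤ → Set} (C : Corner F 𝒜 ℬ) where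
    open FrameProperties F
    open Corner C public
    open TilingProperties tiling public

    point-j : ∀ y → W j (y - o) → ∃[ l ] (𝒜 l × Z i (l - o) × Z j (l - y) × Z k (l - o))
    point-j y w = case crt (λ { i → o ; j → y ; k → o }) of λ (l , c) → l , fibre-j o∈ (∣-self o) (∣-self o) (∣-self o) (c i) (∣-trans l y o (Z⇒W {j} (c j)) w) (c k) , c i , c j , c k

    point-k : ∀ z → W k (z - o′) → ∃[ l ] (𝒜 l × Z i (l - o′) × Z j (l - o′) × Z k (l - z))
    point-k z w = case crt (λ { i → o′ ; j → o′ ; k → z }) of λ (l , c) → l , fibre-k o′∈ (∣-self o′) (∣-self o′) (∣-self o′) (c i) (c j) (∣-trans l z o′ (Z⇒W {k} (c k)) w) , c i , c j , c k

    -- The j-fibre through `o` and the k-fibre through `o′` contain points whose difference is o -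
    -- o′ at i and any given element of W at j and at k; by `sands` this forbids a nonzero
    -- i-component. Inside the two fibres there are differences purely in direction j and purely in
    -- direction k, which forbids being nonzero at exactly one of these. Only the diagonals remain.
    grid-difference : ∀ {b b′} → ℬ b → ℬ b′ → W i (b′ - b) → W j (b′ - b) → W k (b′ - b) →
      Eq (b′ - b) ⊎ (Z i (b′ - b) × ¬ Z j (b′ - b) × ¬ Z k (b′ - b))
    grid-difference {b} {b′} pb pb′ wi wj wk = go (Z? i d) (Z? j d) (Z? k d)
      where
      d = b′ - b
      lem₁ : ∀ o d → d ≡ (o + d) - o
      lem₁ = solve 2 (λ o d → d := (o :+ d) :- o) refl
      lem₂ : ∀ o d → - d ≡ (o - d) - o
      lem₂ = solve 2 (λ o d → :- d := (o :- d) :- o) refl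
      lem₃ : ∀ l o m o′ → (l - o) - (m - o′) ≡ (l - m) - (o - o′)
      lem₃ = solve 4 (λ l o m o′ → (l :- o) :- (m :- o′) := (l :- m) :- (o :- o′)) refl
      lem₄ : ∀ l o d m o′ → ((l - (o + d)) - (m - o′)) - (o′ - o) ≡ (l - m) - d
      lem₄ = solve 5 (λ l o d m o′ → ((l :- (o :+ d)) :- (m :- o′)) :- (o′ :- o) := (l :- m) :- d) refl
      lem₅ : ∀ l o d m o′ → ((l - o) - (m - (o′ - d))) - (o′ - o) ≡ (l - m) - d
      lem₅ = solve 5 (λ l o d m o′ → ((l :- o) :- (m :- (o′ :- d))) :- (o′ :- o) := (l :- m) :- d) refl
      lem₆ : ∀ l m o o′ → ((l - m) - (o - o′)) - (l - m) ≡ o′ - o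
      lem₆ = solve 4 (λ l m o o′ → ((l :- m) :- (o :- o′)) :- (l :- m) := o′ :- o) refl
      lem₇ : ∀ l o d → (l - o) - ((l - o) - d) ≡ d
      lem₇ = solve 3 (λ l o d → (l :- o) :- ((l :- o) :- d) := d) refl
      lem₈ : ∀ l o d → l - (o + d) ≡ (l - o) - d
      lem₈ = solve 3 (λ l o d → l :- (o :+ d) := (l :- o) :- d) refl
      impossible : ¬ Z i d → ∃[ l ] (𝒜 l × Z i (l - o) × Z j (l - (o + d)) × Z k (l - o)) →
        ∃[ m ] (𝒜 m × Z i (m - o′) × Z j (m - o′) × Z k (m - (o′ - d))) → ⊥
      impossible nzi (l , pl , li , lj , lk) (m , pm , mi , mj , mk) = oo-¬Z (by (i-eq ∣- sands pl pm pb′ pb sims i) (lem₆ l m o o′))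
        where
        i-eq : Z i ((l - m) - (o - o′))
        i-eq = by (li ∣- mi) (lem₃ l o m o′)
        sims : ∀ ν → Sim ν (l - m) (b′ - b)
        sims i = sim-trans (sim-≡ i (l - m) (o - o′) i-eq) (sim-T (∣-sym o′ o oo-W) (λ z → oo-¬Z (∣-sym o o′ z)) wi nzi)
        sims j = sim-≡ j (l - m) d (by ((lj ∣- mj) ∣- oo-j) (lem₄ l o d m o′))
        sims k = sim-≡ k (l - m) d (by ((lk ∣- mk) ∣- oo-k) (lem₅ l o d m o′))
      nonzero-j : Z i d → ¬ Z j d → Z k d → ∃[ l ] (𝒜 l × Z i (l - o) × Z j (l - (o + d)) × Z k (l - o)) → ⊥
      nonzero-j zi nzj zk (l , pl , li , lj , lk) = nzj (by (sands pl o∈ pb′ pb sims j ∣- j-eq) (lem₇ l o d))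
        where
        j-eq : Z j ((l - o) - d)
        j-eq = by lj (lem₈ l o d)
        sims : ∀ ν → Sim ν (l - o) d
        sims i = sim-Z li zi
        sims j = sim-≡ j (l - o) d j-eq
        sims k = sim-Z lk zk
      nonzero-k : Z i d → Z j d → ¬ Z k d → ∃[ l ] (𝒜 l × Z i (l - o′) × Z j (l - o′) × Z k (l - (o′ + d))) → ⊥
      nonzero-k zi zj nzk (l , pl , li , lj , lk) = nzk (by (sands pl o′∈ pb′ pb sims k ∣- k-eq) (lem₇ l o′ d))
        where
        k-eq : Z k ((l - o′) - d)
        k-eq = by lk (lem₈ l o′ d)
        sims : ∀ ν → Sim ν (l - o′) d
        sims i = sim-Z li zi
        sims j = sim-Z lj zj
        sims k = sim-≡ k (l - o′) d k-eq
      go : Dec (Z i d) → Dec (Z j d) → Dec (Z k d) → Eq d ⊎ (Z i d × ¬ Z j d × ¬ Z k d)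
      go (yes zi) (yes zj) (yes zk) = inj₁ λ { i → zi ; j → zj ; k → zk }
      go (yes zi) (no nzj) (no nzk) = inj₂ (zi , nzj , nzk)
      go (no nzi) _ _ = ⊥-elim (impossible nzi (point-j (o + d) (by wj (lem₁ o d))) (point-k (o′ - d) (by (∣-neg wk) (lem₂ o′ d))))
      go (yes zi) (no nzj) (yes zk) = ⊥-elim (nonzero-j zi nzj zk (point-j (o + d) (by wj (lem₁ o d))))
      go (yes zi) (yes zj) (no nzk) = ⊥-elim (nonzero-k zi zj nzk (point-k (o′ + d) (by wk (lem₁ o′ d))))

    SameZ : Dir → ℤ → ℤ → Set
    SameZ ν d d′ = (Z ν d → Z ν d′) × (Z ν d′ → Z ν d)

    -- One covering pair found next to a single element of `B` decides the zero pattern at i and j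
    -- for all differences of this kind in `B`. That is what makes pigeonhole arguments far away
    -- from the pair possible.
    Governs : ℤ → Set
    Governs d = ∀ {b₁ b₂} → ℬ b₁ → ℬ b₂ → W i (b₁ - b₂) → W j (b₁ - b₂) → ¬ W k (b₁ - b₂) →
      SameZ i (b₁ - b₂) d × SameZ j (b₁ - b₂) d

    -- The two possible outcomes of covering `xw`. In a grid step the difference vanishes modulo
    -- D(M) and is thus a diagonal; in a unit step its k-component is prime to p_k.
    GridStep : ℤ → ℤ → Set
    GridStep w′ d = Z i d × Z j (d - w′) × W k d × ¬ Z k d

    UnitStep : ℤ → ℤ → ℤ → Set
    UnitStep e′ w′ d = ¬ W k d × (Z i d ⊎ Z i (d - e′)) × (Z j d ⊎ Z j (d - w′)) × Governs d

    -- The point xw ∉ A is covered by a translate of a dilate of B; the bispan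
    -- constraints from points of the two fibres leave few positions for the covering pair.
    neighbour : ∀ {b e′ w′} → ℬ b → W i e′ → ¬ Z i e′ → W j w′ → ¬ Z j w′ →
      ∃[ b′ ] (ℬ b′ × (GridStep w′ (b′ - b) ⊎ UnitStep e′ w′ (b′ - b)))
    neighbour {b} {e′} {w′} pb We ¬Ze Ww ¬Zw = scaled (sim-T oo-W oo-¬Z We ¬Ze) (sim-T xw-j wd-¬Z Ww ¬Zw)
      where
      wd-¬Z : ¬ Z j (xw - o′)
      wd-¬Z z = xw∉ (respA xw o′ (λ { i → xw-i ; j → z ; k → xw-k }) o′∈)
      -- The dilation carries e′ to o′ - o at i and w′ to xw - o′ at j, and is the identity at k.
      module Scaled (u : Dir → ℤ) (pu : ∀ ν → UnitAt ν (u ν)) (ui : Z i ((o′ - o) - u i * e′)) (uj : Z j ((xw - o′) - u j * w′)) (uk : u k ≡ + 1) where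
        go : ∃[ a′ ] ∃[ b′ ] (𝒜 a′ × ℬ b′ × (∀ ν → Z ν ((xw - a′) - u ν * (b′ - b)))) →
          ∃[ b′ ] (ℬ b′ × (GridStep w′ (b′ - b) ⊎ UnitStep e′ w′ (b′ - b)))
        go (a′ , b′ , pa′ , pb′ , c) = b′ , pb′ , step
          where
          d = b′ - b
          sims : ∀ ν → Sim ν (xw - a′) d
          sims ν = sim (u ν) (pu ν) (c ν)
          zero-d : ∀ ν → Z ν (a′ - xw) → Z ν d
          zero-d ν z = unit-cancel-Z {ν} {u ν} (pu ν) (by (∣-neg (z ∣+ c ν)) (solve 4 (λ a x u d → :- ((a :- x) :+ ((x :- a) :- u :* d)) := u :* d) refl a′ xw (u ν) d))
          -- The point of the j-fibre through `o` that shares the j-component of `xw` differs from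
          -- `xw` in direction i only, so `bispan` applies to it.
          I-alt : (Z i d × Z i (a′ - xw)) ⊎ (Z i (d - e′) × Z i (a′ - o))
          I-alt = from (point-j xw (by (xw-j ∣+ Z⇒W {j} oo-j) (solve 3 (λ x o′ o → (x :- o′) :+ (o′ :- o) := x :- o) refl xw o′ o)))
            where
            from : ∃[ l ] (𝒜 l × Z i (l - o) × Z j (l - xw) × Z k (l - o)) → (Z i d × Z i (a′ - xw)) ⊎ (Z i (d - e′) × Z i (a′ - o))
            from (l , pl , li , lj , lk) = from′ (bispan i xw pl pa′ pb pb′ sims off onto)
              where
              lem : ∀ o′ o u e x a l d → ((((o′ - o) - u * e) + (x - o′)) - ((a - l) + (l - o))) - ((x - a) - u * d) ≡ u * (d - e)
              lem = solve 8 (λ o′ o u e x a l d → ((((o′ :- o) :- u :* e) :+ (x :- o′)) :- ((a :- l) :+ (l :- o))) :- ((x :- a) :- u :* d) := u :* (d :- e)) refl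
              lem′ : ∀ x o′ o l → ((x - o′) + (o′ - o)) - (l - o) ≡ x - l
              lem′ = solve 4 (λ x o′ o l → ((x :- o′) :+ (o′ :- o)) :- (l :- o) := x :- l) refl
              off : ∀ μ → μ ≢ i → Z μ (xw - l)
              off i ne = ⊥-elim (ne refl)
              off j _  = ∣-sym l xw lj
              off k _  = by ((xw-k ∣+ oo-k) ∣- lk) (lem′ xw o′ o l)
              onto : W i (xw - l)
              onto = by ((Z⇒W {i} xw-i ∣+ oo-W) ∣- Z⇒W {i} li) (lem′ xw o′ o l)
              from′ : Z i (a′ - xw) ⊎ Z i (a′ - l) → (Z i d × Z i (a′ - xw)) ⊎ (Z i (d - e′) × Z i (a′ - o))
              from′ (inj₁ z) = inj₁ (zero-d i z , z)
              from′ (inj₂ z) = inj₂ (unit-cancel-Z {i} {u i} (pu i) (by (((ui ∣+ xw-i) ∣- (z ∣+ li)) ∣- c i) (lem o′ o (u i) e′ xw a′ l d)) , ∣-trans a′ l o z li)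
          -- Here `bispan` uses `o′` itself, which differs from `xw` in direction j only.
          J-alt : (Z j d × Z j (a′ - xw)) ⊎ (Z j (d - w′) × Z j (a′ - o′))
          J-alt = from (bispan j xw o′∈ pa′ pb pb′ sims (λ { i _ → xw-i ; j ne → ⊥-elim (ne refl) ; k _ → xw-k }) xw-j)
            where
            lem : ∀ x o′ u w a d → (((x - o′) - u * w) - (a - o′)) - ((x - a) - u * d) ≡ u * (d - w)
            lem = solve 6 (λ x o′ u w a d → (((x :- o′) :- u :* w) :- (a :- o′)) :- ((x :- a) :- u :* d) := u :* (d :- w)) refl
            from : Z j (a′ - xw) ⊎ Z j (a′ - o′) → (Z j d × Z j (a′ - xw)) ⊎ (Z j (d - w′) × Z j (a′ - o′))
            from (inj₁ z) = inj₁ (zero-d j z , z)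
            from (inj₂ z) = inj₂ (unit-cancel-Z {j} {u j} (pu j) (by ((uj ∣- z) ∣- c j) (lem xw o′ (u j) w′ a′ d)) , z)
          Wi : W i d
          Wi = from I-alt
            where
            from : (Z i d × Z i (a′ - xw)) ⊎ (Z i (d - e′) × Z i (a′ - o)) → W i d
            from (inj₁ (z , _)) = Z⇒W {i} z
            from (inj₂ (z , _)) = ∣-transport d e′ (Z⇒W {i} z) We
          Wj : W j d
          Wj = from J-alt
            where
            from : (Z j d × Z j (a′ - xw)) ⊎ (Z j (d - w′) × Z j (a′ - o′)) → W j d
            from (inj₁ (z , _)) = Z⇒W {j} z
            from (inj₂ (z , _)) = ∣-transport d w′ (Z⇒W {j} z) Ww
          ck : Z k ((xw - a′) - d)
          ck = by (c k) (cong (λ t → (xw - a′) - t) (trans (cong (_* d) uk) (ℤ.*-identityˡ d)))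
          step : GridStep w′ d ⊎ UnitStep e′ w′ d
          step = decide (W? k d)
            where
            lem : ∀ x a u d → ((x - a) - u * d) + u * d ≡ x - a
            lem = solve 4 (λ x a u d → ((x :- a) :- u :* d) :+ u :* d := x :- a) refl
            grid : W k d → Eq d ⊎ (Z i d × ¬ Z j d × ¬ Z k d) → GridStep w′ d
            grid Wk (inj₁ e) = ⊥-elim (xw∉ (respA xw a′ (λ ν → by (c ν ∣+ (u ν ∣* e ν)) (lem xw a′ (u ν) d)) pa′))
            grid Wk (inj₂ (zi , nzj , nzk)) = from J-alt
              where
              from : (Z j d × Z j (a′ - xw)) ⊎ (Z j (d - w′) × Z j (a′ - o′)) → GridStep w′ d
              from (inj₁ (z , _)) = ⊥-elim (nzj z)
              from (inj₂ (z , _)) = zi , z , Wk , nzk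
            alt₁ : (Z i d × Z i (a′ - xw)) ⊎ (Z i (d - e′) × Z i (a′ - o)) → Z i d ⊎ Z i (d - e′)
            alt₁ (inj₁ (z , _)) = inj₁ z
            alt₁ (inj₂ (z , _)) = inj₂ z
            alt₂ : (Z j d × Z j (a′ - xw)) ⊎ (Z j (d - w′) × Z j (a′ - o′)) → Z j d ⊎ Z j (d - w′)
            alt₂ (inj₁ (z , _)) = inj₁ z
            alt₂ (inj₂ (z , _)) = inj₂ z
            -- Let δ be another such difference. At k, both a′ - o and a′ - o′ are units, as δ is.
            -- The j-fibre through `o` contains a point matching δ at j, so by `sands` a′ - o is not
            -- associated with δ at i; this fixes the pattern at i and makes a′ - o′ associated with
            -- δ there. Then a′ - o′ cannot be associated with δ at j, which fixes the pattern at j.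
            governs : ¬ W k d → Governs d
            governs ¬Wk {b₁} {b₂} p₁ p₂ wi wj ¬wk = same-i , same-j
              where
              δ = b₁ - b₂
              tr : ∀ a l o → (a - l) + (l - o) ≡ a - o
              tr = solve 3 (λ a l o → (a :- l) :+ (l :- o) := a :- o) refl
              tr′ : ∀ a o o′ → (a - o) - (o′ - o) ≡ a - o′
              tr′ = solve 3 (λ a o o′ → (a :- o) :- (o′ :- o) := a :- o′) refl
              tr″ : ∀ a o o′ → (a - o) - (a - o′) ≡ o′ - o
              tr″ = solve 3 (λ a o o′ → (a :- o) :- (a :- o′) := o′ :- o) refl
              lem₁ : ∀ x o a d → ((x - o) - (a - o)) - ((x - a) - d) ≡ d
              lem₁ = solve 4 (λ x o a d → ((x :- o) :- (a :- o)) :- ((x :- a) :- d) := d) refl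
              lem₂ : ∀ a x o′ o → ((a - x) + (x - o′)) + (o′ - o) ≡ a - o
              lem₂ = solve 4 (λ a x o′ o → ((a :- x) :+ (x :- o′)) :+ (o′ :- o) := a :- o) refl
              lem₃ : ∀ a o δ → (a - o) - δ ≡ (a - δ) - o
              lem₃ = solve 3 (λ a o δ → (a :- o) :- δ := (a :- δ) :- o) refl
              lem₄ : ∀ a l δ → - (l - (a - δ)) ≡ (a - l) - δ
              lem₄ = solve 3 (λ a l δ → :- (l :- (a :- δ)) := (a :- l) :- δ) refl
              lem₅ : ∀ a l o → - (l - o) ≡ (a - l) - (a - o)
              lem₅ = solve 3 (λ a l o → :- (l :- o) := (a :- l) :- (a :- o)) refl
              lem₆ : ∀ d e → d - (d - e) ≡ e
              lem₆ = solve 2 (λ d e → d :- (d :- e) := e) refl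
              ¬Wk-a′o′ : ¬ W k (a′ - o′)
              ¬Wk-a′o′ w = ¬Wk (by ((Z⇒W {k} xw-k ∣- w) ∣- Z⇒W {k} ck) (lem₁ xw o′ a′ d))
              ¬Wk-a′o : ¬ W k (a′ - o)
              ¬Wk-a′o w = ¬Wk-a′o′ (by (w ∣- Z⇒W {k} oo-k) (tr′ a′ o o′))
              Wj-a′o : W j (a′ - o)
              Wj-a′o = from J-alt
                where
                from : (Z j d × Z j (a′ - xw)) ⊎ (Z j (d - w′) × Z j (a′ - o′)) → W j (a′ - o)
                from (inj₁ (_ , z)) = by ((Z⇒W {j} z ∣+ xw-j) ∣+ Z⇒W {j} oo-j) (lem₂ a′ xw o′ o)
                from (inj₂ (_ , z)) = by (Z⇒W {j} z ∣+ Z⇒W {j} oo-j) (tr a′ o′ o)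
              kill-i : Sim i (a′ - o) δ → ⊥
              kill-i s = from (point-j (a′ - δ) (by (Wj-a′o ∣- wj) (lem₃ a′ o δ)))
                where
                from : ∃[ l ] (𝒜 l × Z i (l - o) × Z j (l - (a′ - δ)) × Z k (l - o)) → ⊥
                from (l , pl , li , lj , lk) = ¬Wk-a′o (by (Z⇒W {k} (sands pa′ pl p₁ p₂ sims′ k) ∣+ Z⇒W {k} lk) (tr a′ l o))
                  where
                  sims′ : ∀ ν → Sim ν (a′ - l) δ
                  sims′ i = sim-trans (sim-≡ i (a′ - l) (a′ - o) (by (∣-neg li) (lem₅ a′ l o))) s
                  sims′ j = sim-≡ j (a′ - l) δ (by (∣-neg lj) (lem₄ a′ l δ))
                  sims′ k = sim-N k (λ w → ¬Wk-a′o (by (w ∣+ Z⇒W {k} lk) (tr a′ l o))) ¬wk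
              kill-j : Sim i (a′ - o′) δ → Sim j (a′ - o′) δ → ⊥
              kill-j si′ sj′ = ¬Wk-a′o′ (Z⇒W {k} (sands pa′ o′∈ p₁ p₂ (λ { i → si′ ; j → sj′ ; k → sim-N k ¬Wk-a′o′ ¬wk }) k))
              i-case : (Z i d × Z i δ × Z i (a′ - o′)) ⊎ (¬ Z i d × ¬ Z i δ × Z i (a′ - o))
              i-case = from I-alt (Z? i δ)
                where
                from : (Z i d × Z i (a′ - xw)) ⊎ (Z i (d - e′) × Z i (a′ - o)) → Dec (Z i δ) → (Z i d × Z i δ × Z i (a′ - o′)) ⊎ (¬ Z i d × ¬ Z i δ × Z i (a′ - o))
                from (inj₁ (z , z′)) (yes zδ) = inj₁ (z , zδ , ∣-trans a′ xw o′ z′ xw-i)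
                from (inj₁ (z , z′)) (no ¬zδ) = ⊥-elim (kill-i (sim-T
                  (by (Z⇒W {i} (∣-trans a′ xw o′ z′ xw-i) ∣+ oo-W) (tr a′ o′ o))
                  (λ y → oo-¬Z (by (y ∣- ∣-trans a′ xw o′ z′ xw-i) (tr″ a′ o o′))) wi ¬zδ))
                from (inj₂ (z , z′)) (yes zδ) = ⊥-elim (kill-i (sim-Z z′ zδ))
                from (inj₂ (z , z′)) (no ¬zδ) = inj₂ ((λ y → ¬Ze (by (y ∣- z) (lem₆ d e′))) , ¬zδ , z′)
              si′ : Sim i (a′ - o′) δ
              si′ = from i-case
                where
                from : (Z i d × Z i δ × Z i (a′ - o′)) ⊎ (¬ Z i d × ¬ Z i δ × Z i (a′ - o)) → Sim i (a′ - o′) δ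
                from (inj₁ (_ , zδ , z)) = sim-Z z zδ
                from (inj₂ (_ , ¬zδ , z)) = sim-T (by (Z⇒W {i} z ∣- oo-W) (tr′ a′ o o′)) (λ y → oo-¬Z (by (z ∣- y) (tr″ a′ o o′))) wi ¬zδ
              same-i : SameZ i δ d
              same-i = from i-case
                where
                from : (Z i d × Z i δ × Z i (a′ - o′)) ⊎ (¬ Z i d × ¬ Z i δ × Z i (a′ - o)) → SameZ i δ d
                from (inj₁ (z , zδ , _)) = (λ _ → z) , (λ _ → zδ)
                from (inj₂ (¬z , ¬zδ , _)) = (λ y → ⊥-elim (¬zδ y)) , (λ y → ⊥-elim (¬z y))
              same-j : SameZ j δ d
              same-j = from J-alt (Z? j δ)
                where
                from : (Z j d × Z j (a′ - xw)) ⊎ (Z j (d - w′) × Z j (a′ - o′)) → Dec (Z j δ) → SameZ j δ d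
                from (inj₁ (z , _))  (yes zδ) = (λ _ → z) , (λ _ → zδ)
                from (inj₁ (z , z′)) (no ¬zδ) = ⊥-elim (kill-j si′ (sim-T (by (Z⇒W {j} z′ ∣+ xw-j) (tr a′ xw o′))
                  (λ y → wd-¬Z (by (y ∣- z′) (tr″ a′ o′ xw))) wj ¬zδ))
                from (inj₂ (z , z′)) (yes zδ) = ⊥-elim (kill-j si′ (sim-Z z′ zδ))
                from (inj₂ (z , z′)) (no ¬zδ) = (λ y → ⊥-elim (¬zδ y)) , (λ y → ⊥-elim (¬Zw (by (y ∣- z) (lem₆ d w′))))
            unit-step : ¬ W k d → UnitStep e′ w′ d
            unit-step ¬Wk = ¬Wk , alt₁ I-alt , alt₂ J-alt , governs ¬Wk
            decide : Dec (W k d) → GridStep w′ d ⊎ UnitStep e′ w′ d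
            decide (yes Wk) = inj₁ (grid Wk (grid-difference pb pb′ Wi Wj Wk))
            decide (no ¬Wk) = inj₂ (unit-step ¬Wk)

      scaled : Sim i (o′ - o) e′ → Sim j (xw - o′) w′ → ∃[ b′ ] (ℬ b′ × (GridStep w′ (b′ - b) ⊎ UnitStep e′ w′ (b′ - b)))
      scaled (sim ui pi ei) (sim uj pj ej) = Scaled.go u pu ei ej refl (cover xw pb u pu)
        where
        u : Dir → ℤ
        u i = ui
        u j = uj
        u k = + 1
        pu : ∀ ν → UnitAt ν (u ν)
        pu i = pi
        pu j = pj
        pu k = π∤1 k

  search : ∀ {n} {P Q : Fin n → Set} → (∀ a → P a ⊎ Q a) → (∀ a → P a) ⊎ ∃ Q
  search {zero}  h = inj₁ λ ()
  search {suc n} {P} {Q} h = go (h zero) (search (λ a → h (suc a)))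
    where
    go : P zero ⊎ Q zero → (∀ a → P (suc a)) ⊎ ∃ (λ a → Q (suc a)) → (∀ a → P a) ⊎ ∃ Q
    go (inj₂ q) _              = inj₂ (zero , q)
    go (inj₁ p) (inj₂ (a , q)) = inj₂ (suc a , q)
    go (inj₁ p) (inj₁ ps)      = inj₁ λ { zero → p ; (suc a) → ps a }

  -- Every nonempty class is the bijective image of `Fin m` under τ, so `n` is a sum of terms equal
  -- to 0 or `m`.
  class-size-∣ : ∀ {n m c} (cls : Fin n → Fin c) (τ : Fin m → Fin n → Fin n) →
    (∀ l a → cls (τ l a) ≡ cls a) → (∀ a b → cls a ≡ cls b → ∃[ l ] τ l a ≡ b) →
    (∀ {l l′ a} → τ l a ≡ τ l′ a → l ≡ l′) → m ℕ.∣ n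
  class-size-∣ {n} {m} {c} cls τ same onto inj = subst (m ℕ.∣_) total (sum-∣ (λ y → sumℕ (χ y)) fibre)
    where
    χ : Fin c → Fin n → ℕ
    χ y a = if does (cls a Fin.≟ y) then 1 else 0
    χ-yes : ∀ {y a} → cls a ≡ y → χ y a ≡ 1
    χ-yes {y} {a} e = cong (if_then 1 else 0) (dec-true (cls a Fin.≟ y) e)
    χ-no : ∀ {y a} → cls a ≢ y → χ y a ≡ 0
    χ-no {y} {a} e = cong (if_then 1 else 0) (dec-false (cls a Fin.≟ y) e)
    hit : Fin n → Fin n → ℕ
    hit a b = if does (a Fin.≟ b) then 1 else 0
    hit-yes : ∀ {a b} → a ≡ b → hit a b ≡ 1
    hit-yes {a} {b} e = cong (if_then 1 else 0) (dec-true (a Fin.≟ b) e)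
    hit-no : ∀ {a b} → a ≢ b → hit a b ≡ 0
    hit-no {a} {b} e = cong (if_then 1 else 0) (dec-false (a Fin.≟ b) e)
    sum-∣ : ∀ {c} (f : Fin c → ℕ) → (∀ y → m ℕ.∣ f y) → m ℕ.∣ sumℕ f
    sum-∣ {zero}  f h = m ℕ.∣0
    sum-∣ {suc c} f h = ℕ.∣m∣n⇒∣m+n (h zero) (sum-∣ (λ y → f (suc y)) (λ y → h (suc y)))
    ones : ∀ s → sumℕ {s} (λ _ → 1) ≡ s
    ones zero    = refl
    ones (suc s) = cong suc (ones s)
    total : sumℕ (λ y → sumℕ (χ y)) ≡ n
    total = trans (sumℕ-comm χ) (trans (sumℕ-cong (λ a → trans (sumℕ-pick (cls a) (λ y → χ y a) (λ y y≢ → χ-no {y} {a} (λ e → y≢ (sym e)))) (χ-yes refl))) (ones n))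
    fibre′ : ∀ a₀ → sumℕ (χ (cls a₀)) ≡ m
    fibre′ a₀ = trans (sumℕ-cong pointwise) (trans (sumℕ-comm (λ a l → hit (τ l a₀) a))
      (trans (sumℕ-cong (λ l → trans (sumℕ-pick (τ l a₀) (hit (τ l a₀)) (λ b b≢ → hit-no (λ e → b≢ (sym e)))) (hit-yes {τ l a₀} refl))) (ones m)))
      where
      pointwise : ∀ a → χ (cls a₀) a ≡ sumℕ (λ l → hit (τ l a₀) a)
      pointwise a = go (cls a Fin.≟ cls a₀)
        where
        go : Dec (cls a ≡ cls a₀) → χ (cls a₀) a ≡ sumℕ (λ l → hit (τ l a₀) a)
        go (no ne) = trans (χ-no ne) (sym (sumℕ-zero _ (λ l → hit-no (λ e → ne (trans (cong cls (sym e)) (same l a₀))))))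
        go (yes e) = let (l , eq) = onto a₀ a (sym e) in
          trans (χ-yes e) (sym (trans (sumℕ-pick l (λ l → hit (τ l a₀) a) (λ l′ l′≢ → hit-no (λ e′ → l′≢ (inj (trans e′ (sym eq)))))) (hit-yes eq)))
    fibre : ∀ y → m ℕ.∣ sumℕ (χ y)
    fibre y = go (Fin.any? (λ a → cls a Fin.≟ y))
      where
      go : Dec (∃ λ a → cls a ≡ y) → m ℕ.∣ sumℕ (χ y)
      go (yes (a , refl)) = subst (m ℕ.∣_) (sym (fibre′ a)) ℕ.∣-refl
      go (no ne) = subst (m ℕ.∣_) (sym (sumℕ-zero _ (λ a → χ-no (λ e → ne (a , e))))) (m ℕ.∣0)

  module Multiples (F : Frame) where
    open FrameProperties F

    -- Representatives of the subgroup of order `π ν` in ℤ_{Π ν}.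
    mult : ∀ ν → Fin (π ν) → ℤ
    mult ν a = + Π′ ν * + toℕ a

    mult-W : ∀ ν a → W ν (mult ν a)
    mult-W ν a = divides (+ toℕ a) (ℤ.*-comm (+ Π′ ν) (+ toℕ a))

    Π≡ : ∀ ν → + Π ν ≡ + Π′ ν * + π ν
    Π≡ ν = trans (ℤ.pos-* (π ν) (Π′ ν)) (ℤ.*-comm (+ π ν) (+ Π′ ν))

    Π′nz : ∀ ν → NonZero (Π′ ν)
    Π′nz ν = subst NonZero (sym (pow ν)) (ℕ.m^n≢0 (π ν) (ex ν) ⦃ πnz ν ⦄)

    mult-distinct : ∀ ν {a b} → a ≢ b → ¬ Z ν (mult ν a - mult ν b)
    mult-distinct ν {a} {b} a≢b (divides t eq) = a≢b (Fin.toℕ-injective (ordered (ℕ.≤-total (toℕ a) (toℕ b))))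
      where
      P′ = + Π′ ν
      reduced : + toℕ a - + toℕ b ≡ t * + π ν
      reduced = ℤ.*-cancelˡ-≡ P′ _ _ ⦃ ℤ.≢-nonZero (λ e → ℕ.≢-nonZero⁻¹ (Π′ ν) ⦃ Π′nz ν ⦄ (ℤ.+-injective e)) ⦄ (trans (lem P′ (+ toℕ a) (+ toℕ b)) (trans eq (trans (cong (t *_) (Π≡ ν)) (lem′ t P′ (+ π ν)))))
        where
        lem : ∀ p a b → p * (a - b) ≡ p * a - p * b
        lem = solve 3 (λ p a b → p :* (a :- b) := p :* a :- p :* b) refl
        lem′ : ∀ t p q → t * (p * q) ≡ p * (t * q)
        lem′ = solve 3 (λ t p q → t :* (p :* q) := p :* (t :* q)) refl
      small : ∀ m n (t : ℤ) → m ≤ n → n < π ν → + π ν ∣ (+ n - + m) → n ≡ m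
      small m n t m≤n n<π d = ℕ.≤-antisym (ℕ.m∸n≡0⇒m≤n (zero-∸ (n ℕ.∸ m) (ℕ.≤-<-trans (ℕ.m∸n≤m n m) n<π)
        (∣⇒ℕ∣ (subst (+ π ν ∣_) (trans (ℤ.m-n≡m⊖n n m) (ℤ.⊖-≥ m≤n)) d)))) m≤n
        where
        zero-∸ : ∀ s → s < π ν → π ν ℕ.∣ s → s ≡ 0
        zero-∸ zero    _  _ = refl
        zero-∸ (suc s) lt d = ⊥-elim (ℕ.<⇒≱ lt (ℕ.∣⇒≤ d))
      ordered : toℕ a ≤ toℕ b ⊎ toℕ b ≤ toℕ a → toℕ a ≡ toℕ b
      ordered (inj₂ b≤a) = small (toℕ b) (toℕ a) t b≤a (Fin.toℕ<n a) (divides t reduced)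
      ordered (inj₁ a≤b) = sym (small (toℕ a) (toℕ b) t a≤b (Fin.toℕ<n b) (∣-sym (+ toℕ a) (+ toℕ b) (divides t reduced)))

    mult-surjective : ∀ ν d → W ν d → ∃[ a ] Z ν (d - mult ν a)
    mult-surjective ν d (divides t refl) = fromℕ< (ℤ.n%ℕd<d t (π ν)) , divides (t ℤ./ℕ π ν) (begin
      t * P′ - P′ * + toℕ (fromℕ< (ℤ.n%ℕd<d t (π ν))) ≡⟨ cong (λ n → t * P′ - P′ * + n) (Fin.toℕ-fromℕ< (ℤ.n%ℕd<d t (π ν))) ⟩
      t * P′ - P′ * + (t ℤ.%ℕ π ν)                    ≡⟨ cong (λ s → s * P′ - P′ * + (t ℤ.%ℕ π ν)) (ℤ.a≡a%ℕn+[a/ℕn]*n t (π ν)) ⟩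
      (+ (t ℤ.%ℕ π ν) + (t ℤ./ℕ π ν) * + π ν) * P′ - P′ * + (t ℤ.%ℕ π ν) ≡⟨ lem (+ (t ℤ.%ℕ π ν)) (t ℤ./ℕ π ν) (+ π ν) P′ ⟩
      (t ℤ./ℕ π ν) * (P′ * + π ν)                     ≡⟨ cong ((t ℤ./ℕ π ν) *_) (Π≡ ν) ⟨
      (t ℤ./ℕ π ν) * + Π ν                            ∎)
      where
      open ≡-Reasoning
      instance _ = πnz ν
      P′ = + Π′ ν
      lem : ∀ s q p P → (s + q * p) * P - P * s ≡ q * (P * p)
      lem = solve 4 (λ s q p P → (s :+ q :* p) :* P :- P :* s := q :* (P :* p)) refl

    0F : ∀ ν → Fin (π ν)
    0F ν = fromℕ< (ℕ.>-nonZero⁻¹ (π ν) ⦃ πnz ν ⦄)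

    1F : ∀ ν → Fin (π ν)
    1F ν = fromℕ< (ℕ.nonTrivial⇒n>1 (π ν) ⦃ prime⇒nonTrivial (prime ν) ⦄)

    1F≢0F : ∀ ν → 1F ν ≢ 0F ν
    1F≢0F ν e = ℕ.1+n≢0 (trans (sym (Fin.toℕ-fromℕ< (ℕ.nonTrivial⇒n>1 (π ν) ⦃ prime⇒nonTrivial (prime ν) ⦄)))
      (trans (cong toℕ e) (Fin.toℕ-fromℕ< (ℕ.>-nonZero⁻¹ (π ν) ⦃ πnz ν ⦄))))

    mult-0F : ∀ ν → mult ν (0F ν) ≡ + 0
    mult-0F ν = trans (cong (λ n → + Π′ ν * + n) (Fin.toℕ-fromℕ< (ℕ.>-nonZero⁻¹ (π ν) ⦃ πnz ν ⦄))) (ℤ.*-zeroʳ (+ Π′ ν))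

    mult-¬Z : ∀ ν {a} → a ≢ 0F ν → ¬ Z ν (mult ν a)
    mult-¬Z ν {a} a≢0 z = mult-distinct ν a≢0 (by z (trans (sym (ℤ.+-identityʳ (mult ν a))) (cong (λ t → mult ν a - t) (sym (mult-0F ν)))))

  private
    add-diff : ∀ x y z → (x - z) - (y - z) ≡ x - y
    add-diff = solve 3 (λ x y z → (x :- z) :- (y :- z) := x :- y) refl

    shift-diff : ∀ x y z m n → ((x - z) - m) - ((y - z) - n) ≡ (x - y) - (m - n)
    shift-diff = solve 5 (λ x y z m n → ((x :- z) :- m) :- ((y :- z) :- n) := (x :- y) :- (m :- n)) refl

    minus-minus : ∀ d e → d - (d - e) ≡ e
    minus-minus = solve 2 (λ d e → d :- (d :- e) := e) refl

  -- Size comparisons between the primes, and the case without diagonals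

  module Structure {F : Frame} {𝒜 ℬ : ℤ → Set} (C : Corner F 𝒜 ℬ) where
    open FrameProperties F
    open Multiples F
    open CornerProperties C

    common : ∀ {m} x y z → m ∣ x - z → m ∣ y - z → m ∣ x - y
    common x y z p q = by (p ∣- q) (add-diff x y z)

    offsets-distinct : ∀ ν {x y z a b} → a ≢ b → Z ν ((x - z) - mult ν a) → Z ν ((y - z) - mult ν b) → ¬ Z ν (x - y)
    offsets-distinct ν {x} {y} {z} {a} {b} a≢b p q e = mult-distinct ν a≢b
      (by (e ∣- (p ∣- q)) (trans (cong (λ t → (x - y) - t) (shift-diff x y z (mult ν a) (mult ν b))) (minus-minus (x - y) (mult ν a - mult ν b))))

    offset-W : ∀ ν {d a} → Z ν (d - mult ν a) → W ν d
    offset-W ν {d} {a} p = ∣-transport d (mult ν a) (Z⇒W {ν} p) (mult-W ν a)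

    b₀ : ∃[ b ] ℬ b
    b₀ = let (_ , b , _ , pb , _) = exist (+ 1) π∤1 (+ 0) in b , pb

    step-i : ∀ {e′ d} → W i e′ → Z i d ⊎ Z i (d - e′) → W i d
    step-i We (inj₁ z) = Z⇒W {i} z
    step-i {e′} {d} We (inj₂ z) = ∣-transport d e′ (Z⇒W {i} z) We

    step-j : ∀ {w′ d} → W j w′ → Z j d ⊎ Z j (d - w′) → W j d
    step-j Ww (inj₁ z) = Z⇒W {j} z
    step-j {w′} {d} Ww (inj₂ z) = ∣-transport d w′ (Z⇒W {j} z) Ww

    governed : ∀ {d b₁ b₂} → Governs d → ℬ b₁ → ℬ b₂ → W i (b₁ - b₂) → W j (b₁ - b₂) → ¬ W k (b₁ - b₂) →
      SameZ i (b₁ - b₂) d × SameZ j (b₁ - b₂) d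
    governed g = g

    crowd : ∀ c → ∃[ n ] ∃[ c′ ] (π k ≤ n × Crowd F ℬ (λ d → W i d × W j d) n c′)
    crowd c = from (crowd-k c)
      where
      from : Crowd F ℬ (λ d → W i d × W j d) (π k) c ⊎ ∃[ c′ ] Crowd F ℬ (λ d → W i d × W j d) (suc (π k)) c′ → _
      from (inj₁ K) = π k , c , ℕ.≤-refl , K
      from (inj₂ (c′ , K)) = suc (π k) , c′ , ℕ.n≤1+n _ , K

    module CrowdProperties {n c} (K : Crowd F ℬ (λ d → W i d × W j d) n c) where
      open Crowd K public
      Wi : ∀ a b → W i (member a - member b)
      Wi a b = common (member a) (member b) c (proj₁ (near a)) (proj₁ (near b))
      Wj : ∀ a b → W j (member a - member b)
      Wj a b = common (member a) (member b) c (proj₂ (near a)) (proj₂ (near b))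

    -- If p_j < p_k, a crowd of p_k elements congruent modulo `Π′ i` and `Π′ j` has two that agree
    -- at j. Such a pair is not governed, because `d` is nonzero at j, and it is not a diagonal
    -- either.
    governs-j-bound : ∀ {d} → Governs d → ¬ Z j d → π k ≤ π j
    governs-j-bound {d} g nz = ℕ.≮⇒≥ λ lt → go lt (crowd (+ 0))
      where
      go : π j < π k → ∃[ n ] ∃[ c′ ] (π k ≤ n × Crowd F ℬ (λ d → W i d × W j d) n c′) → ⊥
      go lt (n , c , le , K) = finish (coincide j (ℕ.<-≤-trans lt le) member Wj)
        where
        open CrowdProperties K
        finish : ∃[ a ] ∃[ b ] (a ≢ b × Z j (member a - member b)) → ⊥
        finish (a , b , a≢b , z) = test (W? k (member a - member b))
          where
          test : Dec (W k (member a - member b)) → ⊥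
          test (no ¬w) = nz (proj₁ (proj₂ (governed g (isMember a) (isMember b) (Wi a b) (Wj a b) ¬w)) z)
          test (yes w) = grid (grid-difference (isMember b) (isMember a) (Wi a b) (Wj a b) w)
            where
            grid : Eq (member a - member b) ⊎ (Z i (member a - member b) × ¬ Z j (member a - member b) × ¬ Z k (member a - member b)) → ⊥
            grid (inj₁ e) = distinct a≢b e
            grid (inj₂ (_ , nzj , _)) = nzj z

    -- Elements of `B` are then pairwise incongruent modulo D(M).
    NoDiagonal : Set
    NoDiagonal = ∀ {b b′} → ℬ b → ℬ b′ → W i (b′ - b) → W j (b′ - b) → W k (b′ - b) → Eq (b′ - b)

    module NoDiagonals (nd : NoDiagonal) where

      governs-i-bound : ∀ {d} → Governs d → ¬ Z i d → π k ≤ π i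
      governs-i-bound {d} g nz = ℕ.≮⇒≥ λ lt → go lt (crowd (+ 0))
        where
        go : π i < π k → ∃[ n ] ∃[ c′ ] (π k ≤ n × Crowd F ℬ (λ d → W i d × W j d) n c′) → ⊥
        go lt (n , c , le , K) = finish (coincide i (ℕ.<-≤-trans lt le) member Wi)
          where
          open CrowdProperties K
          finish : ∃[ a ] ∃[ b ] (a ≢ b × Z i (member a - member b)) → ⊥
          finish (a , b , a≢b , z) = test (W? k (member a - member b))
            where
            test : Dec (W k (member a - member b)) → ⊥
            test (no ¬w) = nz (proj₁ (proj₁ (governed g (isMember a) (isMember b) (Wi a b) (Wj a b) ¬w)) z)
            test (yes w) = distinct a≢b (nd (isMember b) (isMember a) (Wi a b) (Wj a b) w)

      unit-step : ∀ {b e′ w′} → ℬ b → W i e′ → ¬ Z i e′ → W j w′ → ¬ Z j w′ → ∃[ b′ ] (ℬ b′ × UnitStep e′ w′ (b′ - b))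
      unit-step {b} {e′} {w′} pb We ¬Ze Ww ¬Zw = from (neighbour pb We ¬Ze Ww ¬Zw)
        where
        from : ∃[ b′ ] (ℬ b′ × (GridStep w′ (b′ - b) ⊎ UnitStep e′ w′ (b′ - b))) → ∃[ b′ ] (ℬ b′ × UnitStep e′ w′ (b′ - b))
        from (b′ , pb′ , inj₂ s) = b′ , pb′ , s
        from (b′ , pb′ , inj₁ (zi , zj , wk , nzk)) = ⊥-elim (nzk (nd pb pb′ (Z⇒W {i} zi) (step-j Ww (inj₂ zj)) wk k))

      module Governed {d : ℤ} (g : Governs d) where

        -- With fewer than `π ν` classes modulo `Π′ k` available, two members of the family would
        -- share one, hence coincide by `nd`, although their components at ν differ.
        family-bound : ∀ ν → (f : Fin (π ν) → ℤ) → (∀ a → ℬ (f a)) → ∀ b → (∀ a → W i (f a - b)) → (∀ a → W j (f a - b)) →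
          (∀ a → Z ν ((f a - b) - mult ν a)) → π ν ≤ π k
        family-bound ν f pf b wi wj off = ℕ.≮⇒≥ λ lt → go (coincideW k lt f)
          where
          go : ∃[ a ] ∃[ c ] (a ≢ c × W k (f a - f c)) → ⊥
          go (a , c , a≢c , w) = offsets-distinct ν {f a} {f c} {b} a≢c (off a) (off c)
            (nd (pf c) (pf a) (common (f a) (f c) b (wi a) (wi c)) (common (f a) (f c) b (wj a) (wj c)) w ν)

        step-type : ∀ {e′ w′ b b′} → ℬ b → ℬ b′ → W i e′ → W j w′ → UnitStep e′ w′ (b′ - b) → SameZ i (b′ - b) d × SameZ j (b′ - b) d
        step-type pb pb′ We Ww (¬wk , si , sj , _) = governed g pb′ pb (step-i We si) (step-j Ww sj) ¬wk

        module _ (b : ℤ) (pb : ℬ b) where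
          Choice : (ν : Dir) → Fin (π ν) → Set
          Choice ν a = ∃[ x ] (ℬ x × W i (x - b) × W j (x - b) × Z ν ((x - b) - mult ν a))

          self : ∀ ν {a} → a ≡ 0F ν → Choice ν a
          self ν refl = b , pb , ∣-self b , ∣-self b , by ∣-zero (sym (trans (cong (λ t → (b - b) - t) (mult-0F ν)) (trans (ℤ.+-identityʳ (b - b)) (ℤ.+-inverseʳ b))))

          -- A unit step leaves the j-component alone or moves it as prescribed. When the governing
          -- difference is nonzero at j, the first option is gone, so every offset is attained.
          choose-j : ¬ Z j d → ∀ a → Choice j a
          choose-j nz a = from (a Fin.≟ 0F j)
            where
            from : Dec (a ≡ 0F j) → Choice j a
            from (yes e) = self j e
            from (no ne) = use (unit-step pb (mult-W i (1F i)) (mult-¬Z i (1F≢0F i)) (mult-W j a) (mult-¬Z j ne))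
              where
              use : ∃[ x ] (ℬ x × UnitStep (mult i (1F i)) (mult j a) (x - b)) → Choice j a
              use (x , px , s@(_ , si , sj , _)) = x , px , step-i (mult-W i (1F i)) si , step-j (mult-W j a) sj , moved sj
                where
                moved : Z j (x - b) ⊎ Z j ((x - b) - mult j a) → Z j ((x - b) - mult j a)
                moved (inj₁ z) = ⊥-elim (nz (proj₁ (proj₂ (step-type pb px (mult-W i (1F i)) (mult-W j a) s)) z))
                moved (inj₂ z) = z

          choose-i : ¬ Z i d → ∀ a → Choice i a
          choose-i nz a = from (a Fin.≟ 0F i)
            where
            from : Dec (a ≡ 0F i) → Choice i a
            from (yes e) = self i e
            from (no ne) = use (unit-step pb (mult-W i a) (mult-¬Z i ne) (mult-W j (1F j)) (mult-¬Z j (1F≢0F j)))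
              where
              use : ∃[ x ] (ℬ x × UnitStep (mult i a) (mult j (1F j)) (x - b)) → Choice i a
              use (x , px , s@(_ , si , sj , _)) = x , px , step-i (mult-W i a) si , step-j (mult-W j (1F j)) sj , moved si
                where
                moved : Z i (x - b) ⊎ Z i ((x - b) - mult i a) → Z i ((x - b) - mult i a)
                moved (inj₁ z) = ⊥-elim (nz (proj₁ (proj₁ (step-type pb px (mult-W i a) (mult-W j (1F j)) s)) z))
                moved (inj₂ z) = z

          bound : ∀ ν → (∀ a → Choice ν a) → π ν ≤ π k
          bound ν ch = family-bound ν (λ a → proj₁ (ch a)) (λ a → proj₁ (proj₂ (ch a))) b
            (λ a → proj₁ (proj₂ (proj₂ (ch a)))) (λ a → proj₁ (proj₂ (proj₂ (proj₂ (ch a))))) (λ a → proj₂ (proj₂ (proj₂ (proj₂ (ch a)))))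

        -- Otherwise p_j ≤ p_k by the family of all offsets and p_k ≤ p_j by the crowd, for distinct
        -- primes.
        no-j : ¬ ¬ Z j d
        no-j nz = j≢k (ℕ.≤-antisym (bound (proj₁ b₀) (proj₂ b₀) j (choose-j (proj₁ b₀) (proj₂ b₀) nz)) (governs-j-bound g nz))

        no-i : ¬ ¬ Z i d
        no-i nz = i≢k (ℕ.≤-antisym (bound (proj₁ b₀) (proj₂ b₀) i (choose-i (proj₁ b₀) (proj₂ b₀) nz)) (governs-i-bound g nz))

      governor : ∃[ d ] Governs d
      governor = from (unit-step (proj₂ b₀) (mult-W i (1F i)) (mult-¬Z i (1F≢0F i)) (mult-W j (1F j)) (mult-¬Z j (1F≢0F j)))
        where
        from : ∃[ x ] (ℬ x × UnitStep (mult i (1F i)) (mult j (1F j)) (x - proj₁ b₀)) → ∃[ d ] Governs d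
        from (x , _ , _ , _ , _ , g) = _ , g

      -- A difference in W k is zero by `nd`. Any other has the zero pattern of a governing
      -- difference, which by `no-i` and `no-j` is zero in both directions.
      straight : ∀ {b₁ b₂} → ℬ b₁ → ℬ b₂ → W i (b₁ - b₂) → W j (b₁ - b₂) → Z i (b₁ - b₂) × Z j (b₁ - b₂)
      straight {b₁} {b₂} p₁ p₂ wi wj = go (W? k (b₁ - b₂)) governor
        where
        go : Dec (W k (b₁ - b₂)) → ∃[ d ] Governs d → Z i (b₁ - b₂) × Z j (b₁ - b₂)
        go (yes w) _ = let e = nd p₂ p₁ wi wj w in e i , e j
        go (no ¬w) (d , g) = stable i (λ nz → no-i (λ z → nz (proj₂ (proj₁ same) z))) , stable j (λ nz → no-j (λ z → nz (proj₂ (proj₂ same) z)))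
          where
          open Governed g
          same = governed g p₁ p₂ wi wj ¬w
          stable : ∀ ν → ¬ ¬ Z ν (b₁ - b₂) → Z ν (b₁ - b₂)
          stable ν nn = from (Z? ν (b₁ - b₂))
            where
            from : Dec (Z ν (b₁ - b₂)) → Z ν (b₁ - b₂)
            from (yes z) = z
            from (no nz) = ⊥-elim (nn nz)

  -- Excluding the diagonals

  module NoUnitSteps {F : Frame} {𝒜 ℬ : ℤ → Set} (C : Corner F 𝒜 ℬ) where
    open FrameProperties F
    open Multiples F
    open CornerProperties C
    open Structure C

    -- Here p_j is the smaller prime and a diagonal pair is assumed. Its presence rules out unit
    -- steps everywhere in `B`, so that all neighbours come from grid steps.
    module _ (q<r : π j < π k) {β₁ β₂ : ℤ} (p₁ : ℬ β₁) (p₂ : ℬ β₂) (Wi₁₂ : W i (β₁ - β₂)) (Wj₁₂ : W j (β₁ - β₂)) (Wk₁₂ : W k (β₁ - β₂)) (¬Zj₁₂ : ¬ Z j (β₁ - β₂)) where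

      module Step {b b′ e′ w′ : ℤ} (pb : ℬ b) (pb′ : ℬ b′) (We : W i e′) (Ww : W j w′) (¬Zw : ¬ Z j w′) (s : UnitStep e′ w′ (b′ - b)) where
        d = b′ - b
        ¬Wk : ¬ W k d
        ¬Wk = proj₁ s
        Wi-d : W i d
        Wi-d = step-i We (proj₁ (proj₂ s))
        Wj-d : W j d
        Wj-d = step-j Ww (proj₁ (proj₂ (proj₂ s)))
        g : Governs d
        g = proj₂ (proj₂ (proj₂ s))

        Zj-d : Z j d
        Zj-d = decidable-stable (Z? j d) λ nz → ℕ.<⇒≱ q<r (governs-j-bound g nz)

        -- Diagonals are nonzero at j, whereas governed differences are zero at j by `Zj-d`. So
        -- distinct elements in one class modulo `Π′ i` and `Π′ j` differ either at j or modulo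
        -- `Π′ k`, and never in both ways.
        close : ∀ {x y} → ℬ x → ℬ y → W i (x - y) → W j (x - y) → (Z j (x - y) → Eq (x - y) ⊎ ¬ W k (x - y)) × (¬ Z j (x - y) → W k (x - y))
        close {x} {y} px py wi wj = first , second
          where
          grid : Z j (x - y) → Eq (x - y) ⊎ (Z i (x - y) × ¬ Z j (x - y) × ¬ Z k (x - y)) → Eq (x - y)
          grid z (inj₁ e) = e
          grid z (inj₂ (_ , nz , _)) = ⊥-elim (nz z)
          first : Z j (x - y) → Eq (x - y) ⊎ ¬ W k (x - y)
          first z = from (W? k (x - y))
            where
            from : Dec (W k (x - y)) → Eq (x - y) ⊎ ¬ W k (x - y)
            from (yes w) = inj₁ (grid z (grid-difference py px wi wj w))
            from (no w) = inj₂ w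
          second : ¬ Z j (x - y) → W k (x - y)
          second nz = decidable-stable (W? k (x - y)) λ ¬w → nz (proj₂ (proj₂ (governed g px py wi wj ¬w)) Zj-d)

        -- At least one of x₁, x₂ differs at j from x₃, and hence from x₄. By `close` it is
        -- congruent modulo `Π′ k` to both of these, which are not congruent to each other.
        mixed : ∀ {x₁ x₂ x₃ x₄ c} → ℬ x₁ → ℬ x₂ → ℬ x₃ → ℬ x₄ →
          (∀ {x} → x ≡ x₁ ⊎ x ≡ x₂ ⊎ x ≡ x₃ ⊎ x ≡ x₄ → W i (x - c) × W j (x - c)) →
          ¬ Z j (x₁ - x₂) → Z j (x₃ - x₄) → ¬ Eq (x₃ - x₄) → ⊥
        mixed {x₁} {x₂} {x₃} {x₄} {c} px₁ px₂ px₃ px₄ near nz z ne = pick (Z? j (x₁ - x₃))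
          where
          n₁ = near (inj₁ refl)
          n₂ = near (inj₂ (inj₁ refl))
          n₃ = near (inj₂ (inj₂ (inj₁ refl)))
          n₄ = near (inj₂ (inj₂ (inj₂ refl)))
          wi : ∀ x y → W i (x - c) × W j (x - c) → W i (y - c) × W j (y - c) → W i (x - y)
          wi x y p q = common x y c (proj₁ p) (proj₁ q)
          wj : ∀ x y → W i (x - c) × W j (x - c) → W i (y - c) × W j (y - c) → W j (x - y)
          wj x y p q = common x y c (proj₂ p) (proj₂ q)
          ¬W₃₄ : ¬ W k (x₃ - x₄)
          ¬W₃₄ = from (proj₁ (close px₃ px₄ (wi x₃ x₄ n₃ n₄) (wj x₃ x₄ n₃ n₄)) z)
            where
            from : Eq (x₃ - x₄) ⊎ ¬ W k (x₃ - x₄) → ¬ W k (x₃ - x₄)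
            from (inj₁ e) = ⊥-elim (ne e)
            from (inj₂ w) = w
          far : ∀ {x} → ℬ x → W i (x - c) × W j (x - c) → ¬ Z j (x - x₃) → ⊥
          far {x} px n nz₃ = ¬W₃₄ (∣-trans x₃ x x₄ (∣-sym x x₃ (proj₂ (close px px₃ (wi x x₃ n n₃) (wj x x₃ n n₃)) nz₃))
            (proj₂ (close px px₄ (wi x x₄ n n₄) (wj x x₄ n n₄)) λ z₄ → nz₃ (∣-trans x x₄ x₃ z₄ (∣-sym x₃ x₄ z))))
          pick : Dec (Z j (x₁ - x₃)) → ⊥
          pick (no nz₁) = far px₁ n₁ nz₁
          pick (yes z₁) = far px₂ n₂ λ z₂ → nz (∣-trans x₁ x₃ x₂ z₁ (∣-sym x₂ x₃ z₂))

        both : Z i d → ⊥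
        both _ = from (crowd-k β₁)
          where
          from : Crowd F ℬ (λ d → W i d × W j d) (π k) β₁ ⊎ ∃[ c′ ] Crowd F ℬ (λ d → W i d × W j d) (suc (π k)) c′ → ⊥
          -- The class of β₁ has p_k > p_j elements, so two of them agree at j, while β₁ and β₂
          -- differ there.
          from (inj₁ K) = finish (coincide j q<r member Wj)
            where
            open CrowdProperties K
            finish : ∃[ a ] ∃[ b ] (a ≢ b × Z j (member a - member b)) → ⊥
            finish (a , b , a≢b , z) = mixed {c = β₁} p₁ p₂ (isMember a) (isMember b)
              (λ { (inj₁ refl) → ∣-self β₁ , ∣-self β₁ ; (inj₂ (inj₁ refl)) → ∣-sym β₁ β₂ Wi₁₂ , ∣-sym β₁ β₂ Wj₁₂
                 ; (inj₂ (inj₂ (inj₁ refl))) → near a ; (inj₂ (inj₂ (inj₂ refl))) → near b }) ¬Zj₁₂ z (distinct a≢b)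
          -- Another class has p_k + 1 elements. Two of them agree at j, and two agree modulo
          -- `Π′ k`, which is p_k; the latter must differ at j.
          from (inj₂ (c , K)) = finish (coincide j (ℕ.<-trans q<r (ℕ.n<1+n _)) member Wj) (coincideW k (ℕ.n<1+n _) member)
            where
            open CrowdProperties K
            finish : ∃[ a ] ∃[ b ] (a ≢ b × Z j (member a - member b)) → ∃[ a ] ∃[ b ] (a ≢ b × W k (member a - member b)) → ⊥
            finish (a , b , a≢b , z) (a′ , b′ , a≢b′ , w) = mixed {c = c} (isMember a′) (isMember b′) (isMember a) (isMember b)
              (λ { (inj₁ refl) → near a′ ; (inj₂ (inj₁ refl)) → near b′ ; (inj₂ (inj₂ (inj₁ refl))) → near a ; (inj₂ (inj₂ (inj₂ refl))) → near b })
              nz z (distinct a≢b)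
              where
              nz : ¬ Z j (member a′ - member b′)
              nz z′ = split (proj₁ (close (isMember a′) (isMember b′) (Wi a′ b′) (Wj a′ b′)) z′)
                where
                split : Eq (member a′ - member b′) ⊎ ¬ W k (member a′ - member b′) → ⊥
                split (inj₁ e) = distinct a≢b′ e
                split (inj₂ ¬w) = ¬w w

        module _ (¬Zi-d : ¬ Z i d) where
          Choice : Fin (π i) → Set
          Choice a = ∃[ x ] (ℬ x × W i (x - b) × W j (x - b) × Z i ((x - b) - mult i a))

          choose : ∀ a → Choice a
          choose a = from (a Fin.≟ 0F i)
            where
            from : Dec (a ≡ 0F i) → Choice a
            from (yes refl) = b , pb , ∣-self b , ∣-self b , by ∣-zero (sym (trans (cong (λ t → (b - b) - t) (mult-0F i)) (trans (ℤ.+-identityʳ (b - b)) (ℤ.+-inverseʳ b))))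
            from (no ne) = use (neighbour pb (mult-W i a) (mult-¬Z i ne) Ww ¬Zw)
              where
              use : ∃[ x ] (ℬ x × (GridStep w′ (x - b) ⊎ UnitStep (mult i a) w′ (x - b))) → Choice a
              use (x , px , inj₂ (¬wk , si , sj , _)) = x , px , step-i (mult-W i a) si , step-j Ww sj , moved si
                where
                moved : Z i (x - b) ⊎ Z i ((x - b) - mult i a) → Z i ((x - b) - mult i a)
                moved (inj₁ z) = ⊥-elim (¬Zi-d (proj₁ (proj₁ (governed g px pb (step-i (mult-W i a) si) (step-j Ww sj) ¬wk)) z))
                moved (inj₂ z) = z
              -- A grid step to x cannot occur: x - b′ is governed and thus zero at j like d, so x -
              -- b would be zero at j instead of w′.
              use (x , px , inj₁ (zi , zj , wk , _)) = ⊥-elim (¬Zw (by (x-b ∣- zj) (minus-minus (x - b) w′)))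
                where
                same : SameZ j (x - b′) d
                same = proj₂ (governed g px pb′ (common x b′ b (Z⇒W {i} zi) Wi-d) (common x b′ b (step-j Ww (inj₂ zj)) Wj-d)
                  (λ w → ¬Wk (by (wk ∣- w) (lem x b b′))))
                  where
                  lem : ∀ x b b′ → (x - b) - (x - b′) ≡ b′ - b
                  lem = solve 3 (λ x b b′ → (x :- b) :- (x :- b′) := b′ :- b) refl
                x-b : Z j (x - b)
                x-b = ∣-trans x b′ b (proj₂ same Zj-d) Zj-d

          f : Fin (π i) → ℤ
          f a = proj₁ (choose a)

          -- The elements `f a` have distinct components at i, whereas diagonals are zero there. So
          -- no two of them are congruent modulo `Π′ k`, and there are at most p_k.
          π-i<π-k : π i < π k
          π-i<π-k = ℕ.≤∧≢⇒< (ℕ.≮⇒≥ λ lt → go (coincideW k lt f)) i≢k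
            where
            go : ∃[ a ] ∃[ c ] (a ≢ c × W k (f a - f c)) → ⊥
            go (a , c , a≢c , w) = offsets-distinct i {f a} {f c} {b} a≢c (off a) (off c) (grid (grid-difference (pf c) (pf a) wi wj w))
              where
              pf : ∀ a → ℬ (f a)
              pf a = proj₁ (proj₂ (choose a))
              off : ∀ a → Z i ((f a - b) - mult i a)
              off a = proj₂ (proj₂ (proj₂ (proj₂ (choose a))))
              wi : W i (f a - f c)
              wi = common (f a) (f c) b (proj₁ (proj₂ (proj₂ (choose a)))) (proj₁ (proj₂ (proj₂ (choose c))))
              wj : W j (f a - f c)
              wj = common (f a) (f c) b (proj₁ (proj₂ (proj₂ (proj₂ (choose a))))) (proj₁ (proj₂ (proj₂ (proj₂ (choose c)))))
              grid : Eq (f a - f c) ⊎ (Z i (f a - f c) × ¬ Z j (f a - f c) × ¬ Z k (f a - f c)) → Z i (f a - f c)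
              grid (inj₁ e) = e i
              grid (inj₂ (z , _)) = z

          contradiction : ⊥
          contradiction = go (crowd (+ 0))
            where
            go : ∃[ n ] ∃[ c′ ] (π k ≤ n × Crowd F ℬ (λ d → W i d × W j d) n c′) → ⊥
            go (n , c , le , K) = finish (coincide j (ℕ.<-≤-trans q<r le) member Wj) (coincide i (ℕ.<-≤-trans π-i<π-k le) member Wi)
              where
              open CrowdProperties K
              finish : ∃[ a ] ∃[ b ] (a ≢ b × Z j (member a - member b)) → ∃[ a ] ∃[ b ] (a ≢ b × Z i (member a - member b)) → ⊥
              finish (a , b , a≢b , z) (a′ , b′ , a≢b′ , z′) = mixed {c = c} (isMember a′) (isMember b′) (isMember a) (isMember b)
                (λ { (inj₁ refl) → near a′ ; (inj₂ (inj₁ refl)) → near b′ ; (inj₂ (inj₂ (inj₁ refl))) → near a ; (inj₂ (inj₂ (inj₂ refl))) → near b })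
                nz z (distinct a≢b)
                where
                nz : ¬ Z j (member a′ - member b′)
                nz zj = split (proj₁ (close (isMember a′) (isMember b′) (Wi a′ b′) (Wj a′ b′)) zj)
                  where
                  split : Eq (member a′ - member b′) ⊎ ¬ W k (member a′ - member b′) → ⊥
                  split (inj₁ e) = distinct a≢b′ e
                  split (inj₂ ¬w) = ¬Zi-d (proj₁ (proj₁ (governed g (isMember a′) (isMember b′) (Wi a′ b′) (Wj a′ b′) ¬w)) z′)

        impossible : ⊥
        impossible = from (Z? i d)
          where
          from : Dec (Z i d) → ⊥
          from (yes z) = both z
          from (no nz) = contradiction nz

      always-grid : ∀ {b w′} → ℬ b → W j w′ → ¬ Z j w′ → ∃[ b′ ] (ℬ b′ × GridStep w′ (b′ - b))
      always-grid {b} {w′} pb Ww ¬Zw = from (neighbour pb (mult-W i (1F i)) (mult-¬Z i (1F≢0F i)) Ww ¬Zw)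
        where
        from : ∃[ b′ ] (ℬ b′ × (GridStep w′ (b′ - b) ⊎ UnitStep (mult i (1F i)) w′ (b′ - b))) → ∃[ b′ ] (ℬ b′ × GridStep w′ (b′ - b))
        from (b′ , pb′ , inj₁ s) = b′ , pb′ , s
        from (b′ , pb′ , inj₂ s) = ⊥-elim (Step.impossible pb pb′ (mult-W i (1F i)) Ww ¬Zw s)

  module GridSteps {F : Frame} {𝒜 ℬ : ℤ → Set} (C : Corner F 𝒜 ℬ) where
    open FrameProperties F
    open Multiples F
    open CornerProperties C
    open Structure C

    -- This continues `NoUnitSteps` with j and k exchanged: p_k is now the smaller prime, and `step`
    -- starts a diagonal with any prescribed nonzero k-component at every element of `B`.
    module _ (q<r : π k < π j)
      (step : ∀ {b w} → ℬ b → W k w → ¬ Z k w → ∃[ b′ ] (ℬ b′ × Z i (b′ - b) × Z k ((b′ - b) - w) × W j (b′ - b) × ¬ Z j (b′ - b))) where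

      b : ℤ
      b = proj₁ b₀
      pb : ℬ b
      pb = proj₂ b₀

      -- If grid steps reached all p_j offsets at j, two of the points reached would agree at k
      -- while differing at j, which no diagonal does.
      some-unit-step : ∃[ a ] ∃[ x ] (a ≢ 0F j × ℬ x × UnitStep (mult i (1F i)) (mult j a) (x - b))
      some-unit-step = from (search choice)
        where
        Grid : Fin (π j) → Set
        Grid a = ∃[ x ] (ℬ x × Z i (x - b) × Z j ((x - b) - mult j a) × W k (x - b))
        Unit : Fin (π j) → Set
        Unit a = ∃[ x ] (a ≢ 0F j × ℬ x × UnitStep (mult i (1F i)) (mult j a) (x - b))
        choice : ∀ a → Grid a ⊎ Unit a
        choice a = decide (a Fin.≟ 0F j)
          where
          decide : Dec (a ≡ 0F j) → Grid a ⊎ Unit a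
          decide (yes refl) = inj₁ (b , pb , ∣-self b , by ∣-zero (sym (trans (cong (λ t → (b - b) - t) (mult-0F j)) (trans (ℤ.+-identityʳ (b - b)) (ℤ.+-inverseʳ b)))) , ∣-self b)
          decide (no ne) = use (neighbour pb (mult-W i (1F i)) (mult-¬Z i (1F≢0F i)) (mult-W j a) (mult-¬Z j ne))
            where
            use : ∃[ x ] (ℬ x × (GridStep (mult j a) (x - b) ⊎ UnitStep (mult i (1F i)) (mult j a) (x - b))) → Grid a ⊎ Unit a
            use (x , px , inj₁ (zi , zj , wk , _)) = inj₁ (x , px , zi , zj , wk)
            use (x , px , inj₂ s) = inj₂ (x , ne , px , s)
        from : (∀ a → Grid a) ⊎ ∃ Unit → _
        from (inj₂ u) = u
        from (inj₁ gs) = ⊥-elim (go (coincide k q<r f wk))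
          where
          f : Fin (π j) → ℤ
          f a = proj₁ (gs a)
          wi : ∀ a c → W i (f a - f c)
          wi a c = common (f a) (f c) b (Z⇒W {i} (proj₁ (proj₂ (proj₂ (gs a))))) (Z⇒W {i} (proj₁ (proj₂ (proj₂ (gs c)))))
          wj : ∀ a c → W j (f a - f c)
          wj a c = common (f a) (f c) b (offset-W j {a = a} (proj₁ (proj₂ (proj₂ (proj₂ (gs a)))))) (offset-W j {a = c} (proj₁ (proj₂ (proj₂ (proj₂ (gs c))))))
          wk : ∀ a c → W k (f a - f c)
          wk a c = common (f a) (f c) b (proj₂ (proj₂ (proj₂ (proj₂ (gs a))))) (proj₂ (proj₂ (proj₂ (proj₂ (gs c)))))
          go : ∃[ a ] ∃[ c ] (a ≢ c × Z k (f a - f c)) → ⊥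
          go (a , c , a≢c , z) = grid (grid-difference (proj₁ (proj₂ (gs c))) (proj₁ (proj₂ (gs a))) (wi a c) (wj a c) (wk a c))
            where
            grid : Eq (f a - f c) ⊎ (Z i (f a - f c) × ¬ Z j (f a - f c) × ¬ Z k (f a - f c)) → ⊥
            grid (inj₁ e) = offsets-distinct j {f a} {f c} {b} a≢c (proj₁ (proj₂ (proj₂ (proj₂ (gs a))))) (proj₁ (proj₂ (proj₂ (proj₂ (gs c))))) (e j)
            grid (inj₂ (_ , _ , nz)) = nz z

      module Contradiction {a₀ : Fin (π j)} {x₀ : ℤ} (a₀≢0 : a₀ ≢ 0F j) (px₀ : ℬ x₀) (s : UnitStep (mult i (1F i)) (mult j a₀) (x₀ - b)) where
        d = x₀ - b
        ¬Wk = proj₁ s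
        Wi-d : W i d
        Wi-d = step-i (mult-W i (1F i)) (proj₁ (proj₂ s))
        Wj-d : W j d
        Wj-d = step-j (mult-W j a₀) (proj₁ (proj₂ (proj₂ s)))
        g : Governs d
        g = proj₂ (proj₂ (proj₂ s))

        -- Move `b` along a diagonal to y. The difference x₀ - y is again governed by d, so if d
        -- were zero at j, then x₀ - b, x₀ - y and finally the diagonal y - b would be zero at j.
        ¬Zj-d : ¬ Z j d
        ¬Zj-d z = from (step pb (mult-W k (1F k)) (mult-¬Z k (1F≢0F k)))
          where
          from : ∃[ y ] (ℬ y × Z i (y - b) × Z k ((y - b) - mult k (1F k)) × W j (y - b) × ¬ Z j (y - b)) → ⊥
          from (y , py , zi , zk , wj , nzj) = nzj (by (z ∣- proj₂ same z) (lem x₀ b y))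
            where
            lem : ∀ x b y → (x - b) - (x - y) ≡ y - b
            lem = solve 3 (λ x b y → (x :- b) :- (x :- y) := y :- b) refl
            lem′ : ∀ x b y → (x - y) + (y - b) ≡ x - b
            lem′ = solve 3 (λ x b y → (x :- y) :+ (y :- b) := x :- b) refl
            same : SameZ j (x₀ - y) d
            same = proj₂ (governed g px₀ py (common x₀ y b Wi-d (Z⇒W {i} zi)) (common x₀ y b Wj-d wj)
              λ w → ¬Wk (by (w ∣+ offset-W k {a = 1F k} zk) (lem′ x₀ b y)))

        -- Differences in W k are zero or diagonals, the others are governed by d; both diagonals
        -- and governed differences are nonzero at j.
        determined : ∀ {x y} → ℬ x → ℬ y → W i (x - y) → Z j (x - y) → Eq (x - y)
        determined {x} {y} px py wi z = from (W? k (x - y))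
          where
          grid : Eq (x - y) ⊎ (Z i (x - y) × ¬ Z j (x - y) × ¬ Z k (x - y)) → Eq (x - y)
          grid (inj₁ e) = e
          grid (inj₂ (_ , nz , _)) = ⊥-elim (nz z)
          from : Dec (W k (x - y)) → Eq (x - y)
          from (yes w) = grid (grid-difference py px wi (Z⇒W {j} z) w)
          from (no ¬w) = ⊥-elim (¬Zj-d (proj₁ (proj₂ (governed g px py wi (Z⇒W {j} z) ¬w)) z))

        Choice : Fin (π j) → Set
        Choice a = ∃[ x ] (ℬ x × W i (x - b) × Z j ((x - b) - mult j a))

        choose : ∀ a → Choice a
        choose a = from (a Fin.≟ 0F j)
          where
          from : Dec (a ≡ 0F j) → Choice a
          from (yes refl) = b , pb , ∣-self b , by ∣-zero (sym (trans (cong (λ t → (b - b) - t) (mult-0F j)) (trans (ℤ.+-identityʳ (b - b)) (ℤ.+-inverseʳ b))))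
          from (no ne) = use (neighbour pb (mult-W i (1F i)) (mult-¬Z i (1F≢0F i)) (mult-W j a) (mult-¬Z j ne))
            where
            use : ∃[ x ] (ℬ x × (GridStep (mult j a) (x - b) ⊎ UnitStep (mult i (1F i)) (mult j a) (x - b))) → Choice a
            use (x , px , inj₁ (zi , zj , _)) = x , px , Z⇒W {i} zi , zj
            use (x , px , inj₂ (¬wk , si , sj , _)) = x , px , step-i (mult-W i (1F i)) si , moved sj
              where
              moved : Z j (x - b) ⊎ Z j ((x - b) - mult j a) → Z j ((x - b) - mult j a)
              moved (inj₁ z) = ⊥-elim (¬Zj-d (proj₁ (proj₂ (governed g px pb (step-i (mult-W i (1F i)) si) (step-j (mult-W j a) sj) ¬wk)) z))
              moved (inj₂ z) = z

        -- The members of `B` congruent to `b` modulo `Π′ i` and `Π′ j`, indexed by their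
        -- j-components; `index` shows that the list is complete.
        f : Fin (π j) → ℤ
        f a = proj₁ (choose a)
        pf : ∀ a → ℬ (f a)
        pf a = proj₁ (proj₂ (choose a))
        off : ∀ a → Z j ((f a - b) - mult j a)
        off a = proj₂ (proj₂ (proj₂ (choose a)))
        wi : ∀ a c → W i (f a - f c)
        wi a c = common (f a) (f c) b (proj₁ (proj₂ (proj₂ (choose a)))) (proj₁ (proj₂ (proj₂ (choose c))))
        wj : ∀ a c → W j (f a - f c)
        wj a c = common (f a) (f c) b (offset-W j {a = a} (off a)) (offset-W j {a = c} (off c))

        index : ∀ {y} → ℬ y → W i (y - b) → W j (y - b) → ∃[ a ] Eq (f a - y)
        index {y} py wi′ wj′ = from (mult-surjective j (y - b) wj′)
          where
          from : ∃[ a ] Z j ((y - b) - mult j a) → ∃[ a ] Eq (f a - y)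
          from (a , z) = a , determined (pf a) py (common (f a) y b (proj₁ (proj₂ (proj₂ (choose a)))) wi′)
            (by (off a ∣- z) (trans (add-diff (f a - b) (y - b) (mult j a)) (add-diff (f a) y b)))

        shift : ∀ l a → ∃[ c ] (W k (f c - f a) × Z k ((f c - f a) - mult k l))
        shift l a = from (l Fin.≟ 0F k)
          where
          from : Dec (l ≡ 0F k) → ∃[ c ] (W k (f c - f a) × Z k ((f c - f a) - mult k l))
          from (yes refl) = a , ∣-self (f a) , by ∣-zero (sym (trans (cong (λ t → (f a - f a) - t) (mult-0F k)) (trans (ℤ.+-identityʳ (f a - f a)) (ℤ.+-inverseʳ (f a)))))
          from (no ne) = use (step (pf a) (mult-W k l) (mult-¬Z k ne))
            where
            use : ∃[ y ] (ℬ y × Z i (y - f a) × Z k ((y - f a) - mult k l) × W j (y - f a) × ¬ Z j (y - f a)) → ∃[ c ] (W k (f c - f a) × Z k ((f c - f a) - mult k l))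
            use (y , py , zi , zk , wj′ , _) = move (index py (∣-trans y (f a) b (Z⇒W {i} zi) (proj₁ (proj₂ (proj₂ (choose a))))) (∣-trans y (f a) b wj′ (offset-W j {a = a} (off a))))
              where
              move : ∃[ c ] Eq (f c - y) → ∃[ c ] (W k (f c - f a) × Z k ((f c - f a) - mult k l))
              move (c , e) = c , offset-W k {a = l} zk′ , zk′
                where
                lem : ∀ c y a m → (c - y) + ((y - a) - m) ≡ (c - a) - m
                lem = solve 4 (λ c y a m → (c :- y) :+ ((y :- a) :- m) := (c :- a) :- m) refl
                zk′ : Z k ((f c - f a) - mult k l)
                zk′ = by (e k ∣+ zk) (lem (f c) y (f a) (mult k l))

        -- Because `Π k` is the square of `Π′ k`, multiplication by `Π′ k` turns residues modulo
        -- `Π′ k` into elements of the subgroup that `mult` already indexes. This yields the class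
        -- function `cls`.
        scale-W : ∀ x → W k x → Z k (+ Π′ k * x)
        scale-W x (divides t refl) = divides t (trans (cong (λ n → + Π′ k * (t * + n)) flatk) (trans (lem (+ Π′ k) t (+ π k)) (cong (t *_) (sym (Π≡ k)))))
          where
          lem : ∀ P t p → P * (t * p) ≡ t * (P * p)
          lem = solve 3 (λ P t p → P :* (t :* p) := t :* (P :* p)) refl

        unscale-W : ∀ x → Z k (+ Π′ k * x) → W k x
        unscale-W x (divides t e) = divides t (ℤ.*-cancelˡ-≡ (+ Π′ k) x (t * + Π′ k) ⦃ ℤ.≢-nonZero (λ e → ℕ.≢-nonZero⁻¹ (Π′ k) ⦃ Π′nz k ⦄ (ℤ.+-injective e)) ⦄
          (trans e (trans (cong (t *_) (Π≡ k)) (trans (lem (+ Π′ k) t (+ π k)) (cong (λ n → + Π′ k * (t * + n)) (sym flatk))))))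
          where
          lem : ∀ P t p → t * (P * p) ≡ P * (t * p)
          lem = solve 3 (λ P t p → t :* (P :* p) := P :* (t :* p)) refl

        classify : ∀ x → ∃[ a ] Z k (+ Π′ k * x - mult k a)
        classify x = mult-surjective k (+ Π′ k * x) (divides x (ℤ.*-comm (+ Π′ k) x))

        cls : Fin (π j) → Fin (π k)
        cls a = proj₁ (classify (f a))

        distr : ∀ P x y → P * x - P * y ≡ P * (x - y)
        distr = solve 3 (λ P x y → P :* x :- P :* y := P :* (x :- y)) refl

        cls-≡ : ∀ a c → W k (f a - f c) → cls a ≡ cls c
        cls-≡ a c w = decidable-stable (cls a Fin.≟ cls c) λ ne → mult-distinct k ne
          (by ((by (scale-W (f a - f c) w) (sym (distr (+ Π′ k) (f a) (f c))) ∣- proj₂ (classify (f a))) ∣+ proj₂ (classify (f c)))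
            (lem (+ Π′ k * f a) (+ Π′ k * f c) (mult k (cls a)) (mult k (cls c))))
          where
          lem : ∀ x y m n → ((x - y) - (x - m)) + (y - n) ≡ m - n
          lem = solve 4 (λ x y m n → ((x :- y) :- (x :- m)) :+ (y :- n) := m :- n) refl

        ≡-cls : ∀ a c → cls a ≡ cls c → W k (f a - f c)
        ≡-cls a c e = unscale-W (f a - f c) (by (proj₂ (classify (f a)) ∣- subst (λ m → Z k (+ Π′ k * f c - mult k m)) (sym e) (proj₂ (classify (f c))))
          (trans (add-diff (+ Π′ k * f a) (+ Π′ k * f c) (mult k (cls a))) (distr (+ Π′ k) (f a) (f c))))

        f-injective : ∀ {a c} → Z j (f a - f c) → a ≡ c
        f-injective {a} {c} z = decidable-stable (a Fin.≟ c) λ ne → offsets-distinct j {f a} {f c} {b} ne (off a) (off c) z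

        -- Among the p_j elements `f a`, each class modulo `Π′ k` has exactly p_k members, one for
        -- each k-component: `shift` produces them, and two with equal k-components coincide, since
        -- diagonals are nonzero at k.
        divisibility : π k ℕ.∣ π j
        divisibility = class-size-∣ cls (λ l a → proj₁ (shift l a)) (λ l a → cls-≡ (proj₁ (shift l a)) a (proj₁ (proj₂ (shift l a)))) onto inj
          where
          onto : ∀ a c → cls a ≡ cls c → ∃[ l ] proj₁ (shift l a) ≡ c
          onto a c e = from (mult-surjective k (f c - f a) wca)
            where
            wca : W k (f c - f a)
            wca = ∣-sym (f a) (f c) (≡-cls a c e)
            from : ∃[ l ] Z k ((f c - f a) - mult k l) → ∃[ l ] proj₁ (shift l a) ≡ c
            from (l , z) = l , f-injective (grid (grid-difference (pf c) (pf t) (wi t c) (wj t c) (Z⇒W {k} zk)))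
              where
              t = proj₁ (shift l a)
              zk : Z k (f t - f c)
              zk = by (proj₂ (proj₂ (shift l a)) ∣- z) (trans (add-diff (f t - f a) (f c - f a) (mult k l)) (add-diff (f t) (f c) (f a)))
              grid : Eq (f t - f c) ⊎ (Z i (f t - f c) × ¬ Z j (f t - f c) × ¬ Z k (f t - f c)) → Z j (f t - f c)
              grid (inj₁ eq) = eq j
              grid (inj₂ (_ , _ , nz)) = ⊥-elim (nz zk)
          inj : ∀ {l l′ a} → proj₁ (shift l a) ≡ proj₁ (shift l′ a) → l ≡ l′
          inj {l} {l′} {a} e = decidable-stable (l Fin.≟ l′) λ ne → mult-distinct k ne
            (by (subst (λ t → Z k ((f t - f a) - mult k l′)) (sym e) (proj₂ (proj₂ (shift l′ a))) ∣- proj₂ (proj₂ (shift l a)))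
              (lem (f (proj₁ (shift l a)) - f a) (mult k l) (mult k l′)))
            where
            lem : ∀ x m n → (x - n) - (x - m) ≡ m - n
            lem = solve 3 (λ x m n → (x :- n) :- (x :- m) := m :- n) refl

        impossible : ⊥
        impossible = from (prime⇒irreducible (prime j) divisibility)
          where
          from : π k ≡ 1 ⊎ π k ≡ π j → ⊥
          from (inj₁ e) = ℕ.<-irrefl (sym e) (ℕ.nonTrivial⇒n>1 (π k) ⦃ prime⇒nonTrivial (prime k) ⦄)
          from (inj₂ e) = ℕ.<-irrefl e q<r

      impossible : ⊥
      impossible = from some-unit-step
        where
        from : ∃[ a ] ∃[ x ] (a ≢ 0F j × ℬ x × UnitStep (mult i (1F i)) (mult j a) (x - b)) → ⊥
        from (a , x , ne , px , s) = Contradiction.impossible ne px s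

  -- A single diagonal pair forces all neighbours to be grid steps; read with j and k exchanged,
  -- this is the hypothesis `step` of `GridSteps`, which is contradictory.
  no-diagonal-< : ∀ {F 𝒜 ℬ} (C : Corner F 𝒜 ℬ) → Frame.π F j < Frame.π F k → Structure.NoDiagonal C
  no-diagonal-< {F} {𝒜} {ℬ} C q<r {b} {b′} pb pb′ wi wj wk = from (grid-difference pb pb′ wi wj wk)
    where
    open FrameProperties F
    open CornerProperties C
    from : Eq (b′ - b) ⊎ (Z i (b′ - b) × ¬ Z j (b′ - b) × ¬ Z k (b′ - b)) → Eq (b′ - b)
    from (inj₁ e) = e
    from (inj₂ (_ , nzj , _)) = ⊥-elim (GridSteps.impossible (swapCorner C) q<r
      (λ p w nz → NoUnitSteps.always-grid C q<r pb′ pb wi wj wk nzj p w nz))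

  no-diagonal : ∀ {F 𝒜 ℬ} (C : Corner F 𝒜 ℬ) → Structure.NoDiagonal C
  no-diagonal {F} C with ℕ.<-cmp (Frame.π F j) (Frame.π F k)
  ... | tri< lt _ _ = no-diagonal-< C lt
  ... | tri≈ _ e _ = ⊥-elim (Frame.j≢k F e)
  ... | tri> _ _ gt = λ pb pb′ wi wj wk → let e = no-diagonal-< (swapCorner C) gt pb pb′ wi wk wj in λ { i → e i ; j → e k ; k → e j }

  -- Rigid complements and the slices of A

  triple : ℤ → ℤ → ℤ → Dir → ℤ
  triple x y z i = x
  triple x y z j = y
  triple x y z k = z

  -- All that is kept from the corner about `B`: it represents every class modulo D(M) exactly once,
  -- and elements congruent modulo D(M) / p_j differ in direction j only, likewise for k.
  record Rigid (F : Frame) (ℬ : ℤ → Set) : Set where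
    open FrameProperties F
    field
      thin     : ∀ {b b′} → ℬ b → ℬ b′ → W i (b - b′) → W j (b - b′) → W k (b - b′) → Eq (b - b′)
      along-j  : ∀ {b b′} → ℬ b → ℬ b′ → W i (b - b′) → W k (b - b′) → Z i (b - b′) × Z k (b - b′)
      along-k  : ∀ {b b′} → ℬ b → ℬ b′ → W i (b - b′) → W j (b - b′) → Z i (b - b′) × Z j (b - b′)
      complete : (x : Dir → ℤ) → ∃[ b ] (ℬ b × (∀ ν → W ν (b - x ν)))

  swapRigid : ∀ {F ℬ} → Rigid F ℬ → Rigid (swap F) ℬ
  swapRigid R = record
    { thin = λ p p′ wi wj wk → let e = thin p p′ wi wk wj in λ { i → e i ; j → e k ; k → e j }
    ; along-j = along-k ; along-k = along-j
    ; complete = λ x → let (b , pb , w) = complete (λ ν → x (swapDir ν)) in b , pb , λ { i → w i ; j → w k ; k → w j } }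
    where open Rigid R

  corner-rigid : ∀ {F 𝒜 ℬ} (C : Corner F 𝒜 ℬ) →
    (let open FrameProperties F in ∀ c → Crowd F ℬ (λ d → W i d × W j d × W k d) 1 c ⊎ ∃[ c′ ] Crowd F ℬ (λ d → W i d × W j d × W k d) 2 c′) →
    Rigid F ℬ
  corner-rigid {F} {𝒜} {ℬ} C crowds = record
    { thin = λ p p′ wi wj wk → no-diagonal C p′ p wi wj wk
    ; along-k = λ p p′ wi wj → Structure.NoDiagonals.straight C (no-diagonal C) p p′ wi wj
    ; along-j = λ p p′ wi wk → Structure.NoDiagonals.straight (swapCorner C) (no-diagonal (swapCorner C)) p p′ wi wk
    ; complete = λ x → complete x (crt x) }
    where
    open FrameProperties F
    complete : (x : Dir → ℤ) → ∃[ c ] (∀ ν → Z ν (c - x ν)) → ∃[ b ] (ℬ b × (∀ ν → W ν (b - x ν)))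
    complete x (c , e) = from (crowds c)
      where
      from : Crowd F ℬ (λ d → W i d × W j d × W k d) 1 c ⊎ ∃[ c′ ] Crowd F ℬ (λ d → W i d × W j d × W k d) 2 c′ → ∃[ b ] (ℬ b × (∀ ν → W ν (b - x ν)))
      from (inj₁ K) = member zero , isMember zero , λ ν → ∣-trans (member zero) c (x ν) (at ν) (Z⇒W {ν} (e ν))
        where
        open Crowd K
        at : ∀ ν → W ν (member zero - c)
        at i = proj₁ (near zero)
        at j = proj₁ (proj₂ (near zero))
        at k = proj₂ (proj₂ (near zero))
      -- Two elements of `B` in one class modulo D(M) contradict the absence of diagonals.
      from (inj₂ (c′ , K)) = ⊥-elim (distinct {zero} {suc zero} (λ ()) (no-diagonal C (isMember (suc zero)) (isMember zero)
        (close (proj₁ (near zero)) (proj₁ (near (suc zero)))) (close (proj₁ (proj₂ (near zero))) (proj₁ (proj₂ (near (suc zero)))))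
        (close (proj₂ (proj₂ (near zero))) (proj₂ (proj₂ (near (suc zero)))))))
        where
        open Crowd K
        close : ∀ {m} → m ∣ member zero - c′ → m ∣ member (suc zero) - c′ → m ∣ member zero - member (suc zero)
        close p q = Structure.common C (member zero) (member (suc zero)) c′ p q

  module RigidTiling {F : Frame} {𝒜 ℬ : ℤ → Set} (T : Tiling F 𝒜 ℬ) (R : Rigid F ℬ) where
    open FrameProperties F
    open TilingProperties T
    open Rigid R

    member₀ : ∃[ b ] ℬ b
    member₀ = let (b , pb , _) = complete (λ _ → + 0) in b , pb

    -- The element of `B` congruent to b′ at i and j and to b at k joins the two: it lies along j
    -- from b and along k from b′, and neither move changes the i-component.
    slice : ∀ {b b′} → ℬ b → ℬ b′ → W i (b - b′) → Z i (b - b′)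
    slice {b} {b′} p p′ wi = from (complete (triple b′ b′ b))
      where
      from : ∃[ β ] (ℬ β × (∀ ν → W ν (β - triple b′ b′ b ν))) → Z i (b - b′)
      from (β , pβ , w) = ∣-trans b β b′
        (proj₁ (along-j p pβ (∣-trans b b′ β wi (∣-sym β b′ (w i))) (∣-sym β b (w k))))
        (proj₁ (along-k pβ p′ (w i) (w j)))

    move : ∀ {b} → ℬ b → ∀ n m → ∃[ β ] (ℬ β × Z i (β - b) × W j ((β - b) - n) × W k ((β - b) - m))
    move {b} p n m = from (complete (triple b (b + n) (b + m)))
      where
      lem : ∀ β b n → β - (b + n) ≡ (β - b) - n
      lem = solve 3 (λ β b n → β :- (b :+ n) := (β :- b) :- n) refl
      from : ∃[ β ] (ℬ β × (∀ ν → W ν (β - triple b (b + n) (b + m) ν))) → ∃[ β ] (ℬ β × Z i (β - b) × W j ((β - b) - n) × W k ((β - b) - m))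
      from (β , pβ , w) = β , pβ , slice pβ p (w i) , by (w j) (lem β b n) , by (w k) (lem β b m)

    move-j : ∀ {b} → ℬ b → ∀ n → ∃[ β ] (ℬ β × Z i (β - b) × W j ((β - b) - n) × Z k (β - b))
    move-j {b} p n = from (move p n (+ 0))
      where
      from : ∃[ β ] (ℬ β × Z i (β - b) × W j ((β - b) - n) × W k ((β - b) - + 0)) → ∃[ β ] (ℬ β × Z i (β - b) × W j ((β - b) - n) × Z k (β - b))
      from (β , pβ , zi , wj , wk) = β , pβ , zi , wj , proj₂ (along-j pβ p (Z⇒W {i} zi) (by wk (ℤ.+-identityʳ (β - b))))

    not-W : ∀ {ν d n} → W ν (d - n) → ¬ W ν n → ¬ W ν d
    not-W {ν} {d} {n} w nw w′ = nw (by (w′ ∣- w) (lem d n))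
      where
      lem : ∀ d n → d - (d - n) ≡ n
      lem = solve 2 (λ d n → d :- (d :- n) := n) refl

    -- B contains differences in direction j, so A does not.
    A-j : ∀ {a a′} → 𝒜 a → 𝒜 a′ → Z i (a - a′) → Z k (a - a′) → W j (a - a′)
    A-j {a} {a′} p p′ zi zk = decidable-stable (W? j (a - a′)) λ nw → from nw (move-j (proj₂ member₀) (a - a′))
      where
      b = proj₁ member₀
      from : ¬ W j (a - a′) → ∃[ β ] (ℬ β × Z i (β - b) × W j ((β - b) - (a - a′)) × Z k (β - b)) → ⊥
      from nw (β , pβ , zi′ , wj , zk′) = nw (Z⇒W {j} (sands p p′ pβ (proj₂ member₀)
        (λ { i → sim-Z zi zi′ ; j → sim-N j nw (not-W {j} {β - b} wj nw) ; k → sim-Z zk zk′ }) j))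

    -- By completeness `B` contains differences that are zero at i and units at both j and k; by
    -- `sands` `A` does not.
    A-jk : ∀ {a a′} → 𝒜 a → 𝒜 a′ → Z i (a - a′) → ¬ W j (a - a′) → W k (a - a′)
    A-jk {a} {a′} p p′ zi nj = decidable-stable (W? k (a - a′)) λ nk → from nk (move (proj₂ member₀) (a - a′) (a - a′))
      where
      b = proj₁ member₀
      from : ¬ W k (a - a′) → ∃[ β ] (ℬ β × Z i (β - b) × W j ((β - b) - (a - a′)) × W k ((β - b) - (a - a′))) → ⊥
      from nk (β , pβ , zi′ , wj , wk) = nj (Z⇒W {j} (sands p p′ pβ (proj₂ member₀)
        (λ { i → sim-Z zi zi′ ; j → sim-N j nj (not-W {j} {β - b} wj nj) ; k → sim-N k nk (not-W {k} {β - b} wk nk) }) j))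

    FibreAt : ℤ → Set
    FibreAt y = ∀ t → Z i (t - y) → W j (t - y) → Z k (t - y) → 𝒜 t

  module CornerSlice {F : Frame} {𝒜 ℬ : ℤ → Set} (C : Corner F 𝒜 ℬ) (R : Rigid F ℬ) where
    open FrameProperties F
    open CornerProperties C
    open Rigid R
    open RigidTiling tiling R

    -- Let x have the components of `o` at i and j and that of z at k. If x is in `A`, the fibring
    -- at the corner suffices. Otherwise the element of `A` covering x differs from x in direction j
    -- only, and varying the dilation at j makes it run through a whole fibre.
    fibre-over : ∀ z → W k (z - o) → ∃[ y ] (Z i (y - o) × Z k (y - z) × FibreAt y)
    fibre-over z wz = start (crt (triple o o (z)))
      where
      start : ∃[ x ] (∀ ν → Z ν (x - triple o o (z) ν)) → ∃[ y ] (Z i (y - o) × Z k (y - z) × FibreAt y)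
      start (x , ex) = decide (decA x)
        where
        wk-x : W k (x - o)
        wk-x = ∣-trans x z o (Z⇒W {k} (ex k)) wz
        decide : Dec (𝒜 x) → ∃[ y ] (Z i (y - o) × Z k (y - z) × FibreAt y)
        decide (yes px) = x , ex i , ex k , λ t zi wj zk → fibre-j px (ex i) (Z⇒W {j} (ex j)) wk-x zi wj zk
        decide (no x∉) = base (cover x pb (λ _ → + 1) π∤1)
          where
          b = proj₁ member₀
          pb = proj₂ member₀
          one : ∀ x d {m} → m ∣ x - + 1 * d → m ∣ x - d
          one x d e = by e (cong (λ t → x - t) (ℤ.*-identityˡ d))
          -- the covering pair differs from x only in direction j
          flat-cover : ∀ {a b′} → 𝒜 a → ℬ b′ → (∀ ν → Sim ν (x - a) (b′ - b)) → (Z i ((x - a) - (b′ - b)) × Z k ((x - a) - (b′ - b))) →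
            Z i (b′ - b) × Z k (b′ - b) × Z i (a - x) × Z k (a - x)
          flat-cover {a} {b′} pa pb′ s (ei , ek) = zi , zk , back i ei zi , back k ek zk
            where
            back : ∀ ν → Z ν ((x - a) - (b′ - b)) → Z ν (b′ - b) → Z ν (a - x)
            back ν e z = ∣-sym x a (∣-transport (x - a) (b′ - b) e z)
            forth : ∀ ν → Z ν ((x - a) - (b′ - b)) → W ν (a - x) → W ν (b′ - b)
            forth ν e w = ∣-transport (b′ - b) (x - a) (∣-sym (x - a) (b′ - b) (Z⇒W {ν} e)) (∣-sym a x w)
            wk : W k (a - x)
            wk = from (bispan k x o∈ pa pb pb′ s (λ { i _ → ex i ; j _ → ex j ; k ne → ⊥-elim (ne refl) }) wk-x)
              where
              from : Z k (a - x) ⊎ Z k (a - o) → W k (a - x)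
              from (inj₁ q) = Z⇒W {k} q
              from (inj₂ q) = ∣-trans a o x (Z⇒W {k} q) (∣-sym x o wk-x)
            wi : W i (a - x)
            wi = from (point-k x (∣-trans x o o′ wk-x (∣-sym o′ o (Z⇒W {k} oo-k))))
              where
              from : ∃[ l ] (𝒜 l × Z i (l - o′) × Z j (l - o′) × Z k (l - x)) → W i (a - x)
              from (l , pl , li , lj , lk) = from′ (bispan i x pl pa pb pb′ s (λ { i ne → ⊥-elim (ne refl) ; j _ → off-j ; k _ → ∣-sym l x lk }) onto)
                where
                off-j : Z j (x - l)
                off-j = ∣-trans x o l (ex j) (∣-trans o o′ l (∣-sym o′ o oo-j) (∣-sym l o′ lj))
                onto : W i (x - l)
                onto = ∣-trans x o l (Z⇒W {i} (ex i)) (∣-trans o o′ l (∣-sym o′ o oo-W) (∣-sym l o′ (Z⇒W {i} li)))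
                from′ : Z i (a - x) ⊎ Z i (a - l) → W i (a - x)
                from′ (inj₁ q) = Z⇒W {i} q
                from′ (inj₂ q) = ∣-trans a l x (Z⇒W {i} q) (∣-sym x l onto)
            zz : Z i (b′ - b) × Z k (b′ - b)
            zz = along-j pb′ pb (forth i ei wi) (forth k ek wk)
            zi = proj₁ zz
            zk = proj₂ zz
          base : ∃[ a ] ∃[ b′ ] (𝒜 a × ℬ b′ × (∀ ν → Z ν ((x - a) - + 1 * (b′ - b)))) → ∃[ y ] (Z i (y - o) × Z k (y - z) × FibreAt y)
          base (a₀ , b₀ , pa₀ , pb₀ , e₀) = a₀ , ∣-trans a₀ x o ai₀ (ex i) , ∣-trans a₀ x z ak₀ (ex k) , fibre
            where
            d₀ = b₀ - b
            e₀′ : Eq ((x - a₀) - d₀)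
            e₀′ ν = one (x - a₀) d₀ (e₀ ν)
            fc₀ = flat-cover pa₀ pb₀ (λ ν → sim (+ 1) (π∤1 ν) (e₀ ν)) (e₀′ i , e₀′ k)
            di₀ = proj₁ fc₀
            dk₀ = proj₁ (proj₂ fc₀)
            ai₀ = proj₁ (proj₂ (proj₂ fc₀))
            ak₀ = proj₂ (proj₂ (proj₂ fc₀))
            ¬Wd₀ : ¬ W j d₀
            ¬Wd₀ w = x∉ (respA x a₀ (λ ν → ∣-transport (x - a₀) d₀ (e₀′ ν) (thin pb₀ pb (Z⇒W {i} di₀) w (Z⇒W {k} dk₀) ν)) pa₀)
            fibre : FibreAt a₀
            -- At j both x - t and d₀ are units. In the dilation by their ratio v, rigidity forces x
            -- to be covered with the same b₀, and the partner is then t.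
            fibre t ti tj tk = go (sim-N j ¬Wxt ¬Wd₀)
              where
              ¬Wxt : ¬ W j (x - t)
              ¬Wxt w = ¬Wd₀ (∣-transport d₀ (x - a₀) (∣-sym (x - a₀) d₀ (Z⇒W {j} (e₀′ j))) (∣-trans x t a₀ w tj))
              go : Sim j (x - t) d₀ → 𝒜 t
              go (sim v pv ev) = scaled (cover x pb u pu)
                where
                u : Dir → ℤ
                u i = + 1
                u j = v
                u k = + 1
                pu : ∀ ν → UnitAt ν (u ν)
                pu i = π∤1 i
                pu j = pv
                pu k = π∤1 k
                scaled : ∃[ a ] ∃[ b′ ] (𝒜 a × ℬ b′ × (∀ ν → Z ν ((x - a) - u ν * (b′ - b)))) → 𝒜 t
                scaled (a , b′ , pa , pb′ , e) = respA t a eq pa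
                  where
                  d = b′ - b
                  fc = flat-cover pa pb′ (λ ν → sim (u ν) (pu ν) (e ν)) (one (x - a) d (e i) , one (x - a) d (e k))
                  wa : W j (a - a₀)
                  wa = A-j pa pa₀ (∣-trans a x a₀ (proj₁ (proj₂ (proj₂ fc))) (∣-sym a₀ x ai₀)) (∣-trans a x a₀ (proj₂ (proj₂ (proj₂ fc))) (∣-sym a₀ x ak₀))
                  lem₁ : ∀ x a a₀ t v d d₀ → (((x - t) - v * d₀) - ((x - a) - v * d)) - ((a - a₀) - (t - a₀)) ≡ v * (d - d₀)
                  lem₁ = solve 7 (λ x a a₀ t v d d₀ → (((x :- t) :- v :* d₀) :- ((x :- a) :- v :* d)) :- ((a :- a₀) :- (t :- a₀)) := v :* (d :- d₀)) refl
                  wd : W j (d - d₀)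
                  wd = unit-cancel-W {j} {v} pv (by ((Z⇒W {j} ev ∣- Z⇒W {j} (e j)) ∣- (wa ∣- tj)) (lem₁ x a a₀ t v d d₀))
                  same : Eq (b′ - b₀)
                  same = thin pb′ pb₀ (by (Z⇒W {i} (proj₁ fc ∣- di₀)) (add-diff b′ b₀ b)) (by wd (add-diff b′ b₀ b)) (by (Z⇒W {k} (proj₁ (proj₂ fc) ∣- dk₀)) (add-diff b′ b₀ b))
                  lem₂ : ∀ x a t v b b′ b₀ → (((x - a) - v * (b′ - b)) - ((x - t) - v * (b₀ - b))) + v * (b′ - b₀) ≡ t - a
                  lem₂ = solve 7 (λ x a t v b b′ b₀ → (((x :- a) :- v :* (b′ :- b)) :- ((x :- t) :- v :* (b₀ :- b))) :+ v :* (b′ :- b₀) := t :- a) refl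
                  eq : Eq (t - a)
                  eq i = ∣-trans t a₀ a ti (∣-trans a₀ x a ai₀ (∣-sym a x (proj₁ (proj₂ (proj₂ fc)))))
                  eq j = by ((e j ∣- ev) ∣+ (v ∣* same j)) (lem₂ x a t v b b′ b₀)
                  eq k = ∣-trans t a₀ a tk (∣-trans a₀ x a ak₀ (∣-sym a x (proj₂ (proj₂ (proj₂ fc)))))

    -- The slice through o already tiles with a slice of B, so other elements of A stay in W i.
    aligned : ∀ {a} → 𝒜 a → W i (a - o)
    aligned {a} pa = decidable-stable (W? i (a - o)) λ nw → start nw (complete λ _ → proj₁ member₀ + (a - o))
      where
      b′ = proj₁ member₀
      pb′ = proj₂ member₀
      start : ¬ W i (a - o) → ∃[ b ] (ℬ b × (∀ ν → W ν (b - (b′ + (a - o))))) → ⊥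
      start nw (b , pb , w) = scale (sim-shift (λ z → nw (Z⇒W {i} z)) (λ z → nw (by (Z⇒W {i} z ∣- w i) (lem b b′ (a - o)))) (∣-sym (b - b′) (a - o) (by (w i) (lem′ b b′ (a - o)))))
        where
        lem : ∀ b b′ α → (b - b′) - (b - (b′ + α)) ≡ α
        lem = solve 3 (λ b b′ α → (b :- b′) :- (b :- (b′ :+ α)) := α) refl
        lem′ : ∀ b b′ α → b - (b′ + α) ≡ (b - b′) - α
        lem′ = solve 3 (λ b b′ α → b :- (b′ :+ α) := (b :- b′) :- α) refl
        scale : Sim i (a - o) (b - b′) → ⊥
        scale (sim v pv ev) = units (combine-units u pu)
          where
          u : Dir → ℤ
          u i = v
          u j = + 1
          u k = + 1
          pu : ∀ ν → UnitAt ν (u ν)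
          pu i = pv
          pu j = π∤1 j
          pu k = π∤1 k
          units : ∃[ t ] ((∀ ν → UnitAt ν t) × (∀ ν → Z ν (t - u ν))) → ⊥
          units (t , pt , et) = step₁ (complete (triple b b (b + (y - o))))
            where
            -- Chosen so that y + t b = a + t b′; the ratio v used for t at i puts y into the slice
            -- of `o`.
            y = (a + t * b′) - t * b
            yi : Z i (y - o)
            yi = by (ev ∣- ((b - b′) ∣* et i)) (lem″ a o t b b′ v)
              where
              lem″ : ∀ a o t b b′ v → ((a - o) - v * (b - b′)) - (b - b′) * (t - v) ≡ ((a + t * b′) - t * b) - o
              lem″ = solve 6 (λ a o t b b′ v → ((a :- o) :- v :* (b :- b′)) :- (b :- b′) :* (t :- v) := ((a :+ t :* b′) :- t :* b) :- o) refl
            -- A second representation x + t β of a + t b′ is built with x in the slice of `o`: β₁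
            -- corrects the k-component so that `fibre-over` applies, and β then corrects the
            -- j-component modulo p_j, leaving x inside the fibre found.
            step₁ : ∃[ β ] (ℬ β × (∀ ν → W ν (β - triple b b (b + (y - o)) ν))) → ⊥
            step₁ (β₁ , pβ₁ , w₁) = step₂ (fibre-over (y - (β₁ - b)) (by (∣-neg (w₁ k)) (lem₁ β₁ b y o)))
              where
              lem₁ : ∀ β b y o → - (β - (b + (y - o))) ≡ (y - (β - b)) - o
              lem₁ = solve 4 (λ β b y o → :- (β :- (b :+ (y :- o))) := (y :- (β :- b)) :- o) refl
              step₂ : ∃[ s ] (Z i (s - o) × Z k (s - (y - (β₁ - b))) × FibreAt s) → ⊥
              step₂ (s , si , sk , fs) = step₃ (complete (triple b (b + (y - s)) β₁))
                where
                step₃ : ∃[ β ] (ℬ β × (∀ ν → W ν (β - triple b (b + (y - s)) β₁ ν))) → ⊥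
                step₃ (β , pβ , wβ) = step₄ (crt (triple o (y - (β - b)) (y - (β₁ - b))))
                  where
                  βi : Z i (β - b)
                  βi = slice pβ pb (wβ i)
                  βk : Z k (β - β₁)
                  βk = proj₂ (along-j pβ pβ₁ (∣-trans β b β₁ (wβ i) (∣-sym β₁ b (w₁ i))) (wβ k))
                  step₄ : ∃[ x ] (∀ ν → Z ν (x - triple o (y - (β - b)) (y - (β₁ - b)) ν)) → ⊥
                  step₄ (x , ex) = nw (Z⇒W {i} (∣-trans a x o (∣-sym x a (uniq t pt x a β b′ px pa pβ pb′ eq i)) (ex i)))
                    where
                    lem₂ : ∀ x y β b s → (x - (y - (β - b))) - (β - (b + (y - s))) ≡ x - s
                    lem₂ = solve 5 (λ x y β b s → (x :- (y :- (β :- b))) :- (β :- (b :+ (y :- s))) := x :- s) refl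
                    px : 𝒜 x
                    px = fs x (∣-trans x o s (ex i) (∣-sym s o si)) (by (Z⇒W {j} (ex j) ∣- wβ j) (lem₂ x y β b s)) (∣-trans x (y - (β₁ - b)) s (ex k) (∣-sym s (y - (β₁ - b)) sk))
                    lem-i : ∀ x o a t b b′ β → ((x - o) - (((a + t * b′) - t * b) - o)) + t * (β - b) ≡ (x + t * β) - (a + t * b′)
                    lem-i = solve 7 (λ x o a t b b′ β → ((x :- o) :- (((a :+ t :* b′) :- t :* b) :- o)) :+ t :* (β :- b) := (x :+ t :* β) :- (a :+ t :* b′)) refl
                    lem-j : ∀ x a t b b′ β → (x - (((a + t * b′) - t * b) - (β - b))) + (β - b) * (t - + 1) ≡ (x + t * β) - (a + t * b′)
                    lem-j = solve 6 (λ x a t b b′ β → (x :- (((a :+ t :* b′) :- t :* b) :- (β :- b))) :+ (β :- b) :* (t :- con (+ 1)) := (x :+ t :* β) :- (a :+ t :* b′)) refl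
                    lem-k : ∀ x a t b b′ β β₁ → ((x - (((a + t * b′) - t * b) - (β₁ - b))) + (β - β₁)) + (β - b) * (t - + 1) ≡ (x + t * β) - (a + t * b′)
                    lem-k = solve 7 (λ x a t b b′ β β₁ → ((x :- (((a :+ t :* b′) :- t :* b) :- (β₁ :- b))) :+ (β :- β₁)) :+ (β :- b) :* (t :- con (+ 1)) := (x :+ t :* β) :- (a :+ t :* b′)) refl
                    eq : Eq ((x + t * β) - (a + t * b′))
                    eq i = by ((ex i ∣- yi) ∣+ (t ∣* βi)) (lem-i x o a t b b′ β)
                    eq j = by (ex j ∣+ ((β - b) ∣* et j)) (lem-j x a t b b′ β)
                    eq k = by ((ex k ∣+ βk) ∣+ ((β - b) ∣* et k)) (lem-k x a t b b′ β β₁)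

  -- The situation kept up along the whole chain of fibre shifts. `dec∃` carries the finiteness of
  -- ℤ_M over to integer predicates.
  record Aligned (F : Frame) (𝒜 ℬ : ℤ → Set) (o : ℤ) : Set₁ where
    open FrameProperties F
    field
      tiling : Tiling F 𝒜 ℬ
      rigid  : Rigid F ℬ
      inside : ∀ {a} → 𝒜 a → W i (a - o)
      dec∃   : ∀ {P : ℤ → Set} → (∀ x → Dec (P x)) → (∀ x y → Eq (x - y) → P y → P x) → Dec (∃ P)

  swapAligned : ∀ {F 𝒜 ℬ o} → Aligned F 𝒜 ℬ o → Aligned (swap F) 𝒜 ℬ o
  swapAligned A = record { tiling = swapTiling tiling ; rigid = swapRigid rigid ; inside = inside
    ; dec∃ = λ d r → dec∃ d (λ x y e → r x y λ { i → e i ; j → e k ; k → e j }) }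
    where open Aligned A

  -- Rows, columns and fibre shifts

  module AlignedProperties {F : Frame} {𝒜 ℬ : ℤ → Set} {o : ℤ} (A : Aligned F 𝒜 ℬ o) where
    open FrameProperties F
    open Aligned A
    open RigidTiling tiling rigid
    open TilingProperties tiling
    open Rigid rigid

    private
      b₀ : ℤ
      b₀ = proj₁ member₀
      pb₀ : ℬ b₀
      pb₀ = proj₂ member₀

    -- Since `A` lies in one coset modulo `Π′ i`, the difference taken from `B` is in W i and hence
    -- zero at i. Each slice at i is therefore tiled on its own.
    slice-cover : ∀ x → W i (x - o) → ∃[ a ] ∃[ b ] (𝒜 a × ℬ b × Eq ((x - a) - (b - b₀)) × Z i (b - b₀))
    slice-cover x wx = from (cover x pb₀ (λ _ → + 1) π∤1)
      where
      from : ∃[ a ] ∃[ b ] (𝒜 a × ℬ b × (∀ ν → Z ν ((x - a) - + 1 * (b - b₀)))) → ∃[ a ] ∃[ b ] (𝒜 a × ℬ b × Eq ((x - a) - (b - b₀)) × Z i (b - b₀))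
      from (a , b , pa , pb , e) = a , b , pa , pb , e′ , slice pb pb₀ (by ((wx ∣- inside pa) ∣- Z⇒W {i} (e′ i)) (lem x o a (b - b₀)))
        where
        lem : ∀ x o a d → ((x - o) - (a - o)) - ((x - a) - d) ≡ d
        lem = solve 4 (λ x o a d → ((x :- o) :- (a :- o)) :- ((x :- a) :- d) := d) refl
        e′ : Eq ((x - a) - (b - b₀))
        e′ ν = by (e ν) (cong (λ t → (x - a) - t) (ℤ.*-identityˡ (b - b₀)))

    Row Col : ℤ → Set
    Row a = ∀ {a′} → 𝒜 a′ → Z i (a′ - a) → W k (a′ - a)
    Col a = ∀ {a′} → 𝒜 a′ → Z i (a′ - a) → W j (a′ - a)

    -- Cover t within its slice. By the row property the partner in `B` moves nothing at k, by `A-j`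
    -- nothing modulo `Π′ j`, so by `thin` it does not move at all.
    row-fibre : ∀ {a} → 𝒜 a → Row a → FibreAt a
    row-fibre {a} pa row t ti tj tk = from (slice-cover t (∣-trans t a o (Z⇒W {i} ti) (inside pa)))
      where
      from : ∃[ a′ ] ∃[ b ] (𝒜 a′ × ℬ b × Eq ((t - a′) - (b - b₀)) × Z i (b - b₀)) → 𝒜 t
      from (a′ , b , pa′ , pb , e , zi) = respA t a′ (λ ν → ∣-transport (t - a′) d (e ν) (thin pb pb₀ (Z⇒W {i} zi) wd (Z⇒W {k} zk) ν)) pa′
        where
        d = b - b₀
        diff : ∀ ν → Z ν d → Z ν (a′ - t)
        diff ν z = ∣-sym t a′ (∣-transport (t - a′) d (e ν) z)
        undiff : ∀ ν → W ν (a′ - t) → W ν d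
        undiff ν w = ∣-transport d (t - a′) (∣-sym (t - a′) d (Z⇒W {ν} (e ν))) (∣-sym a′ t w)
        zk : Z k d
        zk = proj₂ (along-j pb pb₀ (Z⇒W {i} zi) (undiff k (∣-trans a′ a t (row pa′ (∣-trans a′ t a (diff i zi) ti)) (∣-sym t a (Z⇒W {k} tk)))))
        wd : W j d
        wd = undiff j (∣-trans a′ a t (A-j pa′ pa (∣-trans a′ t a (diff i zi) ti) (∣-trans a′ t a (diff k zk) tk)) (∣-sym t a tj))

    -- By `A-jk` no two elements of a slice differ modulo both `Π′ j` and `Π′ k`; one element
    -- breaking the row and one breaking the column would form such a pair.
    row-or-col : ∀ {a} → 𝒜 a → Row a ⊎ Col a
    row-or-col {a} pa = from (dec∃ dec resp)
      where
      P : ℤ → Set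
      P x = 𝒜 x × Z i (x - a) × ¬ W k (x - a)
      dec : ∀ x → Dec (P x)
      dec x = decA x ×-dec (Z? i (x - a) ×-dec ¬? (W? k (x - a)))
      resp : ∀ x y → Eq (x - y) → P y → P x
      resp x y e (py , zi , nw) = respA x y e py , ∣-trans x y a (e i) zi , λ w → nw (∣-trans y x a (∣-sym x y (Z⇒W {k} (e k))) w)
      from : Dec (∃ P) → Row a ⊎ Col a
      from (no ne) = inj₁ λ {a′} pa′ z → decidable-stable (W? k (a′ - a)) λ nw → ne (a′ , pa′ , z , nw)
      from (yes (a₁ , p₁ , z₁ , nk₁)) = inj₂ λ {a₂} p₂ z₂ → decidable-stable (W? j (a₂ - a)) λ nj₂ →
        nk₁ (∣-trans a₁ a₂ a (∣-sym a₂ a₁ (A-jk p₂ p₁ (∣-trans a₂ a a₁ z₂ (∣-sym a₁ a z₁))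
          λ wj → nj₂ (∣-trans a₂ a₁ a wj (wj₁ p₁ z₁ nk₁)))) (A-jk p₂ pa z₂ nj₂))
        where
        wj₁ : ∀ {a₁} → 𝒜 a₁ → Z i (a₁ - a) → ¬ W k (a₁ - a) → W j (a₁ - a)
        wj₁ {a₁} p₁ z₁ nk = decidable-stable (W? j (a₁ - a)) λ nj → nk (A-jk p₁ pa z₁ nj)

    Movable : Set
    Movable = ∃[ a ] (𝒜 a × FibreAt a × ¬ W j (a - o))

    -- If no element of the slice is off the grid at j, all are congruent to `o` modulo `Π′ j`. The
    -- slice is then a column too, and it is off the grid at k, where it can be moved instead.
    row-case : ∀ {a} → 𝒜 a → Row a → ¬ (W j (a - o) × W k (a - o)) → Movable ⊎ (¬ W k (a - o) × Col a)
    row-case {a} pa row off = start (W? j (a - o))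
      where
      P : ℤ → Set
      P x = 𝒜 x × Z i (x - a) × ¬ W j (x - o)
      dec : ∀ x → Dec (P x)
      dec x = decA x ×-dec (Z? i (x - a) ×-dec ¬? (W? j (x - o)))
      resp : ∀ x y → Eq (x - y) → P y → P x
      resp x y e (py , zi , nw) = respA x y e py , ∣-trans x y a (e i) zi , λ w → nw (∣-trans y x o (∣-sym x y (Z⇒W {j} (e j))) w)
      start : Dec (W j (a - o)) → Movable ⊎ (¬ W k (a - o) × Col a)
      start (no nw) = inj₁ (a , pa , row-fibre pa row , nw)
      start (yes wj) = from (dec∃ dec resp)
        where
        from : Dec (∃ P) → Movable ⊎ (¬ W k (a - o) × Col a)
        from (yes (a′ , pa′ , z , nw)) = inj₁ (a′ , pa′ , row-fibre pa′ (λ {a″} pa″ z″ →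
          ∣-trans a″ a a′ (row pa″ (∣-trans a″ a′ a z″ z)) (∣-sym a′ a (row pa′ z))) , nw)
        from (no ne) = inj₂ ((λ wk → off (wj , wk)) , λ {a′} pa′ z → ∣-trans a′ o a
          (decidable-stable (W? j (a′ - o)) λ nw → ne (a′ , pa′ , z , nw)) (∣-sym a o wj))

    -- Replace the fibre of a in direction j by the parallel fibre through the grid of o.
    module Shift {a : ℤ} (pa : 𝒜 a) (fibre : FibreAt a) (off : ¬ W j (a - o)) where
      target : ∃[ a* ] (∀ ν → Z ν (a* - triple a o a ν))
      target = crt (triple a o a)

      a* : ℤ
      a* = proj₁ target
      ai : Z i (a* - a)
      ai = proj₂ target i
      aj : Z j (a* - o)
      aj = proj₂ target j
      ak : Z k (a* - a)
      ak = proj₂ target k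

      Fib : ℤ → ℤ → Set
      Fib x y = Z i (y - x) × W j (y - x) × Z k (y - x)

      fib? : ∀ x y → Dec (Fib x y)
      fib? x y = Z? i (y - x) ×-dec (W? j (y - x) ×-dec Z? k (y - x))

      fib-resp : ∀ x y z → Eq (y - z) → Fib x z → Fib x y
      fib-resp x y z e (zi , wj , zk) = ∣-trans y z x (e i) zi , ∣-trans y z x (Z⇒W {j} (e j)) wj , ∣-trans y z x (e k) zk

      𝒜′ : ℤ → Set
      𝒜′ y = (𝒜 y × ¬ Fib a y) ⊎ Fib a* y

      disjoint : ∀ {y} → Fib a* y → ¬ 𝒜 y
      disjoint {y} (zi , wj , zk) py = off (∣-trans a a* o (∣-trans a y a* (∣-sym y a (A-j py pa (∣-trans y a* a zi ai) (∣-trans y a* a zk ak))) wj) (Z⇒W {j} aj))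

      inside′ : ∀ {y} → 𝒜′ y → W i (y - o)
      inside′ (inj₁ (py , _)) = inside py
      inside′ {y} (inj₂ (zi , _)) = ∣-trans y a o (Z⇒W {i} (∣-trans y a* a zi ai)) (inside pa)

      private
        one : ∀ x a b {m} → m ∣ x - (a + + 1 * b) → m ∣ x - (a + b)
        one x a b d = by d (cong (λ t → x - (a + t)) (ℤ.*-identityˡ b))

        two : ∀ a b a′ b′ {m} → m ∣ (a + b) - (a′ + b′) → m ∣ (a + + 1 * b) - (a′ + + 1 * b′)
        two a b a′ b′ d = by d (cong₂ (λ s t → (a + s) - (a′ + t)) (sym (ℤ.*-identityˡ b)) (sym (ℤ.*-identityˡ b′)))

        -- Transport a point of one fibre to the other, compensating inside B.
        transport : ∀ x {y} c {b} → ℬ b → Z i (x - c) → Z k (x - c) → y ≡ x → ∃[ z ] ∃[ β ] (Fib c z × ℬ β × z + β ≡ y + b)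
        transport x c {b} pb zi zk refl = from (move-j pb (x - c))
          where
          lem : ∀ x c β b → (x - c) - (β - b) ≡ ((x + b) - β) - c
          lem = solve 4 (λ x c β b → (x :- c) :- (β :- b) := ((x :+ b) :- β) :- c) refl
          lem′ : ∀ x c β b → - ((β - b) - (x - c)) ≡ ((x + b) - β) - c
          lem′ = solve 4 (λ x c β b → :- ((β :- b) :- (x :- c)) := ((x :+ b) :- β) :- c) refl
          from : ∃[ β ] (ℬ β × Z i (β - b) × W j ((β - b) - (x - c)) × Z k (β - b)) → ∃[ z ] ∃[ β ] (Fib c z × ℬ β × z + β ≡ x + b)
          from (β , pβ , βi , βj , βk) = (x + b) - β , β , (by (zi ∣- βi) (lem x c β b) , by (∣-neg βj) (lem′ x c β b) , by (zk ∣- βk) (lem x c β b)) , pβ ,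
            solve 2 (λ t β → (t :- β) :+ β := t) refl (x + b) β

      exist′ : ∀ x → ∃[ y ] ∃[ b ] (𝒜′ y × ℬ b × Eq (x - (y + b)))
      exist′ x = from (exist (+ 1) π∤1 x)
        where
        from : ∃[ y ] ∃[ b ] (𝒜 y × ℬ b × Eq (x - (y + + 1 * b))) → ∃[ y ] ∃[ b ] (𝒜′ y × ℬ b × Eq (x - (y + b)))
        from (y , b , py , pb , e) = decide (fib? a y)
          where
          e′ : Eq (x - (y + b))
          e′ ν = one x y b (e ν)
          decide : Dec (Fib a y) → ∃[ y ] ∃[ b ] (𝒜′ y × ℬ b × Eq (x - (y + b)))
          decide (no nf) = y , b , inj₁ (py , nf) , pb , e′
          decide (yes (zi , wj , zk)) = use (transport y a* pb (∣-trans y a a* zi (∣-sym a* a ai)) (∣-trans y a a* zk (∣-sym a* a ak)) refl)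
            where
            use : ∃[ z ] ∃[ β ] (Fib a* z × ℬ β × z + β ≡ y + b) → ∃[ y ] ∃[ b ] (𝒜′ y × ℬ b × Eq (x - (y + b)))
            use (z , β , f , pβ , eq) = z , β , inj₂ f , pβ , λ ν → by (e′ ν) (cong (λ t → x - t) (sym eq))

      mixed : ∀ y z {b c} → Fib a* y → 𝒜 z → ¬ Fib a z → ℬ b → ℬ c → ¬ Eq ((y + b) - (z + c))
      mixed y z {b} {c} (zi , wj , zk) pz nf pb pc e = use (transport y a pb (∣-trans y a* a zi ai) (∣-trans y a* a zk ak) refl)
        where
        use : ∃[ x ] ∃[ β ] (Fib a x × ℬ β × x + β ≡ y + b) → ⊥
        use (x , β , f , pβ , eq) = nf (fib-resp a z x (λ ν → ∣-sym x z (uniq (+ 1) π∤1 x z β c (fibre x (proj₁ f) (proj₁ (proj₂ f)) (proj₂ (proj₂ f))) pz pβ pc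
          (λ ν → two x β z c (by (e ν) (cong (_- (z + c)) (sym eq)))) ν)) f)

      uniq′ : ∀ {y z b c} → 𝒜′ y → 𝒜′ z → ℬ b → ℬ c → Eq ((y + b) - (z + c)) → Eq (y - z)
      uniq′ {y} {z} {b} {c} (inj₁ (py , _)) (inj₁ (pz , _)) pb pc e = uniq (+ 1) π∤1 y z b c py pz pb pc (λ ν → two y b z c (e ν))
      uniq′ {y} {z} (inj₂ f) (inj₁ (pz , nf)) pb pc e = ⊥-elim (mixed y z f pz nf pb pc e)
      uniq′ {y} {z} {b} {c} (inj₁ (py , nf)) (inj₂ f) pb pc e = ⊥-elim (mixed z y f py nf pc pb λ ν → ∣-sym (y + b) (z + c) (e ν))
      uniq′ {y} {z} {b} {c} (inj₂ (yi , yj , yk)) (inj₂ (zi , zj , zk)) pb pc e = λ ν → by (e ν ∣- eq ν) (lem y b z c)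
        where
        lem : ∀ y b z c → ((y + b) - (z + c)) - (b - c) ≡ y - z
        lem = solve 4 (λ y b z c → ((y :+ b) :- (z :+ c)) :- (b :- c) := y :- z) refl
        lem′ : ∀ y b z c a → ((y + b) - (z + c)) - ((y - a) - (z - a)) ≡ b - c
        lem′ = solve 5 (λ y b z c a → ((y :+ b) :- (z :+ c)) :- ((y :- a) :- (z :- a)) := b :- c) refl
        eq : Eq (b - c)
        eq = thin pb pc (by (Z⇒W {i} (e i ∣- (yi ∣- zi))) (lem′ y b z c a*)) (by (Z⇒W {j} (e j) ∣- (yj ∣- zj)) (lem′ y b z c a*)) (by (Z⇒W {k} (e k ∣- (yk ∣- zk))) (lem′ y b z c a*))

    -- The covering of x takes from `B` a difference divisible by D(M), which is zero by `thin`.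
    full : (∀ {a} → 𝒜 a → W j (a - o) × W k (a - o)) → ∀ {x} → W i (x - o) → W j (x - o) → W k (x - o) → 𝒜 x
    full h {x} wi wj wk = from (slice-cover x wi)
      where
      lem : ∀ x o a d → ((x - o) - (a - o)) - ((x - a) - d) ≡ d
      lem = solve 4 (λ x o a d → ((x :- o) :- (a :- o)) :- ((x :- a) :- d) := d) refl
      from : ∃[ a ] ∃[ b ] (𝒜 a × ℬ b × Eq ((x - a) - (b - b₀)) × Z i (b - b₀)) → 𝒜 x
      from (a , b , pa , pb , e , zi) = respA x a (λ ν → ∣-transport (x - a) (b - b₀) (e ν) (thin pb pb₀ (Z⇒W {i} zi)
        (by ((wj ∣- proj₁ (h pa)) ∣- Z⇒W {j} (e j)) (lem x o a (b - b₀))) (by ((wk ∣- proj₂ (h pa)) ∣- Z⇒W {k} (e k)) (lem x o a (b - b₀))) ν)) pa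

  module Improve {F : Frame} {𝒜 ℬ : ℤ → Set} {o : ℤ} (A : Aligned F 𝒜 ℬ o) where
    open FrameProperties F
    module J = AlignedProperties A
    module K = AlignedProperties (swapAligned A)

    movable : ∀ {a} → 𝒜 a → ¬ (W j (a - o) × W k (a - o)) → J.Movable ⊎ K.Movable
    movable {a} pa off = from (J.row-or-col pa)
      where
      row : J.Row a → J.Movable ⊎ K.Movable
      row r = use (J.row-case pa r off)
        where
        use : J.Movable ⊎ (¬ W k (a - o) × J.Col a) → J.Movable ⊎ K.Movable
        use (inj₁ m) = inj₁ m
        use (inj₂ (nw , c)) = inj₂ (a , pa , K.row-fibre pa c , nw)
      col : J.Col a → J.Movable ⊎ K.Movable
      col c = use (K.row-case pa c (λ (wk , wj) → off (wj , wk)))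
        where
        use : K.Movable ⊎ (¬ W j (a - o) × K.Col a) → J.Movable ⊎ K.Movable
        use (inj₁ m) = inj₂ m
        use (inj₂ (nw , r)) = inj₁ (a , pa , J.row-fibre pa r , nw)
      from : J.Row a ⊎ J.Col a → J.Movable ⊎ K.Movable
      from (inj₁ r) = row r
      from (inj₂ c) = col c

-- Passing between subsets of ℤ_M and coordinates

module Grids where
  open Congruences
  open Tijdeman
  open Corners
  open PolynomialRing hiding (at)
  open Monomials
  open PolynomialDivisibility
  open CyclotomicPolynomials
  open import Data.Nat as ℕ using (ℕ; zero; suc; _≤_; _<_; z≤n; s≤s; NonZero; _^_)
  import Data.Nat.Properties as ℕ
  import Data.Nat.Divisibility as ℕ
  import Data.Nat.DivMod as ℕ
  open import Data.Nat.Primality using (Prime; prime⇒nonTrivial; prime⇒irreducible; euclidsLemma)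
  open import Data.Integer as ℤ using (ℤ; +_; _+_; _*_; _-_; -_) renaming (∣_∣ to abs)
  import Data.Integer.Properties as ℤ
  import Data.Integer.DivMod as ℤ
  open import Data.Integer.Divisibility.Signed as ℤ∣ using (divides; _∣_)
  open import Data.Integer.Solver using (module +-*-Solver)
  open +-*-Solver using (solve; _:+_; _:*_; _:-_; :-_; con; _:=_)
  open import Data.Bool using (true; false; if_then_else_)
  open import Data.Fin as Fin using (Fin; zero; suc; toℕ; fromℕ<)
  import Data.Fin.Properties as Fin
  open import Data.Fin.Subset using (Subset; _∈_)
  open import Data.Fin.Subset.Properties using (_∈?_; ⊆-antisym)
  open import Data.Vec as Vec using ([]; _∷_; lookup; tabulate; toList)
  open import Data.Vec.Properties using ([]=⇒lookup; lookup⇒[]=; lookup∘tabulate)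
  open import Data.Product using (_,_; ∃; ∃-syntax; _×_; proj₁; proj₂)
  open import Data.Sum using (_⊎_; inj₁; inj₂)
  open import Data.Empty using (⊥; ⊥-elim)
  open import Relation.Nullary using (yes; no; ¬_; Dec; does)
  open import Relation.Nullary.Decidable using (dec-true; dec-false; decidable-stable; map′; _×-dec_; ¬?; _⊎-dec_)
  open import Relation.Binary.PropositionalEquality hiding (J; [_]; resp)
  open import Data.Nat.GCD using (gcd[m,n]∣m; gcd[m,n]∣n; gcd-greatest)
  open import Function.Bundles using (_⇔_; Equivalence; mk⇔)
  open import Data.List using ([]; _∷_; map)
  open import Tactic.RingSolver.NonReflective polySolverRing using (_⊕_; _⊗_; ⊝_; Κ) renaming (solve to solveₚ)
  open import Data.Nat.Induction using (<-wellFounded)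
  open import Induction.WellFounded using (Acc; acc)
  open import Relation.Binary.Construct.Closure.ReflexiveTransitive using (Star; ε; _◅_)
  open import Data.Nat.Coprimality using (coprime-divisor)
  open import Data.Nat.ListAction using (product)
  open import Data.Nat.ListAction.Properties using (∈⇒∣product)
  open import Data.List.Relation.Unary.All as All using (All; []; _∷_)
  open import Data.List.Relation.Unary.Any using (here; there)
  open import Data.List.Relation.Unary.AllPairs using ([]; _∷_)
  open import Data.List.Relation.Unary.Unique.Propositional using (Unique)
  open import Data.List.Membership.Propositional using () renaming (_∈_ to _∈ₗ_)
  open import Data.List.Membership.Propositional.Properties using (∈-map⁺)
  open import Data.Nat.Solver renaming (module +-*-Solver to ℕ-Solver)

  -- Finite sums of natural numbers

  sumℕ-member : ∀ {n} (f : Fin n → ℕ) a → f a ≤ sumℕ f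
  sumℕ-member f zero    = ℕ.m≤m+n (f zero) _
  sumℕ-member f (suc a) = ℕ.≤-trans (sumℕ-member (λ b → f (suc b)) a) (ℕ.m≤n+m _ (f zero))

  sumℕ-pair : ∀ {n} (f : Fin n → ℕ) {a b} → a ≢ b → f a ℕ.+ f b ≤ sumℕ f
  sumℕ-pair f {zero}  {zero}  ne = ⊥-elim (ne refl)
  sumℕ-pair f {zero}  {suc b} ne = ℕ.+-monoʳ-≤ (f zero) (sumℕ-member (λ c → f (suc c)) b)
  sumℕ-pair f {suc a} {zero}  ne = subst (_≤ sumℕ f) (ℕ.+-comm (f zero) (f (suc a))) (ℕ.+-monoʳ-≤ (f zero) (sumℕ-member (λ c → f (suc c)) a))
  sumℕ-pair f {suc a} {suc b} ne = ℕ.≤-trans (sumℕ-pair (λ c → f (suc c)) (λ e → ne (cong suc e))) (ℕ.m≤n+m _ (f zero))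

  sumℕ-one-unique : ∀ {n} (f : Fin n → ℕ) → sumℕ f ≡ 1 → ∀ {a b} → 1 ≤ f a → 1 ≤ f b → a ≡ b
  sumℕ-one-unique f e {a} {b} pa pb = decidable-stable (a Fin.≟ b) λ ne →
    ℕ.<⇒≱ (s≤s (s≤s z≤n)) (ℕ.≤-trans (ℕ.+-mono-≤ pa pb) (ℕ.≤-trans (sumℕ-pair f ne) (ℕ.≤-reflexive e)))

  sumℕ-positive : ∀ {n} (f : Fin n → ℕ) → 1 ≤ sumℕ f → ∃[ a ] 1 ≤ f a
  sumℕ-positive {suc n} f h = go (f zero) refl
    where
    go : ∀ m → f zero ≡ m → ∃[ a ] 1 ≤ f a
    go (suc m) e = zero , subst (1 ≤_) (sym e) (s≤s z≤n)
    go zero e = let (a , p) = sumℕ-positive (λ a → f (suc a)) (subst (λ z → 1 ≤ z ℕ.+ sumℕ (λ a → f (suc a))) e h) in suc a , p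

  sumℕ-≤ : ∀ {n s} (f : Fin n → ℕ) → (∀ a → f a ≤ s) → sumℕ f ≤ n ℕ.* s
  sumℕ-≤ {zero}  f h = z≤n
  sumℕ-≤ {suc n} f h = ℕ.+-mono-≤ (h zero) (sumℕ-≤ (λ a → f (suc a)) (λ a → h (suc a)))

  sumℕ-< : ∀ {n s} (f : Fin n → ℕ) a → (∀ b → f b ≤ s) → f a < s → sumℕ f < n ℕ.* s
  sumℕ-< {suc n} f zero    h lt = ℕ.+-mono-<-≤ lt (sumℕ-≤ (λ a → f (suc a)) (λ a → h (suc a)))
  sumℕ-< {suc n} f (suc a) h lt = ℕ.+-mono-≤-< (h zero) (sumℕ-< (λ a → f (suc a)) a (λ a → h (suc a)) lt)

  -- If no entry exceeded s while the one at `a` fell short of it, the sum would be less than n s.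
  -- This is the source of the alternatives in `Crowd` statements.
  average : ∀ {n s} (f : Fin n → ℕ) → sumℕ f ≡ n ℕ.* s → ∀ a → s ≤ f a ⊎ ∃[ b ] suc s ≤ f b
  average {n} {s} f e a = go (s ℕ.≤? f a) (Fin.any? λ b → suc s ℕ.≤? f b)
    where
    go : Dec (s ≤ f a) → Dec (∃[ b ] suc s ≤ f b) → s ≤ f a ⊎ ∃[ b ] suc s ≤ f b
    go (yes le) _ = inj₁ le
    go (no _) (yes b) = inj₂ b
    go (no nle) (no nb) = ⊥-elim (ℕ.<-irrefl e (sumℕ-< f a (λ b → ℕ.≮⇒≥ λ lt → nb (b , lt)) (ℕ.≰⇒> nle)))

  record Selection {n : ℕ} (P : Fin n → Set) (t : ℕ) : Set where
    constructor selection
    field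
      pick      : Fin t → Fin n
      picked    : ∀ a → P (pick a)
      injective : ∀ a b → pick a ≡ pick b → a ≡ b

  enumerate : ∀ {n} (f : Fin n → ℕ) → (∀ a → f a ≤ 1) → ∀ t → t ≤ sumℕ f → Selection (λ a → 1 ≤ f a) t
  enumerate f h zero le = selection (λ ()) (λ ()) (λ ())
  enumerate {suc n} f h (suc t) le = go (f zero) refl
    where
    rest : Fin n → ℕ
    rest a = f (suc a)
    skip : Selection (λ a → 1 ≤ rest a) (suc t) → Selection (λ a → 1 ≤ f a) (suc t)
    skip (selection g p inj) = selection (λ a → suc (g a)) p (λ a b eq → inj a b (Fin.suc-injective eq))
    extend : 1 ≤ f zero → Selection (λ a → 1 ≤ rest a) t → Selection (λ a → 1 ≤ f a) (suc t)
    extend p₀ (selection g p inj) = selection g′ p′ inj′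
      where
      g′ : Fin (suc t) → Fin (suc n)
      g′ zero    = zero
      g′ (suc a) = suc (g a)
      p′ : ∀ a → 1 ≤ f (g′ a)
      p′ zero    = p₀
      p′ (suc a) = p a
      inj′ : ∀ a b → g′ a ≡ g′ b → a ≡ b
      inj′ zero    zero    _  = refl
      inj′ (suc a) (suc b) eq = cong suc (inj a b (Fin.suc-injective eq))
    go : ∀ m → f zero ≡ m → Selection (λ a → 1 ≤ f a) (suc t)
    go zero    e = skip (enumerate rest (λ a → h (suc a)) (suc t) (subst (λ z → suc t ≤ z ℕ.+ sumℕ rest) e le))
    go (suc m) e = extend (subst (1 ≤_) (sym e) (s≤s z≤n))
      (enumerate rest (λ a → h (suc a)) t (ℕ.≤-pred (ℕ.≤-trans le (ℕ.+-monoˡ-≤ (sumℕ rest) (h zero)))))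

  ∣-small : ∀ {m a b} → a < m → b < m → + m ∣ (+ a - + b) → a ≡ b
  ∣-small {m} {a} {b} a<m b<m d = ordered (ℕ.≤-total a b)
    where
    zero-∸ : ∀ n → n < m → m ℕ.∣ n → n ≡ 0
    zero-∸ zero    _  _ = refl
    zero-∸ (suc n) lt e = ⊥-elim (ℕ.<⇒≱ lt (ℕ.∣⇒≤ e))
    small : ∀ x y → x ≤ y → y < m → + m ∣ (+ y - + x) → y ≡ x
    small x y x≤y y<m e = ℕ.≤-antisym (ℕ.m∸n≡0⇒m≤n (zero-∸ (y ℕ.∸ x) (ℕ.≤-<-trans (ℕ.m∸n≤m y x) y<m)
      (∣⇒ℕ∣ (subst (+ m ∣_) (trans (ℤ.m-n≡m⊖n y x) (ℤ.⊖-≥ x≤y)) e)))) x≤y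
    ordered : a ≤ b ⊎ b ≤ a → a ≡ b
    ordered (inj₁ a≤b) = sym (small a b a≤b b<m (∣-sym (+ a) (+ b) d))
    ordered (inj₂ b≤a) = small b a b≤a a<m d

  %-∣ : ∀ n m .{{_ : NonZero m}} → + m ∣ (+ n - + (n ℕ.% m))
  %-∣ n m = divides (+ (n ℕ./ m)) (begin
    + n - + (n ℕ.% m)                                          ≡⟨ cong (λ t → + t - + (n ℕ.% m)) (ℕ.m≡m%n+[m/n]*n n m) ⟩
    + (n ℕ.% m ℕ.+ n ℕ./ m ℕ.* m) - + (n ℕ.% m)                ≡⟨ cong (λ t → (+ (n ℕ.% m) + t) - + (n ℕ.% m)) (ℤ.pos-* (n ℕ./ m) m) ⟩
    (+ (n ℕ.% m) + + (n ℕ./ m) * + m) - + (n ℕ.% m)            ≡⟨ solve 2 (λ x y → (x :+ y) :- x := y) refl (+ (n ℕ.% m)) (+ (n ℕ./ m) * + m) ⟩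
    + (n ℕ./ m) * + m                                          ∎)
    where open ≡-Reasoning

  ∣⇒%≡ : ∀ a b m .{{_ : NonZero m}} → + m ∣ (+ a - + b) → a ℕ.% m ≡ b ℕ.% m
  ∣⇒%≡ a b m d = ∣-small (ℕ.m%n<n a m) (ℕ.m%n<n b m)
    (∣-trans (+ (a ℕ.% m)) (+ a) (+ (b ℕ.% m)) (∣-sym (+ a) (+ (a ℕ.% m)) (%-∣ a m)) (∣-trans (+ a) (+ b) (+ (b ℕ.% m)) d (%-∣ b m)))

  indicator : ∀ {n} → Subset n → Fin n → ℕ
  indicator A x = if lookup A x then 1 else 0

  indicator-01 : ∀ {n} (A : Subset n) x → indicator A x ≡ 0 ⊎ indicator A x ≡ 1
  indicator-01 A x with lookup A x
  ... | true  = inj₂ refl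
  ... | false = inj₁ refl

  indicator≤1 : ∀ {n} (A : Subset n) x → indicator A x ≤ 1
  indicator≤1 A x with lookup A x
  ... | true  = s≤s z≤n
  ... | false = z≤n

  ∈⇒indicator : ∀ {n} {A : Subset n} {x} → x ∈ A → indicator A x ≡ 1
  ∈⇒indicator {A = A} {x} p = cong (if_then 1 else 0) ([]=⇒lookup p)

  indicator⇒∈ : ∀ {n} {A : Subset n} {x} → 1 ≤ indicator A x → x ∈ A
  indicator⇒∈ {A = A} {x} le with lookup A x in eq
  ... | true  = lookup⇒[]= x A eq
  ... | false = ⊥-elim (ℕ.<⇒≱ (s≤s z≤n) le)

  ∉⇒indicator : ∀ {n} {A : Subset n} {x} → ¬ x ∈ A → indicator A x ≡ 0
  ∉⇒indicator {A = A} {x} np with indicator-01 A x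
  ... | inj₁ e = e
  ... | inj₂ e = ⊥-elim (np (indicator⇒∈ (ℕ.≤-reflexive (sym e))))

  card-sum : ∀ {n} (A : Subset n) → Data.Fin.Subset.∣ A ∣ ≡ sumℕ (indicator A)
  card-sum []          = refl
  card-sum (true ∷ A)  = cong suc (card-sum A)
  card-sum (false ∷ A) = card-sum A

  subset : ∀ {n} {P : Fin n → Set} → (∀ x → Dec (P x)) → Subset n
  subset d = tabulate (λ x → does (d x))

  ∈-subset⁺ : ∀ {n} {P : Fin n → Set} (d : ∀ x → Dec (P x)) {x} → P x → x ∈ subset d
  ∈-subset⁺ d {x} p = lookup⇒[]= x _ (trans (lookup∘tabulate (λ x → does (d x)) x) (dec-true (d x) p))

  ∈-subset⁻ : ∀ {n} {P : Fin n → Set} (d : ∀ x → Dec (P x)) {x} → x ∈ subset d → P x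
  ∈-subset⁻ d {x} m with d x in eq
  ... | yes p = p
  ... | no np with trans (sym (lookup∘tabulate (λ x → does (d x)) x)) ([]=⇒lookup m)
  ...   | e rewrite eq with e
  ...     | ()

  prime-∣-^ : ∀ {p q} → Prime p → Prime q → ∀ n → p ℕ.∣ q ℕ.^ n → p ≡ q
  prime-∣-^ {p} pp pq zero d = ⊥-elim (ℕ.<-irrefl (sym (ℕ.∣1⇒≡1 d)) (ℕ.nonTrivial⇒n>1 p ⦃ prime⇒nonTrivial pp ⦄))
  prime-∣-^ {p} {q} pp pq (suc n) d with euclidsLemma q (q ℕ.^ n) pp d
  ... | inj₂ d′ = prime-∣-^ pp pq n d′
  ... | inj₁ d′ with prime⇒irreducible pq d′
  ...   | inj₁ p≡1 = ⊥-elim (ℕ.<-irrefl (sym p≡1) (ℕ.nonTrivial⇒n>1 p ⦃ prime⇒nonTrivial pp ⦄))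
  ...   | inj₂ eq  = eq

  module Residues (M : ℕ) .{{_ : NonZero M}} where
    open ZM M

    ι : Fin M → ℤ
    ι x = + toℕ x

    res : ℤ → Fin M
    res z = fromℕ< (ℤ.n%ℕd<d z M)

    ι-res : ∀ z → + M ∣ z - ι (res z)
    ι-res z = divides (z ℤ./ℕ M) (begin
      z - ι (res z)                                   ≡⟨ cong₂ (λ s t → s - + t) (ℤ.a≡a%ℕn+[a/ℕn]*n z M) (Fin.toℕ-fromℕ< (ℤ.n%ℕd<d z M)) ⟩
      (+ (z ℤ.%ℕ M) + (z ℤ./ℕ M) * + M) - + (z ℤ.%ℕ M)   ≡⟨ solve 2 (λ x y → (x :+ y) :- x := y) refl (+ (z ℤ.%ℕ M)) ((z ℤ./ℕ M) * + M) ⟩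
      (z ℤ./ℕ M) * + M                                ∎)
      where open ≡-Reasoning

    ι-injective : ∀ {x y} → + M ∣ ι x - ι y → x ≡ y
    ι-injective {x} {y} d = Fin.toℕ-injective (∣-small (Fin.toℕ<n x) (Fin.toℕ<n y) d)

    res-cong : ∀ z z′ → + M ∣ z - z′ → res z ≡ res z′
    res-cong z z′ d = ι-injective (∣-trans (ι (res z)) z (ι (res z′)) (∣-sym z (ι (res z)) (ι-res z)) (∣-trans z z′ (ι (res z′)) d (ι-res z′)))

    res-ι : ∀ x → res (ι x) ≡ x
    res-ι x = ι-injective (∣-sym (ι x) (ι (res (ι x))) (ι-res (ι x)))

    ι-[] : ∀ n → + M ∣ ι [ n ] - + n
    ι-[] n = ∣-sym (+ n) (ι [ n ]) (subst (λ t → + M ∣ + n - + t) (sym (Fin.toℕ-fromℕ< (ℕ.m%n<n n M))) (%-∣ n M))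

    ι-+ : ∀ x y → + M ∣ ι (x +ₘ y) - (ι x + ι y)
    ι-+ x y = ι-[] (toℕ x ℕ.+ toℕ y)

    ι-- : ∀ x y → + M ∣ ι (x -ₘ y) - (ι x - ι y)
    ι-- x y = by (ι-[] (toℕ x ℕ.+ (M ℕ.∸ toℕ y)) ∣+ ℤ∣.∣-refl {+ M})
      (trans (cong (λ t → (ι (x -ₘ y) - (+ toℕ x + t)) + + M) (trans (sym (ℤ.⊖-≥ (ℕ.<⇒≤ (Fin.toℕ<n y)))) (sym (ℤ.m-n≡m⊖n M (toℕ y)))))
        (solve 4 (λ z x y m → (z :- (x :+ (m :- y))) :+ m := z :- (x :- y)) refl (ι (x -ₘ y)) (ι x) (ι y) (+ M)))

    member : Subset M → ℤ → Set
    member A z = res z ∈ A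

    member-resp : ∀ A x y → + M ∣ x - y → member A y → member A x
    member-resp A x y d p = subst (_∈ A) (sym (res-cong x y d)) p

    member-ι : ∀ {A x} → x ∈ A → member A (ι x)
    member-ι {A} {x} p = subst (_∈ A) (sym (res-ι x)) p

    member-ι⁻ : ∀ {A x} → member A (ι x) → x ∈ A
    member-ι⁻ {A} {x} p = subst (_∈ A) (res-ι x) p

    dec∃ : ∀ {P : ℤ → Set} → (∀ x → Dec (P x)) → (∀ x y → + M ∣ x - y → P y → P x) → Dec (∃ P)
    dec∃ {P} d r = map′ (λ (x , p) → ι x , p) (λ (z , p) → res z , r (ι (res z)) z (∣-sym z (ι (res z)) (ι-res z)) p) (Fin.any? (λ x → d (ι x)))

  module TilingCounts (M : ℕ) .{{_ : NonZero M}} (A B : Subset M) where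
    open ZM M
    open Residues M
    open Convolution M (indicator A) (indicator B) public

    term : ℕ → Fin M → Fin M → Fin M → ℕ
    term u x a b = indicator A a ℕ.* indicator B b ℕ.* hit (toℕ a ℕ.+ u ℕ.* toℕ b) x

    hit⇒∣ : ∀ n x → 1 ≤ hit n x → + M ∣ + n - ι x
    hit⇒∣ n x h = go (n ℕ.% M ℕ.≟ toℕ x)
      where
      go : Dec (n ℕ.% M ≡ toℕ x) → + M ∣ + n - ι x
      go (yes e) = subst (λ t → + M ∣ + n - + t) e (%-∣ n M)
      go (no ne) = ⊥-elim (ℕ.<⇒≱ h (ℕ.≤-reflexive (hit-no n x ne)))

    ∣⇒hit : ∀ n x → + M ∣ + n - ι x → hit n x ≡ 1
    ∣⇒hit n x d = hit-yes n x (trans (∣⇒%≡ n (toℕ x) M d) (ℕ.m<n⇒m%n≡m (Fin.toℕ<n x)))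

    private
      factors : ∀ a b → 1 ≤ a ℕ.* b → 1 ≤ a × 1 ≤ b
      factors zero    b       ()
      factors (suc a) zero    h = ⊥-elim (ℕ.<⇒≱ h (ℕ.≤-reflexive (ℕ.*-zeroʳ (suc a))))
      factors (suc a) (suc b) h = s≤s z≤n , s≤s z≤n

    term⇒ : ∀ u x a b → 1 ≤ term u x a b → a ∈ A × b ∈ B × + M ∣ + (toℕ a ℕ.+ u ℕ.* toℕ b) - ι x
    term⇒ u x a b h = let (h₁ , h₂) = factors (indicator A a ℕ.* indicator B b) _ h ; (h₃ , h₄) = factors (indicator A a) _ h₁ in
      indicator⇒∈ h₃ , indicator⇒∈ h₄ , hit⇒∣ _ x h₂

    ⇒term : ∀ u x a b → a ∈ A → b ∈ B → + M ∣ + (toℕ a ℕ.+ u ℕ.* toℕ b) - ι x → term u x a b ≡ 1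
    ⇒term u x a b pa pb d = cong₂ ℕ._*_ (cong₂ ℕ._*_ (∈⇒indicator pa) (∈⇒indicator pb)) (∣⇒hit _ x d)

    count⇒exist : ∀ u x → count u x ≡ 1 → ∃[ a ] ∃[ b ] (a ∈ A × b ∈ B × + M ∣ + (toℕ a ℕ.+ u ℕ.* toℕ b) - ι x)
    count⇒exist u x e = from (sumℕ-positive (λ a → sumℕ (term u x a)) (ℕ.≤-reflexive (sym e)))
      where
      from : ∃[ a ] 1 ≤ sumℕ (term u x a) → ∃[ a ] ∃[ b ] (a ∈ A × b ∈ B × + M ∣ + (toℕ a ℕ.+ u ℕ.* toℕ b) - ι x)
      from (a , h) = let (b , h′) = sumℕ-positive (term u x a) h in a , b , term⇒ u x a b h′

    count⇒unique : ∀ u x → count u x ≡ 1 → ∀ {a b a′ b′} → a ∈ A → b ∈ B → a′ ∈ A → b′ ∈ B →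
      + M ∣ + (toℕ a ℕ.+ u ℕ.* toℕ b) - ι x → + M ∣ + (toℕ a′ ℕ.+ u ℕ.* toℕ b′) - ι x → a ≡ a′
    count⇒unique u x e {a} {b} {a′} {b′} pa pb pa′ pb′ d d′ = sumℕ-one-unique (λ a → sumℕ (term u x a)) e
      (ℕ.≤-trans (ℕ.≤-reflexive (sym (⇒term u x a b pa pb d))) (sumℕ-member (term u x a) b))
      (ℕ.≤-trans (ℕ.≤-reflexive (sym (⇒term u x a′ b′ pa′ pb′ d′))) (sumℕ-member (term u x a′) b′))

    tiles⇒count : Tiles A B → ∀ x → count 1 x ≡ 1
    tiles⇒count (ex , un) x = from (ex x)
      where
      eq : ∀ a b → + M ∣ + (toℕ a ℕ.+ 1 ℕ.* toℕ b) - ι (a +ₘ b)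
      eq a b = ∣-sym (ι (a +ₘ b)) (+ (toℕ a ℕ.+ 1 ℕ.* toℕ b)) (subst (λ t → + M ∣ ι (a +ₘ b) - + (toℕ a ℕ.+ t)) (sym (ℕ.*-identityˡ (toℕ b))) (ι-+ a b))
      from : ∃[ a ] ∃[ b ] (a ∈ A × b ∈ B × a +ₘ b ≡ x) → count 1 x ≡ 1
      from (a , b , pa , pb , refl) = trans (sumℕ-pick a (λ a → sumℕ (term 1 x′ a)) (λ a′ a′≢a → sumℕ-zero (term 1 x′ a′) λ b′ → zero-term a′ b′ (λ (ea , _) → a′≢a ea)))
        (trans (sumℕ-pick b (term 1 x′ a) (λ b′ b′≢b → zero-term a b′ (λ (_ , eb) → b′≢b eb))) (⇒term 1 x′ a b pa pb (eq a b)))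
        where
        x′ = a +ₘ b
        zero-term : ∀ a′ b′ → ¬ (a′ ≡ a × b′ ≡ b) → term 1 x′ a′ b′ ≡ 0
        zero-term a′ b′ ne = ℕ.n<1⇒n≡0 (ℕ.≰⇒> λ h → let (pa′ , pb′ , d) = term⇒ 1 x′ a′ b′ h in
          ne (un a′ a b′ b pa′ pa pb′ pb (ι-injective {a′ +ₘ b′} {x′} (∣-trans (ι (a′ +ₘ b′)) (+ (toℕ a′ ℕ.+ 1 ℕ.* toℕ b′)) (ι x′) (∣-sym (+ (toℕ a′ ℕ.+ 1 ℕ.* toℕ b′)) (ι (a′ +ₘ b′)) (eq a′ b′)) d))))

    sizes : Tiles A B → sumℕ (indicator A) ℕ.* sumℕ (indicator B) ≡ M
    sizes t = trans (sym (sum-count 1)) (trans (sumℕ-cong (tiles⇒count t)) (ones M))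
      where
      ones : ∀ n → sumℕ {n} (λ _ → 1) ≡ n
      ones zero    = refl
      ones (suc n) = cong suc (ones n)

    -- Classes modulo m contain s elements of B on average.
    crowds : ∀ m s → .{{_ : NonZero m}} → sumℕ (indicator B) ≡ m ℕ.* s → ∀ c →
      Selection (λ b → b ∈ B × + m ∣ ι b - c) s ⊎ ∃[ c′ ] Selection (λ b → b ∈ B × + m ∣ ι b - c′) (suc s)
    crowds m s e c = from (average {m} {s} class (trans total e) (fromℕ< (ℤ.n%ℕd<d c m)))
      where
      inClass : Fin m → Fin M → ℕ
      inClass y b = if does (toℕ b ℕ.% m ℕ.≟ toℕ y) then 1 else 0
      inClass≤1 : ∀ y b → inClass y b ≤ 1
      inClass≤1 y b with does (toℕ b ℕ.% m ℕ.≟ toℕ y)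
      ... | true  = s≤s z≤n
      ... | false = z≤n
      weight : Fin m → Fin M → ℕ
      weight y b = inClass y b ℕ.* indicator B b
      class : Fin m → ℕ
      class y = sumℕ (weight y)
      one-class : ∀ b → sumℕ (λ y → inClass y b) ≡ 1
      one-class b = trans (sumℕ-pick r (λ y → inClass y b) (λ y ne → cong (if_then 1 else 0) (dec-false (toℕ b ℕ.% m ℕ.≟ toℕ y)
          λ eq → ne (Fin.toℕ-injective (trans (sym eq) (sym (Fin.toℕ-fromℕ< (ℕ.m%n<n (toℕ b) m))))))))
        (cong (if_then 1 else 0) (dec-true (toℕ b ℕ.% m ℕ.≟ toℕ r) (sym (Fin.toℕ-fromℕ< (ℕ.m%n<n (toℕ b) m)))))
        where r = fromℕ< (ℕ.m%n<n (toℕ b) m)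
      total : sumℕ class ≡ sumℕ (indicator B)
      total = trans (sumℕ-comm weight) (sumℕ-cong λ b → trans (sym (sumℕ-*ʳ (indicator B b) (λ y → inClass y b))) (trans (cong (ℕ._* indicator B b) (one-class b)) (ℕ.*-identityˡ _)))
      weight⇒ : ∀ y b → 1 ≤ weight y b → b ∈ B × + m ∣ ι b - + toℕ y
      weight⇒ y b h = let (h₁ , h₂) = factors (inClass y b) _ h in indicator⇒∈ h₂ , near h₁ (toℕ b ℕ.% m ℕ.≟ toℕ y)
        where
        near : 1 ≤ inClass y b → Dec (toℕ b ℕ.% m ≡ toℕ y) → + m ∣ ι b - + toℕ y
        near _  (yes eq) = subst (λ t → + m ∣ ι b - + t) eq (%-∣ (toℕ b) m)
        near h₁ (no ne)  = ⊥-elim (ℕ.<⇒≱ h₁ (ℕ.≤-reflexive (cong (if_then 1 else 0) (dec-false (toℕ b ℕ.% m ℕ.≟ toℕ y) ne))))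
      weight≤1 : ∀ y b → weight y b ≤ 1
      weight≤1 y b = ℕ.*-mono-≤ (inClass≤1 y b) (indicator≤1 B b)
      y₀ = fromℕ< (ℤ.n%ℕd<d c m)
      y₀≡c : + m ∣ + toℕ y₀ - c
      y₀≡c = ∣-sym c (+ toℕ y₀) (divides (c ℤ./ℕ m) (trans (cong₂ (λ s t → s - + t) (ℤ.a≡a%ℕn+[a/ℕn]*n c m) (Fin.toℕ-fromℕ< (ℤ.n%ℕd<d c m)))
        (solve 2 (λ x y → (x :+ y) :- x := y) refl (+ (c ℤ.%ℕ m)) ((c ℤ./ℕ m) * + m))))
      refine : ∀ y c′ t → + m ∣ + toℕ y - c′ → Selection (λ b → 1 ≤ weight y b) t → Selection (λ b → b ∈ B × + m ∣ ι b - c′) t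
      refine y c′ t d (selection g p inj) = selection g (λ a → let (pb , e′) = weight⇒ y (g a) (p a) in pb , ∣-trans (ι (g a)) (+ toℕ y) c′ e′ d) inj
      from : s ≤ class y₀ ⊎ ∃[ y ] suc s ≤ class y →
        Selection (λ b → b ∈ B × + m ∣ ι b - c) s ⊎ ∃[ c′ ] Selection (λ b → b ∈ B × + m ∣ ι b - c′) (suc s)
      from (inj₁ le) = inj₁ (refine y₀ c s y₀≡c (enumerate (weight y₀) (weight≤1 y₀) s le))
      from (inj₂ (y , le)) = inj₂ (+ toℕ y , refine y (+ toℕ y) (suc s) (∣-self (+ toℕ y)) (enumerate (weight y) (weight≤1 y) (suc s) le))

  module InFrame (F : Frame) (M : ℕ) .{{_ : NonZero M}} (M≡ : M ≡ Frame.π F i ℕ.* Frame.Π′ F i ℕ.* (Frame.π F j ℕ.* Frame.Π′ F j ℕ.* (Frame.π F k ℕ.* Frame.Π′ F k))) where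
    open FrameProperties F public
    open Multiples F
    open ZM M
    open Residues M public

    +M : + M ≡ + Π i * (+ Π j * + Π k)
    +M = trans (cong +_ M≡) (trans (ℤ.pos-* (Π i) _) (cong (+ Π i *_) (ℤ.pos-* (Π j) (Π k))))

    private
      multiply : ∀ ν m {d} → UnitAt ν m → Z ν d → m ∣ d → + Π ν * m ∣ d
      multiply ν m {d} pm z (divides t refl) = extract (unit-cancel-Z {ν} {m} {t} pm (by z (ℤ.*-comm t m)))
        where
        extract : Z ν t → + Π ν * m ∣ t * m
        extract (divides s refl) = divides s (ℤ.*-assoc s (+ Π ν) m)

    Eq⇒∣ : ∀ {d} → Eq d → + M ∣ d
    Eq⇒∣ {d} e = subst (_∣ d) (sym +M) (multiply i (+ Π j * + Π k) (unit-* {i} {+ Π j} {+ Π k} (π∤Π {i} {j} i≢j) (π∤Π {i} {k} i≢k)) (e i)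
      (multiply j (+ Π k) (π∤Π {j} {k} j≢k) (e j) (e k)))

    ∣⇒Eq : ∀ {d} → + M ∣ d → Eq d
    ∣⇒Eq {d} m i = ℤ∣.∣-trans (subst (+ Π i ∣_) (sym +M) (ℤ∣.∣m⇒∣m*n (+ Π j * + Π k) ℤ∣.∣-refl)) m
    ∣⇒Eq {d} m j = ℤ∣.∣-trans (subst (+ Π j ∣_) (sym +M) (ℤ∣.∣n⇒∣m*n (+ Π i) (ℤ∣.∣m⇒∣m*n (+ Π k) ℤ∣.∣-refl))) m
    ∣⇒Eq {d} m k = ℤ∣.∣-trans (subst (+ Π k ∣_) (sym +M) (ℤ∣.∣n⇒∣m*n (+ Π i) (ℤ∣.∣n⇒∣m*n (+ Π j) ℤ∣.∣-refl))) m

    private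
      multiplyW : ∀ ν m {d} → UnitAt ν m → W ν d → m ∣ d → + Π′ ν * m ∣ d
      multiplyW ν m {d} pm z (divides t refl) = extract (unit-cancel-W {ν} {m} {t} pm (by z (ℤ.*-comm t m)))
        where
        extract : W ν t → + Π′ ν * m ∣ t * m
        extract (divides s refl) = divides s (ℤ.*-assoc s (+ Π′ ν) m)

      unit-factor : ∀ {ν u} v → UnitAt ν (v * u) → UnitAt ν u
      unit-factor v p d = p (v ∣* d)

      π∤Π′ : ∀ {μ ν} → π μ ≢ π ν → UnitAt μ (+ Π′ ν)
      π∤Π′ {μ} {ν} ne = unit-factor {μ} {+ Π′ ν} (+ π ν) (subst (UnitAt μ) (ℤ.pos-* (π ν) (Π′ ν)) (π∤Π {μ} {ν} ne))

    -- The number D(M) = p_i^(n_i-1) p_j p_k.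
    D : ℕ
    D = Π′ i ℕ.* (Π′ j ℕ.* Π′ k)

    +D : + D ≡ + Π′ i * (+ Π′ j * + Π′ k)
    +D = trans (ℤ.pos-* (Π′ i) _) (cong (+ Π′ i *_) (ℤ.pos-* (Π′ j) (Π′ k)))

    W⇒D∣ : ∀ {d} → W i d → W j d → W k d → + D ∣ d
    W⇒D∣ {d} wi wj wk = subst (_∣ d) (sym +D) (multiplyW i (+ Π′ j * + Π′ k) (unit-* {i} {+ Π′ j} {+ Π′ k} (π∤Π′ {i} {j} i≢j) (π∤Π′ {i} {k} i≢k)) wi
      (multiplyW j (+ Π′ k) (π∤Π′ {j} {k} j≢k) wj wk))

    D∣⇒W : ∀ {d} → + D ∣ d → ∀ ν → W ν d
    D∣⇒W {d} m i = ℤ∣.∣-trans (subst (+ Π′ i ∣_) (sym +D) (ℤ∣.∣m⇒∣m*n (+ Π′ j * + Π′ k) ℤ∣.∣-refl)) m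
    D∣⇒W {d} m j = ℤ∣.∣-trans (subst (+ Π′ j ∣_) (sym +D) (ℤ∣.∣n⇒∣m*n (+ Π′ i) (ℤ∣.∣m⇒∣m*n (+ Π′ k) ℤ∣.∣-refl))) m
    D∣⇒W {d} m k = ℤ∣.∣-trans (subst (+ Π′ k ∣_) (sym +D) (ℤ∣.∣n⇒∣m*n (+ Π′ i) (ℤ∣.∣n⇒∣m*n (+ Π′ j) ℤ∣.∣-refl))) m

    prime-divisor : ∀ {p} → Prime p → p ℕ.∣ M → ∃[ ν ] p ≡ π ν
    prime-divisor {p} pp d = from (euclidsLemma (Π i) _ pp (subst (p ℕ.∣_) M≡ d))
      where
      at : ∀ ν → p ℕ.∣ Π ν → ∃[ ν ] p ≡ π ν
      at ν e = ν , prime-∣-^ pp (prime ν) (suc (ex ν)) (subst (p ℕ.∣_) (Π-pow ν) e)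
      from : p ℕ.∣ Π i ⊎ p ℕ.∣ Π j ℕ.* Π k → ∃[ ν ] p ≡ π ν
      from (inj₁ e) = at i e
      from (inj₂ e) = from′ (euclidsLemma (Π j) (Π k) pp e)
        where
        from′ : p ℕ.∣ Π j ⊎ p ℕ.∣ Π k → ∃[ ν ] p ≡ π ν
        from′ (inj₁ e) = at j e
        from′ (inj₂ e) = at k e

    -- Fibres and planes in coordinates

    others : Dir → ℕ
    others i = Π j ℕ.* Π k
    others j = Π i ℕ.* Π k
    others k = Π i ℕ.* Π j

    others-unit : ∀ ν → UnitAt ν (+ others ν)
    others-unit i = subst (UnitAt i) (sym (ℤ.pos-* (Π j) (Π k))) (unit-* {i} {+ Π j} {+ Π k} (π∤Π {i} {j} i≢j) (π∤Π {i} {k} i≢k))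
    others-unit j = subst (UnitAt j) (sym (ℤ.pos-* (Π i) (Π k))) (unit-* {j} {+ Π i} {+ Π k} (π∤Π {j} {i} (≢-sym i≢j)) (π∤Π {j} {k} j≢k))
    others-unit k = subst (UnitAt k) (sym (ℤ.pos-* (Π i) (Π j))) (unit-* {k} {+ Π i} {+ Π j} (π∤Π {k} {i} (≢-sym i≢k)) (π∤Π {k} {j} (≢-sym j≢k)))

    -- M / `π ν`, factored so that its divisibility in every direction is visible.
    step : Dir → ℕ
    step ν = Π′ ν ℕ.* others ν

    private
      rearrange-i : ∀ p P q r → p ℕ.* P ℕ.* (q ℕ.* r) ≡ P ℕ.* (q ℕ.* r) ℕ.* p
      rearrange-i p P q r = trans (cong (ℕ._* (q ℕ.* r)) (ℕ.*-comm p P)) (trans (ℕ.*-assoc P p _) (trans (cong (P ℕ.*_) (ℕ.*-comm p _)) (sym (ℕ.*-assoc P _ p))))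

      swap-inner : ∀ a b c → a ℕ.* (b ℕ.* c) ≡ b ℕ.* (a ℕ.* c)
      swap-inner a b c = trans (sym (ℕ.*-assoc a b c)) (trans (cong (ℕ._* c) (ℕ.*-comm a b)) (ℕ.*-assoc b a c))

    M≡step : ∀ ν → M ≡ step ν ℕ.* π ν
    M≡step i = trans M≡ (rearrange-i (π i) (Π′ i) (Π j) (Π k))
    M≡step j = trans M≡ (trans (swap-inner (Π i) (Π j) (Π k)) (rearrange-i (π j) (Π′ j) (Π i) (Π k)))
    M≡step k = trans M≡ (trans (cong (Π i ℕ.*_) (ℕ.*-comm (Π j) (Π k))) (trans (swap-inner (Π i) (Π k) (Π j)) (rearrange-i (π k) (Π′ k) (Π i) (Π j))))

    /'≡step : ∀ ν → M /' π ν ≡ step ν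
    /'≡step ν = go (π ν) (πnz ν) (M≡step ν)
      where
      go : ∀ p → NonZero p → M ≡ step ν ℕ.* p → M /' p ≡ step ν
      go (suc p) _ e = trans (cong (ℕ._/ suc p) e) (ℕ.m*n/n≡m (step ν) (suc p))

    step-W : ∀ ν → W ν (+ step ν)
    step-W ν = ℕ∣⇒∣ (ℕ.m∣m*n (others ν))

    step-Z : ∀ μ ν → μ ≢ ν → Z μ (+ step ν)
    step-Z μ ν ne = ℕ∣⇒∣ (ℕ.∣n⇒∣m*n (Π′ ν) (go μ ν ne))
      where
      go : ∀ μ ν → μ ≢ ν → Π μ ℕ.∣ others ν
      go i i ne = ⊥-elim (ne refl)
      go i j ne = ℕ.m∣m*n (Π k)
      go i k ne = ℕ.m∣m*n (Π j)
      go j i ne = ℕ.m∣m*n (Π k)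
      go j j ne = ⊥-elim (ne refl)
      go j k ne = ℕ.n∣m*n (Π i)
      go k i ne = ℕ.n∣m*n (Π j)
      go k j ne = ℕ.n∣m*n (Π i)
      go k k ne = ⊥-elim (ne refl)

    -- At ν the number `step ν` is `Π′ ν` times the unit `others ν`; t is found after dividing by
    -- that unit.
    multiple : ∀ ν d → W ν d → ∃[ t ] (t < π ν × Z ν (d - + t * + step ν))
    multiple ν d w = from (inverse ν (+ others ν) (others-unit ν))
      where
      lem : ∀ d m v P t → m * (d * v - P * t) - d * (m * v - + 1) ≡ d - t * (P * m)
      lem = solve 5 (λ d m v P t → m :* (d :* v :- P :* t) :- d :* (m :* v :- con (+ 1)) := d :- t :* (P :* m)) refl
      from : ∃[ v ] Z ν (+ others ν * v - + 1) → ∃[ t ] (t < π ν × Z ν (d - + t * + step ν))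
      from (v , e) = from′ (mult-surjective ν (d * v) (by (v ∣* w) (ℤ.*-comm v d)))
        where
        from′ : ∃[ a ] Z ν (d * v - mult ν a) → ∃[ t ] (t < π ν × Z ν (d - + t * + step ν))
        from′ (a , z) = toℕ a , Fin.toℕ<n a , by ((+ others ν ∣* z) ∣- (d ∣* e))
          (trans (lem d (+ others ν) v (+ Π′ ν) (+ toℕ a)) (cong (λ s → d - + toℕ a * s) (sym (ℤ.pos-* (Π′ ν) (others ν)))))

    Near : Dir → ℤ → Set
    Near ν d = W ν d × (∀ μ → μ ≢ ν → Z μ d)

    ι-step : ∀ ν x t → + M ∣ ι (x +ₘ [ t ℕ.* (M /' π ν) ]) - (ι x + + t * + step ν)
    ι-step ν x t = ∣-trans (ι (x +ₘ [ n ])) (ι x + ι [ n ]) (ι x + + t * + step ν) (ι-+ x [ n ])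
      (by (ι-[] n) (trans (lem (ι x) (ι [ n ]) (+ n)) (cong (λ s → (ι x + ι [ n ]) - (ι x + s)) (trans (cong (λ s → + (t ℕ.* s)) (/'≡step ν)) (ℤ.pos-* t (step ν))))))
      where
      n = t ℕ.* (M /' π ν)
      lem : ∀ x a b → a - b ≡ (x + a) - (x + b)
      lem = solve 3 (λ x a b → a :- b := (x :+ a) :- (x :+ b)) refl

    fibre⇒ : ∀ ν {x y} → InFiber (π ν) x y → Near ν (ι y - ι x)
    fibre⇒ ν {x} {y} (t , _ , refl) = by (Z⇒W {ν} (e ν) ∣+ (+ t ∣* step-W ν)) (lem (ι y) (ι x) (+ t * + step ν)) ,
      λ μ ne → by (e μ ∣+ (+ t ∣* step-Z μ ν ne)) (lem (ι y) (ι x) (+ t * + step ν))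
      where
      e : Eq (ι y - (ι x + + t * + step ν))
      e = ∣⇒Eq (ι-step ν x t)
      lem : ∀ y x s → (y - (x + s)) + s ≡ y - x
      lem = solve 3 (λ y x s → (y :- (x :+ s)) :+ s := y :- x) refl

    ⇒fibre : ∀ ν {x y} → Near ν (ι y - ι x) → InFiber (π ν) x y
    ⇒fibre ν {x} {y} (w , z) = from (multiple ν (ι y - ι x) w)
      where
      from : ∃[ t ] (t < π ν × Z ν ((ι y - ι x) - + t * + step ν)) → InFiber (π ν) x y
      from (t , t< , e) = t , t< , ι-injective (∣-trans (ι y) (ι x + + t * + step ν) (ι (x +ₘ [ t ℕ.* (M /' π ν) ]))
        (Eq⇒∣ eq) (∣-sym (ι (x +ₘ [ t ℕ.* (M /' π ν) ])) (ι x + + t * + step ν) (ι-step ν x t)))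
        where
        lem : ∀ y x s → (y - x) - s ≡ y - (x + s)
        lem = solve 3 (λ y x s → (y :- x) :- s := y :- (x :+ s)) refl
        eq : Eq (ι y - (ι x + + t * + step ν))
        eq μ = decide (μ ≟D ν)
          where
          decide : Dec (μ ≡ ν) → Z μ (ι y - (ι x + + t * + step ν))
          decide (yes refl) = by e (lem (ι y) (ι x) (+ t * + step ν))
          decide (no ne) = by (z μ ne ∣- (+ t ∣* step-Z μ ν ne)) (lem (ι y) (ι x) (+ t * + step ν))

    InPlane′ : Fin M → Fin M → Set
    InPlane′ x y = Z i (ι y - ι x) × W j (ι y - ι x) × W k (ι y - ι x)

    plane⇒ : ∀ {x y} → InPlane (π j) (π k) x y → InPlane′ x y
    plane⇒ {x} {y} (t , u , t< , u< , refl) = combine (fibre⇒ j {x} {z} (t , t< , refl)) (fibre⇒ k {z} {y} (u , u< , refl))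
      where
      z = x +ₘ [ t ℕ.* (M /' π j) ]
      combine : Near j (ι z - ι x) → Near k (ι y - ι z) → InPlane′ x y
      combine (wj , zj) (wk , zk) = ∣-trans (ι y) (ι z) (ι x) (zk i λ ()) (zj i λ ()) ,
        ∣-trans (ι y) (ι z) (ι x) (Z⇒W {j} (zk j λ ())) wj , ∣-trans (ι y) (ι z) (ι x) wk (Z⇒W {k} (zj k λ ()))

    ⇒plane : ∀ {x y} → InPlane′ x y → InPlane (π j) (π k) x y
    ⇒plane {x} {y} (zi , wj , wk) = from (crt (triple (ι x) (ι y) (ι x)))
      where
      from : ∃[ t ] (∀ ν → Z ν (t - triple (ι x) (ι y) (ι x) ν)) → InPlane (π j) (π k) x y
      from (t , e) = build (⇒fibre j {x} {z} near-j) (⇒fibre k {z} {y} near-k)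
        where
        z = res t
        zt : Eq (ι z - t)
        zt = ∣⇒Eq (∣-sym t (ι z) (ι-res t))
        at : ∀ ν → Z ν (ι z - triple (ι x) (ι y) (ι x) ν)
        at ν = ∣-trans (ι z) t (triple (ι x) (ι y) (ι x) ν) (zt ν) (e ν)
        near-j : Near j (ι z - ι x)
        near-j = ∣-trans (ι z) (ι y) (ι x) (Z⇒W {j} (at j)) wj , λ { i _ → at i ; j ne → ⊥-elim (ne refl) ; k _ → at k }
        near-k : Near k (ι y - ι z)
        near-k = ∣-trans (ι y) (ι x) (ι z) wk (∣-sym (ι z) (ι x) (Z⇒W {k} (at k))) ,
          λ { i _ → ∣-trans (ι y) (ι x) (ι z) zi (∣-sym (ι z) (ι x) (at i)) ; j _ → ∣-sym (ι z) (ι y) (at j) ; k ne → ⊥-elim (ne refl) }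
        build : InFiber (π j) x z → InFiber (π k) z y → InPlane (π j) (π k) x y
        build (t , t< , e₁) (u , u< , e₂) = t , u , t< , u< , trans e₂ (cong (_+ₘ [ u ℕ.* (M /' π k) ]) e₁)

    module _ (A : Subset M) (a : Fin M) (S : Fin M → Set) (S⇒ : ∀ {y} → S y → y ∈ A × InPlane′ a y) (⇒S : ∀ {y} → y ∈ A → InPlane′ a y → S y)
      (fibred : Fibered (π j) S) where

      plane-fibre : ∀ {x y} → member A x → Z i (x - ι a) → W j (x - ι a) → W k (x - ι a) → Z i (y - x) → W j (y - x) → Z k (y - x) → member A y
      plane-fibre {x} {y} px zi wj wk zi′ wj′ zk′ = from fibred
        where
        X = res x
        Y = res y
        X≡ : Eq (ι X - x)
        X≡ = ∣⇒Eq (∣-sym x (ι X) (ι-res x))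
        Y≡ : Eq (ι Y - y)
        Y≡ = ∣⇒Eq (∣-sym y (ι Y) (ι-res y))
        from : Fibered (π j) S → member A y
        from (S′ , S′⊆ , eq) = use (Equivalence.to (eq X) (⇒S px (∣-trans (ι X) x (ι a) (X≡ i) zi , ∣-trans (ι X) x (ι a) (Z⇒W {j} (X≡ j)) wj , ∣-trans (ι X) x (ι a) (Z⇒W {k} (X≡ k)) wk)))
          where
          use : ∃[ s ] (s ∈ S′ × InFiber (π j) s X) → member A y
          use (s , s∈ , f) = proj₁ (S⇒ (Equivalence.from (eq Y) (s , s∈ , ⇒fibre j near)))
            where
            n = fibre⇒ j f
            Y-X : ∀ ν → Z ν (y - x) → Z ν (ι Y - ι X)
            Y-X ν z = ∣-trans (ι Y) y (ι X) (Y≡ ν) (∣-trans y x (ι X) z (∣-sym (ι X) x (X≡ ν)))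
            near : Near j (ι Y - ι s)
            near = ∣-trans (ι Y) (ι X) (ι s) (∣-trans (ι Y) y (ι X) (Z⇒W {j} (Y≡ j)) (∣-trans y x (ι X) wj′ (∣-sym (ι X) x (Z⇒W {j} (X≡ j))))) (proj₁ n) ,
              λ { i _ → ∣-trans (ι Y) (ι X) (ι s) (Y-X i zi′) (proj₂ n i λ ()) ; j ne → ⊥-elim (ne refl) ; k _ → ∣-trans (ι Y) (ι X) (ι s) (Y-X k zk′) (proj₂ n k λ ()) }

      -- If the whole k-line through `a` belonged to `A`, the j-fibres through its points would fill
      -- the plane, which would then be fibred in direction k as well.
      plane-gap : ¬ Fibered (π k) S → ∃[ v ] (¬ member A v × Z i (v - ι a) × Z j (v - ι a) × W k (v - ι a))
      plane-gap nf = from (dec∃ dec P-resp)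
        where
        P : ℤ → Set
        P v = ¬ member A v × Z i (v - ι a) × Z j (v - ι a) × W k (v - ι a)
        dec : ∀ v → Dec (P v)
        dec v = ¬? (res v ∈? A) ×-dec (Z? i (v - ι a) ×-dec (Z? j (v - ι a) ×-dec W? k (v - ι a)))
        P-resp : ∀ x y → + M ∣ x - y → P y → P x
        P-resp x y m (ny , zi , zj , wk) = (λ p → ny (member-resp A y x (∣-sym x y m) p)) , ∣-trans x y (ι a) (∣⇒Eq m i) zi , ∣-trans x y (ι a) (∣⇒Eq m j) zj , ∣-trans x y (ι a) (Z⇒W {k} (∣⇒Eq m k)) wk
        from : Dec (∃ P) → ∃[ v ] (¬ member A v × Z i (v - ι a) × Z j (v - ι a) × W k (v - ι a))
        from (yes p) = p
        from (no none) = ⊥-elim (nf (subset decS , (λ y y∈ → let (p , q) = ∈-subset⁻ decS y∈ in ⇒S p q) , λ y → mk⇔ (to y) (back y)))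
          where
          decS : ∀ y → Dec (y ∈ A × InPlane′ a y)
          decS y = (y ∈? A) ×-dec (Z? i (ι y - ι a) ×-dec (W? j (ι y - ι a) ×-dec W? k (ι y - ι a)))
          to : ∀ y → S y → ∃[ s ] (s ∈ subset decS × InFiber (π k) s y)
          to y s = y , ∈-subset⁺ decS (S⇒ s) , ⇒fibre k (∣-self (ι y) , λ μ _ → ∣-self (ι y))
          all : ∀ v → Z i (v - ι a) → Z j (v - ι a) → W k (v - ι a) → member A v
          all v zi zj wk = decidable-stable (res v ∈? A) λ nv → none (v , nv , zi , zj , wk)
          back : ∀ y → ∃[ s ] (s ∈ subset decS × InFiber (π k) s y) → S y
          back y (s , s∈ , f) = finish (∈-subset⁻ decS s∈) (fibre⇒ k f)
            where
            finish : s ∈ A × InPlane′ a s → Near k (ι y - ι s) → S y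
            finish (_ , zi , wj , wk) (wk′ , z′) = go (crt (triple (ι a) (ι a) (ι y)))
              where
              yi : Z i (ι y - ι a)
              yi = ∣-trans (ι y) (ι s) (ι a) (z′ i λ ()) zi
              yj : W j (ι y - ι a)
              yj = ∣-trans (ι y) (ι s) (ι a) (Z⇒W {j} (z′ j λ ())) wj
              yk : W k (ι y - ι a)
              yk = ∣-trans (ι y) (ι s) (ι a) wk′ wk
              go : ∃[ v ] (∀ ν → Z ν (v - triple (ι a) (ι a) (ι y) ν)) → S y
              go (v , e) = ⇒S (member-ι⁻ (plane-fibre {v} {ι y} (all v (e i) (e j) wkv) (e i) (Z⇒W {j} (e j)) wkv
                  (∣-trans (ι y) (ι a) v yi (∣-sym v (ι a) (e i))) (∣-trans (ι y) (ι a) v yj (∣-sym v (ι a) (Z⇒W {j} (e j)))) (∣-sym v (ι y) (e k)))) (yi , yj , yk)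
                where
                wkv : W k (v - ι a)
                wkv = ∣-trans v (ι y) (ι a) (Z⇒W {k} (e k)) yk

    -- Tilings and crowds

    tiling : ∀ A B → Tiles A B → Tiling F (member A) (member B)
    tiling A B t = record
      { respA = λ x y e → member-resp A x y (Eq⇒∣ e) ; respB = λ x y e → member-resp B x y (Eq⇒∣ e)
      ; decA = λ x → res x ∈? A ; decB = λ x → res x ∈? B
      ; exist = exist ; uniq = uniq }
      where
      open TilingCounts M A B
      module _ (u : ℤ) (pu : ∀ ν → UnitAt ν u) where
        -- `tijdeman` is about natural multipliers, so the integer unit is replaced by its residue
        -- modulo M.
        v : ℕ
        v = u ℤ.%ℕ M
        u-v : + M ∣ u - + v
        u-v = subst (λ s → + M ∣ u - + s) (Fin.toℕ-fromℕ< (ℤ.n%ℕd<d u M)) (ι-res u)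
        π∤v : ∀ ν → ¬ π ν ℕ.∣ v
        π∤v ν d = pu ν (∣-transport u (+ v) (Z⇒π {ν} (∣⇒Eq u-v ν)) (ℕ∣⇒∣ d))
        one : ∀ x → count v x ≡ 1
        one = tijdeman (indicator-01 B) (tiles⇒count t) v ⦃ ℕ.≢-nonZero (λ v≡0 → π∤v i (subst (π i ℕ.∣_) (sym v≡0) (π i ℕ.∣0))) ⦄
          λ pp p∣v p∣M → let (ν , e) = prime-divisor pp p∣M in π∤v ν (subst (ℕ._∣ v) e p∣v)
        pos : ∀ a b → + (toℕ a ℕ.+ v ℕ.* toℕ b) ≡ ι a + + v * ι b
        pos a b = cong (λ s → ι a + s) (ℤ.pos-* v (toℕ b))
        exist : ∀ x → ∃[ a ] ∃[ b ] (member A a × member B b × Eq (x - (a + u * b)))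
        exist x = from (count⇒exist v (res x) (one (res x)))
          where
          lem : ∀ x r a b u v → ((x - r) - ((a + v * b) - r)) - b * (u - v) ≡ x - (a + u * b)
          lem = solve 6 (λ x r a b u v → ((x :- r) :- ((a :+ v :* b) :- r)) :- b :* (u :- v) := x :- (a :+ u :* b)) refl
          from : ∃[ a ] ∃[ b ] (a ∈ A × b ∈ B × + M ∣ + (toℕ a ℕ.+ v ℕ.* toℕ b) - ι (res x)) → ∃[ a ] ∃[ b ] (member A a × member B b × Eq (x - (a + u * b)))
          from (a , b , pa , pb , d) = ι a , ι b , member-ι pa , member-ι pb , ∣⇒Eq (by ((ι-res x ∣- subst (λ s → + M ∣ s - ι (res x)) (pos a b) d) ∣- (ι b ∣* u-v)) (lem x (ι (res x)) (ι a) (ι b) u (+ v)))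
        uniq : ∀ a a′ b b′ → member A a → member A a′ → member B b → member B b′ → Eq ((a + u * b) - (a′ + u * b′)) → Eq (a - a′)
        uniq a a′ b b′ pa pa′ pb pb′ e = ∣⇒Eq (∣-trans a (ι (res a)) a′ (ι-res a) (subst (λ r → + M ∣ ι r - a′) (sym same) (∣-sym a′ (ι (res a′)) (ι-res a′))))
          where
          n = toℕ (res a) ℕ.+ v ℕ.* toℕ (res b)
          n′ = toℕ (res a′) ℕ.+ v ℕ.* toℕ (res b′)
          approx : ∀ a b → + M ∣ + (toℕ (res a) ℕ.+ v ℕ.* toℕ (res b)) - (a + u * b)
          approx a b = by (∣-neg (ι-res a ∣+ ((+ v ∣* ι-res b) ∣+ (b ∣* u-v)))) (trans (lem a b (ι (res a)) (ι (res b)) u (+ v)) (cong (_- (a + u * b)) (sym (pos (res a) (res b)))))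
            where
            lem : ∀ a b ra rb u v → - ((a - ra) + (v * (b - rb) + b * (u - v))) ≡ (ra + v * rb) - (a + u * b)
            lem = solve 6 (λ a b ra rb u v → :- ((a :- ra) :+ (v :* (b :- rb) :+ b :* (u :- v))) := (ra :+ v :* rb) :- (a :+ u :* b)) refl
          x = res (+ n)
          same : res a ≡ res a′
          same = count⇒unique v x (one x) pa pb pa′ pb′ (ι-res (+ n))
            (∣-trans (+ n′) (+ n) (ι x) (∣-trans (+ n′) (a′ + u * b′) (+ n) (approx a′ b′) (∣-trans (a′ + u * b′) (a + u * b) (+ n) (∣-sym (a + u * b) (a′ + u * b′) (Eq⇒∣ e)) (∣-sym (+ n) (a + u * b) (approx a b)))) (ι-res (+ n)))

    tiles : ∀ {𝒜 : ℤ → Set} B (d : ∀ x → Dec (𝒜 (ι x))) → (∀ x y → Eq (x - y) → 𝒜 y → 𝒜 x) →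
      (∀ x → ∃[ a ] ∃[ b ] (𝒜 a × member B b × Eq (x - (a + b)))) →
      (∀ {a a′ b b′} → 𝒜 a → 𝒜 a′ → member B b → member B b′ → Eq ((a + b) - (a′ + b′)) → Eq (a - a′)) → Tiles (subset d) B
    tiles {𝒜} B d 𝒜-resp ex un = exist , uniq
      where
      exist : ∀ x → ∃[ a ] ∃[ b ] (a ∈ subset d × b ∈ B × a +ₘ b ≡ x)
      exist x = from (ex (ι x))
        where
        from : ∃[ a ] ∃[ b ] (𝒜 a × member B b × Eq (ι x - (a + b))) → ∃[ a ] ∃[ b ] (a ∈ subset d × b ∈ B × a +ₘ b ≡ x)
        from (a , b , pa , pb , e) = res a , res b , ∈-subset⁺ d (𝒜-resp (ι (res a)) a (∣⇒Eq (∣-sym a (ι (res a)) (ι-res a))) pa) , pb ,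
          ι-injective (∣-trans (ι (res a +ₘ res b)) (ι (res a) + ι (res b)) (ι x) (ι-+ (res a) (res b))
            (by (∣-neg (Eq⇒∣ e ∣+ (ι-res a ∣+ ι-res b))) (lem (ι x) a b (ι (res a)) (ι (res b)))))
          where
          lem : ∀ x a b ra rb → - ((x - (a + b)) + ((a - ra) + (b - rb))) ≡ (ra + rb) - x
          lem = solve 5 (λ x a b ra rb → :- ((x :- (a :+ b)) :+ ((a :- ra) :+ (b :- rb))) := (ra :+ rb) :- x) refl
      uniq : ∀ a a′ b b′ → a ∈ subset d → a′ ∈ subset d → b ∈ B → b′ ∈ B → a +ₘ b ≡ a′ +ₘ b′ → a ≡ a′ × b ≡ b′
      uniq a a′ b b′ pa pa′ pb pb′ e = a≡ , b≡
        where
        sums : + M ∣ (ι a + ι b) - (ι a′ + ι b′)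
        sums = ∣-trans (ι a + ι b) (ι (a +ₘ b)) (ι a′ + ι b′) (∣-sym (ι (a +ₘ b)) (ι a + ι b) (ι-+ a b)) (subst (λ s → + M ∣ ι s - (ι a′ + ι b′)) (sym e) (ι-+ a′ b′))
        diff : + M ∣ ι a - ι a′
        diff = Eq⇒∣ (un {ι a} {ι a′} {ι b} {ι b′} (∈-subset⁻ d pa) (∈-subset⁻ d pa′) (member-ι {B} pb) (member-ι {B} pb′) (∣⇒Eq sums))
        a≡ : a ≡ a′
        a≡ = ι-injective diff
        lem : ∀ a b a′ b′ → ((a + b) - (a′ + b′)) - (a - a′) ≡ b - b′
        lem = solve 4 (λ a b a′ b′ → ((a :+ b) :- (a′ :+ b′)) :- (a :- a′) := b :- b′) refl
        b≡ : b ≡ b′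
        b≡ = ι-injective (by (sums ∣- diff) (lem (ι a) (ι b) (ι a′) (ι b′)))

    crowds′ : ∀ A B {R : ℤ → Set} m s → .{{_ : NonZero m}} → (∀ {d} → + m ∣ d → R d) → sumℕ (indicator B) ≡ m ℕ.* s → ∀ c →
      Crowd F (member B) R s c ⊎ ∃[ c′ ] Crowd F (member B) R (suc s) c′
    crowds′ A B {R} m s m⇒R e c = from (TilingCounts.crowds M A B m s e c)
      where
      crowd : ∀ {t c} → Selection (λ b → b ∈ B × + m ∣ ι b - c) t → Crowd F (member B) R t c
      crowd (selection g p inj) = record
        { member = λ a → ι (g a) ; isMember = λ a → member-ι (proj₁ (p a)) ; near = λ a → m⇒R (proj₂ (p a))
        ; distinct = λ {a} {b} ne eq → ne (inj a b (ι-injective (Eq⇒∣ eq))) }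
      from : Selection (λ b → b ∈ B × + m ∣ ι b - c) s ⊎ ∃[ c′ ] Selection (λ b → b ∈ B × + m ∣ ι b - c′) (suc s) →
        Crowd F (member B) R s c ⊎ ∃[ c′ ] Crowd F (member B) R (suc s) c′
      from (inj₁ σ) = inj₁ (crowd σ)
      from (inj₂ (c′ , σ)) = inj₂ (c′ , crowd σ)

  -- Mask polynomials and the effect of a fibre shift on them

  weighted : ∀ {n} → (Fin n → ℕ) → Poly
  weighted f = sumP (λ x → κ (f x) *ₚ mono (toℕ x))

  weighted-cong : ∀ {n} {f g : Fin n → ℕ} → (∀ x → f x ≡ g x) → weighted f ≋ weighted g
  weighted-cong {f = f} e = sumP-cong λ x → subst (λ t → κ (f x) *ₚ mono (toℕ x) ≋ κ t *ₚ mono (toℕ x)) (e x) ≋-refl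

  weighted-+ : ∀ {n} (f g : Fin n → ℕ) → weighted (λ x → f x ℕ.+ g x) ≋ weighted f +ₚ weighted g
  weighted-+ f g = ≋-trans (sumP-cong λ x → ≋-trans (*ₚ-cong (κ-+ (f x) (g x)) (≋-refl {mono (toℕ x)})) (*ₚ-distribʳ (mono (toℕ x)) (κ (f x)) (κ (g x))))
    (sumP-+ (λ x → κ (f x) *ₚ mono (toℕ x)) (λ x → κ (g x) *ₚ mono (toℕ x)))

  mask≋ : ∀ {n} (A : Subset n) → map (λ b → if b then + 1 else + 0) (toList A) ≋ weighted (indicator A)
  mask≋ [] = ≋-refl
  mask≋ {suc n} (b ∷ A) = ≋-trans (split (if b then + 1 else + 0) (map (λ b → if b then + 1 else + 0) (toList A))) (+ₚ-cong (head b)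
    (≋-trans (*ₚ-cong (≋-refl {mono 1}) (mask≋ A)) (≋-trans (sumP-*ˡ (mono 1) (λ x → κ (indicator A x) *ₚ mono (toℕ x)))
      (sumP-cong λ x → ≋-trans (solveₚ 3 (λ m c y → m ⊗ (c ⊗ y) ⊜ c ⊗ (m ⊗ y)) ≋-refl (mono 1) (κ (indicator A x)) (mono (toℕ x)))
        (*ₚ-cong (≋-refl {κ (indicator A x)}) (≋-sym (mono-+ 1 (toℕ x))))))))
    where
    split : ∀ a p → a ∷ p ≋ (a ∷ []) +ₚ mono 1 *ₚ p
    split a p = ≋-trans shape (+ₚ-cong (≋-refl {a ∷ []}) (≋-sym (≋-trans (0∷-* 1ₚ p) (∷-cong refl (*ₚ-identityˡ p)))))
      where
      shape : a ∷ p ≋ (a ∷ []) +ₚ (+ 0 ∷ p)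
      shape = mk≋ λ { zero → sym (ℤ.+-identityʳ a) ; (suc n) → refl }
    head : ∀ b → (if b then + 1 else + 0) ∷ [] ≋ κ (if b then 1 else 0) *ₚ mono 0
    head true  = ≋-sym (≋-trans (*ₚ-cong const-1 (≋-refl {1ₚ})) (*ₚ-identityˡ 1ₚ))
    head false = ≋-trans zeros (≋-sym (*ₚ-cong const-0 (≋-refl {1ₚ})))
      where
      zeros : + 0 ∷ [] ≋ []
      zeros = mk≋ λ { zero → refl ; (suc n) → refl }

  sum-geo : ∀ N t → sumP {t} (λ a → mono (toℕ a ℕ.* N)) ≋ geo N t
  sum-geo N zero    = ≋-refl
  sum-geo N (suc t) = +ₚ-cong (≋-refl {1ₚ}) (≋-trans (sumP-cong {t} λ a → mono-+ N (toℕ a ℕ.* N))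
    (≋-trans (≋-sym (sumP-*ˡ {t} (mono N) (λ a → mono (toℕ a ℕ.* N)))) (*ₚ-cong (≋-refl {mono N}) (sum-geo N t))))

  ~⇒∣ : ∀ {m φ f g} → φ ∣P m → Congruent m (+ 0) f g → φ ∣P g → φ ∣P f
  ~⇒∣ {m} {φ} {f} {g} dm (cong-by S T e) dg = ∣P-resp (≋-sym e′) (∣P-+ dg (∣P-*ʳ S dm))
    where
    e′ : f ≋ g +ₚ m *ₚ S
    e′ = ≋-trans e (+ₚ-cong (≋-refl {g}) (≋-trans (+ₚ-cong (≋-refl {m *ₚ S}) (*ₚ-cong const-0 (≋-refl {T}))) (+ₚ-identityʳ _)))

  mono-difference : ∀ d .{{_ : NonZero d}} x y → + d ∣ (+ x - + y) → EE d ∣P mono x +ₚ negₚ (mono y)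
  mono-difference d x y dv = ~⇒∣ {EE d} {EE d} {mono x +ₚ negₚ (mono y)} {[]} ∣P-refl
    (~-trans (~-+ (~-trans (mono~ x) (≋⇒~ (subst (λ n → mono (x ℕ.% d) ≋ mono n) (∣⇒%≡ x y d dv) ≋-refl))) (negate (mono~ y))) (≋⇒~ (negₚ-inverseʳ (mono (y ℕ.% d)))))
    ([] , ≋-sym (*ₚ-zeroʳ (EE d)))
    where
    open Congruence (EE d) (+ 0)
    open Convolution.Mod d (λ _ → 0) (λ _ → 0) (+ 0)
    negate : ∀ {f g} → f ~ g → negₚ f ~ negₚ g
    negate {f} {g} e = ~-trans (≋⇒~ (neg≋ f)) (~-trans (~-*ˡ (negₚ 1ₚ) e) (≋⇒~ (≋-sym (neg≋ g))))
      where
      neg≋ : ∀ f → negₚ f ≋ negₚ 1ₚ *ₚ f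
      neg≋ f = solveₚ 1 (λ f → ⊝ f ⊜ (⊝ Κ 1ₚ) ⊗ f) ≋-refl f

  -- A part φ of constant weight c is exchanged for a part φ′ of the same total and smaller constant
  -- weight c′. The balance equation is additive to avoid truncated subtraction.
  measure-decreases : ∀ {n} (w α α′ φ φ′ : Fin n → ℕ) c c′ → (∀ x → α′ x ℕ.+ φ x ≡ α x ℕ.+ φ′ x) → sumℕ α′ ≡ sumℕ α → 1 ≤ sumℕ φ →
    (∀ x → φ x ℕ.* w x ≡ φ x ℕ.* c) → (∀ x → φ′ x ℕ.* w x ≡ φ′ x ℕ.* c′) → c′ < c →
    sumℕ (λ x → α′ x ℕ.* w x) < sumℕ (λ x → α x ℕ.* w x)
  measure-decreases w α α′ φ φ′ c c′ bal card pos wφ wφ′ c′<c = ℕ.+-cancelʳ-< (sumℕ φ ℕ.* c) _ _ (begin-strict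
    S α′ ℕ.+ sumℕ φ ℕ.* c      ≡⟨ cong (S α′ ℕ.+_) (const-weight φ c wφ) ⟨
    S α′ ℕ.+ S φ               ≡⟨ sums ⟩
    S α ℕ.+ S φ′               ≡⟨ cong (S α ℕ.+_) (trans (const-weight φ′ c′ wφ′) (cong (ℕ._* c′) (sym φ≡φ′))) ⟩
    S α ℕ.+ sumℕ φ ℕ.* c′      <⟨ ℕ.+-monoʳ-< (S α) (ℕ.*-monoʳ-< (sumℕ φ) ⦃ ℕ.>-nonZero pos ⦄ c′<c) ⟩
    S α ℕ.+ sumℕ φ ℕ.* c       ∎)
    where
    open ℕ.≤-Reasoning
    S : (Fin _ → ℕ) → ℕ
    S f = sumℕ (λ x → f x ℕ.* w x)
    const-weight : ∀ f c → (∀ x → f x ℕ.* w x ≡ f x ℕ.* c) → S f ≡ sumℕ f ℕ.* c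
    const-weight f c h = trans (sumℕ-cong h) (sym (sumℕ-*ʳ c f))
    φ≡φ′ : sumℕ φ ≡ sumℕ φ′
    φ≡φ′ = ℕ.+-cancelˡ-≡ (sumℕ α) _ _ (trans (cong (ℕ._+ sumℕ φ) (sym card)) (trans (sym (sumℕ-+ α′ φ)) (trans (sumℕ-cong bal) (sumℕ-+ α φ′))))
    sums : S α′ ℕ.+ S φ ≡ S α ℕ.+ S φ′
    sums = trans (sym (sumℕ-+ (λ x → α′ x ℕ.* w x) (λ x → φ x ℕ.* w x))) (trans (sumℕ-cong λ x →
      trans (sym (ℕ.*-distribʳ-+ (w x) (α′ x) (φ x))) (trans (cong (ℕ._* w x) (bal x)) (ℕ.*-distribʳ-+ (w x) (α x) (φ′ x)))) (sumℕ-+ (λ x → α x ℕ.* w x) (λ x → φ′ x ℕ.* w x)))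

  module ShiftedMasks (F : Frame) (M : ℕ) .{{_ : NonZero M}} (M≡ : M ≡ Frame.π F i ℕ.* Frame.Π′ F i ℕ.* (Frame.π F j ℕ.* Frame.Π′ F j ℕ.* (Frame.π F k ℕ.* Frame.Π′ F k))) where
    open InFrame F M M≡
    open ZM M hiding (mask)

    NearJ : Fin M → Fin M → Set
    NearJ a x = Z i (ι x - ι a) × W j (ι x - ι a) × Z k (ι x - ι a)

    nearJ? : ∀ a x → Dec (NearJ a x)
    nearJ? a x = Z? i (ι x - ι a) ×-dec (W? j (ι x - ι a) ×-dec Z? k (ι x - ι a))

    nearInd : Fin M → Fin M → ℕ
    nearInd a x = if does (nearJ? a x) then 1 else 0

    toNear : ∀ {a x} → NearJ a x → Near j (ι x - ι a)
    toNear (zi , wj , zk) = wj , λ { i _ → zi ; j ne → ⊥-elim (ne refl) ; k _ → zk }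

    fromNear : ∀ {a x} → Near j (ι x - ι a) → NearJ a x
    fromNear (wj , z) = z i (λ ()) , wj , z k (λ ())

    N : ℕ
    N = step j

    -- Then Φ_s divides the difference of two fibres in direction j that agree in the other directions:
    -- either it divides each of them, or it divides X^x - X^x′ for representatives x, x′.
    Good : ℕ → Set
    Good s = 1 ≤ s × s ℕ.∣ M × (¬ s ℕ.∣ step j ⊎ s ℕ.∣ others j)

    private
      open Congruence (EE M) (+ 0)
      module C = Convolution M (λ _ → 0) (λ _ → 0)
      open C.Mod (+ 0)

      pos : ∀ a t → + (toℕ a ℕ.+ t ℕ.* N) ≡ ι a + + t * + N
      pos a t = cong (λ s → ι a + s) (ℤ.pos-* t N)

      hit⇒near : ∀ (a : Fin M) t x → C.hit (toℕ a ℕ.+ t ℕ.* N) x ≢ 0 → + M ∣ + (toℕ a ℕ.+ t ℕ.* N) - ι x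
      hit⇒near a t x h = go ((toℕ a ℕ.+ t ℕ.* N) ℕ.% M ℕ.≟ toℕ x)
        where
        go : Dec ((toℕ a ℕ.+ t ℕ.* N) ℕ.% M ≡ toℕ x) → + M ∣ + (toℕ a ℕ.+ t ℕ.* N) - ι x
        go (yes e) = subst (λ s → + M ∣ + (toℕ a ℕ.+ t ℕ.* N) - + s) e (%-∣ (toℕ a ℕ.+ t ℕ.* N) M)
        go (no ne) = ⊥-elim (h (C.hit-no _ x ne))

      nearInd-sum : ∀ a x → nearInd a x ≡ sumℕ {π j} (λ t → C.hit (toℕ a ℕ.+ toℕ t ℕ.* N) x)
      nearInd-sum a x = go (nearJ? a x)
        where
        lem : ∀ a s x → - ((a + s) - x) + s ≡ x - a
        lem = solve 3 (λ a s x → :- ((a :+ s) :- x) :+ s := x :- a) refl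
        near : ∀ t → + M ∣ + (toℕ a ℕ.+ t ℕ.* N) - ι x → NearJ a x
        near t d = fromNear {a} {x} (by (∣-neg (Z⇒W {j} (e j)) ∣+ (+ t ∣* step-W j)) (lem (ι a) (+ t * + N) (ι x)) ,
          λ μ ne → by (∣-neg (e μ) ∣+ (+ t ∣* step-Z μ j ne)) (lem (ι a) (+ t * + N) (ι x)))
          where
          e : Eq ((ι a + + t * + N) - ι x)
          e = ∣⇒Eq (subst (λ s → + M ∣ s - ι x) (pos a t) d)
        go : Dec (NearJ a x) → nearInd a x ≡ sumℕ {π j} (λ t → C.hit (toℕ a ℕ.+ toℕ t ℕ.* N) x)
        go (no nn) = trans (cong (if_then 1 else 0) (dec-false (nearJ? a x) nn)) (sym (sumℕ-zero {π j} (λ t → C.hit (toℕ a ℕ.+ toℕ t ℕ.* N) x) λ t →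
          decidable-stable (C.hit (toℕ a ℕ.+ toℕ t ℕ.* N) x ℕ.≟ 0) λ h → nn (near (toℕ t) (hit⇒near a (toℕ t) x h))))
        go (yes n) = trans (cong (if_then 1 else 0) (dec-true (nearJ? a x) n)) (sym (use (⇒fibre j (toNear {a} {x} n))))
          where
          use : InFiber (π j) a x → sumℕ {π j} (λ t → C.hit (toℕ a ℕ.+ toℕ t ℕ.* N) x) ≡ 1
          use (t , t< , e) = trans (sumℕ-pick t′ (λ t → C.hit (toℕ a ℕ.+ toℕ t ℕ.* N) x) others-zero) at-t
            where
            t′ : Fin (π j)
            t′ = fromℕ< t<
            toℕ-t′ : toℕ t′ ≡ t
            toℕ-t′ = Fin.toℕ-fromℕ< t<
            dt : + M ∣ + (toℕ a ℕ.+ toℕ t′ ℕ.* N) - ι x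
            dt = subst (λ s → + M ∣ s - ι x) (sym (trans (cong (λ t → + (toℕ a ℕ.+ t ℕ.* N)) toℕ-t′) (pos a t)))
              (subst (λ y → + M ∣ (ι a + + t * + N) - ι y) (sym e) (∣-sym (ι (a +ₘ [ t ℕ.* (M /' π j) ])) (ι a + + t * + N) (ι-step j a t)))
            at-t : C.hit (toℕ a ℕ.+ toℕ t′ ℕ.* N) x ≡ 1
            at-t = C.hit-yes (toℕ a ℕ.+ toℕ t′ ℕ.* N) x (trans (∣⇒%≡ (toℕ a ℕ.+ toℕ t′ ℕ.* N) (toℕ x) M dt) (ℕ.m<n⇒m%n≡m (Fin.toℕ<n x)))
            others-zero : ∀ s → s ≢ t′ → C.hit (toℕ a ℕ.+ toℕ s ℕ.* N) x ≡ 0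
            others-zero s s≢ = decidable-stable (C.hit (toℕ a ℕ.+ toℕ s ℕ.* N) x ℕ.≟ 0) λ h → s≢ (same (hit⇒near a (toℕ s) x h))
              where
              lem′ : ∀ a s t n x → ((a + s * n) - x) - ((a + t * n) - x) ≡ n * (s - t)
              lem′ = solve 5 (λ a s t n x → ((a :+ s :* n) :- x) :- ((a :+ t :* n) :- x) := n :* (s :- t)) refl
              same : + M ∣ + (toℕ a ℕ.+ toℕ s ℕ.* N) - ι x → s ≡ t′
              same ds = Fin.toℕ-injective (∣-small (Fin.toℕ<n s) (Fin.toℕ<n t′) (cancel (by (subst (λ z → + M ∣ z - ι x) (pos a (toℕ s)) ds ∣- subst (λ z → + M ∣ z - ι x) (pos a (toℕ t′)) dt)
                (lem′ (ι a) (+ toℕ s) (+ toℕ t′) (+ N) (ι x)))))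
                where
                cancel : + M ∣ + N * (+ toℕ s - + toℕ t′) → + π j ∣ (+ toℕ s - + toℕ t′)
                cancel (divides c eq) = divides c (ℤ.*-cancelˡ-≡ (+ N) _ _ ⦃ ℤ.≢-nonZero N≢0 ⦄ (trans eq (trans (cong (λ m → c * m) (trans (cong +_ (M≡step j)) (ℤ.pos-* N (π j)))) (lem″ c (+ N) (+ π j)))))
                  where
                  lem″ : ∀ c n p → c * (n * p) ≡ n * (c * p)
                  lem″ = solve 3 (λ c n p → c :* (n :* p) := n :* (c :* p)) refl
                  N≢0 : + N ≢ + 0
                  N≢0 z = ℕ.≢-nonZero⁻¹ M (trans (M≡step j) (cong (ℕ._* π j) (ℤ.+-injective z)))

      -- The points of the fibre are a + t N with t < p_j and N = M / p_j.
      fibre-poly : ∀ a → weighted (nearInd a) ~ mono (toℕ a) *ₚ geo N (π j)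
      fibre-poly a = ~-trans (≋⇒~ (≋-trans (weighted-cong (nearInd-sum a)) expand)) (~-trans (~-sum {π j} λ t → ~-sym (mono~hits (toℕ a ℕ.+ toℕ t ℕ.* N))) (≋⇒~ collect))
        where
        f : Fin (π j) → Fin M → ℕ
        f t x = C.hit (toℕ a ℕ.+ toℕ t ℕ.* N) x
        expand : weighted (λ x → sumℕ {π j} (λ t → f t x)) ≋ sumP {π j} (λ t → sumP (λ x → κ (f t x) *ₚ mono (toℕ x)))
        expand = ≋-trans (sumP-cong λ x → ≋-trans (*ₚ-cong (κ-sum {π j} (λ t → f t x)) (≋-refl {mono (toℕ x)})) (sumP-*ʳ {π j} (mono (toℕ x)) (λ t → κ (f t x))))
          (sumP-comm {M} {π j} (λ x t → κ (f t x) *ₚ mono (toℕ x)))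
        collect : sumP {π j} (λ t → mono (toℕ a ℕ.+ toℕ t ℕ.* N)) ≋ mono (toℕ a) *ₚ geo N (π j)
        collect = ≋-trans (sumP-cong {π j} λ t → mono-+ (toℕ a) (toℕ t ℕ.* N)) (≋-trans (≋-sym (sumP-*ˡ {π j} (mono (toℕ a)) (λ t → mono (toℕ t ℕ.* N)))) (*ₚ-cong (≋-refl {mono (toℕ a)}) (sum-geo N (π j))))

    fibre-shift-∣ : ∀ {s a a*} → Good s → Z i (ι a* - ι a) → Z k (ι a* - ι a) → Φ s ∣P weighted (nearInd a) +ₚ negₚ (weighted (nearInd a*))
    fibre-shift-∣ {s} {a} {a*} (1≤s , s∣M , good) zi zk = ~⇒∣ {EE M} Φ∣M
      (~-+ (fibre-poly a) (~-trans (≋⇒~ (neg≋ (weighted (nearInd a*)))) (~-*ˡ (negₚ 1ₚ) (fibre-poly a*)))) (∣P-resp (≋-sym shape) (from good))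
      where
      G = geo N (π j)
      neg≋ : ∀ f → negₚ f ≋ negₚ 1ₚ *ₚ f
      neg≋ f = solveₚ 1 (λ f → ⊝ f ⊜ (⊝ Κ 1ₚ) ⊗ f) ≋-refl f
      Φ∣M : Φ s ∣P EE M
      Φ∣M = Φ∣EE 1≤s s∣M
      shape : mono (toℕ a) *ₚ G +ₚ negₚ 1ₚ *ₚ (mono (toℕ a*) *ₚ G) ≋ (mono (toℕ a) +ₚ negₚ (mono (toℕ a*))) *ₚ G
      shape = solveₚ 3 (λ x y g → x ⊗ g ⊕ (⊝ Κ 1ₚ) ⊗ (y ⊗ g) ⊜ (x ⊕ ⊝ y) ⊗ g) ≋-refl (mono (toℕ a)) (mono (toℕ a*)) G
      EEM : EE M ≋ EE N *ₚ G
      EEM = subst (λ m → EE m ≋ EE N *ₚ G) (trans (ℕ.*-comm (π j) N) (sym (M≡step j))) (EE-geo N (π j))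
      from : ¬ s ℕ.∣ step j ⊎ s ℕ.∣ others j → Φ s ∣P (mono (toℕ a) +ₚ negₚ (mono (toℕ a*))) *ₚ G
      -- Φ_s divides X^M - 1 = (X^N - 1) G and is coprime to X^N - 1.
      from (inj₁ s∤) = ∣P-*ˡ (mono (toℕ a) +ₚ negₚ (mono (toℕ a*))) (Φ-cancel-EE {s} {N} {G} 1≤s s∤ (∣P-resp EEM Φ∣M))
      -- The representatives of the two fibres agree at i and k, hence modulo a multiple of s.
      from (inj₂ s∣) = ∣P-*ʳ G (∣P-trans (Φ∣EE 1≤s s∣) (mono-difference (others j) ⦃ others-nz ⦄ (toℕ a) (toℕ a*) (subst (_∣ ι a - ι a*) (sym (ℤ.pos-* (Π i) (Π k)))
        (extract (unit-cancel-Z {i} {+ Π k})))))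
        where
        others-nz : NonZero (others j)
        others-nz = ℕ.≢-nonZero λ z → ℕ.≢-nonZero⁻¹ M (trans (M≡step j) (cong (ℕ._* π j) (trans (cong (Π′ j ℕ.*_) z) (ℕ.*-zeroʳ (Π′ j)))))
        d = ι a - ι a*
        extract : (∀ {t} → UnitAt i (+ Π k) → Z i (+ Π k * t) → Z i t) → + Π i * + Π k ∣ d
        extract cancel = go (∣-sym (ι a*) (ι a) zk)
          where
          go : Z k d → + Π i * + Π k ∣ d
          go (divides t e) = go′ (cancel {t} (π∤Π {i} {k} i≢k) (by (∣-sym (ι a*) (ι a) zi) (trans e (ℤ.*-comm t (+ Π k)))))
            where
            go′ : Z i t → + Π i * + Π k ∣ d
            go′ (divides r e′) = divides r (trans e (trans (cong (_* + Π k) e′) (ℤ.*-assoc r (+ Π i) (+ Π k))))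

    -- The gcd is a multiple of `others j`, and the cofactor divides p_j^2 without being divisible
    -- by p_j.
    gcd-shift : ∀ x → Z i (ι x) → ¬ W j (ι x) → Z k (ι x) → gcdM x ≡ M /' (π j ℕ.* π j)
    gcd-shift x zi nw zk = trans g≡ (sym quotient)
      where
      q = π j
      O = others j
      M≡O : M ≡ O ℕ.* (q ℕ.* q)
      M≡O = trans (M≡step j) (trans (cong (ℕ._* q) (trans (cong (ℕ._* O) flatj) (ℕ.*-comm q O))) (ℕ.*-assoc O q q))
      quotient : M /' (q ℕ.* q) ≡ O
      quotient = go (q ℕ.* q) (ℕ.m*n≢0 q q ⦃ πnz j ⦄ ⦃ πnz j ⦄) M≡O
        where
        go : ∀ p → NonZero p → M ≡ O ℕ.* p → M /' p ≡ O
        go (suc p) _ e = trans (cong (ℕ._/ suc p) e) (ℕ.m*n/n≡m O (suc p))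
      g = gcdM x
      O∣x : O ℕ.∣ toℕ x
      O∣x = ∣⇒ℕ∣ (subst (_∣ ι x) (sym (ℤ.pos-* (Π i) (Π k))) (go zk))
        where
        go : Z k (ι x) → + Π i * + Π k ∣ ι x
        go (divides t e) = go′ (unit-cancel-Z {i} {+ Π k} {t} (π∤Π {i} {k} i≢k) (by zi (trans e (ℤ.*-comm t (+ Π k)))))
          where
          go′ : Z i t → + Π i * + Π k ∣ ι x
          go′ (divides r e′) = divides r (trans e (trans (cong (_* + Π k) e′) (ℤ.*-assoc r (+ Π i) (+ Π k))))
      O∣g : O ℕ.∣ g
      O∣g = gcd-greatest O∣x (ℕ.divides (q ℕ.* q) (trans M≡O (ℕ.*-comm O _)))
      g≡ : g ≡ O
      g≡ = go O∣g (gcd[m,n]∣n (toℕ x) M) (gcd[m,n]∣m (toℕ x) M)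
        where
        go : O ℕ.∣ g → g ℕ.∣ M → g ℕ.∣ toℕ x → g ≡ O
        go (ℕ.divides h e) g∣M g∣x = trans e (trans (cong (ℕ._* O) h≡1) (ℕ.*-identityˡ O))
          where
          instance
            Onz : NonZero O
            Onz = ℕ.≢-nonZero λ z → ℕ.≢-nonZero⁻¹ M (trans M≡O (cong (ℕ._* (q ℕ.* q)) z))
          h∣qq : h ℕ.∣ q ℕ.^ 2
          h∣qq = ℕ.*-cancelˡ-∣ O (subst₂ ℕ._∣_ (trans e (ℕ.*-comm h O)) (trans M≡O (cong (λ t → O ℕ.* (q ℕ.* t)) (sym (ℕ.*-identityʳ q)))) g∣M)
          h≡1 : h ≡ 1
          h≡1 = ∤⇒∣primePower⇒≡1 (prime j) 2 (λ q∣h → nw (subst (λ n → + n ∣ ι x) (sym flatj) (ℕ∣⇒∣ (ℕ.∣-trans (ℕ.∣-trans q∣h (ℕ.divides O (trans e (ℕ.*-comm h O)))) g∣x)))) h∣qq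

  -- The chain of fibre shifts

  module Move (F : Frame) (M : ℕ) .{{_ : NonZero M}} (M≡ : M ≡ Frame.π F i ℕ.* Frame.Π′ F i ℕ.* (Frame.π F j ℕ.* Frame.Π′ F j ℕ.* (Frame.π F k ℕ.* Frame.Π′ F k)))
    (B : Subset M) (rigid : Rigid F (Residues.member M B)) (o : ℤ) where
    open InFrame F M M≡
    open ShiftedMasks F M M≡
    open ZM M

    module State (A : Subset M) (t : Tiles A B) (inside : ∀ {a} → a ∈ A → W i (ι a - o)) where

      aligned : Aligned F (member A) (member B) o
      aligned = record
        { tiling = tiling A B t ; rigid = rigid
        ; inside = λ {a} p → ∣-trans a (ι (res a)) o (Z⇒W {i} (∣⇒Eq (ι-res a) i)) (inside {res a} p)
        ; dec∃ = λ d r → dec∃ d (λ x y e → r x y (∣⇒Eq e)) }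

    open State public

    bad : Dir → Fin M → ℕ
    bad ν x = if does (W? ν (ι x - o)) then 0 else 1

    bad-no : ∀ ν x → ¬ W ν (ι x - o) → bad ν x ≡ 1
    bad-no ν x nw = cong (if_then 0 else 1) (dec-false (W? ν (ι x - o)) nw)

    bad-yes : ∀ ν x → W ν (ι x - o) → bad ν x ≡ 0
    bad-yes ν x w = cong (if_then 0 else 1) (dec-true (W? ν (ι x - o)) w)

    bad-cong : ∀ ν x y → W ν (ι x - ι y) → bad ν x ≡ bad ν y
    bad-cong ν x y w = go (W? ν (ι y - o))
      where
      go : Dec (W ν (ι y - o)) → bad ν x ≡ bad ν y
      go (yes wy) = trans (bad-yes ν x (∣-trans (ι x) (ι y) o w wy)) (sym (bad-yes ν y wy))
      go (no nw) = trans (bad-no ν x (λ wx → nw (∣-trans (ι y) (ι x) o (∣-sym (ι x) (ι y) w) wx))) (sym (bad-no ν y nw))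

    nearInd-yes : ∀ a x → NearJ a x → nearInd a x ≡ 1
    nearInd-yes a x n = cong (if_then 1 else 0) (dec-true (nearJ? a x) n)

    nearInd-no : ∀ a x → ¬ NearJ a x → nearInd a x ≡ 0
    nearInd-no a x n = cong (if_then 1 else 0) (dec-false (nearJ? a x) n)

    record Moved (A : Subset M) : Set where
      field
        A′      : Subset M
        a a*    : Fin M
        shift   : FiberShift (π j) A A′
        tiles′  : Tiles A′ B
        inside′ : ∀ {x} → x ∈ A′ → W i (ι x - o)
        off     : ¬ W j (ι a - o)
        on      : W j (ι a* - o)
        moved-i : Z i (ι a* - ι a)
        moved-k : Z k (ι a* - ι a)
        balance : ∀ x → indicator A′ x ℕ.+ nearInd a x ≡ indicator A x ℕ.+ nearInd a* x

      mask-transfer : ∀ {s} → Good s → Φ s ∣P weighted (indicator A′) → Φ s ∣P weighted (indicator A)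
      mask-transfer good d = ∣P-resp (≋-sym eq) (∣P-+ d (fibre-shift-∣ {a = a} {a*} good moved-i moved-k))
        where
        wA = weighted (indicator A)
        wA′ = weighted (indicator A′)
        wa = weighted (nearInd a)
        wa* = weighted (nearInd a*)
        sums : wA′ +ₚ wa ≋ wA +ₚ wa*
        sums = ≋-trans (≋-sym (weighted-+ (indicator A′) (nearInd a))) (≋-trans (weighted-cong balance) (weighted-+ (indicator A) (nearInd a*)))
        eq : wA ≋ wA′ +ₚ (wa +ₚ negₚ wa*)
        eq = ≋-trans (solveₚ 2 (λ x y → x ⊜ (x ⊕ y) ⊕ ⊝ y) ≋-refl wA wa*) (≋-trans (+ₚ-cong (≋-sym sums) (≋-refl {negₚ wa*}))
          (+ₚ-assoc wA′ wa (negₚ wa*)))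

      decrease : (w : Fin M → ℕ) → (∀ x → w x ≡ bad j x ℕ.+ bad k x) → Tiles A B →
        sumℕ (λ x → indicator A′ x ℕ.* w x) < sumℕ (λ x → indicator A x ℕ.* w x)
      -- The old fibre is off the grid at j and the new one is not, while both behave alike at k:
      -- weights 1 + `bad k a` and `bad k a`.
      decrease w we t = measure-decreases w (indicator A) (indicator A′) (nearInd a) (nearInd a*) (1 ℕ.+ bad k a) (bad k a) balance card
        (ℕ.≤-trans (ℕ.≤-reflexive (sym (nearInd-yes a a (∣-self (ι a) , ∣-self (ι a) , ∣-self (ι a))))) (sumℕ-member (nearInd a) a))
        (λ x → on-near a x (1 ℕ.+ bad k a) λ (_ , wj , zk) → trans (we x) (cong₂ ℕ._+_ (trans (bad-cong j x a wj) (bad-no j a off)) (bad-cong k x a (Z⇒W {k} zk))))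
        (λ x → on-near a* x (bad k a) λ (_ , wj , zk) → trans (we x) (cong₂ ℕ._+_ (trans (bad-cong j x a* wj) (bad-yes j a* on)) (trans (bad-cong k x a* (Z⇒W {k} zk)) (bad-cong k a* a (Z⇒W {k} moved-k)))))
        (ℕ.n<1+n _)
        where
        on-near : ∀ b x c → (NearJ b x → w x ≡ c) → nearInd b x ℕ.* w x ≡ nearInd b x ℕ.* c
        on-near b x c h = go (nearJ? b x)
          where
          go : Dec (NearJ b x) → nearInd b x ℕ.* w x ≡ nearInd b x ℕ.* c
          go (yes n) = cong (nearInd b x ℕ.*_) (h n)
          go (no n) = trans (cong (ℕ._* w x) (nearInd-no b x n)) (cong (ℕ._* c) (sym (nearInd-no b x n)))
        sA = TilingCounts.sizes M A B t
        sA′ = TilingCounts.sizes M A′ B tiles′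
        card : sumℕ (indicator A′) ≡ sumℕ (indicator A)
        card = ℕ.*-cancelʳ-≡ _ _ (sumℕ (indicator B)) ⦃ ℕ.≢-nonZero (λ z → ℕ.≢-nonZero⁻¹ M (trans (sym sA) (trans (cong (sumℕ (indicator A) ℕ.*_) z) (ℕ.*-zeroʳ (sumℕ (indicator A)))))) ⦄ (trans sA′ (sym sA))

    module Perform (A : Subset M) (t : Tiles A B) (inside : ∀ {a} → a ∈ A → W i (ι a - o)) where
      open AlignedProperties (aligned A t inside)

      move : Movable → Moved A
      move (a , pa , fibre , off) = record
        { A′ = subset d ; a = X ; a* = X* ; shift = X , X* , (λ y f → member-ι⁻ (near-A y (fromNear {X} {y} (fibre⇒ j f)))) , gcd-eq , λ y → mk⇔ (to y) (back y)
        ; tiles′ = tiles {𝒜′} B d 𝒜′-resp exist′ (λ {y} {z} {b} {c} → uniq′ {y} {z} {b} {c})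
        ; inside′ = λ {x} x∈ → inside′ {ι x} (∈-subset⁻ d x∈)
        ; off = λ w → off (∣-trans a (ι X) o (Z⇒W {j} (∣⇒Eq (ι-res a) j)) w)
        ; on = ∣-trans (ι X*) a* o (∣-sym a* (ι X*) (Z⇒W {j} (∣⇒Eq (ι-res a*) j))) (Z⇒W {j} aj)
        ; moved-i = moved i ai ; moved-k = moved k ak
        ; balance = balance }
        where
        open Shift pa fibre off
        X = res a
        X* = res a*
        d : ∀ x → Dec (𝒜′ (ι x))
        d x = ((res (ι x) ∈? A) ×-dec ¬? (fib? a (ι x))) ⊎-dec fib? a* (ι x)
        𝒜′-resp : ∀ x y → Eq (x - y) → 𝒜′ y → 𝒜′ x
        𝒜′-resp x y e (inj₁ (py , nf)) = inj₁ (member-resp A x y (Eq⇒∣ e) py , λ f → nf (fib-resp a y x (λ ν → ∣-sym x y (e ν)) f))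
        𝒜′-resp x y e (inj₂ f) = inj₂ (fib-resp a* x y e f)
        moved : ∀ ν → Z ν (a* - a) → Z ν (ι X* - ι X)
        moved ν z = ∣-trans (ι X*) a* (ι X) (∣-sym a* (ι X*) (∣⇒Eq (ι-res a*) ν)) (∣-trans a* a (ι X) z (∣⇒Eq (ι-res a) ν))
        near⇒fib : ∀ c y → NearJ (res c) y → Fib c (ι y)
        near⇒fib c y (zi , wj , zk) = ∣-trans (ι y) (ι (res c)) c zi (e i) , ∣-trans (ι y) (ι (res c)) c wj (Z⇒W {j} (e j)) , ∣-trans (ι y) (ι (res c)) c zk (e k)
          where
          e : Eq (ι (res c) - c)
          e ν = ∣-sym c (ι (res c)) (∣⇒Eq (ι-res c) ν)
        fib⇒near : ∀ c y → Fib c (ι y) → NearJ (res c) y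
        fib⇒near c y (zi , wj , zk) = ∣-trans (ι y) c (ι (res c)) zi (e i) , ∣-trans (ι y) c (ι (res c)) wj (Z⇒W {j} (e j)) , ∣-trans (ι y) c (ι (res c)) zk (e k)
          where
          e : Eq (c - ι (res c))
          e = ∣⇒Eq (ι-res c)
        near-A : ∀ y → NearJ X y → member A (ι y)
        near-A y n = let (zi , wj , zk) = near⇒fib a y n in fibre (ι y) zi wj zk
        to : ∀ y → y ∈ subset d → (y ∈ A × ¬ InFiber (π j) X y) ⊎ InFiber (π j) X* y
        to y y∈ = go (∈-subset⁻ d y∈)
          where
          go : 𝒜′ (ι y) → (y ∈ A × ¬ InFiber (π j) X y) ⊎ InFiber (π j) X* y
          go (inj₁ (p , nf)) = inj₁ (member-ι⁻ p , λ f → nf (near⇒fib a y (fromNear {X} {y} (fibre⇒ j f))))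
          go (inj₂ f) = inj₂ (⇒fibre j (toNear {X*} {y} (fib⇒near a* y f)))
        back : ∀ y → (y ∈ A × ¬ InFiber (π j) X y) ⊎ InFiber (π j) X* y → y ∈ subset d
        back y (inj₁ (p , nf)) = ∈-subset⁺ d (inj₁ (member-ι p , λ f → nf (⇒fibre j (toNear {X} {y} (fib⇒near a y f)))))
        back y (inj₂ f) = ∈-subset⁺ d (inj₂ (near⇒fib a* y (fromNear {X*} {y} (fibre⇒ j f))))
        gcd-eq : gcdM (X -ₘ X*) ≡ M /' (π j ℕ.* π j)
        gcd-eq = gcd-shift (X -ₘ X*) (diff i ai) (λ w → off (∣-trans a (ι X) o (Z⇒W {j} (∣⇒Eq (ι-res a) j)) (∣-trans (ι X) (ι X*) o
            (∣-transport′ (Z⇒W {j} (∣⇒Eq (ι-- X X*) j)) w) (∣-trans (ι X*) a* o (∣-sym a* (ι X*) (Z⇒W {j} (∣⇒Eq (ι-res a*) j))) (Z⇒W {j} aj))))) (diff k ak)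
          where
          diff : ∀ ν → Z ν (a* - a) → Z ν (ι (X -ₘ X*))
          diff ν z = ∣-transport (ι (X -ₘ X*)) (ι X - ι X*) (∣⇒Eq (ι-- X X*) ν) (∣-sym (ι X*) (ι X) (moved ν z))
          ∣-transport′ : W j (ι (X -ₘ X*) - (ι X - ι X*)) → W j (ι (X -ₘ X*)) → W j (ι X - ι X*)
          ∣-transport′ e w = ∣-transport (ι X - ι X*) (ι (X -ₘ X*)) (∣-sym (ι (X -ₘ X*)) (ι X - ι X*) e) w
        balance : ∀ x → indicator (subset d) x ℕ.+ nearInd X x ≡ indicator A x ℕ.+ nearInd X* x
        balance x = go (nearJ? X* x) (nearJ? X x) (x ∈? A)
          where
          go : Dec (NearJ X* x) → Dec (NearJ X x) → Dec (x ∈ A) → indicator (subset d) x ℕ.+ nearInd X x ≡ indicator A x ℕ.+ nearInd X* x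
          go (yes n*) (yes n) _ = ⊥-elim (disjoint {ι x} (near⇒fib a* x n*) (near-A x n))
          go (yes n*) (no nn) (yes p) = ⊥-elim (disjoint {ι x} (near⇒fib a* x n*) (member-ι p))
          go (yes n*) (no nn) (no np) = trans (cong₂ ℕ._+_ (∈⇒indicator (∈-subset⁺ d (inj₂ (near⇒fib a* x n*)))) (nearInd-no X x nn))
            (sym (cong₂ ℕ._+_ (∉⇒indicator np) (nearInd-yes X* x n*)))
          go (no nn*) (yes n) (no np) = ⊥-elim (np (member-ι⁻ (near-A x n)))
          go (no nn*) (yes n) (yes p) = trans (cong₂ ℕ._+_ (∉⇒indicator not-in) (nearInd-yes X x n)) (sym (cong₂ ℕ._+_ (∈⇒indicator p) (nearInd-no X* x nn*)))
            where
            not-in : ¬ x ∈ subset d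
            not-in x∈ = case (∈-subset⁻ d x∈)
              where
              case : 𝒜′ (ι x) → ⊥
              case (inj₁ (_ , nf)) = nf (near⇒fib a x n)
              case (inj₂ f) = nn* (fib⇒near a* x f)
          go (no nn*) (no nn) (yes p) = cong₂ ℕ._+_ (trans (∈⇒indicator (∈-subset⁺ d (inj₁ (member-ι p , λ f → nn (fib⇒near a x f))))) (sym (∈⇒indicator p)))
            (trans (nearInd-no X x nn) (sym (nearInd-no X* x nn*)))
          go (no nn*) (no nn) (no np) = cong₂ ℕ._+_ (trans (∉⇒indicator not-in) (sym (∉⇒indicator np))) (trans (nearInd-no X x nn) (sym (nearInd-no X* x nn*)))
            where
            not-in : ¬ x ∈ subset d
            not-in x∈ = case (∈-subset⁻ d x∈)
              where
              case : 𝒜′ (ι x) → ⊥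
              case (inj₁ (p , _)) = np (member-ι⁻ p)
              case (inj₂ f) = nn* (fib⇒near a* x f)

  module Chain (F : Frame) (M : ℕ) .{{_ : NonZero M}}
    (M≡ : M ≡ Frame.π F i ℕ.* Frame.Π′ F i ℕ.* (Frame.π F j ℕ.* Frame.Π′ F j ℕ.* (Frame.π F k ℕ.* Frame.Π′ F k)))
    (M≡′ : M ≡ Frame.π F i ℕ.* Frame.Π′ F i ℕ.* (Frame.π F k ℕ.* Frame.Π′ F k ℕ.* (Frame.π F j ℕ.* Frame.Π′ F j)))
    (B : Subset M) (rigid : Rigid F (Residues.member M B)) (o : ℤ) (Λ : Subset M) where
    open InFrame F M M≡
    open ZM M
    module MJ = Move F M M≡ B rigid o
    module MK = Move (swap F) M M≡′ B (swapRigid rigid) o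
    module SJ = ShiftedMasks F M M≡
    module SK = ShiftedMasks (swap F) M M≡′

    weight : Fin M → ℕ
    weight x = MJ.bad j x ℕ.+ MJ.bad k x

    -- Divisibility by Φ_s travels backwards along the chain, because it is for Λ at the end that
    -- these divisors can be computed directly.
    Reaches : Subset M → Set
    Reaches A = Star (ShiftStep (π j) (π k) B) A Λ × Tiles Λ B ×
      (∀ s → SJ.Good s → SK.Good s → Φ s ∣P weighted (indicator Λ) → Φ s ∣P weighted (indicator A))

    module _ (Λ⇒ : ∀ {y} → y ∈ Λ → W i (ι y - o) × W j (ι y - o) × W k (ι y - o)) (⇒Λ : ∀ {y} → W i (ι y - o) → W j (ι y - o) → W k (ι y - o) → y ∈ Λ) where

      reach : ∀ A → Tiles A B → (∀ {a} → a ∈ A → W i (ι a - o)) → Acc _<_ (sumℕ (λ x → indicator A x ℕ.* weight x)) → Reaches A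
      reach A t inside (acc rs) = start (Fin.any? dec)
        where
        P : Fin M → Set
        P x = x ∈ A × ¬ (W j (ι x - o) × W k (ι x - o))
        dec : ∀ x → Dec (P x)
        dec x = (x ∈? A) ×-dec ¬? (W? j (ι x - o) ×-dec W? k (ι x - o))
        al = MJ.aligned A t inside
        module Im = Improve al
        start : Dec (∃ P) → Reaches A
        start (no none) = subst Reaches (sym A≡Λ) (ε , subst (λ S → Tiles S B) A≡Λ t , λ s _ _ d → d)
          where
          good : ∀ {a} → a ∈ A → W j (ι a - o) × W k (ι a - o)
          good {a} p = decidable-stable (W? j (ι a - o) ×-dec W? k (ι a - o)) λ n → none (a , p , n)
          good′ : ∀ {a} → member A a → W j (a - o) × W k (a - o)
          good′ {a} p = let (wj , wk) = good {res a} p in ∣-trans a (ι (res a)) o (Z⇒W {j} (∣⇒Eq (ι-res a) j)) wj , ∣-trans a (ι (res a)) o (Z⇒W {k} (∣⇒Eq (ι-res a) k)) wk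
          A≡Λ : A ≡ Λ
          A≡Λ = ⊆-antisym (λ {x} p → let (wj , wk) = good {x} p in ⇒Λ {x} (inside {x} p) wj wk)
            (λ {x} p → let (wi , wj , wk) = Λ⇒ {x} p in member-ι⁻ (AlignedProperties.full al (λ {a} → good′ {a}) {ι x} wi wj wk))
        start (yes (x , p , off)) = from (Im.movable {ι x} (member-ι p) off)
          where
          by-j : MJ.Moved A → Reaches A
          by-j m = extend (reach A′ tiles′ inside′ (rs (decrease weight (λ _ → refl) t)))
            where
            open MJ.Moved m
            extend : Reaches A′ → Reaches A
            extend (path , tΛ , tr) = (inj₁ shift , tiles′) ◅ path , tΛ , λ s gj gk d → mask-transfer gj (tr s gj gk d)
          by-k : MK.Moved A → Reaches A
          by-k m = extend (reach A′ tiles′ inside′ (rs (decrease weight (λ x → ℕ.+-comm (MJ.bad j x) (MJ.bad k x)) t)))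
            where
            open MK.Moved m
            extend : Reaches A′ → Reaches A
            extend (path , tΛ , tr) = (inj₂ shift , tiles′) ◅ path , tΛ , λ s gj gk d → mask-transfer gk (tr s gj gk d)
          from : Im.J.Movable ⊎ Im.K.Movable → Reaches A
          from (inj₁ m) = by-j (MJ.Perform.move A t inside m)
          from (inj₂ m) = by-k (MK.Perform.move A t inside m)

  -- Condition (T2) from cyclotomic divisors

  primePower : ℕ × ℕ → ℕ
  primePower pα = proj₁ pα ^ proj₂ pα

  prime∣product : ∀ {q} ps → Prime q → All (λ pα → Prime (proj₁ pα)) ps → q ℕ.∣ product (map primePower ps) → ∃[ pα ] (pα ∈ₗ ps × q ≡ proj₁ pα)
  prime∣product [] pq [] d = ⊥-elim (ℕ.<-irrefl (sym (ℕ.∣1⇒≡1 d)) (ℕ.nonTrivial⇒n>1 _ ⦃ prime⇒nonTrivial pq ⦄))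
  prime∣product (pα ∷ ps) pq (pp ∷ pps) d = from (euclidsLemma (primePower pα) _ pq d)
    where
    from : _ ⊎ _ → ∃[ pβ ] (pβ ∈ₗ pα ∷ ps × _ ≡ proj₁ pβ)
    from (inj₁ e) = pα , here refl , prime-∣-^ pq pp (proj₂ pα) e
    from (inj₂ e) = let (pβ , m , eq) = prime∣product ps pq pps e in pβ , there m , eq

  product-∣ : ∀ {m} ps → All (λ pα → Prime (proj₁ pα)) ps → All (λ pα → primePower pα ℕ.∣ m) ps → Unique (map proj₁ ps) → product (map primePower ps) ℕ.∣ m
  product-∣ [] _ _ _ = ℕ.1∣ _
  product-∣ {m} (pα ∷ ps) (pp ∷ pps) (d ∷ ds) (fresh ∷ unique) = extend (product-∣ ps pps ds unique)
    where
    p∤ : ¬ proj₁ pα ℕ.∣ product (map primePower ps)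
    p∤ e = let (pβ , mem , eq) = prime∣product ps pp pps e in All.lookup fresh (∈-map⁺ proj₁ mem) eq
    extend : product (map primePower ps) ℕ.∣ m → primePower pα ℕ.* product (map primePower ps) ℕ.∣ m
    extend (ℕ.divides t e) = subst (primePower pα ℕ.* P ℕ.∣_) (sym e) (ℕ.*-monoˡ-∣ P (coprime-divisor
      (λ (c∣pα , c∣P) → ∤⇒∣primePower⇒≡1 pp (proj₂ pα) (λ p∣c → p∤ (ℕ.∣-trans p∣c c∣P)) c∣pα) (subst (primePower pα ℕ.∣_) (trans e (ℕ.*-comm t P)) d)))
      where P = product (map primePower ps)

  module Project (d : ℕ) .{{_ : NonZero d}} where
    open Convolution d (λ _ → 0) (λ _ → 0)
    open Mod (+ 0)
    open Congruence (EE d) (+ 0)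

    sum-hit : ∀ {n} c (f : Fin n → ℕ) y x₀ → + d ∣ + (c ℕ.+ toℕ x₀) - + toℕ y → (∀ x → f x ≢ 0 → + d ∣ + (c ℕ.+ toℕ x) - + toℕ y → x ≡ x₀) →
      sumℕ (λ x → f x ℕ.* hit (c ℕ.+ toℕ x) y) ≡ f x₀
    sum-hit c f y x₀ at only = trans (sumℕ-pick x₀ (λ x → f x ℕ.* hit (c ℕ.+ toℕ x) y) elsewhere)
      (trans (cong (f x₀ ℕ.*_) (hit-yes (c ℕ.+ toℕ x₀) y (trans (∣⇒%≡ (c ℕ.+ toℕ x₀) (toℕ y) d at) (ℕ.m<n⇒m%n≡m (Fin.toℕ<n y))))) (ℕ.*-identityʳ (f x₀)))
      where
      elsewhere : ∀ x → x ≢ x₀ → f x ℕ.* hit (c ℕ.+ toℕ x) y ≡ 0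
      elsewhere x ne = go (f x ℕ.≟ 0)
        where
        go : Dec (f x ≡ 0) → f x ℕ.* hit (c ℕ.+ toℕ x) y ≡ 0
        go (yes z) = cong (ℕ._* hit (c ℕ.+ toℕ x) y) z
        go (no nz) = trans (cong (f x ℕ.*_) (hit-no (c ℕ.+ toℕ x) y (λ e → ne (only x nz (subst (λ t → + d ∣ + (c ℕ.+ toℕ x) - + t) e (%-∣ (c ℕ.+ toℕ x) d)))))) (ℕ.*-zeroʳ (f x))

    -- Reducing exponents modulo d adds up the weights in each residue class, here after a
    -- translation by c.
    project : ∀ {n} c (f : Fin n → ℕ) (g : Fin d → ℕ) → (∀ y → sumℕ (λ x → f x ℕ.* hit (c ℕ.+ toℕ x) y) ≡ g y) → mono c *ₚ weighted f ~ weighted g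
    project {n} c f g h = ~-trans (≋⇒~ expand) (~-trans (~-sum λ x → ~-*ˡ (κ (f x)) (mono~hits (c ℕ.+ toℕ x))) (≋⇒~ collect))
      where
      expand : mono c *ₚ weighted f ≋ sumP (λ x → κ (f x) *ₚ mono (c ℕ.+ toℕ x))
      expand = ≋-trans (sumP-*ˡ (mono c) (λ x → κ (f x) *ₚ mono (toℕ x))) (sumP-cong λ x →
        ≋-trans (solveₚ 3 (λ m c y → m ⊗ (c ⊗ y) ⊜ c ⊗ (m ⊗ y)) ≋-refl (mono c) (κ (f x)) (mono (toℕ x))) (*ₚ-cong (≋-refl {κ (f x)}) (≋-sym (mono-+ c (toℕ x)))))
      t : Fin n → Fin d → ℕ
      t x y = hit (c ℕ.+ toℕ x) y
      collect : sumP (λ x → κ (f x) *ₚ sumP (λ y → κ (t x y) *ₚ mono (toℕ y))) ≋ weighted g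
      collect = ≋-trans (sumP-cong λ x → ≋-trans (sumP-*ˡ (κ (f x)) (λ y → κ (t x y) *ₚ mono (toℕ y)))
          (sumP-cong λ y → ≋-trans (≋-sym (*ₚ-assoc (κ (f x)) (κ (t x y)) (mono (toℕ y)))) (*ₚ-cong (≋-sym (κ-* (f x) (t x y))) (≋-refl {mono (toℕ y)}))))
        (≋-trans (sumP-comm (λ x y → κ (f x ℕ.* t x y) *ₚ mono (toℕ y)))
        (≋-trans (sumP-cong λ y → ≋-trans (≋-sym (sumP-*ʳ (mono (toℕ y)) (λ x → κ (f x ℕ.* t x y)))) (*ₚ-cong (≋-sym (κ-sum (λ x → f x ℕ.* t x y))) (≋-refl {mono (toℕ y)})))
          (weighted-cong h)))

  eval1-κ : ∀ n → eval1 (κ n) ≡ + n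
  eval1-κ zero = eval1-cong const-0
  eval1-κ (suc n) = trans (eval1-cong (κ-+ 1 n)) (trans (eval1-+ (κ 1) (κ n)) (cong₂ _+_ (eval1-cong const-1) (eval1-κ n)))

  eval1-weighted : ∀ {n} (f : Fin n → ℕ) → eval1 (weighted f) ≡ + sumℕ f
  eval1-weighted f = sums f toℕ
    where
    sums : ∀ {n} (c m : Fin n → ℕ) → eval1 (sumP (λ x → κ (c x) *ₚ mono (m x))) ≡ + sumℕ c
    sums {zero} c m = refl
    sums {suc n} c m = trans (eval1-+ (κ (c zero) *ₚ mono (m zero)) _) (cong₂ _+_
      (trans (eval1-* (κ (c zero)) (mono (m zero))) (trans (cong₂ _*_ (eval1-κ (c zero)) (eval1-mono (m zero))) (ℤ.*-identityʳ (+ c zero))))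
      (sums (λ x → c (suc x)) (λ x → m (suc x))))

  ^-∣ : ∀ p {a b} → a ≤ b → (p ^ a) ℕ.∣ (p ^ b)
  ^-∣ p {a} {b} le = subst (λ t → (p ^ a) ℕ.∣ (p ^ t)) (ℕ.m+[n∸m]≡n le) (subst ((p ^ a) ℕ.∣_) (sym (ℕ.^-distribˡ-+-* p a (b ℕ.∸ a))) (ℕ.m∣m*n _))

  module Structured (F : Frame) (M : ℕ) .{{_ : NonZero M}} (M≡ : M ≡ Frame.π F i ℕ.* Frame.Π′ F i ℕ.* (Frame.π F j ℕ.* Frame.Π′ F j ℕ.* (Frame.π F k ℕ.* Frame.Π′ F k))) where
    open InFrame F M M≡
    open ZM M

    divisor-pos : ∀ {s m} → .{{_ : NonZero m}} → s ℕ.∣ m → 1 ≤ s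
    divisor-pos {zero} {m} d = ⊥-elim (ℕ.≢-nonZero⁻¹ m (ℕ.0∣⇒≡0 d))
    divisor-pos {suc s} d = s≤s z≤n

    π-injective : ∀ μ ν → π μ ≡ π ν → μ ≡ ν
    π-injective i i e = refl
    π-injective i j e = ⊥-elim (i≢j e)
    π-injective i k e = ⊥-elim (i≢k e)
    π-injective j i e = ⊥-elim (i≢j (sym e))
    π-injective j j e = refl
    π-injective j k e = ⊥-elim (j≢k e)
    π-injective k i e = ⊥-elim (i≢k (sym e))
    π-injective k j e = ⊥-elim (j≢k (sym e))
    π-injective k k e = refl

    Π′-nz : ∀ ν → NonZero (Π′ ν)
    Π′-nz ν = ℕ.≢-nonZero λ z → ℕ.≢-nonZero⁻¹ M (trans (M≡step ν) (cong (ℕ._* π ν) (cong (ℕ._* others ν) z)))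

    M≡Π : ∀ ν → M ≡ Π ν ℕ.* others ν
    M≡Π ν = trans (M≡step ν) (trans (ℕ.*-comm (step ν) (π ν)) (sym (ℕ.*-assoc (π ν) (Π′ ν) (others ν))))

    Π∣M : ∀ ν → Π ν ℕ.∣ M
    Π∣M ν = ℕ.divides (others ν) (trans (M≡Π ν) (ℕ.*-comm (Π ν) (others ν)))

    Π∤step : ∀ ν → ¬ Π ν ℕ.∣ step ν
    Π∤step ν d = others-unit ν (ℕ∣⇒∣ (ℕ.*-cancelˡ-∣ (Π′ ν) ⦃ Π′-nz ν ⦄ (subst (ℕ._∣ step ν) (ℕ.*-comm (π ν) (Π′ ν)) d)))

    D∣step : ∀ ν → D ℕ.∣ step ν
    D∣step ν = ∣⇒ℕ∣ (W⇒D∣ (w i) (w j) (w k))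
      where
      w : ∀ μ → W μ (+ step ν)
      w μ = go (μ ≟D ν)
        where
        go : Dec (μ ≡ ν) → W μ (+ step ν)
        go (yes refl) = step-W ν
        go (no ne) = Z⇒W {μ} (step-Z μ ν ne)

    Π∤D : ∀ ν → ¬ Π ν ℕ.∣ D
    Π∤D ν d = Π∤step ν (ℕ.∣-trans d (D∣step ν))

    coprime-part : ∀ ν {s} → s ℕ.∣ M → ¬ π ν ℕ.∣ s → s ℕ.∣ others ν
    coprime-part ν {s} d p∤ = coprime-divisor {m = s} {n = Π ν} {o = others ν}
      (λ {c} (c∣s , c∣Π) → ∤⇒∣primePower⇒≡1 (prime ν) (suc (ex ν)) (λ p∣c → p∤ (ℕ.∣-trans p∣c c∣s)) (subst (c ℕ.∣_) (Π-pow ν) c∣Π))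
      (subst (s ℕ.∣_) (M≡Π ν) d)

    -- Every prime of M occurring in s does so with its full power. For `A` and Λ these are the only
    -- indices that (T2) can ask about, by `only-top`, and fibre shifts respect them.
    Saturated : ℕ → Set
    Saturated s = ∀ ν → π ν ℕ.∣ s → Π ν ℕ.∣ s

    saturated⇒ : ∀ {s} → s ℕ.∣ M → Saturated s → ∀ ν → ¬ s ℕ.∣ step ν ⊎ s ℕ.∣ others ν
    saturated⇒ {s} d sat ν = go (π ν ℕ.∣? s)
      where
      go : Dec (π ν ℕ.∣ s) → ¬ s ℕ.∣ step ν ⊎ s ℕ.∣ others ν
      go (yes p) = inj₁ λ e → Π∤step ν (ℕ.∣-trans (sat ν p) e)
      go (no np) = inj₂ (coprime-part ν d np)

    Π-saturated : ∀ ν → Saturated (Π ν)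
    Π-saturated ν μ d = subst (λ κ → Π κ ℕ.∣ Π ν) (sym (π-injective μ ν (prime-∣-^ (prime μ) (prime ν) (suc (ex ν)) (subst (π μ ℕ.∣_) (Π-pow ν) d)))) ℕ.∣-refl

    power-cases : ∀ ν {α} → (π ν ^ α) ℕ.∣ M → (π ν ^ α) ℕ.∣ Π′ ν ⊎ π ν ^ α ≡ Π ν
    power-cases ν {α} d = go (α ℕ.≤? ex ν)
      where
      p = π ν
      d′ : (p ^ α) ℕ.∣ Π ν
      d′ = coprime-divisor {m = p ^ α} {n = others ν} {o = Π ν}
        (λ {c} (c∣p , c∣o) → ∤⇒∣primePower⇒≡1 (prime ν) α (λ p∣c → others-unit ν (ℕ∣⇒∣ (ℕ.∣-trans p∣c c∣o))) c∣p)
        (subst ((p ^ α) ℕ.∣_) (trans (M≡Π ν) (ℕ.*-comm (Π ν) (others ν))) d)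
      go : Dec (α ≤ ex ν) → (p ^ α) ℕ.∣ Π′ ν ⊎ p ^ α ≡ Π ν
      go (yes le) = inj₁ (subst ((p ^ α) ℕ.∣_) (sym (pow ν)) (^-∣ p le))
      go (no nle) = inj₂ (ℕ.∣-antisym d′ (subst (ℕ._∣ (p ^ α)) (sym (Π-pow ν)) (^-∣ p (ℕ.≰⇒> nle))))

    -- Φ_s and Φ_t are coprime as soon as t ∤ s, since Φ_s divides X^s - 1.
    Φ-coprime : ∀ {s t} → 1 ≤ s → 1 ≤ t → ¬ t ℕ.∣ s → CoprimeP (Φ t) (Φ s)
    Φ-coprime {s} {t} 1≤s 1≤t t∤s = coprimeP-∣ (Φ∣EE 1≤s ℕ.∣-refl) (Cyclotomic.coprime (cyclotomic t 1≤t) s t∤s)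

    cyc⇒ : ∀ s S → CycDiv s S → Φ s ∣P weighted (indicator S)
    cyc⇒ s S (R , e) = R , ≋-trans (≋-sym (mask≋ S)) (≈ₚ⇒≋ e)

    ⇒cyc : ∀ s S → Φ s ∣P weighted (indicator S) → CycDiv s S
    ⇒cyc s S (R , e) = R , ≋⇒≈ₚ (≋-trans (mask≋ S) e)

    module _ (S : Subset M) (size : sumℕ (indicator S) ≡ π i ℕ.* π j ℕ.* π k)
      (top : ∀ s → s ℕ.∣ M → Saturated s → ¬ s ℕ.∣ D → Φ s ∣P weighted (indicator S)) where

      -- Φ_{Π ν} already contributes one factor p to S(1) = p_i p_j p_k. A second Φ of a power of
      -- the same p would make p^2 divide this product of distinct primes.
      only-top : ∀ ν {α} → 1 ≤ α → (π ν ^ α) ℕ.∣ M → Φ (π ν ^ α) ∣P weighted (indicator S) → π ν ^ α ≡ Π ν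
      only-top ν {suc α} _ d Φ∣ = from (power-cases ν {suc α} d)
        where
        p = π ν
        from : (p ^ suc α) ℕ.∣ Π′ ν ⊎ p ^ suc α ≡ Π ν → p ^ suc α ≡ Π ν
        from (inj₂ e) = e
        from (inj₁ e) = ⊥-elim (absurd (ℤ∣.∣-trans (subst (_∣ eval1 (Φ (p ^ suc α)) * eval1 (Φ (Π ν))) (sym (ℤ.pos-* p p)) pp∣)
            (subst₂ _∣_ (eval1-* (Φ (p ^ suc α)) (Φ (Π ν))) (trans (eval1-weighted (indicator S)) (cong +_ size)) (eval1-∣ both))))
          where
          1≤s = divisor-pos d
          1≤t = divisor-pos (Π∣M ν)
          Π∤s : ¬ Π ν ℕ.∣ (p ^ suc α)
          Π∤s f = Π∤step ν (ℕ.∣-trans f (ℕ.∣-trans e (ℕ.m∣m*n (others ν))))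
          both : Φ (p ^ suc α) *ₚ Φ (Π ν) ∣P weighted (indicator S)
          both = coprimeP-∣-* (Φ-unit (Π ν) 1≤t) (Φ-coprime 1≤s 1≤t Π∤s) (top (Π ν) (Π∣M ν) (Π-saturated ν) (Π∤D ν)) Φ∣
          pp∣ : + p * + p ∣ eval1 (Φ (p ^ suc α)) * eval1 (Φ (Π ν))
          pp∣ = multiply (prime∣Φ1 α (prime ν)) (subst (λ t → + p ∣ eval1 (Φ t)) (sym (Π-pow ν)) (prime∣Φ1 (ex ν) (prime ν)))
            where
            multiply : ∀ {m n x y} → m ∣ x → n ∣ y → m * n ∣ x * y
            multiply {m} {n} (divides q refl) (divides r refl) = divides (q * r) (solve 4 (λ q m r n → q :* m :* (r :* n) := q :* r :* (m :* n)) refl q m r n)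
          absurd : ¬ + (p ℕ.* p) ∣ + (π i ℕ.* π j ℕ.* π k)
          absurd f = go ν refl
            where
            g : (p ℕ.* p) ℕ.∣ π i ℕ.* π j ℕ.* π k
            g = ∣⇒ℕ∣ f
            clash : ∀ a b c → π a ≢ π b → π a ≢ π c → π i ℕ.* π j ℕ.* π k ≡ π a ℕ.* (π b ℕ.* π c) → a ≡ ν → ⊥
            clash a b c ab ac e refl = from′ (euclidsLemma (π b) (π c) (prime a) (ℕ.*-cancelˡ-∣ (π a) ⦃ πnz a ⦄ (subst (p ℕ.* p ℕ.∣_) e g)))
              where
              single : ∀ c → π a ≢ π c → ¬ π a ℕ.∣ π c
              single c ne h = ne (prime-∣-^ (prime a) (prime c) 1 (subst (π a ℕ.∣_) (sym (ℕ.*-identityʳ (π c))) h))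
              from′ : π a ℕ.∣ π b ⊎ π a ℕ.∣ π c → ⊥
              from′ (inj₁ h) = single b ab h
              from′ (inj₂ h) = single c ac h
            go : ∀ a → a ≡ ν → ⊥
            go i = clash i j k i≢j i≢k (ℕ.*-assoc (π i) (π j) (π k))
            go j = clash j i k (≢-sym i≢j) j≢k (trans (cong (ℕ._* π k) (ℕ.*-comm (π i) (π j))) (ℕ.*-assoc (π j) (π i) (π k)))
            go k = clash k i j (≢-sym i≢k) (≢-sym j≢k) (ℕ.*-comm (π i ℕ.* π j) (π k))

      t2-top : T2 S
      t2-top ps ps≢[] all unique = ⇒cyc s S (top s s∣M saturated (s∤D ps ps≢[] refl))
        where
        s = product (map primePower ps)
        primes : All (λ pα → Prime (proj₁ pα)) ps
        primes = All.map proj₁ all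
        s∣M : s ℕ.∣ M
        s∣M = product-∣ ps primes (All.map (λ (_ , _ , d , _) → d) all) unique
        entry : ∀ {pα} → pα ∈ₗ ps → ∀ ν → proj₁ pα ≡ π ν → Π ν ℕ.∣ s
        entry {p , α} m ν refl = use (All.lookup all m)
          where
          use : Prime p × 1 ≤ α × (p ^ α) ℕ.∣ M × CycDiv (p ^ α) S → Π ν ℕ.∣ s
          use (_ , 1≤α , d , c) = subst (ℕ._∣ s) (only-top ν {α} 1≤α d (cyc⇒ (p ^ α) S c)) (∈⇒∣product (∈-map⁺ primePower m))
        saturated : Saturated s
        saturated ν d = let (pα , m , e) = prime∣product ps (prime ν) primes d in entry m ν (sym e)
        s∤D : ∀ qs → qs ≢ [] → qs ≡ ps → ¬ s ℕ.∣ D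
        s∤D [] ne _ = ⊥-elim (ne refl)
        s∤D ((p , α) ∷ qs) _ refl d = use all
          where
          use : All _ ((p , α) ∷ qs) → ⊥
          use ((pp , 1≤α , p∣M , _) ∷ _) = let (ν , e) = prime-divisor pp (ℕ.∣-trans (divides-power α 1≤α) p∣M) in Π∤D ν (ℕ.∣-trans (entry (here refl) ν e) d)
            where
            divides-power : ∀ α → 1 ≤ α → p ℕ.∣ (p ^ α)
            divides-power (suc α) _ = ℕ.m∣m*n (p ^ α)

    module Grid (Λ : Subset M) (a : ℤ) (Λ⇒ : ∀ y → y ∈ Λ → + D ∣ ι y - a) (⇒Λ : ∀ y → + D ∣ ι y - a → y ∈ Λ) where
      open Project M
      open Congruence (EE M) (+ 0)

      -- Λ is invariant under translation by D, so X^M - 1 divides (X^D - 1) Λ(X).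
      invariant : mono D *ₚ weighted (indicator Λ) ~ weighted (indicator Λ)
      invariant = project D (indicator Λ) (indicator Λ) λ y → trans (sum-hit D (indicator Λ) y (back y) (shifted y) (λ x _ → only x y)) (same y)
        where
        back : Fin M → Fin M
        back y = res (ι y - + D)
        lem : ∀ d y b → - ((y - d) - b) ≡ (d + b) - y
        lem = solve 3 (λ d y b → :- ((y :- d) :- b) := (d :+ b) :- y) refl
        shifted : ∀ y → + M ∣ + (D ℕ.+ toℕ (back y)) - ι y
        shifted y = by (∣-neg (ι-res (ι y - + D))) (lem (+ D) (ι y) (ι (back y)))
        only : ∀ x y → + M ∣ + (D ℕ.+ toℕ x) - ι y → x ≡ back y
        only x y d = ι-injective (by (d ∣- shifted y) (solve 4 (λ d x b y → ((d :+ x) :- y) :- ((d :+ b) :- y) := x :- b) refl (+ D) (ι x) (ι (back y)) (ι y)))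
        D∣M : + D ∣ + M
        D∣M = ℕ∣⇒∣ (ℕ.∣-trans (D∣step i) (ℕ.divides (π i) (trans (M≡step i) (ℕ.*-comm (step i) (π i)))))
        near : ∀ y → + D ∣ ι (back y) - ι y
        near y = by (ℤ∣.∣-trans D∣M (shifted y) ∣- ℤ∣.∣-refl {+ D}) (solve 3 (λ d b y → ((d :+ b) :- y) :- d := b :- y) refl (+ D) (ι (back y)) (ι y))
        same : ∀ y → indicator Λ (back y) ≡ indicator Λ y
        same y = go (y ∈? Λ)
          where
          go : Dec (y ∈ Λ) → indicator Λ (back y) ≡ indicator Λ y
          go (yes p) = trans (∈⇒indicator (⇒Λ (back y) (∣-trans (ι (back y)) (ι y) a (near y) (Λ⇒ y p)))) (sym (∈⇒indicator p))
          go (no np) = trans (∉⇒indicator (λ p → np (⇒Λ y (∣-trans (ι y) (ι (back y)) a (∣-sym (ι (back y)) (ι y) (near y)) (Λ⇒ (back y) p))))) (sym (∉⇒indicator np))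

      Φ∣grid : ∀ s → s ℕ.∣ M → ¬ s ℕ.∣ D → Φ s ∣P weighted (indicator Λ)
      Φ∣grid s s∣M s∤D = Φ-cancel-EE {s} {D} 1≤s s∤D (∣P-resp (≋-sym shape) (~⇒∣ {EE M} (Φ∣EE 1≤s s∣M)
        (~-trans (~-+ invariant (≋⇒~ ≋-refl)) (≋⇒~ (negₚ-inverseʳ (weighted (indicator Λ))))) ([] , ≋-sym (*ₚ-zeroʳ (Φ s)))))
        where
        1≤s = divisor-pos s∣M
        shape : EE D *ₚ weighted (indicator Λ) ≋ mono D *ₚ weighted (indicator Λ) +ₚ negₚ (weighted (indicator Λ))
        shape = solveₚ 2 (λ m w → (m ⊕ ⊝ Κ 1ₚ) ⊗ w ⊜ m ⊗ w ⊕ ⊝ w) ≋-refl (mono D) (weighted (indicator Λ))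

    module Complement (B : Subset M) (rigid : Rigid F (member B)) (size : sumℕ (indicator B) ≡ D) where
      open Rigid rigid

      instance
        D-nz : NonZero D
        D-nz = ℕ.m*n≢0 (Π′ i) _ ⦃ Π′-nz i ⦄ ⦃ ℕ.m*n≢0 (Π′ j) (Π′ k) ⦃ Π′-nz j ⦄ ⦃ Π′-nz k ⦄ ⦄

      open Project D
      open Congruence (EE D) (+ 0)
      wB = weighted (indicator B)

      -- By rigidity B is a system of representatives modulo D.
      wB~ : wB ~ geo 1 D
      wB~ = ~-trans (≋⇒~ (≋-sym (*ₚ-identityˡ wB))) (~-trans (project 0 (indicator B) (λ _ → 1) one)
        (≋⇒~ (≋-trans (sumP-cong {D} λ x → ≋-trans (*ₚ-cong const-1 (≋-refl {mono (toℕ x)})) (*ₚ-identityˡ (mono (toℕ x)))) (geo-sum D))))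
        where
        one : ∀ y → sumℕ (λ x → indicator B x ℕ.* Convolution.hit D (λ _ → 0) (λ _ → 0) (toℕ x) y) ≡ 1
        one y = from (complete (λ _ → + toℕ y))
          where
          from : ∃[ b ] (member B b × (∀ ν → W ν (b - + toℕ y))) → sumℕ (λ x → indicator B x ℕ.* Convolution.hit D (λ _ → 0) (λ _ → 0) (toℕ x) y) ≡ 1
          from (b , pb , w) = trans (sum-hit 0 (indicator B) y (res b) match only) (∈⇒indicator pb)
            where
            e : ∀ ν → W ν (ι (res b) - + toℕ y)
            e ν = ∣-trans (ι (res b)) b (+ toℕ y) (∣-sym b (ι (res b)) (Z⇒W {ν} (∣⇒Eq (ι-res b) ν))) (w ν)
            match : + D ∣ + toℕ (res b) - + toℕ y
            match = W⇒D∣ (e i) (e j) (e k)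
            only : ∀ x → indicator B x ≢ 0 → + D ∣ + toℕ x - + toℕ y → x ≡ res b
            only x nz d = ι-injective (Eq⇒∣ (thin {ι x} {ι (res b)} (member-ι {B} (indicator⇒∈ (ℕ.n≢0⇒n>0 nz))) (member-ι {B} pb) (diff i) (diff j) (diff k)))
              where
              diff : ∀ ν → W ν (ι x - ι (res b))
              diff ν = ∣-trans (ι x) (+ toℕ y) (ι (res b)) (D∣⇒W d ν) (∣-sym (ι (res b)) (+ toℕ y) (e ν))

      EED : EE D ≋ EE 1 *ₚ geo 1 D
      EED = subst (λ n → EE n ≋ EE 1 *ₚ geo 1 D) (ℕ.*-identityʳ D) (EE-geo 1 D)

      -- Modulo X^D - 1 the mask of `B` is (X^D - 1) / (X - 1), and Φ_s divides the numerator but is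
      -- coprime to X - 1.
      Φ∣complement : ∀ s → s ℕ.∣ D → s ≢ 1 → Φ s ∣P wB
      Φ∣complement s s∣D s≢1 = ~⇒∣ {EE D} Φ∣D wB~ (Φ-cancel-EE {s} {1} 1≤s (λ d → s≢1 (ℕ.∣1⇒≡1 d)) (∣P-resp EED Φ∣D))
        where
        1≤s = divisor-pos s∣D
        Φ∣D = Φ∣EE 1≤s s∣D

      -- Otherwise Φ_{Π ν} and 1 + X + … + X^{Π′ ν - 1} both divide B(X), and evaluation at 1 gives Π ν ∣ |B| = D.
      Φ∤top : ∀ ν → ¬ Φ (Π ν) ∣P wB
      Φ∤top ν Φ∣ = Π∤D ν (∣⇒ℕ∣ (subst (_∣ + D) (sym (ℤ.pos-* (π ν) P)) (ℤ∣.∣-trans πP∣ (subst₂ _∣_ (trans (eval1-* (geo 1 P) (Φ (Π ν))) (cong (_* eval1 (Φ (Π ν))) (eval1-geo 1 P)))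
          (trans (eval1-weighted (indicator B)) (cong +_ size)) (eval1-∣ both)))))
        where
        P = Π′ ν
        1≤Π = divisor-pos (Π∣M ν)
        EEP : EE P ≋ EE 1 *ₚ geo 1 P
        EEP = subst (λ n → EE n ≋ EE 1 *ₚ geo 1 P) (ℕ.*-identityʳ P) (EE-geo 1 P)
        Π∤P : ¬ Π ν ℕ.∣ P
        Π∤P d = Π∤step ν (ℕ.∣-trans d (ℕ.m∣m*n (others ν)))
        coprime : CoprimeP (Φ (Π ν)) (geo 1 P)
        coprime = coprimeP-∣ (EE 1 , ≋-trans EEP (*ₚ-comm (EE 1) (geo 1 P))) (Cyclotomic.coprime (cyclotomic (Π ν) 1≤Π) P Π∤P)
        P∣D : P ℕ.∣ D
        P∣D = ∣⇒ℕ∣ (D∣⇒W ℤ∣.∣-refl ν)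
        geo∣ : geo 1 P ∣P geo 1 D
        geo∣ = from P∣D
          where
          from : P ℕ.∣ D → geo 1 P ∣P geo 1 D
          from (ℕ.divides t e) = geo P t , unitConst-cancel {EE 1} (unitConst-EE 1 (s≤s z≤n)) (≋-trans (≋-sym EED) (≋-trans (subst (λ n → EE n ≋ EE P *ₚ geo P t) (sym e) (EE-geo P t))
            (≋-trans (*ₚ-cong EEP (≋-refl {geo P t})) (*ₚ-assoc (EE 1) (geo 1 P) (geo P t)))))
        both : geo 1 P *ₚ Φ (Π ν) ∣P wB
        both = coprimeP-∣-* (Φ-unit (Π ν) 1≤Π) coprime Φ∣ (~⇒∣ {EE D} (∣P-resp (≋-sym EED) (∣P-*ˡ (EE 1) geo∣)) wB~ geo∣)
        πP∣ : + π ν * + P ∣ + P * eval1 (Φ (Π ν))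
        πP∣ = from (subst (λ t → + π ν ∣ eval1 (Φ t)) (sym (Π-pow ν)) (prime∣Φ1 (ex ν) (prime ν)))
          where
          from : + π ν ∣ eval1 (Φ (Π ν)) → + π ν * + P ∣ + P * eval1 (Φ (Π ν))
          from (divides q e) = divides q (trans (cong (+ P *_) e) (solve 3 (λ P q p → P :* (q :* p) := q :* (p :* P)) refl (+ P) q (+ π ν)))

      -- By `Φ∤top` the prime powers in question all divide D, and so does the product of powers of
      -- distinct primes.
      t2-complement : T2 B
      t2-complement ps ps≢[] all unique = ⇒cyc s B (Φ∣complement s (product-∣ ps (All.map proj₁ all) (All.map ∣D all) unique) (s≢1 ps ps≢[] refl))
        where
        s = product (map primePower ps)
        divides-power : ∀ p α → 1 ≤ α → p ℕ.∣ (p ^ α)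
        divides-power p (suc α) _ = ℕ.m∣m*n (p ^ α)
        ∣D : ∀ {pα} → Prime (proj₁ pα) × 1 ≤ proj₂ pα × primePower pα ℕ.∣ M × CycDiv (primePower pα) B → primePower pα ℕ.∣ D
        ∣D {p , α} (pp , 1≤α , d , c) = local (prime-divisor pp (ℕ.∣-trans (divides-power p α 1≤α) d))
          where
          local : ∃[ ν ] p ≡ π ν → (p ^ α) ℕ.∣ D
          local (ν , refl) = from (power-cases ν {α} d)
            where
            from : (p ^ α) ℕ.∣ Π′ ν ⊎ p ^ α ≡ Π ν → (p ^ α) ℕ.∣ D
            from (inj₁ e) = ℕ.∣-trans e (∣⇒ℕ∣ (D∣⇒W ℤ∣.∣-refl ν))
            from (inj₂ e) = ⊥-elim (Φ∤top ν (subst (λ t → Φ t ∣P wB) e (cyc⇒ (p ^ α) B c)))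
        s≢1 : ∀ qs → qs ≢ [] → qs ≡ ps → s ≢ 1
        s≢1 [] ne _ = ⊥-elim (ne refl)
        s≢1 ((p , α) ∷ qs) _ refl e = use all
          where
          use : All _ ((p , α) ∷ qs) → ⊥
          use ((pp , 1≤α , _) ∷ _) = ℕ.<-irrefl (sym (ℕ.∣1⇒≡1 (subst (p ℕ.∣_) e (ℕ.∣-trans (divides-power p α 1≤α) (ℕ.m∣m*n (product (map primePower qs))))))) (ℕ.nonTrivial⇒n>1 p ⦃ prime⇒nonTrivial pp ⦄)

  -- Extracting the corner from the hypotheses and concluding

  module Assembly (F : Frame) (M : ℕ) .{{_ : NonZero M}}
    (M≡ : M ≡ Frame.π F i ℕ.* Frame.Π′ F i ℕ.* (Frame.π F j ℕ.* Frame.Π′ F j ℕ.* (Frame.π F k ℕ.* Frame.Π′ F k)))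
    (A B Λ : Subset M) (t : ZM.Tiles M A B) (card : Data.Fin.Subset.∣ A ∣ ≡ Frame.π F i ℕ.* Frame.π F j ℕ.* Frame.π F k)
    (grid : ZM.IsGrid M (M /' (Frame.π F i ℕ.* Frame.π F j ℕ.* Frame.π F k)) Λ)
    (a ai : Fin M) (a∈A : a ∈ A) (ai∈A : ai ∈ A) (a∈Λ : a ∈ Λ)
    (gcd≡ : ZM.gcdM M (ZM._-ₘ_ M a ai) ≡ M /' Frame.π F i)
    (fibred-j : ZM.Fibered M (Frame.π F j) (λ y → y ∈ A × ZM.InPlane M (Frame.π F j) (Frame.π F k) a y))
    (unfibred-k : ¬ ZM.Fibered M (Frame.π F k) (λ y → y ∈ A × ZM.InPlane M (Frame.π F j) (Frame.π F k) a y))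
    (fibred-k : ZM.Fibered M (Frame.π F k) (λ y → y ∈ A × ZM.InPlane M (Frame.π F j) (Frame.π F k) ai y))
    (unfibred-j : ¬ ZM.Fibered M (Frame.π F j) (λ y → y ∈ A × ZM.InPlane M (Frame.π F j) (Frame.π F k) ai y)) where

    open Structured F M M≡
    open InFrame F M M≡
    open ZM M

    M≡′ : M ≡ π i ℕ.* Π′ i ℕ.* (π k ℕ.* Π′ k ℕ.* (π j ℕ.* Π′ j))
    M≡′ = trans M≡ (cong (Π i ℕ.*_) (ℕ.*-comm (Π j) (Π k)))

    module G = InFrame (swap F) M M≡′

    P : ℕ
    P = π i ℕ.* π j ℕ.* π k

    M≡DP : M ≡ D ℕ.* P
    M≡DP = trans M≡ (rearrange (π i) (Π′ i) (π j) (Π′ j) (π k) (Π′ k))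
      where
      open ℕ-Solver renaming (solve to solveℕ; _:*_ to _⊛_; _:=_ to _≔_)
      rearrange : ∀ p P q Q r R → p ℕ.* P ℕ.* (q ℕ.* Q ℕ.* (r ℕ.* R)) ≡ P ℕ.* (Q ℕ.* R) ℕ.* (p ℕ.* q ℕ.* r)
      rearrange = solveℕ 6 (λ p P q Q r R → p ⊛ P ⊛ (q ⊛ Q ⊛ (r ⊛ R)) ≔ P ⊛ (Q ⊛ R) ⊛ (p ⊛ q ⊛ r)) refl

    P-nz : NonZero P
    P-nz = ℕ.m*n≢0 (π i ℕ.* π j) (π k) ⦃ ℕ.m*n≢0 (π i) (π j) ⦃ πnz i ⦄ ⦃ πnz j ⦄ ⦄ ⦃ πnz k ⦄

    M/'P≡D : M /' P ≡ D
    M/'P≡D = go P P-nz M≡DP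
      where
      go : ∀ p → NonZero p → M ≡ D ℕ.* p → M /' p ≡ D
      go (suc p) _ e = trans (cong (ℕ._/ suc p) e) (ℕ.m*n/n≡m D (suc p))

    sizeA : sumℕ (indicator A) ≡ P
    sizeA = trans (sym (card-sum A)) card

    sizeB : sumℕ (indicator B) ≡ D
    sizeB = ℕ.*-cancelˡ-≡ (sumℕ (indicator B)) D P ⦃ P-nz ⦄ (trans (cong (ℕ._* sumℕ (indicator B)) (sym sizeA)) (trans (TilingCounts.sizes M A B t) (trans M≡DP (ℕ.*-comm D P))))

    o o′ : ℤ
    o  = ι a
    o′ = ι ai

    step∣ : + step i ∣ ι (a -ₘ ai)
    step∣ = ℕ∣⇒∣ (subst (ℕ._∣ toℕ (a -ₘ ai)) (trans gcd≡ (/'≡step i)) (gcd[m,n]∣m (toℕ (a -ₘ ai)) M))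

    difference : ∀ {m} → m ∣ + step i → m ∣ + M → m ∣ ι ai - ι a
    difference {m} ms mM = ∣-sym (ι a) (ι ai) (∣-transport (ι a - ι ai) (ι (a -ₘ ai)) (∣-sym (ι (a -ₘ ai)) (ι a - ι ai) (ℤ∣.∣-trans mM (ι-- a ai))) (ℤ∣.∣-trans ms step∣))

    Z∣M : ∀ ν → Z ν (+ M)
    Z∣M ν = ∣⇒Eq ℤ∣.∣-refl ν

    oo-j : Z j (o′ - o)
    oo-j = difference (step-Z j i (λ ())) (Z∣M j)

    oo-k : Z k (o′ - o)
    oo-k = difference (step-Z k i (λ ())) (Z∣M k)

    -- Otherwise a = a_i, and the gcd would be M rather than M / p_i.
    oo-¬Z : ¬ Z i (o′ - o)
    oo-¬Z z = Π∤step i (ℕ.∣-trans (Π∣M i) (subst (M ℕ.∣_) (trans gcd≡ (/'≡step i)) (gcd-greatest (∣⇒ℕ∣ M∣x) ℕ.∣-refl)))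
      where
      e : Eq (ι a - ι ai)
      e i = ∣-sym (ι ai) (ι a) z
      e j = ∣-sym (ι ai) (ι a) oo-j
      e k = ∣-sym (ι ai) (ι a) oo-k
      M∣x : + M ∣ ι (a -ₘ ai)
      M∣x = ∣-transport (ι (a -ₘ ai)) (ι a - ι ai) (ι-- a ai) (Eq⇒∣ e)

    Plane : Fin M → Fin M → Set
    Plane c y = y ∈ A × InPlane (π j) (π k) c y

    plane⇒′ : ∀ {y} → Plane a y → y ∈ A × InPlane′ a y
    plane⇒′ {y} (p , q) = p , plane⇒ {a} {y} q

    ⇒plane′ : ∀ {y} → y ∈ A → InPlane′ a y → Plane a y
    ⇒plane′ {y} p q = p , ⇒plane {a} {y} q

    swapped⇒ : ∀ {y} → Plane ai y → y ∈ A × G.InPlane′ ai y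
    swapped⇒ {y} (p , q) = let (zi , wj , wk) = plane⇒ {ai} {y} q in p , zi , wk , wj

    ⇒swapped : ∀ {y} → y ∈ A → G.InPlane′ ai y → Plane ai y
    ⇒swapped {y} p (zi , wk , wj) = p , ⇒plane {ai} {y} (zi , wj , wk)

    gap-k = plane-gap A a (Plane a) plane⇒′ ⇒plane′ fibred-j unfibred-k
    gap-j = G.plane-gap A ai (Plane ai) swapped⇒ ⇒swapped fibred-k unfibred-j

    corner : Corner F (member A) (member B)
    corner = record
      { tiling = tiling A B t ; o = o ; o′ = o′ ; o∈ = member-ι a∈A ; o′∈ = member-ι ai∈A
      ; oo-W = difference (step-W i) (Z⇒W {i} (Z∣M i)) ; oo-¬Z = oo-¬Z ; oo-j = oo-j ; oo-k = oo-k
      ; fibre-j = λ {x} {y} → plane-fibre A a (Plane a) plane⇒′ ⇒plane′ fibred-j {x} {y}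
      ; fibre-k = λ {x} {y} px zi wj wk zi′ zj′ wk′ → G.plane-fibre A ai (Plane ai) swapped⇒ ⇒swapped fibred-k {x} {y} px zi wk wj zi′ wk′ zj′
      ; xv = proj₁ gap-k ; xv∉ = proj₁ (proj₂ gap-k) ; xv-i = proj₁ (proj₂ (proj₂ gap-k)) ; xv-j = proj₁ (proj₂ (proj₂ (proj₂ gap-k))) ; xv-k = proj₂ (proj₂ (proj₂ (proj₂ gap-k)))
      ; xw = proj₁ gap-j ; xw∉ = proj₁ (proj₂ gap-j) ; xw-i = proj₁ (proj₂ (proj₂ gap-j)) ; xw-k = proj₁ (proj₂ (proj₂ (proj₂ gap-j))) ; xw-j = proj₂ (proj₂ (proj₂ (proj₂ gap-j)))
      ; crowd-j = crowds′ A B (Π′ i ℕ.* Π′ k) (π j) ⦃ ℕ.m*n≢0 (Π′ i) (Π′ k) ⦃ Π′-nz i ⦄ ⦃ Π′-nz k ⦄ ⦄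
          (λ d → ℤ∣.∣-trans (ℕ∣⇒∣ (ℕ.m∣m*n (Π′ k))) d , ℤ∣.∣-trans (ℕ∣⇒∣ (ℕ.n∣m*n (Π′ i))) d)
          (trans sizeB (trans (cong (λ s → Π′ i ℕ.* (s ℕ.* Π′ k)) flatj) (trans (cong (Π′ i ℕ.*_) (ℕ.*-comm (π j) (Π′ k))) (sym (ℕ.*-assoc (Π′ i) (Π′ k) (π j))))))
      ; crowd-k = crowds′ A B (Π′ i ℕ.* Π′ j) (π k) ⦃ ℕ.m*n≢0 (Π′ i) (Π′ j) ⦃ Π′-nz i ⦄ ⦃ Π′-nz j ⦄ ⦄
          (λ d → ℤ∣.∣-trans (ℕ∣⇒∣ (ℕ.m∣m*n (Π′ j))) d , ℤ∣.∣-trans (ℕ∣⇒∣ (ℕ.n∣m*n (Π′ i))) d)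
          (trans sizeB (trans (cong (λ s → Π′ i ℕ.* (Π′ j ℕ.* s)) flatk) (sym (ℕ.*-assoc (Π′ i) (Π′ j) (π k)))))
      }

    instance
      D-nz : NonZero D
      D-nz = ℕ.≢-nonZero λ z → ℕ.≢-nonZero⁻¹ M (trans M≡DP (cong (ℕ._* P) z))

    rigid : Rigid F (member B)
    rigid = corner-rigid corner (crowds′ A B D 1 (λ d → D∣⇒W d i , D∣⇒W d j , D∣⇒W d k) (trans sizeB (sym (ℕ.*-identityʳ D))))

    aligned : ∀ {x} → x ∈ A → W i (ι x - o)
    aligned {x} p = CornerSlice.aligned corner rigid {ι x} (member-ι p)

    D∣M : + D ∣ + M
    D∣M = ℕ∣⇒∣ (ℕ.divides P (trans M≡DP (ℕ.*-comm D P)))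

    Λ⇔ : ∀ y → y ∈ Λ ⇔ + D ∣ ι y - o
    Λ⇔ y = from grid
      where
      from : IsGrid (M /' P) Λ → y ∈ Λ ⇔ + D ∣ ι y - o
      from (x , iff) = mk⇔ (λ p → ∣-trans (ι y) (ι x) o (to y p) (∣-sym o (ι x) (to a a∈Λ)))
        (λ d → back y (∣-trans (ι y) o (ι x) d (to a a∈Λ)))
        where
        sub : ∀ y → + D ∣ ι (y -ₘ x) - (ι y - ι x)
        sub y = ℤ∣.∣-trans D∣M (ι-- y x)
        to : ∀ y → y ∈ Λ → + D ∣ ι y - ι x
        to y p = ∣-transport (ι y - ι x) (ι (y -ₘ x)) (∣-sym (ι (y -ₘ x)) (ι y - ι x) (sub y)) (ℕ∣⇒∣ (subst (ℕ._∣ toℕ (y -ₘ x)) M/'P≡D (Equivalence.to (iff y) p)))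
        back : ∀ y → + D ∣ ι y - ι x → y ∈ Λ
        back y d = Equivalence.from (iff y) (subst (ℕ._∣ toℕ (y -ₘ x)) (sym M/'P≡D) (∣⇒ℕ∣ (∣-transport (ι (y -ₘ x)) (ι y - ι x) (sub y) d)))

    open Chain F M M≡ M≡′ B rigid o Λ using (Reaches; reach)

    reached : Reaches A
    reached = reach (λ {y} p → let d = Equivalence.to (Λ⇔ y) p in D∣⇒W d i , D∣⇒W d j , D∣⇒W d k) (λ {y} wi wj wk → Equivalence.from (Λ⇔ y) (W⇒D∣ wi wj wk))
      A t aligned (<-wellFounded _)

    Φ∣Λ : ∀ s → s ℕ.∣ M → ¬ s ℕ.∣ D → Φ s ∣P weighted (indicator Λ)
    Φ∣Λ = Grid.Φ∣grid Λ o (λ y → Equivalence.to (Λ⇔ y)) (λ y → Equivalence.from (Λ⇔ y))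

    t2A : T2 A
    t2A = t2-top A sizeA λ s s∣M sat s∤D → let good = saturated⇒ s∣M sat in
      proj₂ (proj₂ reached) s (divisor-pos s∣M , s∣M , good j) (divisor-pos s∣M , s∣M , good k) (Φ∣Λ s s∣M s∤D)

    sizeΛ : sumℕ (indicator Λ) ≡ P
    sizeΛ = ℕ.*-cancelˡ-≡ (sumℕ (indicator Λ)) P D (trans (ℕ.*-comm D _) (trans (cong (sumℕ (indicator Λ) ℕ.*_) (sym sizeB)) (trans (TilingCounts.sizes M Λ B (proj₁ (proj₂ reached))) M≡DP)))

    t2Λ : T2 Λ
    t2Λ = t2-top Λ sizeΛ λ s s∣M _ s∤D → Φ∣Λ s s∣M s∤D

    conclusion : T2EquivViaShifts (π j) (π k) A Λ B × T2 A × T2 B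
    -- The equivalence of (T2) for `A` and Λ holds because both satisfy it.
    conclusion = (t , proj₁ (proj₂ reached) , mk⇔ (λ _ → t2Λ) (λ _ → t2A) , proj₁ reached) , t2A , Complement.t2-complement B rigid sizeB

-- The theorem for M given by its prime powers

open import Data.Nat using (ℕ; _*_; _^_; _≤_; NonZero)
open import Data.Nat.Primality using (Prime)
open import Data.Fin.Subset using (Subset; _∈_; _∩_)
open import Data.Product using (∃-syntax; _×_)
open import Relation.Nullary using (¬_)
open import Relation.Binary.PropositionalEquality using (_≡_; _≢_)
open import Data.Nat using (suc)
import Data.Nat.Properties as ℕ
open import Data.Fin.Subset.Properties using (x∈p∩q⁻)
open import Data.Product using (_,_; proj₁; proj₂)
open import Relation.Binary.PropositionalEquality using (refl; sym; trans; cong; cong₂)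
open Corners using (i; j; k; Frame)
open Grids using (module Assembly)

theorem8p1 : (pi pj pk ni : ℕ) → Prime pi → Prime pj → Prime pk →
             pi ≢ pj → pi ≢ pk → pj ≢ pk → 1 ≤ ni →
             (M : ℕ) .{{_ : NonZero M}} → M ≡ pi ^ ni * pj ^ 2 * pk ^ 2 →
             (A B Λ : Subset M) →
             ZM.Tiles M A B →
             Data.Fin.Subset.∣ A ∣ ≡ pi * pj * pk →
             ZM.CycDiv M M A →
             ZM.IsGrid M (M /' (pi * pj * pk)) Λ →
             (∃[ a ] ∃[ ai ] (a ∈ (A ∩ Λ) × ai ∈ (A ∩ Λ) ×
                ZM.gcdM M (ZM._-ₘ_ M a ai) ≡ M /' pi ×
                ZM.Fibered M pj (λ y → y ∈ A × ZM.InPlane M pj pk a y) ×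
                ¬ ZM.Fibered M pk (λ y → y ∈ A × ZM.InPlane M pj pk a y) ×
                ZM.Fibered M pk (λ y → y ∈ A × ZM.InPlane M pj pk ai y) ×
                ¬ ZM.Fibered M pj (λ y → y ∈ A × ZM.InPlane M pj pk ai y))) →
             ZM.T2EquivViaShifts M pj pk A Λ B × ZM.T2 M A × ZM.T2 M B
theorem8p1 pi pj pk (suc n) Pi Pj Pk pi≢pj pi≢pk pj≢pk _ M M≡ A B Λ t card _ grid
  (a , ai , a∈ , ai∈ , gcd≡ , fibred-j , unfibred-k , fibred-k , unfibred-j) =
  Assembly.conclusion frame M M≡Π A B Λ t card grid a ai (proj₁ (x∈p∩q⁻ A Λ a∈)) (proj₁ (x∈p∩q⁻ A Λ ai∈)) (proj₂ (x∈p∩q⁻ A Λ a∈)) gcd≡ fibred-j unfibred-k fibred-k unfibred-j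
  where
  frame : Frame
  frame = record
    -- Here n_i = n + 1, so the entry p_i^n of `Π′` is p_i^(n_i-1), and the product of the three
    -- entries is D(M).
    { π = λ { i → pi ; j → pj ; k → pk } ; Π′ = λ { i → pi ^ n ; j → pj ; k → pk } ; ex = λ { i → n ; j → 1 ; k → 1 }
    ; prime = λ { i → Pi ; j → Pj ; k → Pk }
    ; pow = λ { i → refl ; j → sym (ℕ.*-identityʳ pj) ; k → sym (ℕ.*-identityʳ pk) }
    ; i≢j = pi≢pj ; i≢k = pi≢pk ; j≢k = pj≢pk ; flatj = refl ; flatk = refl }
  square : ∀ p → p ^ 2 ≡ p * p
  square p = cong (p *_) (ℕ.*-identityʳ p)
  M≡Π : M ≡ pi * pi ^ n * (pj * pj * (pk * pk))
  M≡Π = trans M≡ (trans (ℕ.*-assoc (pi ^ suc n) (pj ^ 2) (pk ^ 2)) (cong (pi ^ suc n *_) (cong₂ _*_ (square pj) (square pk))))
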